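{- Let $\kappa$ be a cardinal, $\alpha<\kappa$, and let $\vec U=\langle U_\gamma\mid\gamma<\alpha\rangle$ be a sequence of normal ultrafilters on $\kappa$ that is increasing in the Mitchell order. Let $\vec f=\langle f^\delta_\gamma\mid\gamma<\delta<\alpha\rangle$ be functions with $[f^\delta_\gamma]_{U_\delta}=U_\gamma$, let $\mathbb M=\mathbb M(\vec U,\vec f)$ be the associated Magidor forcing, and let $\mathbb M^*$ be its complete Boolean algebra. Let $\langle M_\gamma\mid\gamma\le\alpha\rangle$, $\langle\pi_{\gamma,\delta}\mid\gamma\le\delta\le\alpha\rangle$ be the iteration in which, at stage $\xi<\alpha$, the ultrapower of $M_\xi$ by $\pi_{0,\xi}(U_\xi)$ is formed, let $\vec\kappa=\langle\kappa_\gamma\mid\gamma<\alpha\rangle$ be its sequence of critical points, and let $G^*_{\vec\kappa}$ be the ultrafilter on $\pi_{0,\alpha}(\mathbb M^*)$ generated by the $M_\alpha$-generic filter $G_{\vec\kappa}\subseteq\pi_{0,\alpha}(\mathbb M)$ determined by $\vec\kappa$. Then $M_\alpha$ is the Boolean ultrapower of $\mathrm V$ by the ultrafilter $F=\pi_{0,\alpha}^{ -1}[G^*_{\vec\kappa}]=\{b\in\mathbb M^*\mid\pi_{0,\alpha}(b)\in G^*_{\vec\kappa}\}$ on $\mathbb M^*$.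
   Context: Mitchell order: $\mu$ is below $\nu$ iff $\mu\in\mathrm{Ult}(\mathrm V,\nu)$. Iteration: $M_0=\mathrm V$, $\pi_{0,0}=\mathrm{id}$; for $\xi<\alpha$, $\pi_{\xi,\xi+1}:M_\xi\to M_{\xi+1}$ is the ultrapower embedding (with $M_{\xi+1}$ transitive) of $M_\xi$ by $\pi_{0,\xi}(U_\xi)$, and $\pi_{\zeta,\xi+1}=\pi_{\xi,\xi+1}\circ\pi_{\zeta,\xi}$; at limits the (transitivized) direct limit is taken. Magidor forcing: the functions $f^\delta_\gamma$ have domain $\kappa$. For $\beta<\alpha$ let $A_\beta$ be the set of $\xi$ with $\alpha<\xi<\kappa$ such that for all $\gamma<\beta$, $f^\beta_\gamma(\xi)$ is a normal ultrafilter on $\xi$, and for all $\gamma<\delta<\beta$, $[f^\delta_\gamma\restriction\xi]_{f^\beta_\delta(\xi)}=f^\beta_\gamma(\xi)$ (so $A_\beta\in U_\beta$). Conditions of $\mathbb M$ are pairs $\langle s,T\rangle$ such that: $s$ is a strictly increasing function whose domain is a finite subset of $\alpha$, with $s(\beta)\in A_\beta$ for $\beta\in\mathrm{dom}(s)$; $T$ is a function with domain $\alpha\setminus\mathrm{dom}(s)$; for $\beta\in\mathrm{dom}(T)$, if no element of $\mathrm{dom}(s)$ is greater than $\beta$ then $T(\beta)\in U_\beta$, and otherwise, letting $\gamma=\min(\mathrm{dom}(s)\setminus(\beta+1))$, $T(\beta)\in f^\gamma_\beta(s(\gamma))$; and if $\mathrm{dom}(s)\cap\beta\ne\emptyset$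 then $T(\beta)\cap(s(\max(\mathrm{dom}(s)\cap\beta))+1)=\emptyset$. The order is: $\langle s',T'\rangle\le\langle s,T\rangle$ iff $s\subseteq s'$, $s'(\beta)\in T(\beta)$ for all $\beta\in\mathrm{dom}(s')\setminus\mathrm{dom}(s)$, and $T'(\beta)\subseteq T(\beta)$ for all $\beta\in\alpha\setminus\mathrm{dom}(s')$. $\mathbb M^*$ is the complete Boolean algebra of $\mathbb M$, with $\mathbb M$ viewed as a dense subset. The filter $G_{\vec\kappa}$ is the set of $\langle s,T\rangle\in\pi_{0,\alpha}(\mathbb M)$ with $s=\vec\kappa\restriction\mathrm{dom}(s)$ and $\kappa_\xi\in T(\xi)$ for all $\xi\in\alpha\setminus\mathrm{dom}(s)$. It is a known fact (which may be assumed) that $G_{\vec\kappa}$ is $\pi_{0,\alpha}(\mathbb M)$-generic over $M_\alpha$. Boolean ultrapower: for a complete Boolean algebra $\mathbb B$ and an ultrafilter $U\in\mathrm V$ on $\mathbb B$, identify $\mathbb B$-names $\sigma,\tau$ when $[\![\sigma=\tau]\!]\in U$, and let $[\sigma]_U\,E\,[\tau]_U$ iff $[\![\sigma\in\tau]\!]\in U$. The Boolean ultrapower $\check{\mathrm V}_U$ consists of the classes $[\sigma]_U$ of names with $[\![\sigma\in\check{\mathrm V}]\!]\in U$, where $[\![\sigma\in\check{\mathrm V}]\!]=\bigvee_{x\in\mathrm V}[\![\sigma=\check x]\!]$, equipped with $E$, and is identified with its transitive collapse when well-founded. -}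

module Defs where

open import Level using (Level)
open import Data.Nat using (ℕ; suc) renaming (_+_ to _+ℕ_)
open import Data.Fin using (Fin)
open import Data.Vec using (Vec; []; _∷_; _++_; lookup)
open import Data.Product using (∃; _×_; ∃-syntax)
open import Data.Sum using (_⊎_)
open import Data.Unit.Polymorphic using (⊤)
open import Function.Bundles using (_⇔_)
open import Relation.Nullary using (¬_)
open import Relation.Binary.PropositionalEquality using (_≡_)

-- Variables are de Bruijn indices: "ex" binds index zero.

data Formula : ℕ → Set where
  mem eq : ∀ {n} → Fin n → Fin n → Formula n
  neg    : ∀ {n} → Formula n → Formula n
  and    : ∀ {n} → Formula n → Formula n → Formula n
  ex     : ∀ {n} → Formula (suc n) → Formula n

-- (V, ∈) is an arbitrary structure; "IsZFC" below says that it is a model of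
-- ZFC.  All notions are interpreted inside it.  Notions are relational:
-- "IsThing x₁ … xₙ y" reads "y is the thing determined by x₁ … xₙ".

module SetTheory {ℓ : Level} (V : Set ℓ) (_∈_ : V → V → Set ℓ) where

  infix 4 _⊆_ _⊴_

  Sat : ∀ {n} → Formula n → Vec V n → Set ℓ
  Sat (mem i j) v = lookup v i ∈ lookup v j
  Sat (eq i j)  v = lookup v i ≡ lookup v j
  Sat (neg φ)   v = ¬ Sat φ v
  Sat (and φ ψ) v = Sat φ v × Sat ψ v
  Sat (ex φ)    v = ∃ λ x → Sat φ (x ∷ v)

  -- As usual in ZFC, a (k-ary) class is given by a formula with parameters.

  record Class (k : ℕ) : Set ℓ where
    constructor class
    field
      {arity} : ℕ
      formula : Formula (k +ℕ arity)
      params  : Vec V arity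

  infix 5 _[_]
  _[_] : ∀ {k} → Class k → Vec V k → Set ℓ
  C [ xs ] = Sat (Class.formula C) (xs ++ Class.params C)

  _⊆_ : V → V → Set ℓ
  x ⊆ y = ∀ z → z ∈ x → z ∈ y

  _Is｛_｝ : V → (V → Set ℓ) → Set ℓ
  a Is｛ P ｝ = ∀ z → z ∈ a ⇔ P z

  IsEmpty : V → Set ℓ
  IsEmpty a = ∀ z → ¬ z ∈ a

  IsSuc : V → V → Set ℓ
  IsSuc x y = y Is｛ (λ z → z ∈ x ⊎ z ≡ x) ｝

  IsUnorderedPair : V → V → V → Set ℓ
  IsUnorderedPair x y p = p Is｛ (λ z → z ≡ x ⊎ z ≡ y) ｝

  record IsZFC : Set ℓ where
    field
      extensionality : ∀ x y → (∀ z → z ∈ x ⇔ z ∈ y) → x ≡ y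
      foundation     : ∀ x → (∃[ y ] y ∈ x) →
                       ∃[ y ] y ∈ x × (∀ z → z ∈ y → ¬ z ∈ x)
      pairing        : ∀ x y → ∃[ p ] IsUnorderedPair x y p
      union          : ∀ a → ∃[ u ] u Is｛ (λ z → ∃[ x ] x ∈ a × z ∈ x) ｝
      powerset       : ∀ a → ∃[ b ] b Is｛ (λ z → z ⊆ a) ｝
      infinity       : ∃[ w ] (∃[ o ] IsEmpty o × o ∈ w)
                            × (∀ x → x ∈ w → ∃[ y ] IsSuc x y × y ∈ w)
      separation     : ∀ (C : Class 1) a →
                       ∃[ b ] b Is｛ (λ z → z ∈ a × C [ z ∷ [] ]) ｝
      replacement    : ∀ (C : Class 2) a →
                       (∀ x y y′ → x ∈ a → C [ x ∷ y ∷ [] ] → C [ x ∷ y′ ∷ [] ] → y ≡ y′) →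
                       ∃[ b ] b Is｛ (λ y → ∃[ x ] x ∈ a × C [ x ∷ y ∷ [] ]) ｝
      choice         : ∀ a →
                       (∀ x → x ∈ a → ∃[ z ] z ∈ x) →
                       (∀ x y z → x ∈ a → y ∈ a → z ∈ x → z ∈ y → x ≡ y) →
                       ∃[ c ] (∀ x → x ∈ a → ∃[ z ] z ∈ x × z ∈ c
                                 × (∀ z′ → z′ ∈ x → z′ ∈ c → z′ ≡ z))

  -- Kuratowski pairs: p = {{x},{x,y}}.
  IsPair : V → V → V → Set ℓ
  IsPair x y p = ∃[ a ] ∃[ b ] IsUnorderedPair x x a × IsUnorderedPair x y b
                             × IsUnorderedPair a b p

  -- ⟨x,y⟩ ∈ f.  This is "f(x) = y" when f is a function and "x f y" when f is
  -- a relation.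
  app : V → V → V → Set ℓ
  app f x y = ∃[ p ] IsPair x y p × p ∈ f

  app₂ : V → V → V → V → Set ℓ
  app₂ f x y z = ∃[ p ] IsPair x y p × app f p z

  IsFunction : V → Set ℓ
  IsFunction f = (∀ p → p ∈ f → ∃[ x ] ∃[ y ] IsPair x y p)
               × (∀ x y y′ → app f x y → app f x y′ → y ≡ y′)

  IsDomain : V → V → Set ℓ
  IsDomain f d = d Is｛ (λ x → ∃[ y ] app f x y) ｝

  InDom : V → V → Set ℓ
  InDom f x = ∃[ y ] app f x y

  FunctionOn : V → V → Set ℓ
  FunctionOn d f = IsFunction f × IsDomain f d

  IsRestriction : V → V → V → Set ℓ
  IsRestriction f a g =
    g Is｛ (λ p → p ∈ f × ∃[ x ] ∃[ y ] IsPair x y p × x ∈ a) ｝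

  IsConst : V → V → V → Set ℓ
  IsConst d x c = c Is｛ (λ p → ∃[ i ] i ∈ d × IsPair i x p) ｝

  IsTransitive : V → Set ℓ
  IsTransitive x = ∀ y → y ∈ x → y ⊆ x

  IsOrdinal : V → Set ℓ
  IsOrdinal x = IsTransitive x × (∀ y → y ∈ x → IsTransitive y)

  -- ξ ≤ η, for ordinals
  _⊴_ : V → V → Set ℓ
  ξ ⊴ η = ξ ∈ η ⊎ ξ ≡ η

  IsLimit : V → Set ℓ
  IsLimit x = IsOrdinal x × ¬ IsEmpty x × ¬ (∃[ y ] IsSuc y x)

  IsNatural : V → Set ℓ
  IsNatural n = IsOrdinal n
              × (∀ m → m ⊴ n → IsEmpty m ⊎ (∃[ k ] IsSuc k m))

  IsFinite : V → Set ℓ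
  IsFinite a = ∃[ n ] IsNatural n × ∃[ g ] FunctionOn n g
             × (∀ i j y → app g i y → app g j y → i ≡ j)
             × (∀ y → y ∈ a ⇔ (∃[ i ] app g i y))

  IsCardinal : V → Set ℓ
  IsCardinal κ = IsOrdinal κ
    × (∀ β → β ∈ κ →
       ¬ (∃[ g ] FunctionOn β g × (∀ y → y ∈ κ → ∃[ i ] app g i y)))

  -- {z | P z} ∈ U
  _∋｛_｝ : V → (V → Set ℓ) → Set ℓ
  U ∋｛ P ｝ = ∃[ a ] a Is｛ P ｝ × a ∈ U

  record IsNormalUltrafilter (κ U : V) : Set ℓ where
    field
      ordinal      : IsOrdinal κ
      subsets      : ∀ a → a ∈ U → a ⊆ κ
      proper       : ∀ a → IsEmpty a → ¬ a ∈ U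
      upward       : ∀ a b → a ∈ U → a ⊆ b → b ⊆ κ → b ∈ U
      intersection : ∀ a b → a ∈ U → b ∈ U → U ∋｛ (λ z → z ∈ a × z ∈ b) ｝
      ultra        : ∀ a → a ⊆ κ → a ∈ U ⊎ (U ∋｛ (λ z → z ∈ κ × ¬ z ∈ a) ｝)
      nonprincipal : ∀ x → ¬ (U ∋｛ (λ z → z ≡ x) ｝)
      complete     : ∀ η X → η ∈ κ → FunctionOn η X →
                     (∀ i a → app X i a → a ∈ U) →
                     U ∋｛ (λ z → z ∈ κ × (∀ i a → app X i a → z ∈ a)) ｝
      diagonal     : ∀ X → FunctionOn κ X →
                     (∀ i a → app X i a → a ∈ U) →
                     U ∋｛ (λ z → z ∈ κ × (∀ i a → i ∈ z → app X i a → z ∈ a)) ｝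

  -- N is the transitive collapse of the ultrapower of the class M by U (an
  -- ultrafilter on κ in M), formed from the functions on κ lying in M, and
  -- "rep g x" says [g]_U = x.
  record IsUltrapower (M : V → Set ℓ) (κ U : V)
                      (N : V → Set ℓ) (rep : V → V → Set ℓ) : Set ℓ where
    field
      transitive : ∀ x y → N y → x ∈ y → N x
      typed      : ∀ g x → rep g x → M g × FunctionOn κ g × N x
      total      : ∀ g → M g → FunctionOn κ g → ∃[ x ] rep g x
      onto       : ∀ x → N x → ∃[ g ] rep g x
      equality   : ∀ g h x y → rep g x → rep h y →
                   x ≡ y ⇔ (U ∋｛ (λ i → i ∈ κ × ∃[ a ] app g i a × app h i a) ｝)
      membership : ∀ g h x y → rep g x → rep h y →
                   x ∈ y ⇔ (U ∋｛ (λ i → i ∈ κ ×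
                                  ∃[ a ] ∃[ b ] app g i a × app h i b × a ∈ b) ｝)

  IsUltrapowerOfV : (κ U : V) → Class 1 → Class 2 → Set ℓ
  IsUltrapowerOfV κ U N rep =
    IsUltrapower (λ _ → ⊤) κ U (λ x → N [ x ∷ [] ]) (λ g x → rep [ g ∷ x ∷ [] ])

  -- [g]_U = x, in Ult(V,U)
  IsUltrapowerClass : (κ U g x : V) → Set ℓ
  IsUltrapowerClass κ U g x =
    ∃[ N ] ∃[ rep ] IsUltrapowerOfV κ U N rep × rep [ g ∷ x ∷ [] ]

  -- μ ∈ Ult(V,ν), where ν is an ultrafilter on κ
  MitchellBelow : (κ μ ν : V) → Set ℓ
  MitchellBelow κ μ ν = ∃[ N ] ∃[ rep ] IsUltrapowerOfV κ ν N rep × N [ μ ∷ [] ]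

  -- U is the sequence ⟨U_γ | γ<α⟩, and f is the function
  -- ⟨γ,δ⟩ ↦ f^δ_γ for γ<δ<α; thus "app₂ f γ δ g" says f^δ_γ = g.

  record IsMitchellSequence (κ α U f : V) : Set ℓ where
    field
      sequence   : FunctionOn α U
      normal     : ∀ γ u → app U γ u → IsNormalUltrafilter κ u
      increasing : ∀ γ δ u v → γ ∈ δ → app U γ u → app U δ v → MitchellBelow κ u v
      functions  : IsFunction f
      indices    : ∀ p → InDom f p ⇔ (∃[ γ ] ∃[ δ ] δ ∈ α × γ ∈ δ × IsPair γ δ p)
      domains    : ∀ γ δ g → app₂ f γ δ g → FunctionOn κ g
      represents : ∀ γ δ g u v → app₂ f γ δ g → app U γ u → app U δ v →
                   IsUltrapowerClass κ v g u

  -- f^δ_γ(ξ) = x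
  value : (f γ δ ξ x : V) → Set ℓ
  value f γ δ ξ x = ∃[ g ] app₂ f γ δ g × app g ξ x

  -- ξ ∈ A_β
  InA : (κ α f β ξ : V) → Set ℓ
  InA κ α f β ξ =
      α ∈ ξ × ξ ∈ κ
    × (∀ γ → γ ∈ β → ∃[ u ] value f γ β ξ u × IsNormalUltrafilter ξ u)
    × (∀ γ δ → γ ∈ δ → δ ∈ β →
       ∃[ g ] ∃[ h ] ∃[ v ] ∃[ u ]
           app₂ f γ δ g × IsRestriction g ξ h
         × value f δ β ξ v × value f γ β ξ u
         × IsUltrapowerClass ξ v h u)

  record IsCondition (κ α U f s T : V) : Set ℓ where
    field
      s-function   : IsFunction s
      s-domain     : ∀ β → InDom s β → β ∈ α
      s-finite     : ∃[ d ] IsDomain s d × IsFinite d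
      s-increasing : ∀ β β′ x x′ → β ∈ β′ → app s β x → app s β′ x′ → x ∈ x′
      s-values     : ∀ β x → app s β x → InA κ α f β x
      T-function   : IsFunction T
      T-domain     : ∀ β → InDom T β ⇔ (β ∈ α × ¬ InDom s β)
      T-top        : ∀ β a u → app T β a → app U β u →
                     ¬ (∃[ γ ] InDom s γ × β ∈ γ) → a ∈ u
      -- γ = min (dom s ∖ (β+1))
      T-below      : ∀ β a γ x → app T β a → app s γ x → β ∈ γ →
                     (∀ γ′ → InDom s γ′ → β ∈ γ′ → γ ⊴ γ′) →
                     ∃[ u ] value f β γ x u × a ∈ u
      -- γ = max (dom s ∩ β)
      T-above      : ∀ β a γ x → app T β a → app s γ x → γ ∈ β →
                     (∀ γ′ → InDom s γ′ → γ′ ∈ β → γ′ ⊴ γ) →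
                     ∀ ξ → ξ ∈ a → ¬ ξ ⊴ x

  -- ⟨s′,T′⟩ ≤ ⟨s,T⟩
  Extends : (α s′ T′ s T : V) → Set ℓ
  Extends α s′ T′ s T =
      s ⊆ s′
    × (∀ β x → app s′ β x → ¬ InDom s β → ∃[ a ] app T β a × x ∈ a)
    × (∀ β → β ∈ α → ¬ InDom s′ β →
       ∃[ a′ ] ∃[ a ] app T′ β a′ × app T β a × a′ ⊆ a)

  -- P and ≤P are the underlying set and the order of 𝕄(U,f).
  record IsMagidorForcing (κ α U f P ≤P : V) : Set ℓ where
    field
      conditions : P Is｛ (λ p → ∃[ s ] ∃[ T ] IsPair s T p × IsCondition κ α U f s T) ｝
      order      : ≤P Is｛ (λ r → ∃[ q ] ∃[ p ] IsPair q p r × q ∈ P × p ∈ P ×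
                     ∃[ s′ ] ∃[ T′ ] ∃[ s ] ∃[ T ]
                       IsPair s′ T′ q × IsPair s T p × Extends α s′ T′ s T) ｝

  -- B and ≤B are elements of V; ≤B is a set of pairs ordering B.
  module Order (B ≤B : V) where

    _≤_ : V → V → Set ℓ
    x ≤ y = app ≤B x y

    IsSup : (V → Set ℓ) → V → Set ℓ
    IsSup X b = b ∈ B × (∀ x → X x → x ≤ b)
              × (∀ c → c ∈ B → (∀ x → X x → x ≤ c) → b ≤ c)

    IsInf : (V → Set ℓ) → V → Set ℓ
    IsInf X b = b ∈ B × (∀ x → X x → b ≤ x)
              × (∀ c → c ∈ B → (∀ x → X x → c ≤ x) → c ≤ b)

    IsBottom IsTop : V → Set ℓ
    IsBottom b = b ∈ B × (∀ x → x ∈ B → b ≤ x)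
    IsTop    b = b ∈ B × (∀ x → x ∈ B → x ≤ b)

    IsMeet IsJoin : V → V → V → Set ℓ
    IsMeet x y z = IsInf (λ w → w ≡ x ⊎ w ≡ y) z
    IsJoin x y z = IsSup (λ w → w ≡ x ⊎ w ≡ y) z

    IsComplement : V → V → Set ℓ
    IsComplement x y = x ∈ B × y ∈ B × (∃[ o ] IsBottom o × IsMeet x y o)
                                     × (∃[ t ] IsTop t × IsJoin x y t)

    -- z = ¬x ∨ y
    IsImplication : V → V → V → Set ℓ
    IsImplication x y z = ∃[ w ] IsComplement x w × IsJoin w y z

  record IsCompleteBooleanAlgebra (B ≤B : V) : Set ℓ where
    open Order B ≤B
    field
      order-on      : ∀ r → r ∈ ≤B → ∃[ x ] ∃[ y ] IsPair x y r × x ∈ B × y ∈ B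
      reflexive     : ∀ x → x ∈ B → x ≤ x
      transitive    : ∀ x y z → x ≤ y → y ≤ z → x ≤ z
      antisymmetric : ∀ x y → x ≤ y → y ≤ x → x ≡ y
      sups          : ∀ X → X ⊆ B → ∃[ b ] IsSup (λ x → x ∈ X) b
      infs          : ∀ X → X ⊆ B → ∃[ b ] IsInf (λ x → x ∈ X) b
      complements   : ∀ x → x ∈ B → ∃[ y ] IsComplement x y
      distributive  : ∀ x y z j m n₁ n₂ k →
                      IsJoin y z j → IsMeet x j m →
                      IsMeet x y n₁ → IsMeet x z n₂ → IsJoin n₁ n₂ k → m ≡ k
      nontrivial    : ∀ o t → IsBottom o → IsTop t → ¬ o ≡ t

  record IsUltrafilterOn (B ≤B F : V) : Set ℓ where
    open Order B ≤B
    field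
      subset : F ⊆ B
      top    : ∀ t → IsTop t → t ∈ F
      proper : ∀ o → IsBottom o → ¬ o ∈ F
      upward : ∀ x y → x ∈ F → x ≤ y → y ∈ F
      meets  : ∀ x y z → x ∈ F → y ∈ F → IsMeet x y z → z ∈ F
      ultra  : ∀ x y → IsComplement x y → x ∈ F ⊎ y ∈ F

  -- (B,≤B) is the complete Boolean algebra of (P,≤P); e is the canonical map of
  -- P onto a dense subset.  (P need not be separative, so e need not be
  -- injective.)  This determines (B,≤B,e) up to isomorphism.
  record IsCompletion (P ≤P B ≤B e : V) : Set ℓ where
    open Order B ≤B
    field
      algebra      : IsCompleteBooleanAlgebra B ≤B
      function     : FunctionOn P e
      nonzero      : ∀ p b → app e p b → b ∈ B × ¬ IsBottom b
      monotone     : ∀ p q b c → app ≤P p q → app e p b → app e q c → b ≤ c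
      incompatible : ∀ p q b c → app e p b → app e q c →
                     ¬ (∃[ r ] app ≤P r p × app ≤P r q) →
                     ∃[ o ] IsBottom o × IsMeet b c o
      dense        : ∀ b → b ∈ B → ¬ IsBottom b → ∃[ p ] ∃[ c ] app e p c × c ≤ b

  module BooleanValued (B ≤B : V) where
    open Order B ≤B

    -- Every element of D is a set of pairs ⟨ρ,b⟩ with ρ ∈ D and b ∈ B.
    NameClosed : V → Set ℓ
    NameClosed D = ∀ τ p → τ ∈ D → p ∈ τ → ∃[ ρ ] ∃[ b ] IsPair ρ b p × ρ ∈ D × b ∈ B

    -- The recursive definition (σ is a set of pairs ⟨ρ,b⟩ with ρ a name and
    -- b ∈ B), unfolded by means of a set witnessing the recursion.
    IsName : V → Set ℓ
    IsName σ = ∃[ D ] NameClosed D × σ ∈ D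

    -- The functions e(σ,τ) = ⟦σ=τ⟧ and m(σ,τ) = ⟦σ∈τ⟧ on D × D, given by
    --   ⟦σ∈τ⟧ = ⋁ { c ∧ ⟦σ=ρ⟧ | ⟨ρ,c⟩ ∈ τ },
    --   ⟦σ=τ⟧ = ⋀ { ¬c ∨ ⟦ρ∈τ⟧ | ⟨ρ,c⟩ ∈ σ } ∧ ⋀ { ¬c ∨ ⟦ρ∈σ⟧ | ⟨ρ,c⟩ ∈ τ }.
    record IsValuation (D e m : V) : Set ℓ where
      field
        names    : NameClosed D
        elements : ∀ σ τ b → σ ∈ D → τ ∈ D →
                   app₂ m σ τ b ⇔
                   IsSup (λ x → ∃[ ρ ] ∃[ c ] ∃[ d ]
                            app τ ρ c × app₂ e σ ρ d × IsMeet c d x) b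
        equality : ∀ σ τ b → σ ∈ D → τ ∈ D →
                   app₂ e σ τ b ⇔
                   IsInf (λ x → (∃[ ρ ] ∃[ c ] ∃[ d ]
                                   app σ ρ c × app₂ m ρ τ d × IsImplication c d x)
                              ⊎ (∃[ ρ ] ∃[ c ] ∃[ d ]
                                   app τ ρ c × app₂ m ρ σ d × IsImplication c d x)) b

    -- ⟦σ=τ⟧ = b  and  ⟦σ∈τ⟧ = b
    ⟦_≐_⟧ ⟦_∈̇_⟧ : V → V → V → Set ℓ
    ⟦ σ ≐ τ ⟧ b = ∃[ D ] ∃[ e ] ∃[ m ] IsValuation D e m × σ ∈ D × τ ∈ D × app₂ e σ τ b
    ⟦ σ ∈̇ τ ⟧ b = ∃[ D ] ∃[ e ] ∃[ m ] IsValuation D e m × σ ∈ D × τ ∈ D × app₂ m σ τ b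

    -- x̌ = { ⟨y̌,1⟩ | y ∈ x }; h is the function y ↦ y̌ on a transitive set t ∋ x.
    IsCheck : V → V → Set ℓ
    IsCheck x x̌ = ∃[ t ] ∃[ h ] IsTransitive t × FunctionOn t h
      × (∀ y y̌ → app h y y̌ →
         y̌ Is｛ (λ p → ∃[ z ] ∃[ ž ] ∃[ 𝟙 ] z ∈ y × app h z ž × IsTop 𝟙 × IsPair ž 𝟙 p) ｝)
      × app h x x̌

    -- ⟦σ ∈ V̌⟧ = b
    ⟦_∈V̌⟧ : V → V → Set ℓ
    ⟦ σ ∈V̌⟧ b = IsSup (λ c → ∃[ x ] ∃[ x̌ ] IsCheck x x̌ × ⟦ σ ≐ x̌ ⟧ c) b

    module _ (F : V) where

      ForcedInV : V → Set ℓ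
      ForcedInV σ = IsName σ × ∃[ b ] ⟦ σ ∈V̌⟧ b × b ∈ F

      -- The transitive class N is the collapse of V̌_F; "c σ x" says that the
      -- collapse sends [σ]_F to x.
      record IsCollapse (N : V → Set ℓ) (c : V → V → Set ℓ) : Set ℓ where
        field
          transitive : ∀ x y → N y → x ∈ y → N x
          typed      : ∀ σ x → c σ x → ForcedInV σ × N x
          total      : ∀ σ → ForcedInV σ → ∃[ x ] c σ x
          onto       : ∀ x → N x → ∃[ σ ] c σ x
          equality   : ∀ σ τ x y → c σ x → c τ y →
                       x ≡ y ⇔ (∃[ b ] ⟦ σ ≐ τ ⟧ b × b ∈ F)
          membership : ∀ σ τ x y → c σ x → c τ y →
                       x ∈ y ⇔ (∃[ b ] ⟦ σ ∈̇ τ ⟧ b × b ∈ F)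

  IsBooleanUltrapower : (B ≤B F : V) → (V → Set ℓ) → Set ℓ
  IsBooleanUltrapower B ≤B F N =
      IsCompleteBooleanAlgebra B ≤B
    × IsUltrafilterOn B ≤B F
    × ∃[ c ] IsCollapse F N (λ σ x → c [ σ ∷ x ∷ [] ])
    where open BooleanValued B ≤B

  -- M ξ is the class M_ξ, "π ζ ξ x y" says π_{ζ,ξ}(x) = y, and
  -- "rep ξ g x" says that g represents x in the ultrapower of M_ξ.

  record IsIteration (κ α U : V) (M : V → V → Set ℓ)
                     (π : V → V → V → V → Set ℓ)
                     (rep : V → V → V → Set ℓ) : Set ℓ where
    field
      typed      : ∀ ζ ξ x y → ξ ⊴ α → ζ ⊴ ξ → π ζ ξ x y → M ζ x × M ξ y
      functional : ∀ ζ ξ x y y′ → ξ ⊴ α → ζ ⊴ ξ → π ζ ξ x y → π ζ ξ x y′ → y ≡ y′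
      total      : ∀ ζ ξ x → ξ ⊴ α → ζ ⊴ ξ → M ζ x → ∃[ y ] π ζ ξ x y
      start      : ∀ o x → IsEmpty o → M o x
      identity   : ∀ ξ x y → ξ ⊴ α → π ξ ξ x y ⇔ (M ξ x × x ≡ y)

      -- Stage η = ξ+1, with u = U_ξ, κ′ = π_{0,ξ}(κ) and u′ = π_{0,ξ}(U_ξ).
      successor  : ∀ o ξ η u κ′ u′ → IsEmpty o → ξ ∈ α → IsSuc ξ η →
                   app U ξ u → π o ξ κ κ′ → π o ξ u u′ →
                     IsUltrapower (M ξ) κ′ u′ (M η) (rep ξ)
                   × (∀ x y → π ξ η x y ⇔ (∃[ c ] IsConst κ′ x c × rep ξ c y))
      compose    : ∀ ζ ξ η x z → ξ ∈ α → IsSuc ξ η → ζ ⊴ ξ →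
                   π ζ η x z ⇔ (∃[ y ] π ζ ξ x y × π ξ η y z)

      -- At limits, M_λ is the transitive class isomorphic to the direct limit:
      -- pairs (ζ,x), (ζ′,x′) name the same element (resp. an element and a
      -- set containing it) iff they do so at some later stage η < λ.
      limit-transitive : ∀ l x y → l ⊴ α → IsLimit l → M l y → x ∈ y → M l x
      limit-onto       : ∀ l y → l ⊴ α → IsLimit l → M l y →
                         ∃[ ζ ] ∃[ x ] ζ ∈ l × π ζ l x y
      limit-equality   : ∀ l ζ ζ′ x x′ y y′ → l ⊴ α → IsLimit l → ζ ∈ l → ζ′ ∈ l →
                         π ζ l x y → π ζ′ l x′ y′ →
                         y ≡ y′ ⇔
                         (∃[ η ] η ∈ l × ζ ⊴ η × ζ′ ⊴ η ×
                           ∃[ z ] ∃[ z′ ] π ζ η x z × π ζ′ η x′ z′ × z ≡ z′)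
      limit-membership : ∀ l ζ ζ′ x x′ y y′ → l ⊴ α → IsLimit l → ζ ∈ l → ζ′ ∈ l →
                         π ζ l x y → π ζ′ l x′ y′ →
                         y ∈ y′ ⇔
                         (∃[ η ] η ∈ l × ζ ⊴ η × ζ′ ⊴ η ×
                           ∃[ z ] ∃[ z′ ] π ζ η x z × π ζ′ η x′ z′ × z ∈ z′)

  IsCriticalPoint : (V → V → Set ℓ) → V → Set ℓ
  IsCriticalPoint j k = IsOrdinal k × ¬ j k k × (∀ β → β ∈ k → j β β)

  -- K = ⟨κ_ξ | ξ<α⟩, where κ_ξ is the critical point of π_{ξ,ξ+1}.
  IsCriticalSequence : (α : V) (π : V → V → V → V → Set ℓ) (K : V) → Set ℓ
  IsCriticalSequence α π K = FunctionOn α K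
    × (∀ ξ η k → IsSuc ξ η → app K ξ k → IsCriticalPoint (π ξ η) k)

  -- The filter G_K on P, the forcing π_{0,α}(𝕄).
  InG : (α K P p : V) → Set ℓ
  InG α K P p = p ∈ P × ∃[ s ] ∃[ T ] IsPair s T p
    × (∃[ d ] IsDomain s d × IsRestriction K d s)
    × (∀ ξ → ξ ∈ α → ¬ InDom s ξ → ∃[ k ] ∃[ a ] app K ξ k × app T ξ a × k ∈ a)

  record IsGeneric (N : V → Set ℓ) (P ≤P : V) (G : V → Set ℓ) : Set ℓ where
    field
      subset   : ∀ p → G p → p ∈ P
      nonempty : ∃[ p ] G p
      upward   : ∀ p q → G p → app ≤P p q → G q
      directed : ∀ p q → G p → G q → ∃[ r ] G r × app ≤P r p × app ≤P r q
      meets    : ∀ D → N D → D ⊆ P →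
                 (∀ p → p ∈ P → ∃[ q ] q ∈ D × app ≤P q p) →
                 ∃[ q ] q ∈ D × G q

  -- The filter on (B,≤B) generated by the image of G under e.
  InGenerated : (B ≤B e : V) (G : V → Set ℓ) → V → Set ℓ
  InGenerated B ≤B e G b = b ∈ B × ∃[ p ] ∃[ c ] G p × app e p c × app ≤B c b

-- Write j for π_{0,α}.  A cofinal map preserving ten basic formulas is
-- elementary; hence elementarity of the whole iteration is a single formula of
-- V, proved by induction on the stage with Łoś's theorem and direct limits.
-- By normality the critical point κ_ξ is [id], so M_α is generated from the
-- range of j and the κ_ξ under application of functions.
--
-- Therefore every x ∈ M_α is the value j(h)(p), p ∈ G, of some h ∈ V defined on
-- conditions and coherent: compatible conditions get the same value.  For
-- x = κ_ξ this needs ξ ∈ dom(s) for some ⟨s,T⟩ ∈ G.  Now the conditions with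
-- ξ ∈ dom(s) or κ_ξ ∉ T(ξ) are dense, since one point can be removed from T(ξ),
-- and the second alternative is impossible in G.
--
-- A coherent h is turned into a name σ by mixing, with e(p) ≤ ⟦σ=x̌⟧ if
-- h(p) = x.  Conversely a name σ with ⟦σ∈V̌⟧ ∈ F yields the coherent h_σ sending
-- p to the x with e(p) ≤ ⟦σ=x̌⟧.  The collapse sends [σ] to the value of j(h_σ)
-- along G; it is well defined and an isomorphism because conditions forcing
-- σ = x̌ and τ = y̌ decide ⟦σ=τ⟧ and ⟦σ∈τ⟧ according to whether x = y, x ∈ y.

module Submission where

open import Defs
open import Level using (Level; _⊔_)
open import Axiom.ExcludedMiddle using (ExcludedMiddle)
open import Data.Empty using (⊥; ⊥-elim)
open import Data.Fin using (Fin; zero; suc; #_; _↑ˡ_; _↑ʳ_)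
open import Data.Nat using (ℕ; zero; suc) renaming (_+_ to _+ℕ_)
open import Data.Product using (Σ; ∃; ∃-syntax; _×_; _,_; proj₁; proj₂)
open import Data.Sum using (_⊎_; inj₁; inj₂; [_,_]′)
open import Data.Unit.Polymorphic using (⊤; tt)
open import Data.Vec using (Vec; []; _∷_; _++_; lookup; map)
open import Data.Vec.Properties using (map-++; map-id; map-∘; map-cong; lookup-++ˡ; lookup-++ʳ; lookup-map)
open import Function.Base using (_∘_; id; case_of_)
open import Function.Bundles using (_⇔_; mk⇔; Equivalence)
open import Relation.Nullary using (¬_; yes; no)
open import Relation.Nullary.Decidable using (recompute)
open import Relation.Binary.PropositionalEquality
  using (_≡_; refl; sym; trans; cong; cong₂; subst; subst₂)

open Equivalence using (to; from)

-- The structure `V` may be ill-founded, so induction on a stage is available only for properties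
-- expressed by a formula of `V` with parameters. `Embedding` ranges over all formulas of the
-- metatheory and is no such property; this obstacle is the reason for reducing elementarity to
-- finitely many formulas. Names are handled in `V` only. Every argument about conditions and
-- Boolean values takes place there, and its conclusion, a formula with parameters in `V`, is
-- carried to the last model by `j`; no valuation of names in the last model is needed. A coherent
-- function takes the place of a function on a maximal antichain, the usual representative of an
-- element of a Boolean ultrapower: no antichain has to be chosen, and common extensions of
-- conditions can be taken freely.

⇔-sym : ∀ {a b} {A : Set a} {B : Set b} → A ⇔ B → B ⇔ A
⇔-sym f = mk⇔ (from f) (to f)

infixr 2 _⟨⇔⟩_
_⟨⇔⟩_ : ∀ {a b c} {A : Set a} {B : Set b} {C : Set c} → A ⇔ B → B ⇔ C → A ⇔ C
f ⟨⇔⟩ g = mk⇔ (to g ∘ to f) (from f ∘ from g)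

⇔-refl : ∀ {a} {A : Set a} → A ⇔ A
⇔-refl = mk⇔ id id

≡⇒⇔ : ∀ {a} {A B : Set a} → A ≡ B → A ⇔ B
≡⇒⇔ refl = ⇔-refl

_×-⇔_ : ∀ {a b c d} {A : Set a} {B : Set b} {C : Set c} {D : Set d} →
        A ⇔ B → C ⇔ D → (A × C) ⇔ (B × D)
f ×-⇔ g = mk⇔ (λ (x , y) → to f x , to g y) (λ (x , y) → from f x , from g y)

¬-⇔ : ∀ {a b} {A : Set a} {B : Set b} → A ⇔ B → (¬ A) ⇔ (¬ B)
¬-⇔ f = mk⇔ (_∘ from f) (_∘ to f)

∃-⇔ : ∀ {a b c} {A : Set a} {P : A → Set b} {Q : A → Set c} →
      (∀ x → P x ⇔ Q x) → (∃ P) ⇔ (∃ Q)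
∃-⇔ f = mk⇔ (λ (x , p) → x , to (f x) p) (λ (x , q) → x , from (f x) q)

-- The interpretation of these formulas computes to the predicates of Defs, so
-- that a predicate is shown to be a class by writing down its formula.

data Tm {c} (C : Set c) (n : ℕ) : Set c where
  var : Fin n → Tm C n
  `_  : C → Tm C n

infix 9 `_

wk : ∀ {c} {C : Set c} {n} → Tm C n → Tm C (suc n)
wk (var i) = var (suc i)
wk (` c)   = ` c

vars : ∀ {c} {C : Set c} {n m} → (Fin n → Fin m) → Vec (Tm C m) n
vars {n = zero}  ρ = []
vars {n = suc n} ρ = var (ρ zero) ∷ vars (ρ ∘ suc)

#0 : ∀ {c} {C : Set c} {n} → Tm C (1 +ℕ n)
#0 = var zero
#1 : ∀ {c} {C : Set c} {n} → Tm C (2 +ℕ n)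
#1 = wk #0
#2 : ∀ {c} {C : Set c} {n} → Tm C (3 +ℕ n)
#2 = wk #1
#3 : ∀ {c} {C : Set c} {n} → Tm C (4 +ℕ n)
#3 = wk #2
#4 : ∀ {c} {C : Set c} {n} → Tm C (5 +ℕ n)
#4 = wk #3
#5 : ∀ {c} {C : Set c} {n} → Tm C (6 +ℕ n)
#5 = wk #4
#6 : ∀ {c} {C : Set c} {n} → Tm C (7 +ℕ n)
#6 = wk #5
#7 : ∀ {c} {C : Set c} {n} → Tm C (8 +ℕ n)
#7 = wk #6
#8 : ∀ {c} {C : Set c} {n} → Tm C (9 +ℕ n)
#8 = wk #7
#9 : ∀ {c} {C : Set c} {n} → Tm C (10 +ℕ n)
#9 = wk #8

infix  8 _∈ᶠ_ _≡ᶠ_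
infix  7 ¬ᶠ_
infixr 6 _∧ᶠ_
infixr 5 _∨ᶠ_
infixr 4 _⇒ᶠ_
infix  3 _⇔ᶠ_
infix  2 ∃ᶠ_ ∀ᶠ_

-- The connectives mirror those of Agda, so that `⟦_⟧` unfolds to the intended predicate. Atoms keep
-- compiled notions folded: they are classes inside one model, arbitrary formulas when the schemes
-- of ZFC are moved, and absent (`NoAtom`) when a fixed statement is compared between two
-- structures.
data Fm {a c} (At : ℕ → Set a) (C : Set c) : ℕ → Set (a ⊔ c) where
  _∈ᶠ_ _≡ᶠ_ : ∀ {n} → Tm C n → Tm C n → Fm At C n
  atom      : ∀ {n m} → At m → Vec (Tm C n) m → Fm At C n
  ¬ᶠ_       : ∀ {n} → Fm At C n → Fm At C n
  _∧ᶠ_ _∨ᶠ_ _⇒ᶠ_ _⇔ᶠ_ : ∀ {n} → Fm At C n → Fm At C n → Fm At C n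
  ∃ᶠ_ ∀ᶠ_   : ∀ {n} → Fm At C (suc n) → Fm At C n

module Interpretation {ℓ a c : Level} (V : Set ℓ) (_∈_ : V → V → Set ℓ)
  {At : ℕ → Set a} {C : Set c} (I : ∀ {m} → At m → Vec V m → Set ℓ) (g : C → V) where

  eval : ∀ {n} → Vec V n → Tm C n → V
  eval v (var i) = lookup v i
  eval v (` c)   = g c

  evals : ∀ {n m} → Vec V n → Vec (Tm C n) m → Vec V m
  evals v []       = []
  evals v (t ∷ ts) = eval v t ∷ evals v ts

  eval-wk : ∀ {n} x (v : Vec V n) t → eval (x ∷ v) (wk t) ≡ eval v t
  eval-wk x v (var i) = refl
  eval-wk x v (` c)   = refl

  evals-vars : ∀ {n m} (ρ : Fin n → Fin m) (v : Vec V m) (w : Vec V n) →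
               (∀ i → lookup v (ρ i) ≡ lookup w i) → evals v (vars ρ) ≡ w
  evals-vars ρ v []       h = refl
  evals-vars ρ v (x ∷ w)  h = cong₂ _∷_ (h zero) (evals-vars (ρ ∘ suc) v w (h ∘ suc))

  ⟦_⟧ : ∀ {n} → Fm At C n → Vec V n → Set ℓ
  ⟦ s ∈ᶠ t ⟧    v = eval v s ∈ eval v t
  ⟦ s ≡ᶠ t ⟧    v = eval v s ≡ eval v t
  ⟦ atom A ts ⟧ v = I A (evals v ts)
  ⟦ ¬ᶠ φ ⟧      v = ¬ ⟦ φ ⟧ v
  ⟦ φ ∧ᶠ ψ ⟧    v = ⟦ φ ⟧ v × ⟦ ψ ⟧ v
  ⟦ φ ∨ᶠ ψ ⟧    v = ⟦ φ ⟧ v ⊎ ⟦ ψ ⟧ v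
  ⟦ φ ⇒ᶠ ψ ⟧    v = ⟦ φ ⟧ v → ⟦ ψ ⟧ v
  ⟦ φ ⇔ᶠ ψ ⟧    v = ⟦ φ ⟧ v ⇔ ⟦ ψ ⟧ v
  ⟦ ∃ᶠ φ ⟧      v = ∃ λ x → ⟦ φ ⟧ (x ∷ v)
  ⟦ ∀ᶠ φ ⟧      v = ∀ x → ⟦ φ ⟧ (x ∷ v)

-- Compilation into formulas of set theory with parameters

ren : ∀ {m n} → (Fin m → Fin n) → Formula m → Formula n
ren ρ (mem i j) = mem (ρ i) (ρ j)
ren ρ (eq i j)  = eq (ρ i) (ρ j)
ren ρ (neg φ)   = neg (ren ρ φ)
ren ρ (and φ ψ) = and (ren ρ φ) (ren ρ ψ)
ren {m} {n} ρ (ex φ) = ex (ren ρ⁺ φ)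
  where
  ρ⁺ : Fin (suc m) → Fin (suc n)
  ρ⁺ zero    = zero
  ρ⁺ (suc i) = suc (ρ i)

module _ {ℓ : Level} (V : Set ℓ) (_∈_ : V → V → Set ℓ) where
  open SetTheory V _∈_

  Sat-ren : ∀ {m n} (φ : Formula m) (ρ : Fin m → Fin n) (v : Vec V m) (w : Vec V n) →
            (∀ i → lookup w (ρ i) ≡ lookup v i) → Sat (ren ρ φ) w ⇔ Sat φ v
  Sat-ren (mem i j) ρ v w h = ≡⇒⇔ (cong₂ _∈_ (h i) (h j))
  Sat-ren (eq i j)  ρ v w h = ≡⇒⇔ (cong₂ _≡_ (h i) (h j))
  Sat-ren (neg φ)   ρ v w h = ¬-⇔ (Sat-ren φ ρ v w h)
  Sat-ren (and φ ψ) ρ v w h = Sat-ren φ ρ v w h ×-⇔ Sat-ren ψ ρ v w h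
  Sat-ren (ex φ)    ρ v w h =
    ∃-⇔ λ x → Sat-ren φ _ (x ∷ v) (x ∷ w) λ { zero → refl ; (suc i) → h i }

-- The constants stay in a table apart from the formula, so that one formula can be evaluated in two
-- structures with two interpretations of the table; elementarity then applies to the formula alone.
record Coded {c} (C : Set c) (n : ℕ) : Set c where
  constructor coded
  field
    {size}  : ℕ
    formula : Formula (n +ℕ size)
    table   : Vec C size

Embedding : ∀ {ℓ} {V W : Set ℓ} → (V → V → Set ℓ) → (W → W → Set ℓ) → (V → W) → Set ℓ
Embedding {V = V} {W} _∈_ _∈′_ j =
  ∀ {n} (φ : Formula n) (v : Vec V n) →
  SetTheory.Sat V _∈_ φ v ⇔ SetTheory.Sat W _∈′_ φ (map j v)

left : ∀ n {k l} → Fin (n +ℕ k) → Fin (n +ℕ (k +ℕ l))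
left zero    i       = i ↑ˡ _
left (suc n) zero    = zero
left (suc n) (suc i) = suc (left n i)

right : ∀ n {k l} → Fin (n +ℕ l) → Fin (n +ℕ (k +ℕ l))
right zero {k} i     = k ↑ʳ i
right (suc n) zero    = zero
right (suc n) (suc i) = suc (right n i)

module _ {v} {V : Set v} where

  lookup-left : ∀ {n k l} (xs : Vec V n) (ys : Vec V k) (zs : Vec V l) i →
                lookup (xs ++ ys ++ zs) (left n i) ≡ lookup (xs ++ ys) i
  lookup-left []       ys zs i       = lookup-++ˡ ys zs i
  lookup-left (x ∷ xs) ys zs zero    = refl
  lookup-left (x ∷ xs) ys zs (suc i) = lookup-left xs ys zs i

  lookup-right : ∀ {n k l} (xs : Vec V n) (ys : Vec V k) (zs : Vec V l) i →
                 lookup (xs ++ ys ++ zs) (right n i) ≡ lookup (xs ++ zs) i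
  lookup-right []       ys zs i       = lookup-++ʳ ys zs i
  lookup-right (x ∷ xs) ys zs zero    = refl
  lookup-right (x ∷ xs) ys zs (suc i) = lookup-right xs ys zs i

record CodedTms {c} (C : Set c) (n m : ℕ) : Set c where
  constructor codedTms
  field
    {size}  : ℕ
    indices : Vec (Fin (n +ℕ size)) m
    table   : Vec C size

plug : ∀ n k {m l} → Vec (Fin (n +ℕ k)) m → Fin (m +ℕ l) → Fin (n +ℕ (k +ℕ l))
plug n k []       i       = n ↑ʳ (k ↑ʳ i)
plug n k (r ∷ rs) zero    = left n r
plug n k (r ∷ rs) (suc i) = plug n k rs i

module _ {c} {C : Set c} where

  and-coded : ∀ {n} → Coded C n → Coded C n → Coded C n
  and-coded {n} (coded φ ps) (coded ψ qs) =
    coded (and (ren (left n) φ) (ren (right n) ψ)) (ps ++ qs)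

  neg-coded : ∀ {n} → Coded C n → Coded C n
  neg-coded (coded φ ps) = coded (neg φ) ps

  ex-coded : ∀ {n} → Coded C (suc n) → Coded C n
  ex-coded (coded φ ps) = coded (ex φ) ps

  codeTm : ∀ {n} → Tm C n → CodedTms C n 1
  codeTm (var i)     = codedTms ((i ↑ˡ 0) ∷ []) []
  codeTm {n} (` x)   = codedTms ((n ↑ʳ zero) ∷ []) (x ∷ [])

  codeTms : ∀ {n m} → Vec (Tm C n) m → CodedTms C n m
  codeTms []               = codedTms [] []
  codeTms {n} (t ∷ ts) with codeTm t | codeTms ts
  ... | codedTms (i ∷ []) ps | codedTms is qs =
    codedTms (left n i ∷ map (right n) is) (ps ++ qs)

  apply-coded : ∀ {n m} → Coded C m → CodedTms C n m → Coded C n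
  apply-coded {n} (coded φ qs) (codedTms is ps) = coded (ren (plug n _ is) φ) (ps ++ qs)

  module Coding {a} {At : ℕ → Set a} (codeAtom : ∀ {m} → At m → Coded C m) where

    code : ∀ {n} → Fm At C n → Coded C n
    code (s ∈ᶠ t)    = apply-coded (coded (mem zero (suc zero)) []) (codeTms (s ∷ t ∷ []))
    code (s ≡ᶠ t)    = apply-coded (coded (eq zero (suc zero)) []) (codeTms (s ∷ t ∷ []))
    code (atom A ts) = apply-coded (codeAtom A) (codeTms ts)
    code (¬ᶠ φ)      = neg-coded (code φ)
    code (φ ∧ᶠ ψ)    = and-coded (code φ) (code ψ)
    code (φ ∨ᶠ ψ)    = neg-coded (and-coded (neg-coded (code φ)) (neg-coded (code ψ)))
    code (φ ⇒ᶠ ψ)    = neg-coded (and-coded (code φ) (neg-coded (code ψ)))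
    code (φ ⇔ᶠ ψ)    = and-coded (neg-coded (and-coded (code φ) (neg-coded (code ψ))))
                                 (neg-coded (and-coded (code ψ) (neg-coded (code φ))))
    code (∃ᶠ φ)      = ex-coded (code φ)
    code (∀ᶠ φ)      = neg-coded (ex-coded (neg-coded (code φ)))

module CodingCorrect {ℓ a c : Level} (V : Set ℓ) (_∈_ : V → V → Set ℓ) (em : ExcludedMiddle ℓ)
  {At : ℕ → Set a} {C : Set c} (I : ∀ {m} → At m → Vec V m → Set ℓ) (g : C → V)
  (codeAtom : ∀ {m} → At m → Coded C m)
  (atom-correct : ∀ {m} (A : At m) xs →
    SetTheory.Sat V _∈_ (Coded.formula (codeAtom A)) (xs ++ map g (Coded.table (codeAtom A)))
    ⇔ I A xs)
  where

  open SetTheory V _∈_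
  open Interpretation V _∈_ I g
  open Coding codeAtom

  stable : ∀ {A : Set ℓ} → ¬ ¬ A → A
  stable {A} nn with em {A}
  ... | yes a = a
  ... | no ¬a = ⊥-elim (nn ¬a)

  Holds : ∀ {n} → Coded C n → Vec V n → Set ℓ
  Holds (coded φ ps) xs = Sat φ (xs ++ map g ps)

  and-correct : ∀ {n} (φ ψ : Coded C n) xs →
                Holds (and-coded φ ψ) xs ⇔ (Holds φ xs × Holds ψ xs)
  and-correct {n} (coded φ ps) (coded ψ qs) xs rewrite map-++ g ps qs =
    Sat-ren V _∈_ φ (left n) _ _ (lookup-left xs (map g ps) (map g qs))
    ×-⇔ Sat-ren V _∈_ ψ (right n) _ _ (lookup-right xs (map g ps) (map g qs))

  Represents : ∀ {n m} → CodedTms C n m → Vec (Tm C n) m → Vec V n → Set ℓ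
  Represents (codedTms is ps) ts xs =
    ∀ i → lookup (xs ++ map g ps) (lookup is i) ≡ lookup (evals xs ts) i

  codeTms-correct : ∀ {n m} (ts : Vec (Tm C n) m) xs → Represents (codeTms ts) ts xs
  codeTms-correct {n} (t ∷ ts) xs i with codeTm t in eq | codeTms ts | codeTms-correct ts xs
  codeTms-correct {n} (t ∷ ts) xs zero | codedTms (j ∷ []) ps | codedTms is qs | ih
    rewrite map-++ g ps qs = trans (lookup-left xs (map g ps) (map g qs) j) (tm t eq)
    where
    tm : ∀ t → codeTm t ≡ codedTms (j ∷ []) ps → lookup (xs ++ map g ps) j ≡ eval xs t
    tm (var k) refl = lookup-++ˡ xs [] k
    tm (` x)   refl = lookup-++ʳ xs (g x ∷ []) zero
  codeTms-correct {n} (t ∷ ts) xs (suc i) | codedTms (j ∷ []) ps | codedTms is qs | ih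
    rewrite map-++ g ps qs =
    trans (cong (lookup (xs ++ map g ps ++ map g qs)) (lookup-map i (right n) is))
          (trans (lookup-right xs (map g ps) (map g qs) (lookup is i)) (ih i))

  lookup-plug : ∀ {n m k l} (xs : Vec V n) (ys : Vec V k) (zs : Vec V l)
                (is : Vec (Fin (n +ℕ k)) m) (ws : Vec V m) →
                (∀ i → lookup (xs ++ ys) (lookup is i) ≡ lookup ws i) →
                ∀ i → lookup (xs ++ ys ++ zs) (plug n k is i) ≡ lookup (ws ++ zs) i
  lookup-plug xs ys zs []       []       h i       =
    trans (lookup-++ʳ xs (ys ++ zs) _) (lookup-++ʳ ys zs i)
  lookup-plug xs ys zs (j ∷ is) (w ∷ ws) h zero    = trans (lookup-left xs ys zs j) (h zero)
  lookup-plug xs ys zs (j ∷ is) (w ∷ ws) h (suc i) = lookup-plug xs ys zs is ws (h ∘ suc) i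

  apply-correct : ∀ {n m} (φ : Coded C m) (ts : Vec (Tm C n) m) xs →
                  Holds (apply-coded φ (codeTms ts)) xs ⇔ Holds φ (evals xs ts)
  apply-correct {n} (coded φ qs) ts xs with codeTms ts | codeTms-correct ts xs
  ... | codedTms is ps | h rewrite map-++ g ps qs =
    Sat-ren V _∈_ φ (plug n _ is) _ _ (lookup-plug xs (map g ps) (map g qs) is (evals xs ts) h)

  ∧¬⇔→ : ∀ {A B : Set ℓ} → (¬ (A × ¬ B)) ⇔ (A → B)
  ∧¬⇔→ = mk⇔ (λ h x → stable λ ¬b → h (x , ¬b)) (λ f (x , ¬b) → ¬b (f x))

  imp-correct : ∀ {n} (φ ψ : Coded C n) xs →
                Holds (neg-coded (and-coded φ (neg-coded ψ))) xs ⇔ (Holds φ xs → Holds ψ xs)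
  imp-correct φ ψ xs = ¬-⇔ (and-correct φ (neg-coded ψ) xs) ⟨⇔⟩ ∧¬⇔→

  -- `Formula` has only negation, conjunction and existence. The other connectives are compiled to
  -- classical abbreviations, which agree with those of Agda by excluded middle (`stable`).
  code-correct : ∀ {n} (φ : Fm At C n) xs → Holds (code φ) xs ⇔ ⟦ φ ⟧ xs
  code-correct (s ∈ᶠ t)    xs = apply-correct (coded (mem zero (suc zero)) []) (s ∷ t ∷ []) xs
  code-correct (s ≡ᶠ t)    xs = apply-correct (coded (eq zero (suc zero)) []) (s ∷ t ∷ []) xs
  code-correct (atom A ts) xs = apply-correct (codeAtom A) ts xs ⟨⇔⟩ atom-correct A _
  code-correct (¬ᶠ φ)      xs = ¬-⇔ (code-correct φ xs)
  code-correct (φ ∧ᶠ ψ)    xs =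
    and-correct (code φ) (code ψ) xs ⟨⇔⟩ code-correct φ xs ×-⇔ code-correct ψ xs
  code-correct (φ ∨ᶠ ψ)    xs = ¬-⇔ (and-correct (neg-coded (code φ)) (neg-coded (code ψ)) xs)
    ⟨⇔⟩ mk⇔
      (λ h → stable λ n → h ((λ p → n (inj₁ (to (code-correct φ xs) p)))
                           , (λ q → n (inj₂ (to (code-correct ψ xs) q)))))
      [ (λ p (n , _) → n (from (code-correct φ xs) p))
      , (λ q (_ , n) → n (from (code-correct ψ xs) q)) ]′
  code-correct (φ ⇒ᶠ ψ)    xs = imp-correct (code φ) (code ψ) xs ⟨⇔⟩
    mk⇔ (λ f p → to (code-correct ψ xs) (f (from (code-correct φ xs) p)))
        (λ f p → from (code-correct ψ xs) (f (to (code-correct φ xs) p)))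
  code-correct (φ ⇔ᶠ ψ)    xs = and-correct (neg-coded (and-coded (code φ) (neg-coded (code ψ))))
                                             (neg-coded (and-coded (code ψ) (neg-coded (code φ)))) xs
    ⟨⇔⟩ (imp-correct (code φ) (code ψ) xs ×-⇔ imp-correct (code ψ) (code φ) xs)
    ⟨⇔⟩ mk⇔
      (λ (f , h) → code-correct φ xs ⁻ ⟨⇔⟩ mk⇔ f h ⟨⇔⟩ code-correct ψ xs)
      (λ e → let d = code-correct φ xs ⟨⇔⟩ e ⟨⇔⟩ code-correct ψ xs ⁻ in to d , from d)
    where
    _⁻ : ∀ {A B : Set ℓ} → A ⇔ B → B ⇔ A
    _⁻ = ⇔-sym
  code-correct (∃ᶠ φ)      xs = ∃-⇔ λ x → code-correct φ (x ∷ xs)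
  code-correct (∀ᶠ φ)      xs = mk⇔
    (λ h x → stable λ n → h (x , n ∘ to (code-correct φ (x ∷ xs))))
    (λ f (x , n) → n (from (code-correct φ (x ∷ xs)) (f x)))

-- Formulas for the basic notions of set theory

module Codes {a c : Level} {At : ℕ → Set a} {C : Set c} where

  private
    T : ℕ → Set c
    T = Tm C

    F : ℕ → Set (a ⊔ c)
    F = Fm At C

  infix 8 _⊆ᶠ_ _⊴ᶠ_

  _⊆ᶠ_ : ∀ {n} → T n → T n → F n
  x ⊆ᶠ y = ∀ᶠ #0 ∈ᶠ wk x ⇒ᶠ #0 ∈ᶠ wk y

  emptyᶠ : ∀ {n} → T n → F n
  emptyᶠ x = ∀ᶠ ¬ᶠ #0 ∈ᶠ wk x

  sucᶠ : ∀ {n} → T n → T n → F n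
  sucᶠ x y = ∀ᶠ #0 ∈ᶠ wk y ⇔ᶠ #0 ∈ᶠ wk x ∨ᶠ #0 ≡ᶠ wk x

  upairᶠ : ∀ {n} → T n → T n → T n → F n
  upairᶠ x y p = ∀ᶠ #0 ∈ᶠ wk p ⇔ᶠ #0 ≡ᶠ wk x ∨ᶠ #0 ≡ᶠ wk y

  pairᶠ : ∀ {n} → T n → T n → T n → F n
  pairᶠ x y p = ∃ᶠ ∃ᶠ upairᶠ (wk (wk x)) (wk (wk x)) #1 ∧ᶠ upairᶠ (wk (wk x)) (wk (wk y)) #0
                     ∧ᶠ upairᶠ #1 #0 (wk (wk p))

  appᶠ : ∀ {n} → T n → T n → T n → F n
  appᶠ f x y = ∃ᶠ pairᶠ (wk x) (wk y) #0 ∧ᶠ #0 ∈ᶠ wk f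

  app₂ᶠ : ∀ {n} → T n → T n → T n → T n → F n
  app₂ᶠ f x y z = ∃ᶠ pairᶠ (wk x) (wk y) #0 ∧ᶠ appᶠ (wk f) #0 (wk z)

  functionᶠ : ∀ {n} → T n → F n
  functionᶠ f = (∀ᶠ #0 ∈ᶠ wk f ⇒ᶠ (∃ᶠ ∃ᶠ pairᶠ #1 #0 #2))
             ∧ᶠ (∀ᶠ ∀ᶠ ∀ᶠ appᶠ (wk (wk (wk f))) #2 #1 ⇒ᶠ appᶠ (wk (wk (wk f))) #2 #0 ⇒ᶠ #1 ≡ᶠ #0)

  inDomᶠ : ∀ {n} → T n → T n → F n
  inDomᶠ f x = ∃ᶠ appᶠ (wk f) (wk x) #0

  functionOnᶠ : ∀ {n} → T n → T n → F n
  functionOnᶠ d f = functionᶠ f ∧ᶠ (∀ᶠ #0 ∈ᶠ wk d ⇔ᶠ inDomᶠ (wk f) #0)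

  transitiveᶠ : ∀ {n} → T n → F n
  transitiveᶠ x = ∀ᶠ #0 ∈ᶠ wk x ⇒ᶠ #0 ⊆ᶠ wk x

  ordinalᶠ : ∀ {n} → T n → F n
  ordinalᶠ x = transitiveᶠ x ∧ᶠ (∀ᶠ #0 ∈ᶠ wk x ⇒ᶠ transitiveᶠ #0)

  _⊴ᶠ_ : ∀ {n} → T n → T n → F n
  x ⊴ᶠ y = x ∈ᶠ y ∨ᶠ x ≡ᶠ y

  domainᶠ : ∀ {n} → T n → T n → F n
  domainᶠ f d = ∀ᶠ #0 ∈ᶠ wk d ⇔ᶠ inDomᶠ (wk f) #0

  restrictionᶠ : ∀ {n} → T n → T n → T n → F n
  restrictionᶠ f a g = ∀ᶠ #0 ∈ᶠ wk g ⇔ᶠ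
    #0 ∈ᶠ wk f ∧ᶠ (∃ᶠ ∃ᶠ pairᶠ #1 #0 #2 ∧ᶠ #1 ∈ᶠ wk (wk (wk a)))

-- Set theory in a model of ZFC

record ZFCModel (ℓ : Level) : Set (Level.suc ℓ) where
  field
    V   : Set ℓ
    _∈_ : V → V → Set ℓ
    em  : ExcludedMiddle ℓ
    zfc : SetTheory.IsZFC V _∈_

module ZF {ℓ : Level} (𝒱 : ZFCModel ℓ) where

  open ZFCModel 𝒱
  open SetTheory V _∈_
  open IsZFC zfc
  open Codes

  Fm₀ : ℕ → Set ℓ
  Fm₀ = Fm Class V

  open Interpretation V _∈_ {At = Class} {C = V} (λ C xs → C [ xs ]) id public using (⟦_⟧)

  private
    codeClass : ∀ {m} → Class m → Coded V m
    codeClass (class φ ps) = coded φ ps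

    codeClass-correct : ∀ {m} (A : Class m) xs →
      Sat (Coded.formula (codeClass A)) (xs ++ map id (Coded.table (codeClass A))) ⇔ A [ xs ]
    codeClass-correct (class φ ps) xs rewrite map-id ps = ⇔-refl

    module C = Coding (codeClass)
    module CC = CodingCorrect V _∈_ em {At = Class} {C = V} (λ C xs → C [ xs ]) id
                  codeClass codeClass-correct

  stable : ∀ {A : Set ℓ} → ¬ ¬ A → A
  stable = CC.stable

  dec : (A : Set ℓ) → A ⊎ ¬ A
  dec A with em {A}
  ... | yes a = inj₁ a
  ... | no ¬a = inj₂ ¬a

  ¬∀→∃¬ : ∀ {A : Set ℓ} {P : A → Set ℓ} → ¬ (∀ x → P x) → ∃[ x ] ¬ P x
  ¬∀→∃¬ n = stable λ h → n λ x → stable λ ¬p → h (x , ¬p)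

  opaque
    toClass : ∀ {n} → Fm₀ n → Class n
    toClass φ = class (Coded.formula (C.code φ)) (Coded.table (C.code φ))

    toClass-correct : ∀ {n} (φ : Fm₀ n) xs → toClass φ [ xs ] ⇔ ⟦ φ ⟧ xs
    toClass-correct φ xs =
      ≡⇒⇔ (cong (λ ps → Sat (Coded.formula (C.code φ)) (xs ++ ps)) (sym (map-id (Coded.table (C.code φ)))))
      ⟨⇔⟩ CC.code-correct φ xs

  ext : ∀ {x y} → (∀ z → z ∈ x → z ∈ y) → (∀ z → z ∈ y → z ∈ x) → x ≡ y
  ext f g = extensionality _ _ λ z → mk⇔ (f z) (g z)

  Is-unique : ∀ {P : V → Set ℓ} {a b} → a Is｛ P ｝ → b Is｛ P ｝ → a ≡ b
  Is-unique p q = extensionality _ _ λ z → p z ⟨⇔⟩ ⇔-sym (q z)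

  opaque
    comp : (φ : Fm₀ 1) (a : V) → V
    comp φ a = proj₁ (separation (toClass φ) a)

    ∈-comp : ∀ φ a → comp φ a Is｛ (λ z → z ∈ a × ⟦ φ ⟧ (z ∷ [])) ｝
    ∈-comp φ a z = proj₂ (separation (toClass φ) a) z ⟨⇔⟩ (⇔-refl ×-⇔ toClass-correct φ _)

    image : (φ : Fm₀ 2) (a : V) →
            (∀ x y y′ → x ∈ a → ⟦ φ ⟧ (x ∷ y ∷ []) → ⟦ φ ⟧ (x ∷ y′ ∷ []) → y ≡ y′) →
            ∃[ b ] b Is｛ (λ y → ∃[ x ] x ∈ a × ⟦ φ ⟧ (x ∷ y ∷ [])) ｝
    image φ a fun with replacement (toClass φ) a
      (λ x y y′ m p q → fun x y y′ m (to (toClass-correct φ _) p) (to (toClass-correct φ _) q))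
    ... | b , h = b , λ y → h y ⟨⇔⟩ ∃-⇔ λ x → ⇔-refl ×-⇔ toClass-correct φ _

    pr : V → V → V
    pr x y = proj₁ (pairing x y)

    ∈-pr : ∀ x y → IsUnorderedPair x y (pr x y)
    ∈-pr x y = proj₂ (pairing x y)

    ⋃ : V → V
    ⋃ a = proj₁ (union a)

    ∈-⋃ : ∀ a → ⋃ a Is｛ (λ z → ∃[ x ] x ∈ a × z ∈ x) ｝
    ∈-⋃ a = proj₂ (union a)

    𝒫 : V → V
    𝒫 a = proj₁ (powerset a)

    ∈-𝒫 : ∀ a → 𝒫 a Is｛ (λ z → z ⊆ a) ｝
    ∈-𝒫 a = proj₂ (powerset a)

    ∅ : V
    ∅ = proj₁ (proj₁ (proj₂ infinity))

    ∉∅ : IsEmpty ∅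
    ∉∅ = proj₁ (proj₂ (proj₁ (proj₂ infinity)))

    infix 10 _∪_
    _∪_ : V → V → V
    a ∪ b = ⋃ (pr a b)

    ∈-∪ : ∀ a b → (a ∪ b) Is｛ (λ z → z ∈ a ⊎ z ∈ b) ｝
    ∈-∪ a b z = ∈-⋃ _ z ⟨⇔⟩ mk⇔
      (λ (x , m , n) → [ (λ { refl → inj₁ n }) , (λ { refl → inj₂ n }) ]′ (to (∈-pr a b x) m))
      [ (λ m → a , from (∈-pr a b a) (inj₁ refl) , m)
      , (λ m → b , from (∈-pr a b b) (inj₂ refl) , m) ]′

  sg : V → V
  sg x = pr x x

  ∈-sg : ∀ x → sg x Is｛ (λ z → z ≡ x) ｝
  ∈-sg x z = ∈-pr x x z ⟨⇔⟩ mk⇔ [ id , id ]′ inj₁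

  self∈sg : ∀ x → x ∈ sg x
  self∈sg x = from (∈-sg x x) refl

  empty-unique : ∀ {a} → IsEmpty a → a ≡ ∅
  empty-unique h = ext (λ z m → ⊥-elim (h z m)) (λ z m → ⊥-elim (∉∅ z m))

  nonempty : ∀ {a} → ¬ IsEmpty a → ∃[ z ] z ∈ a
  nonempty n = stable λ h → n λ z m → h (z , m)

  upair-inj : ∀ {x y x′ y′ a} → IsUnorderedPair x y a → IsUnorderedPair x′ y′ a →
              (x ≡ x′ × y ≡ y′) ⊎ (x ≡ y′ × y ≡ x′)
  upair-inj {x} {y} {x′} {y′} p q
    with to (q x) (from (p x) (inj₁ refl)) | to (q y) (from (p y) (inj₂ refl))
       | to (p x′) (from (q x′) (inj₁ refl)) | to (p y′) (from (q y′) (inj₂ refl))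
  ... | inj₁ refl | inj₁ refl | _ | inj₁ refl = inj₁ (refl , refl)
  ... | inj₁ refl | inj₁ refl | _ | inj₂ refl = inj₁ (refl , refl)
  ... | inj₁ refl | inj₂ refl | _ | _         = inj₁ (refl , refl)
  ... | inj₂ refl | inj₁ refl | _ | _         = inj₂ (refl , refl)
  ... | inj₂ refl | inj₂ refl | inj₁ refl | _ = inj₁ (refl , refl)
  ... | inj₂ refl | inj₂ refl | inj₂ refl | _ = inj₁ (refl , refl)

  pair-inj : ∀ {x y x′ y′ p} → IsPair x y p → IsPair x′ y′ p → x ≡ x′ × y ≡ y′
  pair-inj {x} {y} {x′} {y′} (a , b , sa , ub , h) (a′ , b′ , sa′ , ub′ , h′) with upair-inj h h′
  ... | inj₁ (refl , refl) with upair-inj sa sa′ | upair-inj ub ub′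
  ...   | inj₁ (refl , _) | inj₁ (_ , refl) = refl , refl
  ...   | inj₁ (refl , _) | inj₂ (refl , refl) = refl , refl
  ...   | inj₂ (refl , _) | inj₁ (_ , refl) = refl , refl
  ...   | inj₂ (refl , _) | inj₂ (refl , refl) = refl , refl
  pair-inj (a , b , sa , ub , h) (a′ , b′ , sa′ , ub′ , h′)
      | inj₂ (refl , refl) with upair-inj sa ub′ | upair-inj ub sa′
  ...   | inj₁ (refl , refl) | inj₁ (_ , refl) = refl , refl
  ...   | inj₁ (refl , refl) | inj₂ (_ , refl) = refl , refl
  ...   | inj₂ (refl , refl) | inj₁ (_ , refl) = refl , refl
  ...   | inj₂ (refl , refl) | inj₂ (_ , refl) = refl , refl

  opaque
    ⟨_,_⟩ : V → V → V
    ⟨ x , y ⟩ = pr (sg x) (pr x y)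

    isPair : ∀ x y → IsPair x y ⟨ x , y ⟩
    isPair x y = sg x , pr x y , ∈-pr x x , ∈-pr x y , ∈-pr (sg x) (pr x y)

    pair≡ : ∀ {x y p} → IsPair x y p → p ≡ ⟨ x , y ⟩
    pair≡ {x} {y} (a , b , sa , ub , h)
      with refl ← Is-unique sa (∈-pr x x) | refl ← Is-unique ub (∈-pr x y) = Is-unique h (∈-pr _ _)

  app-intro : ∀ {f x y} → ⟨ x , y ⟩ ∈ f → app f x y
  app-intro m = _ , isPair _ _ , m

  app-elim : ∀ {f x y} → app f x y → ⟨ x , y ⟩ ∈ f
  app-elim (p , h , m) = subst (_∈ _) (pair≡ h) m

  app-∈ : ∀ {f x y p} → IsPair x y p → app f x y → p ∈ f
  app-∈ h (q , h′ , m) = subst (_∈ _) (trans (pair≡ h′) (sym (pair≡ h))) m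

  app₂-elim : ∀ {f x y z} → app₂ f x y z → app f ⟨ x , y ⟩ z
  app₂-elim (p , h , a) = subst (λ p → app _ p _) (pair≡ h) a

  private
    IsPair→∈⋃⋃ : ∀ {f x y p} → IsPair x y p → p ∈ f → x ∈ ⋃ (⋃ f) × y ∈ ⋃ (⋃ f)
    IsPair→∈⋃⋃ {f} {x} {y} {p} (a , b , sa , ub , h) m =
      from (∈-⋃ _ _) (b , from (∈-⋃ _ _) (p , m , from (h b) (inj₂ refl)) , from (ub x) (inj₁ refl)) ,
      from (∈-⋃ _ _) (b , from (∈-⋃ _ _) (p , m , from (h b) (inj₂ refl)) , from (ub y) (inj₂ refl))

  app-fields : ∀ {f x y} → app f x y → x ∈ ⋃ (⋃ f) × y ∈ ⋃ (⋃ f)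
  app-fields (p , h , m) = IsPair→∈⋃⋃ h m

  ∪₁ : ∀ {a b z} → z ∈ a → z ∈ (a ∪ b)
  ∪₁ m = from (∈-∪ _ _ _) (inj₁ m)

  ∪₂ : ∀ {a b z} → z ∈ b → z ∈ (a ∪ b)
  ∪₂ m = from (∈-∪ _ _ _) (inj₂ m)

  opaque
    _⊗_ : V → V → V
    a ⊗ b = comp (∃ᶠ ∃ᶠ pairᶠ #1 #0 #2 ∧ᶠ #1 ∈ᶠ ` a ∧ᶠ #0 ∈ᶠ ` b) (𝒫 (𝒫 (a ∪ b)))

    ∈-⊗ : ∀ a b → (a ⊗ b) Is｛ (λ p → ∃[ x ] ∃[ y ] IsPair x y p × x ∈ a × y ∈ b) ｝
    ∈-⊗ a b p = ∈-comp _ _ p ⟨⇔⟩ mk⇔ proj₂ λ { w@(x , y , (s , u , hs , hu , h) , mx , my) →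
      from (∈-𝒫 _ p) (λ q mq → from (∈-𝒫 _ q) λ z mz → case hs hu mx my (to (h q) mq) mz) , w }
      where
      case : ∀ {x y s u q z} → IsUnorderedPair x x s → IsUnorderedPair x y u → x ∈ a → y ∈ b →
             q ≡ s ⊎ q ≡ u → z ∈ q → z ∈ (a ∪ b)
      case hs hu mx my (inj₁ refl) mz =
        [ (λ { refl → ∪₁ mx }) , (λ { refl → ∪₁ mx }) ]′ (to (hs _) mz)
      case hs hu mx my (inj₂ refl) mz =
        [ (λ { refl → ∪₁ mx }) , (λ { refl → ∪₂ my }) ]′ (to (hu _) mz)

  IsRelation : V → Set ℓ
  IsRelation r = ∀ p → p ∈ r → ∃[ x ] ∃[ y ] IsPair x y p

  opaque
    relation : (φ : Fm₀ 2) (a b : V) → ∃[ r ] IsRelation r ×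
               (∀ x y → app r x y ⇔ (x ∈ a × y ∈ b × ⟦ φ ⟧ (x ∷ y ∷ [])))
    relation φ a b = r , isRel , λ x y → mk⇔ (⇒ x y) (⇐ x y)
      where
      ψ : Fm₀ 1
      ψ = ∃ᶠ ∃ᶠ pairᶠ #1 #0 #2 ∧ᶠ atom (toClass φ) (#1 ∷ #0 ∷ [])
      r : V
      r = comp ψ (a ⊗ b)
      isRel : IsRelation r
      isRel p m = let _ , x , y , h , _ = to (∈-comp ψ _ p) m in x , y , h
      ⇒ : ∀ x y → app r x y → x ∈ a × y ∈ b × ⟦ φ ⟧ (x ∷ y ∷ [])
      ⇒ x y (p , hp , m) with to (∈-comp ψ _ p) m
      ... | mp , x′ , y′ , hp′ , h with to (∈-⊗ a b p) mp
      ... | x″ , y″ , hp″ , mx , my with pair-inj hp hp′ | pair-inj hp hp″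
      ... | refl , refl | refl , refl = mx , my , to (toClass-correct φ _) h
      ⇐ : ∀ x y → x ∈ a × y ∈ b × ⟦ φ ⟧ (x ∷ y ∷ []) → app r x y
      ⇐ x y (mx , my , h) = _ , isPair x y , from (∈-comp ψ _ _)
        (from (∈-⊗ a b _) (x , y , isPair x y , mx , my)
        , x , y , isPair x y , from (toClass-correct φ _) h)

    graph : (φ : Fm₀ 2) (a : V) →
            (∀ x y y′ → x ∈ a → ⟦ φ ⟧ (x ∷ y ∷ []) → ⟦ φ ⟧ (x ∷ y′ ∷ []) → y ≡ y′) →
            ∃[ f ] IsFunction f × (∀ x y → app f x y ⇔ (x ∈ a × ⟦ φ ⟧ (x ∷ y ∷ [])))
    graph φ a fun with image φ a fun
    ... | b , hb with relation φ a b
    ... | r , isRel , h =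
      r , (isRel , λ x y y′ m m′ → let p , _ , q = to (h x y) m
                                       _ , _ , q′ = to (h x y′) m′ in fun x y y′ p q q′)
        , λ x y → mk⇔ (λ m → let p , _ , q = to (h x y) m in p , q)
                      (λ (p , q) → from (h x y) (p , from (hb y) (x , p , q) , q))

  functionGraph : (φ : Fm₀ 2) (a : V) →
    (∀ x y y′ → x ∈ a → ⟦ φ ⟧ (x ∷ y ∷ []) → ⟦ φ ⟧ (x ∷ y′ ∷ []) → y ≡ y′) →
    (∀ x → x ∈ a → ∃[ y ] ⟦ φ ⟧ (x ∷ y ∷ [])) →
    ∃[ f ] FunctionOn a f × (∀ x y → app f x y ⇔ (x ∈ a × ⟦ φ ⟧ (x ∷ y ∷ [])))
  functionGraph φ a fun tot with graph φ a fun
  ... | f , isf , h = f , (isf , λ x → mk⇔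
      (λ m → let y , q = tot x m in y , from (h x y) (m , q))
      (λ (y , q) → proj₁ (to (h x y) q))) , h

  ∈-irrefl : ∀ x → ¬ x ∈ x
  ∈-irrefl x m with foundation (sg x) (x , self∈sg x)
  ... | y , my , h with refl ← to (∈-sg x y) my = h y m my

  ∈-asym : ∀ x y → x ∈ y → ¬ y ∈ x
  ∈-asym x y m n with foundation (pr x y) (x , from (∈-pr x y x) (inj₁ refl))
  ... | z , mz , h with to (∈-pr x y z) mz
  ...   | inj₁ refl = h y n (from (∈-pr x y y) (inj₂ refl))
  ...   | inj₂ refl = h x m (from (∈-pr x y x) (inj₁ refl))

  suc-∈ : ∀ {x y} → IsSuc x y → x ∈ y
  suc-∈ h = from (h _) (inj₂ refl)

  suc-inj : ∀ {x x′ y} → IsSuc x y → IsSuc x′ y → x ≡ x′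
  suc-inj {x} {x′} h h′ with to (h′ x) (suc-∈ h) | to (h x′) (suc-∈ h′)
  ... | inj₂ e | _      = e
  ... | inj₁ _ | inj₂ e = sym e
  ... | inj₁ m | inj₁ n = ⊥-elim (∈-asym x x′ m n)

  -- A set of pairs ⟨n,v⟩ each of which is either ⟨∅,x⟩ or ⟨k+1,⋃u⟩ for another
  -- pair ⟨k,u⟩ of the set.  Foundation makes v unique for each n.
  private module TransitiveClosure (x : V) where

    w : V
    w = proj₁ infinity

    goodᶠ : ∀ {n} → Tm V n → Fm₀ n
    goodᶠ f = ∀ᶠ ∀ᶠ appᶠ (wk (wk f)) #1 #0 ⇒ᶠ
      #1 ∈ᶠ ` w ∧ᶠ (emptyᶠ #1 ∧ᶠ #0 ≡ᶠ ` x ∨ᶠ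
        (∃ᶠ ∃ᶠ sucᶠ #1 #3 ∧ᶠ appᶠ (wk (wk (wk (wk f)))) #1 #0 ∧ᶠ
          (∀ᶠ #0 ∈ᶠ #3 ⇔ᶠ (∃ᶠ #0 ∈ᶠ #2 ∧ᶠ #1 ∈ᶠ #0))))

    Good : V → Set ℓ
    Good f = ⟦ goodᶠ (` f) ⟧ []

    reached : Fm₀ 2
    reached = ∃ᶠ goodᶠ #0 ∧ᶠ appᶠ #0 #1 #2

    Reached : V → V → Set ℓ
    Reached n v = ∃[ f ] Good f × app f n v

    reached-unique : ∀ n v v′ → n ∈ w → Reached n v → Reached n v′ → v ≡ v′
    reached-unique n v v′ m r r′ = stable λ ne →
      let k , mk , min = foundation (comp φ w) (n , from (∈-comp φ w n) (m , v , v′ , r , r′ , ne))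
          _ , u , u′ , q , q′ , ne′ = to (∈-comp φ w k) mk
      in ne′ (step k u u′ min q q′)
      where
      φ : Fm₀ 1
      φ = ∃ᶠ ∃ᶠ (∃ᶠ goodᶠ #0 ∧ᶠ appᶠ #0 #3 #2) ∧ᶠ (∃ᶠ goodᶠ #0 ∧ᶠ appᶠ #0 #3 #1) ∧ᶠ ¬ᶠ #1 ≡ᶠ #0
      step : ∀ k u u′ → (∀ z → z ∈ k → ¬ z ∈ comp φ w) → Reached k u → Reached k u′ → u ≡ u′
      step k u u′ min (f , gf , a) (f′ , gf′ , a′) with gf k u a | gf′ k u′ a′
      ... | _ , inj₁ (_ , refl) | _ , inj₁ (_ , refl) = refl
      ... | _ , inj₁ (e , _) | _ , inj₂ (i , _ , s , _) = ⊥-elim (e i (suc-∈ s))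
      ... | _ , inj₂ (i , _ , s , _) | _ , inj₁ (e , _) = ⊥-elim (e i (suc-∈ s))
      ... | _ , inj₂ (i , t , s , b , h) | _ , inj₂ (i′ , t′ , s′ , b′ , h′)
        with refl ← suc-inj s s′
        with dec (t ≡ t′)
      ... | inj₁ refl = Is-unique h h′
      ... | inj₂ ne = ⊥-elim (min i (suc-∈ s) (from (∈-comp φ w i)
              (proj₁ (gf i t b) , t , t′ , (f , gf , b) , (f′ , gf′ , b′) , ne)))

    reached-zero : Reached ∅ x
    reached-zero = sg ⟨ ∅ , x ⟩ , good , app-intro (self∈sg _)
      where
      good : Good (sg ⟨ ∅ , x ⟩)
      good n v (p , hp , m) with refl ← to (∈-sg _ p) m with pair-inj hp (isPair ∅ x)
      ... | refl , refl = ∅∈w , inj₁ (∉∅ , refl)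
        where
        ∅∈w : ∅ ∈ w
        ∅∈w with proj₁ (proj₂ infinity)
        ... | o , e , m = subst (_∈ w) (empty-unique e) m

    reached-suc : ∀ k u → k ∈ w → Reached k u → ∃[ n ] n ∈ w × Reached n (⋃ u)
    reached-suc k u m (f , gf , a) with proj₂ (proj₂ infinity) k m
    ... | n , s , mn = n , mn , f′ , good , app-intro (∪₂ (self∈sg _))
      where
      f′ : V
      f′ = f ∪ sg ⟨ n , ⋃ u ⟩
      lift : ∀ {i t} → app f i t → app f′ i t
      lift b = app-intro (∪₁ (app-elim b))
      good : Good f′
      good i t (p , hp , mp) with to (∈-∪ _ _ p) mp
      ... | inj₁ mp′ with gf i t (p , hp , mp′)
      ...   | mi , inj₁ e = mi , inj₁ e
      ...   | mi , inj₂ (i₀ , t₀ , s₀ , a₀ , h) = mi , inj₂ (i₀ , t₀ , s₀ , lift a₀ , h)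
      good i t (p , hp , mp) | inj₂ mp′ with refl ← to (∈-sg _ p) mp′ with pair-inj hp (isPair n (⋃ u))
      ... | refl , refl = mn , inj₂ (k , u , s , lift a , ∈-⋃ u)

    -- `⋃ c` is the union of `x`, `⋃ x`, `⋃ (⋃ x)` and so on. Replacement over `w` collects these
    -- values, which is why they must be unique. Transitivity holds because a reached `v` is
    -- followed by a reached `⋃ v`.
    closure : ∃[ t ] IsTransitive t × x ⊆ t
    closure with image reached w reached-unique
    ... | c , hc = ⋃ c , tr , λ z m → from (∈-⋃ c z)
        (x , from (hc x) (∅ , proj₁ (proj₁ (proj₂ reached-zero) ∅ x (proj₂ (proj₂ reached-zero))) , reached-zero) , m)
      where
      tr : IsTransitive (⋃ c)
      tr y my z mz with to (∈-⋃ c y) my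
      ... | v , mv , y∈v with to (hc v) mv
      ... | k , mk , r with reached-suc k v mk r
      ... | n , mn , r′ = from (∈-⋃ c z) (⋃ v , from (hc _) (n , mn , r′) , from (∈-⋃ v z) (y , y∈v , mz))

  opaque
    transitive-⊇ : ∀ x → ∃[ t ] IsTransitive t × x ⊆ t
    transitive-⊇ x = TransitiveClosure.closure x

  opaque
    -- Foundation concerns sets, so the failures are collected inside a transitive set around `x`. A
    -- minimal failure there has all its elements in that set, and they satisfy φ.
    ∈-induction : (φ : Fm₀ 1) →
                  (∀ x → (∀ y → y ∈ x → ⟦ φ ⟧ (y ∷ [])) → ⟦ φ ⟧ (x ∷ [])) → ∀ x → ⟦ φ ⟧ (x ∷ [])
    ∈-induction φ step x with transitive-⊇ (sg x)
    ... | t , tr , sub = stable λ ¬φx →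
      let b = comp (¬ᶠ φ) t
          y , my , min = foundation b (x , from (∈-comp (¬ᶠ φ) t x) (sub x (self∈sg x) , ¬φx))
          mt , ¬φy = to (∈-comp (¬ᶠ φ) t y) my
      in ¬φy (step y λ z mz → stable λ ¬φz →
           min z mz (from (∈-comp (¬ᶠ φ) t z) (tr y mt z mz , ¬φz)))

  -- Membership in the transitive closure; quantifying over all transitive supersets makes it a
  -- formula without any recursion. Recursions on names follow this relation, since a name in the
  -- domain of `σ` is below `σ` but need not be a member of it.
  _∈⁺_ : V → V → Set ℓ
  y ∈⁺ x = ∀ s → IsTransitive s → x ⊆ s → y ∈ s

  ∈⁺ᶠ : ∀ {n} → Tm V n → Tm V n → Fm₀ n
  ∈⁺ᶠ y x = ∀ᶠ transitiveᶠ #0 ⇒ᶠ wk x ⊆ᶠ #0 ⇒ᶠ wk y ∈ᶠ #0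

  ∈⇒∈⁺ : ∀ {x y} → y ∈ x → y ∈⁺ x
  ∈⇒∈⁺ m s tr sub = sub _ m

  ∈⁺-step : ∀ {x y z} → z ∈ y → y ∈⁺ x → z ∈⁺ x
  ∈⁺-step m h s tr sub = tr _ (h s tr sub) _ m

  ∈⁺-trans : ∀ {x y z} → z ∈⁺ y → y ∈⁺ x → z ∈⁺ x
  ∈⁺-trans k h s tr sub = k s tr (tr _ (h s tr sub))

  opaque
    -- The sets satisfying the disjunction, cut out of some transitive superset of `x`, form again a
    -- transitive superset of `x`; hence `y` is one of them.
    ∈⁺-split : ∀ {x y} → y ∈⁺ x → y ∈ x ⊎ (∃[ z ] z ∈ x × y ∈⁺ z)
    ∈⁺-split {x} {y} h with transitive-⊇ x
    ... | t , tr , sub = proj₂ (to (∈-comp φ t y) (h (comp φ t) tr′ sub′))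
      where
      φ : Fm₀ 1
      φ = #0 ∈ᶠ ` x ∨ᶠ (∃ᶠ #0 ∈ᶠ ` x ∧ᶠ ∈⁺ᶠ #1 #0)
      sub′ : x ⊆ comp φ t
      sub′ z m = from (∈-comp φ t z) (sub z m , inj₁ m)
      tr′ : IsTransitive (comp φ t)
      tr′ u mu z mz with to (∈-comp φ t u) mu
      ... | mt , inj₁ m = from (∈-comp φ t z) (tr u mt z mz , inj₂ (u , m , ∈⇒∈⁺ mz))
      ... | mt , inj₂ (v , mv , k) = from (∈-comp φ t z) (tr u mt z mz , inj₂ (v , mv , ∈⁺-step mz k))

  opaque
    -- Ordinary induction proves φ for all `y ∈⁺ x`: by `∈⁺-split` such a `y` is a member of `x`,
    -- where the step applies, or lies below a member.
    ∈⁺-induction : (φ : Fm₀ 1) →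
                   (∀ x → (∀ y → y ∈⁺ x → ⟦ φ ⟧ (y ∷ [])) → ⟦ φ ⟧ (x ∷ [])) → ∀ x → ⟦ φ ⟧ (x ∷ [])
    ∈⁺-induction φ step x = to (toClass-correct φ _) (below (sg x) x (∈⇒∈⁺ (self∈sg x)))
      where
      ψ : Fm₀ 1
      ψ = ∀ᶠ ∈⁺ᶠ #0 #1 ⇒ᶠ atom (toClass φ) (#0 ∷ [])
      below : ∀ x y → y ∈⁺ x → toClass φ [ y ∷ [] ]
      below = ∈-induction ψ λ x ih y k → case ih (∈⁺-split k)
        where
        case : ∀ {x y} → (∀ z → z ∈ x → ∀ y → y ∈⁺ z → toClass φ [ y ∷ [] ]) →
               y ∈ x ⊎ (∃[ z ] z ∈ x × y ∈⁺ z) → toClass φ [ y ∷ [] ]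
        case ih (inj₁ m) = from (toClass-correct φ _)
          (step _ λ z k → to (toClass-correct φ _) (ih _ m z k))
        case ih (inj₂ (z , m , k)) = ih z m _ k

  ∈⁺-irrefl : ∀ x → ¬ x ∈⁺ x
  ∈⁺-irrefl = ∈⁺-induction (¬ᶠ ∈⁺ᶠ #0 #0) λ x ih k → ih x k k

-- Recursion along membership, levels of the hierarchy, choice for classes, ordinals

module Recursion {ℓ : Level} (𝒱 : ZFCModel ℓ) where

  open ZFCModel 𝒱
  open SetTheory V _∈_
  open IsZFC zfc
  open Codes
  open ZF 𝒱

  tc : V → V
  tc x = let t , _ = transitive-⊇ x in comp (∈⁺ᶠ #0 (` x)) t

  ∈-tc : ∀ x → tc x Is｛ (λ y → y ∈⁺ x) ｝
  ∈-tc x y = let t , tr , sub = transitive-⊇ x in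
    mk⇔ (λ m → proj₂ (to (∈-comp _ t y) m)) (λ k → from (∈-comp _ t y) (k t tr sub , k))

  tc-transitive : ∀ x → IsTransitive (tc x)
  tc-transitive x y my z mz = from (∈-tc x z) (∈⁺-step mz (to (∈-tc x y) my))

  -- `G` receives an entire attempt `f`, not its restriction to the predecessors of `y`; `local`
  -- says that only the values there matter. Attempts on different transitive sets can thus be
  -- compared directly.
  module Rec (G : Class 3)
    (unique : ∀ y f w w′ → G [ y ∷ f ∷ w ∷ [] ] → G [ y ∷ f ∷ w′ ∷ [] ] → w ≡ w′)
    (exists : ∀ y f → IsFunction f → (∀ z → z ∈⁺ y → InDom f z) → ∃[ w ] G [ y ∷ f ∷ w ∷ [] ])
    (local  : ∀ y f f′ w → (∀ z → z ∈⁺ y → ∀ u → app f z u ⇔ app f′ z u) →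
              G [ y ∷ f ∷ w ∷ [] ] → G [ y ∷ f′ ∷ w ∷ [] ])
    where

    Attempt : V → V → Set ℓ
    Attempt t f = IsTransitive t × FunctionOn t f × (∀ y w → app f y w → G [ y ∷ f ∷ w ∷ [] ])

    attemptᶠ : ∀ {n} → Tm V n → Tm V n → Fm₀ n
    attemptᶠ t f = transitiveᶠ t ∧ᶠ functionOnᶠ t f ∧ᶠ
      (∀ᶠ ∀ᶠ appᶠ (wk (wk f)) #1 #0 ⇒ᶠ atom G (#1 ∷ wk (wk f) ∷ #0 ∷ []))

    opaque
      valueClass : Class 2
      valueClass = toClass (∃ᶠ ∃ᶠ attemptᶠ #1 #0 ∧ᶠ appᶠ #0 #2 #3)

    Value : V → V → Set ℓ
    Value y w = valueClass [ y ∷ w ∷ [] ]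

    valueᶠ : ∀ {n} → Tm V n → Tm V n → Fm₀ n
    valueᶠ y w = atom valueClass (y ∷ w ∷ [])

    opaque
      unfolding valueClass

      attempt⇒value : ∀ {y w t f} → Attempt t f → app f y w → Value y w
      attempt⇒value at m = from (toClass-correct _ _) (_ , _ , at , m)

      value⇒attempt : ∀ {y w} → Value y w → ∃[ t ] ∃[ f ] Attempt t f × app f y w
      value⇒attempt = to (toClass-correct _ _)

    InDom→∈ : ∀ {t f y w} → Attempt t f → app f y w → y ∈ t
    InDom→∈ (_ , (_ , d) , _) m = from (d _) (_ , m)

    below-dom : ∀ {t f y w} → Attempt t f → app f y w → ∀ z → z ∈⁺ y → InDom f z
    below-dom at@(tr , (_ , d) , _) m z k = to (d z) (k _ tr (tr _ (InDom→∈ at m)))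

    opaque
      value-unique : ∀ y w w′ → Value y w → Value y w′ → w ≡ w′
      value-unique y w w′ v v′ = ∈⁺-induction (∀ᶠ ∀ᶠ valueᶠ #2 #1 ⇒ᶠ valueᶠ #2 #0 ⇒ᶠ #1 ≡ᶠ #0)
        step y w w′ v v′
        where
        step : ∀ y → (∀ z → z ∈⁺ y → ∀ w w′ → Value z w → Value z w′ → w ≡ w′) →
               ∀ w w′ → Value y w → Value y w′ → w ≡ w′
        step y ih w w′ v v′ = compare (value⇒attempt v) (value⇒attempt v′)
          where
          compare : (∃[ t ] ∃[ f ] Attempt t f × app f y w) → (∃[ t ] ∃[ f ] Attempt t f × app f y w′) → w ≡ w′
          compare (t , f , at , m) (t′ , f′ , at′ , m′) =
            unique y f′ w w′ (local y f f′ w agree (proj₂ (proj₂ at) y w m)) (proj₂ (proj₂ at′) y w′ m′)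
            where
            agree : ∀ z → z ∈⁺ y → ∀ u → app f z u ⇔ app f′ z u
            agree z k u = let a , ma = below-dom at m z k ; b , mb = below-dom at′ m′ z k in mk⇔
              (λ n → subst (app f′ z) (ih z k b u (attempt⇒value at′ mb) (attempt⇒value at n)) mb)
              (λ n → subst (app f z) (ih z k a u (attempt⇒value at ma) (attempt⇒value at′ n)) ma)

    opaque
      attempt-on : ∀ t → IsTransitive t → (∀ y → y ∈ t → ∃[ w ] Value y w) →
                   ∃[ f ] Attempt t f × (∀ y w → app f y w ⇔ (y ∈ t × Value y w))
      attempt-on t tr tot with functionGraph (valueᶠ #0 #1) t (λ y w w′ _ → value-unique y w w′) tot
      ... | f , fun , hf = f , (tr , fun , λ y w m → correct y w (to (hf y w) m)) , hf
        where
        module _ (y w : V) (my : y ∈ t) where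
          by-attempt : (∃[ t′ ] ∃[ g ] Attempt t′ g × app g y w) → G [ y ∷ f ∷ w ∷ [] ]
          by-attempt (t′ , g , at , mg) = local y g f w agree (proj₂ (proj₂ at) y w mg)
            where
            agree : ∀ z → z ∈⁺ y → ∀ u → app g z u ⇔ app f z u
            agree z k u = mk⇔ (λ n → from (hf z u) (k t tr (tr y my) , attempt⇒value at n))
              (λ n → let b , mb = below-dom at mg z k
                     in subst (app g z) (value-unique z b u (attempt⇒value at mb) (proj₂ (to (hf z u) n))) mb)
        correct : ∀ y w → y ∈ t × Value y w → G [ y ∷ f ∷ w ∷ [] ]
        correct y w (my , v) = by-attempt y w my (value⇒attempt v)

    opaque
      -- The attempt on `tc x` given by the induction hypothesis is extended by the pair of `x` and
      -- `w`. By `∈⁺-irrefl` neither the values at points of `tc x` nor the one at `x` depend on the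
      -- new pair, so `local` applies.
      value-exists : ∀ y → ∃[ w ] Value y w
      value-exists = ∈⁺-induction (∃ᶠ valueᶠ #1 #0) step
        where
        step : ∀ x → (∀ y → y ∈⁺ x → ∃[ w ] Value y w) → ∃[ w ] Value x w
        step x ih with attempt-on (tc x) (tc-transitive x) (λ y m → ih y (to (∈-tc x y) m))
        ... | f , at@(tr , ((rel , fun) , dom) , cor) , hf
          with exists x f (rel , fun) (λ z k → to (dom z) (from (∈-tc x z) k))
        ... | w , hw = w , attempt⇒value (tr′ , ((rel′ , fun′) , dom′) , cor′) new
          where
          t′ f′ : V
          t′ = tc x ∪ sg x
          f′ = f ∪ sg ⟨ x , w ⟩
          new : app f′ x w
          new = app-intro (∪₂ (self∈sg _))
          old : ∀ {y u} → app f y u → app f′ y u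
          old m = app-intro (∪₁ (app-elim m))
          split : ∀ y u → app f′ y u → app f y u ⊎ (y ≡ x × u ≡ w)
          split y u (p , hp , m) with to (∈-∪ _ _ p) m
          ... | inj₁ n = inj₁ (p , hp , n)
          ... | inj₂ n with refl ← to (∈-sg _ p) n = inj₂ (pair-inj hp (isPair x w))
          x∉dom : ∀ {u} → ¬ app f x u
          x∉dom m = ∈⁺-irrefl x (to (∈-tc x x) (InDom→∈ at m))
          tr′ : IsTransitive t′
          tr′ y my z mz with to (∈-∪ _ _ y) my
          ... | inj₁ n = ∪₁ (tr y n z mz)
          ... | inj₂ n with refl ← to (∈-sg _ y) n = ∪₁ (from (∈-tc x z) (∈⇒∈⁺ mz))
          rel′ : ∀ p → p ∈ f′ → ∃[ a ] ∃[ b ] IsPair a b p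
          rel′ p m with to (∈-∪ _ _ p) m
          ... | inj₁ n = rel p n
          ... | inj₂ n with refl ← to (∈-sg _ p) n = x , w , isPair x w
          fun′ : ∀ y u u′ → app f′ y u → app f′ y u′ → u ≡ u′
          fun′ y u u′ m m′ with split y u m | split y u′ m′
          ... | inj₁ n | inj₁ n′ = fun y u u′ n n′
          ... | inj₁ n | inj₂ (refl , refl) = ⊥-elim (x∉dom n)
          ... | inj₂ (refl , refl) | inj₁ n′ = ⊥-elim (x∉dom n′)
          ... | inj₂ (refl , refl) | inj₂ (_ , refl) = refl
          dom′ : IsDomain f′ t′
          dom′ y = mk⇔ ⇒ (λ (u , m) → ⇐ u (split y u m))
            where
            ⇒ : y ∈ t′ → InDom f′ y
            ⇒ my with to (∈-∪ _ _ y) my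
            ... | inj₁ n = let u , m = to (dom y) n in u , old m
            ... | inj₂ n with refl ← to (∈-sg _ y) n = w , new
            ⇐ : ∀ u → app f y u ⊎ (y ≡ x × u ≡ w) → y ∈ t′
            ⇐ u (inj₁ m) = ∪₁ (InDom→∈ at m)
            ⇐ u (inj₂ (refl , _)) = ∪₂ (self∈sg x)
          agree : ∀ y → ¬ x ∈⁺ y → ∀ z → z ∈⁺ y → ∀ u → app f z u ⇔ app f′ z u
          agree y nx z k u = mk⇔ old λ m → [ id , (λ { (refl , refl) → ⊥-elim (nx k) }) ]′ (split z u m)
          cor′ : ∀ y u → app f′ y u → G [ y ∷ f′ ∷ u ∷ [] ]
          cor′ y u m with split y u m
          ... | inj₁ n = local y f f′ u
            (agree y λ k → ∈⁺-irrefl x (∈⁺-trans k (to (∈-tc x y) (InDom→∈ at n)))) (cor y u n)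
          ... | inj₂ (refl , refl) = local x f f′ w (agree x (∈⁺-irrefl x)) hw

  -- R(x) = ⋃ { 𝒫(R(y)) | y ∈ x } is the least level V_ξ that includes x.
  private
    levelᶠ : Fm₀ 3
    levelᶠ = ∀ᶠ #0 ∈ᶠ #3 ⇔ᶠ (∃ᶠ ∃ᶠ #1 ∈ᶠ #3 ∧ᶠ appᶠ #4 #1 #0 ∧ᶠ #2 ⊆ᶠ #0)

    IsLevel : V → V → V → Set ℓ
    IsLevel y f w = ⟦ levelᶠ ⟧ (y ∷ f ∷ w ∷ [])

    code⇒ : ∀ {y f w} → toClass levelᶠ [ y ∷ f ∷ w ∷ [] ] → IsLevel y f w
    code⇒ = to (toClass-correct levelᶠ _)

    code⇐ : ∀ {y f w} → IsLevel y f w → toClass levelᶠ [ y ∷ f ∷ w ∷ [] ]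
    code⇐ = from (toClass-correct levelᶠ _)

    opaque
      level-exists : ∀ y f → IsFunction f → (∀ z → z ∈⁺ y → InDom f z) → ∃[ w ] IsLevel y f w
      level-exists y f (_ , fun) _ with image (appᶠ (` f) #0 #1) y (λ x u u′ _ → fun x u u′)
      ... | c , hc = comp φ (𝒫 (⋃ c)) , λ z → ∈-comp φ _ z ⟨⇔⟩ mk⇔ proj₂ λ (x , r , mx , m , sub) →
          from (∈-𝒫 _ z) (λ u mu → from (∈-⋃ c u) (r , from (hc r) (x , mx , m) , sub u mu))
        , x , r , mx , m , sub
        where
        φ : Fm₀ 1
        φ = ∃ᶠ ∃ᶠ #1 ∈ᶠ ` y ∧ᶠ appᶠ (` f) #1 #0 ∧ᶠ #2 ⊆ᶠ #0

    level-local : ∀ y f f′ w → (∀ z → z ∈⁺ y → ∀ u → app f z u ⇔ app f′ z u) →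
                  IsLevel y f w → IsLevel y f′ w
    level-local y f f′ w agree h z = h z ⟨⇔⟩ mk⇔
      (λ (x , r , mx , m , s) → x , r , mx , to (agree x (∈⇒∈⁺ mx) r) m , s)
      (λ (x , r , mx , m , s) → x , r , mx , from (agree x (∈⇒∈⁺ mx) r) m , s)

    opaque
      levelClass : Class 3
      levelClass = toClass levelᶠ

      levelClass-unique : ∀ y f w w′ → levelClass [ y ∷ f ∷ w ∷ [] ] → levelClass [ y ∷ f ∷ w′ ∷ [] ] → w ≡ w′
      levelClass-unique y f w w′ p q = Is-unique (code⇒ p) (code⇒ q)

      levelClass-exists : ∀ y f → IsFunction f → (∀ z → z ∈⁺ y → InDom f z) → ∃[ w ] levelClass [ y ∷ f ∷ w ∷ [] ]
      levelClass-exists y f isf h = proj₁ (level-exists y f isf h) , code⇐ (proj₂ (level-exists y f isf h))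

      levelClass-local : ∀ y f f′ w → (∀ z → z ∈⁺ y → ∀ u → app f z u ⇔ app f′ z u) →
                         levelClass [ y ∷ f ∷ w ∷ [] ] → levelClass [ y ∷ f′ ∷ w ∷ [] ]
      levelClass-local y f f′ w agree h = code⇐ (level-local y f f′ w agree (code⇒ h))

      levelClass-correct : ∀ {y f w} → levelClass [ y ∷ f ∷ w ∷ [] ] → IsLevel y f w
      levelClass-correct = code⇒

    module Lv = Rec levelClass levelClass-unique levelClass-exists levelClass-local

  opaque
    R : V → V
    R x = proj₁ (Lv.value-exists x)

    private
      R-value : ∀ x → Lv.Value x (R x)
      R-value x = proj₂ (Lv.value-exists x)

  private
    R≡ : ∀ {x r} → Lv.Value x r → r ≡ R x
    R≡ v = Lv.value-unique _ _ _ v (R-value _)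

  opaque
    ∈-R : ∀ x → R x Is｛ (λ z → ∃[ y ] y ∈ x × z ⊆ R y) ｝
    ∈-R x z = by-attempt (Lv.value⇒attempt (R-value x))
      where
      by-attempt : (∃[ t ] ∃[ f ] Lv.Attempt t f × app f x (R x)) → z ∈ R x ⇔ (∃[ y ] y ∈ x × z ⊆ R y)
      by-attempt (t , f , at , m) = levelClass-correct (proj₂ (proj₂ at) x (R x) m) z ⟨⇔⟩ mk⇔
        (λ (y , r , my , mr , s) → y , my , subst (z ⊆_) (R≡ (Lv.attempt⇒value at mr)) s)
        (λ (y , my , s) → let r , mr = Lv.below-dom at m y (∈⇒∈⁺ my)
          in y , r , my , mr , subst (z ⊆_) (sym (R≡ (Lv.attempt⇒value at mr))) s)

  opaque
    ⊆-R : ∀ x → x ⊆ R x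
    ⊆-R x = ∈-induction φ step x (R x) (R-value x)
      where
      φ : Fm₀ 1
      φ = ∀ᶠ Lv.valueᶠ #1 #0 ⇒ᶠ #1 ⊆ᶠ #0
      step : ∀ x → (∀ y → y ∈ x → ∀ r → Lv.Value y r → y ⊆ r) → ∀ r → Lv.Value x r → x ⊆ r
      step x ih r v z m with refl ← R≡ v = from (∈-R x z) (z , m , ih z m (R z) (R-value z))

  private
    R-monotone-aux : ∀ x z → z ∈ R x → ∀ y → y ⊆ z → y ∈ R x
    R-monotone-aux x z m y s = let u , mu , s′ = to (∈-R x z) m
      in from (∈-R x y) (u , mu , λ v mv → s′ v (s v mv))

  opaque
    -- If `z` is in `R x` but not in `R y`, it is included in `R x′` for some `x′` in `x`. For every
    -- `y′` in `y` the induction hypothesis then gives `R y′ ∈ R x′`, since `R x′ ⊆ R y′` would put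
    -- `z` into `R y`; hence `R y ⊆ R x′`.
    R-comparable : ∀ x y → R x ⊆ R y ⊎ R y ∈ R x
    R-comparable x y = ∈-induction φ step x y (R x) (R y) (R-value x) (R-value y)
      where
      φ : Fm₀ 1
      φ = ∀ᶠ ∀ᶠ ∀ᶠ Lv.valueᶠ #3 #1 ⇒ᶠ Lv.valueᶠ #2 #0 ⇒ᶠ #1 ⊆ᶠ #0 ∨ᶠ #0 ∈ᶠ #1
      core : ∀ x y → (∀ x′ → x′ ∈ x → ∀ y → R x′ ⊆ R y ⊎ R y ∈ R x′) → R x ⊆ R y ⊎ R y ∈ R x
      core x y ih with dec (R x ⊆ R y)
      ... | inj₁ s = inj₁ s
      ... | inj₂ n with ¬∀→∃¬ n
      ... | z , n′ with dec (z ∈ R x)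
      ... | inj₂ n″ = ⊥-elim (n′ λ m → ⊥-elim (n″ m))
      ... | inj₁ mz with to (∈-R x z) mz
      ... | x′ , mx , s = inj₂ (from (∈-R x (R y)) (x′ , mx , sub))
        where
        below : ∀ y′ → y′ ∈ y → R y′ ∈ R x′
        below y′ my with ih x′ mx y′
        ... | inj₂ m = m
        ... | inj₁ s′ = ⊥-elim (n′ λ _ → from (∈-R y z) (y′ , my , λ v mv → s′ v (s v mv)))
        sub : R y ⊆ R x′
        sub w mw with to (∈-R y w) mw
        ... | y′ , my , s′ = R-monotone-aux x′ (R y′) (below y′ my) w s′
      step : ∀ x → (∀ x′ → x′ ∈ x → ∀ y r s → Lv.Value x′ r → Lv.Value y s → r ⊆ s ⊎ s ∈ r) →
             ∀ y r s → Lv.Value x r → Lv.Value y s → r ⊆ s ⊎ s ∈ r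
      step x ih y r s v v′ with refl ← R≡ v with refl ← R≡ v′ =
        core x y λ x′ m y → ih x′ m y (R x′) (R y) (R-value x′) (R-value y)

  -- Scott's trick: the witnesses of least level form a set even when the class of all witnesses
  -- does not. Levels enter through `Lv.Value`, because formulas have no function symbol for `R`.
  module Scott (C : Class 2) where

    IsLeast : V → V → Set ℓ
    IsLeast i y = C [ i ∷ y ∷ [] ] × (∀ y′ → C [ i ∷ y′ ∷ [] ] →
                  ∀ r r′ → Lv.Value y r → Lv.Value y′ r′ → r ⊆ r′)

    opaque
      leastClass : Class 2
      leastClass = toClass (atom C (#0 ∷ #1 ∷ []) ∧ᶠ (∀ᶠ atom C (#1 ∷ #0 ∷ []) ⇒ᶠ
        (∀ᶠ ∀ᶠ Lv.valueᶠ #4 #1 ⇒ᶠ Lv.valueᶠ #2 #0 ⇒ᶠ #1 ⊆ᶠ #0)))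

    Least : V → V → Set ℓ
    Least i y = leastClass [ i ∷ y ∷ [] ]

    leastᶠ : ∀ {n} → Tm V n → Tm V n → Fm₀ n
    leastᶠ i y = atom leastClass (i ∷ y ∷ [])

    opaque
      unfolding leastClass

      least-correct : ∀ i y → Least i y ⇔ IsLeast i y
      least-correct i y = toClass-correct _ (i ∷ y ∷ [])

    opaque
      least-exists : ∀ i y → C [ i ∷ y ∷ [] ] → ∃[ y ] Least i y
      least-exists i y c = stable λ none → ∈-induction φ (step none) (R y) y c (R-value y)
        where
        φ : Fm₀ 1
        φ = ∀ᶠ atom C (` i ∷ #0 ∷ []) ⇒ᶠ ¬ᶠ Lv.valueᶠ #0 #1
        step : ¬ (∃[ y ] Least i y) → ∀ r → (∀ r′ → r′ ∈ r → ∀ y → C [ i ∷ y ∷ [] ] → ¬ Lv.Value y r′) →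
               ∀ y → C [ i ∷ y ∷ [] ] → ¬ Lv.Value y r
        step none r ih y c v = none (y , from (least-correct i y) (c , below))
          where
          below : ∀ y′ → C [ i ∷ y′ ∷ [] ] → ∀ s s′ → Lv.Value y s → Lv.Value y′ s′ → s ⊆ s′
          below y′ c′ s s′ w w′ with refl ← R≡ v with refl ← R≡ w with refl ← R≡ w′
            with R-comparable y y′
          ... | inj₁ h = h
          ... | inj₂ m = ⊥-elim (ih (R y′) m y′ c′ w′)

    opaque
      least-set : ∀ i → ∃[ q ] q Is｛ (λ p → ∃[ y ] IsPair i y p × Least i y) ｝
      least-set i with dec (∃[ y ] Least i y)
      ... | inj₂ n = ∅ , λ p → mk⇔ (λ m → ⊥-elim (∉∅ p m)) (λ (y , _ , l) → ⊥-elim (n (y , l)))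
      -- Every least `y` satisfies `y ⊆ R y ⊆ R y₀`, so replacement over `𝒫 (R y₀)` collects all of
      -- them.
      ... | inj₁ (y₀ , l₀) with image (pairᶠ (` i) #0 #1 ∧ᶠ leastᶠ (` i) #0) (𝒫 (R y₀))
          (λ { y p p′ _ (h , _) (h′ , _) → trans (pair≡ h) (sym (pair≡ h′)) })
      ... | q , hq = q , λ p → hq p ⟨⇔⟩ mk⇔ (λ (y , _ , h) → y , h) λ (y , h , l) →
        y , from (∈-𝒫 (R y₀) y) (λ z m →
              proj₂ (to (least-correct i y) l) y₀ (proj₁ (to (least-correct i y₀) l₀)) (R y) (R y₀) (R-value y)
                  (R-value y₀) z (⊆-R y z m)) , h , l

  private
    module Selection (L : V → V → Set ℓ) (a A c : V)
      (fibres : A Is｛ (λ q → ∃[ i ] i ∈ a × q Is｛ (λ p → ∃[ y ] IsPair i y p × L i y) ｝) ｝)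
      (fibre  : ∀ i → ∃[ q ] q Is｛ (λ p → ∃[ y ] IsPair i y p × L i y) ｝)
      (chosen : ∀ x → x ∈ A → ∃[ z ] z ∈ x × z ∈ c × (∀ z′ → z′ ∈ x → z′ ∈ c → z′ ≡ z))
      (h : V) (∈h : h Is｛ (λ p → p ∈ ⋃ A × p ∈ c) ｝) where

      Elem : V → V → V → Set ℓ
      Elem p i y = IsPair i y p × i ∈ a × L i y × p ∈ c ×
                   (∃[ q ] q ∈ A × p ∈ q × q Is｛ (λ p → ∃[ y ] IsPair i y p × L i y) ｝)

      elem : ∀ p → p ∈ h → ∃[ i ] ∃[ y ] Elem p i y
      elem p m with to (∈h p) m
      ... | mu , mc with to (∈-⋃ A p) mu
      ... | q , mq , mp with to (fibres q) mq
      ... | i , mi , hq with to (hq p) mp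
      ... | y , hp , l = i , y , hp , mi , l , mc , q , mq , mp , hq

      elem′ : ∀ i y → app h i y → ∃[ p ] Elem p i y
      elem′ i y (p , hp , m) with elem p m
      ... | i′ , y′ , e with refl , refl ← pair-inj hp (proj₁ e) = p , e

      functional : ∀ i y y′ → app h i y → app h i y′ → y ≡ y′
      functional i y y′ m m′ with elem′ i y m | elem′ i y′ m′
      ... | p₁ , hp₁ , _ , _ , mc₁ , q₁ , mq₁ , mp₁ , h₁
          | p₂ , hp₂ , _ , _ , mc₂ , q₂ , mq₂ , mp₂ , h₂
        with refl ← Is-unique h₁ h₂ with chosen q₁ mq₁
      ... | z , _ , _ , u with refl ← trans (u p₁ mp₁ mc₁) (sym (u p₂ mp₂ mc₂)) =
        proj₂ (pair-inj hp₁ hp₂)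

      total : ∀ i → i ∈ a → InDom h i
      total i mi with fibre i
      ... | q , hq with from (fibres q) (i , mi , hq)
      ... | mq with chosen q mq
      ... | p , mp , mc , _ with to (hq p) mp
      ... | y , hp , _ = y , p , hp , from (∈h p) (from (∈-⋃ A p) (q , mq , mp) , mc)

      function : FunctionOn a h
      function = ((λ p m → let i , y , e = elem p m in i , y , proj₁ e) , functional) ,
        λ i → mk⇔ (total i) (λ (y , m) → proj₁ (proj₂ (proj₂ (elem′ i y m))))

      correct : ∀ i y → app h i y → L i y
      correct i y m = proj₁ (proj₂ (proj₂ (proj₂ (elem′ i y m))))

  opaque
    -- Scott's trick makes the candidates for each `i` a set. Tagging them with `i` makes the sets
    -- for different `i` disjoint, as the axiom of choice demands, and the selector, cut down to
    -- `⋃ A`, is already the graph of a function.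
    definable-choice : (C : Class 2) (a : V) → (∀ i → i ∈ a → ∃[ y ] C [ i ∷ y ∷ [] ]) →
                       ∃[ h ] FunctionOn a h × (∀ i y → app h i y → C [ i ∷ y ∷ [] ])
    definable-choice C a tot
      with image (∀ᶠ #0 ∈ᶠ #2 ⇔ᶠ (∃ᶠ pairᶠ #2 #0 #1 ∧ᶠ Scott.leastᶠ C #2 #0)) a (λ i q q′ _ → Is-unique)
    ... | A , fibres with choice A nonempty-fibre disjoint
      where
      nonempty-fibre : ∀ q → q ∈ A → ∃[ z ] z ∈ q
      nonempty-fibre q m with to (fibres q) m
      ... | i , mi , hq with tot i mi
      ... | y₀ , c₀ with Scott.least-exists C i y₀ c₀
      ... | y , l = ⟨ i , y ⟩ , from (hq _) (y , isPair i y , l)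
      disjoint : ∀ q q′ z → q ∈ A → q′ ∈ A → z ∈ q → z ∈ q′ → q ≡ q′
      disjoint q q′ z m m′ mz mz′ with to (fibres q) m | to (fibres q′) m′
      ... | i , _ , h | i′ , _ , h′ with to (h z) mz | to (h′ z) mz′
      ... | _ , p , _ | _ , p′ , _ with refl ← proj₁ (pair-inj p p′) = Is-unique h h′
    ... | c , chosen = _ , function , λ i y m → proj₁ (to (Scott.least-correct C i y) (correct i y m))
      where
      open Selection (Scott.Least C) a A c fibres (Scott.least-set C) chosen
                     (comp (#0 ∈ᶠ ` c) (⋃ A)) (∈-comp (#0 ∈ᶠ ` c) (⋃ A))

  ordinal-∈ : ∀ {x y} → IsOrdinal x → y ∈ x → IsOrdinal y
  ordinal-∈ (tr , h) m = h _ m , λ z mz → h z (tr _ m z mz)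

  Comparable : V → V → Set ℓ
  Comparable x y = x ∈ y ⊎ x ≡ y ⊎ y ∈ x

  private
    comparableᶠ : ∀ {n} → Tm V n → Tm V n → Fm₀ n
    comparableᶠ x y = x ∈ᶠ y ∨ᶠ x ≡ᶠ y ∨ᶠ y ∈ᶠ x

  opaque
    ordinal-comparable : ∀ x y → IsOrdinal x → IsOrdinal y → Comparable x y
    ordinal-comparable x y ox oy = ∈-induction
      (ordinalᶠ #0 ⇒ᶠ (∀ᶠ ordinalᶠ #0 ⇒ᶠ comparableᶠ #1 #0))
      (λ x ihx ox → ∈-induction (ordinalᶠ #0 ⇒ᶠ comparableᶠ (` x) #0)
        (λ y ihy oy → step ox oy (λ z m → ihx z m (ordinal-∈ ox m) y oy)
                                 (λ w m → ihy w m (ordinal-∈ oy m)))) x ox y oy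
      where
      step : ∀ {x y} → IsOrdinal x → IsOrdinal y → (∀ z → z ∈ x → Comparable z y) →
             (∀ w → w ∈ y → Comparable x w) → Comparable x y
      step {x} {y} ox oy hx hy with dec (x ⊆ y) | dec (y ⊆ x)
      ... | inj₁ s | inj₁ s′ = inj₂ (inj₁ (ext s s′))
      ... | inj₂ n | _ with ¬∀→∃¬ n
      ...   | z , nz with dec (z ∈ x)
      ...     | inj₂ ¬m = ⊥-elim (nz λ m → ⊥-elim (¬m m))
      ...     | inj₁ m with hx z m
      ...       | inj₁ k = ⊥-elim (nz λ _ → k)
      ...       | inj₂ (inj₁ refl) = inj₂ (inj₂ m)
      ...       | inj₂ (inj₂ k) = inj₂ (inj₂ (proj₁ ox z m y k))
      step {x} {y} ox oy hx hy | _ | inj₂ n with ¬∀→∃¬ n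
      ...   | w , nw with dec (w ∈ y)
      ...     | inj₂ ¬m = ⊥-elim (nw λ m → ⊥-elim (¬m m))
      ...     | inj₁ m with hy w m
      ...       | inj₁ k = inj₁ (proj₁ oy w m x k)
      ...       | inj₂ (inj₁ refl) = inj₁ m
      ...       | inj₂ (inj₂ k) = ⊥-elim (nw λ _ → k)

  ∅∈ordinal : ∀ {x} → IsOrdinal x → ¬ IsEmpty x → ∅ ∈ x
  ∅∈ordinal {x} (tr , _) ne with foundation x (nonempty ne)
  ... | y , m , h = subst (_∈ x) (empty-unique λ z mz → h z mz (tr y m z mz)) m

-- Truth along tuples of functions and Łoś's theorem

module Along {ℓ : Level} (𝒱 : ZFCModel ℓ) where

  open ZFCModel 𝒱
  open SetTheory V _∈_
  open Codes
  open ZF 𝒱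

  AppAll : V → ∀ {n} → Vec V n → Vec V n → Set ℓ
  AppAll i []       []       = ⊤
  AppAll i (h ∷ hs) (x ∷ xs) = app h i x × AppAll i hs xs

  AllFunctionsOn : V → ∀ {n} → Vec V n → Set ℓ
  AllFunctionsOn d []       = ⊤
  AllFunctionsOn d (h ∷ hs) = FunctionOn d h × AllFunctionsOn d hs

  appAll-lookup : ∀ {i n} (hs xs : Vec V n) → AppAll i hs xs → ∀ k → app (lookup hs k) i (lookup xs k)
  appAll-lookup (h ∷ hs) (x ∷ xs) (a , _) zero    = a
  appAll-lookup (h ∷ hs) (x ∷ xs) (_ , as) (suc k) = appAll-lookup hs xs as k

  appAll-exists : ∀ {d i n} (hs : Vec V n) → AllFunctionsOn d hs → i ∈ d → ∃[ xs ] AppAll i hs xs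
  appAll-exists []       _              m = [] , tt
  appAll-exists (h ∷ hs) ((_ , dm) , f) m =
    let x , a = to (dm _) m ; xs , as = appAll-exists hs f m in x ∷ xs , a , as

  appAll-unique : ∀ {d i n} (hs xs ys : Vec V n) → AllFunctionsOn d hs →
                  AppAll i hs xs → AppAll i hs ys → xs ≡ ys
  appAll-unique []       []       []       _                    _        _        = refl
  appAll-unique (h ∷ hs) (x ∷ xs) (y ∷ ys) (((_ , fn) , _) , f) (a , as) (b , bs) =
    cong₂ _∷_ (fn _ x y a b) (appAll-unique hs xs ys f as bs)

  private
    open Interpretation V _∈_ {At = Class} {C = V} (λ C xs → C [ xs ]) id using (evals-vars)

    stepᶠ : ∀ {n} → Class (3 +ℕ n) → V → Fm₀ (2 +ℕ n)
    stepᶠ C h = ∃ᶠ appᶠ (` h) #2 #0 ∧ᶠ atom C (#1 ∷ #2 ∷ #0 ∷ vars (λ k → suc (suc (suc k))))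

    opaque
      stepClass : ∀ {n} → Class (3 +ℕ n) → V → Class (2 +ℕ n)
      stepClass C h = toClass (stepᶠ C h)

      stepClass-correct : ∀ {n} (C : Class (3 +ℕ n)) h y i (xs : Vec V n) →
        stepClass C h [ y ∷ i ∷ xs ] ⇔ (∃[ x ] app h i x × C [ y ∷ i ∷ x ∷ xs ])
      stepClass-correct C h y i xs = toClass-correct (stepᶠ C h) (y ∷ i ∷ xs) ⟨⇔⟩ ∃-⇔ λ x → ⇔-refl ×-⇔
        ≡⇒⇔ (cong (λ zs → C [ y ∷ i ∷ x ∷ zs ])
          (evals-vars (λ k → suc (suc (suc k))) (x ∷ y ∷ i ∷ xs) xs λ _ → refl))

    alongClass : ∀ {n} → Class (2 +ℕ n) → Vec V n → Class 2
    alongClass C []       = C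
    alongClass C (h ∷ hs) = alongClass (stepClass C h) hs

    alongClass-correct : ∀ {n} (C : Class (2 +ℕ n)) (hs : Vec V n) y i →
      alongClass C hs [ y ∷ i ∷ [] ] ⇔ (∃[ xs ] AppAll i hs xs × C [ y ∷ i ∷ xs ])
    alongClass-correct C [] y i = mk⇔ (λ c → [] , tt , c) nil
      where
      nil : (∃[ xs ] AppAll i [] xs × C [ y ∷ i ∷ xs ]) → C [ y ∷ i ∷ [] ]
      nil ([] , _ , c) = c
    alongClass-correct C (h ∷ hs) y i = alongClass-correct (stepClass C h) hs y i ⟨⇔⟩ mk⇔ ⇒ ⇐
      where
      ⇒ : (∃[ xs ] AppAll i hs xs × stepClass C h [ y ∷ i ∷ xs ]) → ∃[ xs ] AppAll i (h ∷ hs) xs × C [ y ∷ i ∷ xs ]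
      ⇒ (xs , as , c) = let x , a , c′ = to (stepClass-correct C h y i xs) c in x ∷ xs , (a , as) , c′
      ⇐ : (∃[ xs ] AppAll i (h ∷ hs) xs × C [ y ∷ i ∷ xs ]) → ∃[ xs ] AppAll i hs xs × stepClass C h [ y ∷ i ∷ xs ]
      ⇐ (x ∷ xs , (a , as) , c) = xs , as , from (stepClass-correct C h y i xs) (x , a , c)

  opaque
    -- The class of all `y`, `i` with φ(y, h₁(i), ..., hₙ(i)). The length of the tuple is a number
    -- of the metatheory, so the functions are absorbed one at a time, each by an existential
    -- quantifier over its value.
    along : ∀ {n} → Formula (suc n) → Vec V n → Class 2
    along {n} φ hs = alongClass (class (ren ρ φ) []) hs
      where
      ρ : Fin (suc n) → Fin ((2 +ℕ n) +ℕ 0)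
      ρ zero    = zero
      ρ (suc k) = suc (suc (k ↑ˡ 0))

    along-correct : ∀ {n} (φ : Formula (suc n)) (hs : Vec V n) y i →
      along φ hs [ y ∷ i ∷ [] ] ⇔ (∃[ xs ] AppAll i hs xs × Sat φ (y ∷ xs))
    along-correct φ hs y i = alongClass-correct _ hs y i ⟨⇔⟩ ∃-⇔ λ xs → ⇔-refl ×-⇔
      Sat-ren V _∈_ φ _ (y ∷ xs) _ λ { zero → refl ; (suc k) → lookup-++ˡ xs [] k }

    -- `ren suc` makes φ ignore the first place of `along`, and `∅` is a dummy that fills it.
    holdsAt : ∀ {n} → Formula n → Vec V n → Fm₀ 1
    holdsAt φ hs = atom (along (ren suc φ) hs) (` ∅ ∷ #0 ∷ [])

  At : ∀ {n} → Formula n → Vec V n → V → Set ℓ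
  At φ hs i = ∃[ xs ] AppAll i hs xs × Sat φ xs

  opaque
    unfolding holdsAt
    holdsAt-correct : ∀ {n} (φ : Formula n) (hs : Vec V n) i → ⟦ holdsAt φ hs ⟧ (i ∷ []) ⇔ At φ hs i
    holdsAt-correct φ hs i = along-correct (ren suc φ) hs ∅ i ⟨⇔⟩ ∃-⇔ λ xs → ⇔-refl ×-⇔
      Sat-ren V _∈_ φ suc xs (∅ ∷ xs) λ _ → refl

  truthSet : ∀ {n} → Formula n → Vec V n → V → V
  truthSet φ hs d = comp (holdsAt φ hs) d

  ∈-truthSet : ∀ {n} (φ : Formula n) (hs : Vec V n) d →
               truthSet φ hs d Is｛ (λ i → i ∈ d × At φ hs i) ｝
  ∈-truthSet φ hs d i = ∈-comp _ d i ⟨⇔⟩ (⇔-refl ×-⇔ holdsAt-correct φ hs i)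

  open Recursion 𝒱

  private
    witnessᶠ : ∀ {n} → Formula (suc n) → Vec V n → Fm₀ 2
    witnessᶠ φ hs = atom (along φ hs) (#1 ∷ #0 ∷ []) ∨ᶠ ¬ᶠ (∃ᶠ atom (along φ hs) (#0 ∷ #1 ∷ []))

  opaque
    witnesses : ∀ {n} (φ : Formula (suc n)) (hs : Vec V n) d → AllFunctionsOn d hs →
      ∃[ h ] FunctionOn d h × (∀ i → i ∈ d → At (ex φ) hs i → At φ (h ∷ hs) i)
    witnesses φ hs d fhs with definable-choice (toClass ψ) d tot
      where
      ψ : Fm₀ 2
      ψ = witnessᶠ φ hs
      tot : ∀ i → i ∈ d → ∃[ y ] toClass ψ [ i ∷ y ∷ [] ]
      tot i m with dec (∃[ y ] along φ hs [ y ∷ i ∷ [] ])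
      ... | inj₁ (y , c) = y , from (toClass-correct ψ _) (inj₁ c)
      ... | inj₂ n       = ∅ , from (toClass-correct ψ _) (inj₂ n)
    ... | h , fh , hh = h , fh , λ i m (xs , as , y , s) → case i m xs as y s
      where
      case : ∀ i → i ∈ d → ∀ xs → AppAll i hs xs → ∀ y → Sat φ (y ∷ xs) → At φ (h ∷ hs) i
      case i m xs as y s with to (proj₂ fh i) m
      ... | z , a with to (toClass-correct (witnessᶠ φ hs) _) (hh i z a)
      ... | inj₂ n = ⊥-elim (n (y , from (along-correct φ hs y i) (xs , as , s)))
      ... | inj₁ c = let ys , bs , s′ = to (along-correct φ hs z i) c in z ∷ ys , (a , bs) , s′

-- An abstract form of Łoś's theorem that covers ultrapowers as well as
-- elementarity of maps given by seeds.  "Rep c h y" says that h represents y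
-- in the context c, and "Large c" is an ultrafilter on dom c.
module Łoś {ℓ : Level} (𝒱 : ZFCModel ℓ) (W : Set ℓ) (_∈′_ : W → W → Set ℓ) where

  open ZFCModel 𝒱
  open SetTheory V _∈_
  open ZF 𝒱
  open Along 𝒱
  module W = SetTheory W _∈′_

  -- In an ultrapower one context represents everything and `extend` is trivial. For the seeds of a
  -- map a new element `y` may require a larger index set, with `f` the projection to the old one:
  -- representatives are pulled back along `f`, and a set whose preimage is large is itself large.
  record Representation : Set (Level.suc ℓ) where
    field
      Ctx       : Set ℓ
      dom       : Ctx → V
      Large     : Ctx → V → Set ℓ
      Rep       : Ctx → V → W → Set ℓ
      rep-fun   : ∀ c {h y} → Rep c h y → FunctionOn (dom c) h
      rep-total : ∀ c {h} → FunctionOn (dom c) h → ∃[ y ] Rep c h y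
      rep-eq    : ∀ c {h k x y a} → Rep c h x → Rep c k y →
                  a Is｛ (λ i → i ∈ dom c × ∃[ u ] app h i u × app k i u) ｝ → x ≡ y ⇔ Large c a
      rep-mem   : ∀ c {h k x y a} → Rep c h x → Rep c k y →
                  a Is｛ (λ i → i ∈ dom c × ∃[ u ] ∃[ v ] app h i u × app k i v × u ∈ v) ｝ →
                  x ∈′ y ⇔ Large c a
      large-and : ∀ c {a b k} → a ⊆ dom c → b ⊆ dom c → k Is｛ (λ z → z ∈ a × z ∈ b) ｝ →
                  Large c k ⇔ (Large c a × Large c b)
      large-neg : ∀ c {a k} → a ⊆ dom c → k Is｛ (λ z → z ∈ dom c × ¬ z ∈ a) ｝ →
                  Large c k ⇔ (¬ Large c a)
      extend    : ∀ c y → ∃[ c′ ] ∃[ f ] (∀ i′ → i′ ∈ dom c′ → ∃[ i ] app f i′ i × i ∈ dom c)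
                  × (∀ h x → Rep c h x → ∃[ h′ ] Rep c′ h′ x ×
                      (∀ i′ i u → app f i′ i → app h i u → app h′ i′ u))
                  × (∀ a a′ → a ⊆ dom c → a′ Is｛ (λ i′ → i′ ∈ dom c′ × ∃[ i ] i ∈ a × app f i′ i) ｝ →
                      Large c′ a′ → Large c a)
                  × (∃[ h ] Rep c′ h y)

  module _ (𝓡 : Representation) where
    open Representation 𝓡

    RepAll : Ctx → ∀ {n} → Vec V n → Vec W n → Set ℓ
    RepAll c []       []       = ⊤
    RepAll c (h ∷ hs) (x ∷ xs) = Rep c h x × RepAll c hs xs

    repAll-fun : ∀ c {n} (hs : Vec V n) xs → RepAll c hs xs → AllFunctionsOn (dom c) hs
    repAll-fun c []       []       _        = tt
    repAll-fun c (h ∷ hs) (x ∷ xs) (r , rs) = rep-fun c r , repAll-fun c hs xs rs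

    repAll-lookup : ∀ c {n} (hs : Vec V n) xs → RepAll c hs xs → ∀ k → Rep c (lookup hs k) (lookup xs k)
    repAll-lookup c (h ∷ hs) (x ∷ xs) (r , rs) zero    = r
    repAll-lookup c (h ∷ hs) (x ∷ xs) (r , rs) (suc k) = repAll-lookup c hs xs rs k

    large-upward : ∀ c {a b} → a ⊆ b → b ⊆ dom c → Large c a → Large c b
    large-upward c s t l = proj₂ (to (large-and c (λ z m → t z (s z m)) t
      (λ z → mk⇔ (λ m → m , s z m) proj₁)) l)

    private
      unique-value : ∀ c {h x i u v} → Rep c h x → app h i u → app h i v → u ≡ v
      unique-value c r = proj₂ (proj₁ (rep-fun c r)) _ _ _

    extendAll : ∀ {c c′ f} →
      (∀ h x → Rep c h x → ∃[ h′ ] Rep c′ h′ x × (∀ i′ i u → app f i′ i → app h i u → app h′ i′ u)) →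
      ∀ {n} (hs : Vec V n) xs → RepAll c hs xs →
      ∃[ hs′ ] RepAll c′ hs′ xs × (∀ i′ i us → app f i′ i → AppAll i hs us → AppAll i′ hs′ us)
    extendAll e []       []       _        = [] , tt , λ { _ _ [] _ _ → tt }
    extendAll e (h ∷ hs) (x ∷ xs) (r , rs) =
      let h′ , r′ , p = e h x r ; hs′ , rs′ , ps = extendAll e hs xs rs in
      h′ ∷ hs′ , (r′ , rs′) , λ { i′ i (u ∷ us) a (b , bs) → p i′ i u a b , ps i′ i us a bs }

    łoś : ∀ {n} (φ : Formula n) c (hs : Vec V n) xs → RepAll c hs xs → ∀ a →
          a Is｛ (λ i → i ∈ dom c × At φ hs i) ｝ → W.Sat φ xs ⇔ Large c a
    łoś (mem p q) c hs xs rs a ha = rep-mem c (repAll-lookup c hs xs rs p) (repAll-lookup c hs xs rs q)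
      λ i → ha i ⟨⇔⟩ mk⇔
        (λ (m , us , as , e) → m , _ , _ , appAll-lookup hs us as p , appAll-lookup hs us as q , e)
        (λ (m , u , v , b , d , e) → let us , as = appAll-exists hs (repAll-fun c hs xs rs) m in
          m , us , as , subst₂ _∈_
            (unique-value c (repAll-lookup c hs xs rs p) b (appAll-lookup hs us as p))
            (unique-value c (repAll-lookup c hs xs rs q) d (appAll-lookup hs us as q)) e)
    łoś (eq p q) c hs xs rs a ha = rep-eq c (repAll-lookup c hs xs rs p) (repAll-lookup c hs xs rs q)
      λ i → ha i ⟨⇔⟩ mk⇔
        (λ (m , us , as , e) → m , _ , appAll-lookup hs us as p
          , subst (app (lookup hs q) i) (sym e) (appAll-lookup hs us as q))
        (λ (m , u , b , d) → let us , as = appAll-exists hs (repAll-fun c hs xs rs) m in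
          m , us , as , trans
            (unique-value c (repAll-lookup c hs xs rs p) (appAll-lookup hs us as p) b)
            (unique-value c (repAll-lookup c hs xs rs q) d (appAll-lookup hs us as q)))
    łoś (neg φ) c hs xs rs a ha = ¬-⇔ (łoś φ c hs xs rs b hb) ⟨⇔⟩ ⇔-sym (large-neg c
      (λ i m → proj₁ (to (hb i) m)) λ i → ha i ⟨⇔⟩ mk⇔
        (λ (m , us , as , n) → m , λ mb → let _ , vs , bs , s = to (hb i) mb in
          n (subst (Sat φ) (appAll-unique hs vs us (repAll-fun c hs xs rs) bs as) s))
        (λ (m , n) → let us , as = appAll-exists hs (repAll-fun c hs xs rs) m in
          m , us , as , λ s → n (from (hb i) (m , us , as , s))))
      where
      b : V
      b = truthSet φ hs (dom c)
      hb = ∈-truthSet φ hs (dom c)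
    łoś (and φ ψ) c hs xs rs a ha =
      (łoś φ c hs xs rs b hb ×-⇔ łoś ψ c hs xs rs d hd) ⟨⇔⟩ ⇔-sym (large-and c
        (λ i m → proj₁ (to (hb i) m)) (λ i m → proj₁ (to (hd i) m)) λ i → ha i ⟨⇔⟩ mk⇔
        (λ (m , us , as , s , t) → from (hb i) (m , us , as , s) , from (hd i) (m , us , as , t))
        (λ (mb , md) → let m , us , as , s = to (hb i) mb ; _ , vs , bs , t = to (hd i) md in
          m , us , as , s , subst (Sat ψ) (appAll-unique hs vs us (repAll-fun c hs xs rs) bs as) t))
      where
      b d : V
      b = truthSet φ hs (dom c)
      d = truthSet ψ hs (dom c)
      hb = ∈-truthSet φ hs (dom c)
      hd = ∈-truthSet ψ hs (dom c)
    łoś (ex φ) c hs xs rs a ha = mk⇔ ⇒ ⇐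
      where
      ⇒ : W.Sat (ex φ) xs → Large c a
      -- The witness `y` may have no representative over `c`. Over `c′` it has one; the truth set
      -- computed there projects into `a`, and `shrink` brings largeness back to `c`.
      ⇒ (y , s) with extend c y
      ... | c′ , f , total , lift , shrink , h , r with extendAll lift hs xs rs
      ... | hs′ , rs′ , lifts = shrink a (comp ψ (dom c′)) (λ i m → proj₁ (to (ha i) m)) (∈-comp ψ (dom c′))
          (large-upward c′ sub (λ i′ m → proj₁ (to (∈-comp ψ _ i′) m))
            (to (łoś φ c′ (h ∷ hs′) (y ∷ xs) (r , rs′) _ (∈-truthSet φ (h ∷ hs′) (dom c′))) s))
        where
        open Codes
        ψ : Fm₀ 1
        ψ = ∃ᶠ #0 ∈ᶠ ` a ∧ᶠ appᶠ (` f) #1 #0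
        sub : truthSet φ (h ∷ hs′) (dom c′) ⊆ comp ψ (dom c′)
        sub i′ m with to (∈-truthSet φ (h ∷ hs′) (dom c′) i′) m
        ... | m′ , (u ∷ us) , (_ , as) , t with total i′ m′
        ... | i , b , mi with appAll-exists hs (repAll-fun c hs xs rs) mi
        ... | vs , bs with refl ← appAll-unique hs′ us vs (repAll-fun c′ hs′ xs rs′) as (lifts i′ i vs b bs) =
          from (∈-comp ψ _ i′) (m′ , i , from (ha i) (mi , vs , bs , u , t) , b)
      ⇐ : Large c a → W.Sat (ex φ) xs
      -- Definable choice merges the pointwise witnesses into one function, and the element that it
      -- represents is the witness in `W`.
      ⇐ l with witnesses φ hs (dom c) (repAll-fun c hs xs rs)
      ... | h , fh , hh with rep-total c fh
      ... | y , r = y , from (łoś φ c (h ∷ hs) (y ∷ xs) (r , rs) _ hb)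
          (large-upward c (λ i m → let mi , t = to (ha i) m in from (hb i) (mi , hh i mi t))
                          (λ i m → proj₁ (to (hb i) m)) l)
        where
        hb = ∈-truthSet φ (h ∷ hs) (dom c)

    -- If `dom c` were not large, its complement `∅` would be, by `large-neg`; but `∅` is also the
    -- intersection of `∅` and `dom c`, so `large-and` would make `dom c` large.
    large-dom : ∀ c → Large c (dom c)
    large-dom c = stable λ n → n (proj₂ (to (large-and c {b = dom c} (λ z m → ⊥-elim (∉∅ z m)) (λ z m → m)
        (λ z → mk⇔ (λ m → ⊥-elim (∉∅ z m)) (λ (m , _) → m)))
      (from (large-neg c (λ z m → m) (λ z → mk⇔ (λ m → ⊥-elim (∉∅ z m)) (λ (m , k) → ⊥-elim (k m)))) n)))

    ¬large-∅ : ∀ c → ¬ Large c ∅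
    ¬large-∅ c l = to (large-neg c {a = dom c} (λ z m → m)
      (λ z → mk⇔ (λ m → ⊥-elim (∉∅ z m)) (λ (m , k) → ⊥-elim (k m)))) l (large-dom c)

    large-everywhere : ∀ {n} (φ : Formula n) c hs xs → RepAll c hs xs →
                       (∀ i → i ∈ dom c → At φ hs i) → W.Sat φ xs
    large-everywhere φ c hs xs rs h = from (łoś φ c hs xs rs (dom c) λ i → mk⇔ (λ m → m , h i m) proj₁)
                                          (large-dom c)

    -- Along constant functions the truth set of a formula is the whole index set or empty,
    -- according to its truth in `V`; Łoś's theorem turns this into truth or falsity of the formula
    -- for the images.
    representable-embedding : (j : V → W) (c : Ctx) →
      (∀ x → ∃[ h ] Rep c h (j x) × (∀ i → i ∈ dom c → app h i x)) → Embedding _∈_ _∈′_ j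
    representable-embedding j c const φ v = let hs , rs , as = all v in mk⇔
      (λ s → large-everywhere φ c hs (map j v) rs λ i m → v , as i m , s)
      (λ s → stable λ n → ¬large-∅ c (to (łoś φ c hs (map j v) rs ∅ λ i → mk⇔ (λ m → ⊥-elim (∉∅ i m))
        λ (m , us , bs , t) → ⊥-elim (n (subst (Sat φ)
          (appAll-unique hs us v (repAll-fun c hs (map j v) rs) bs (as i m)) t))) s))
      where
      all : ∀ {n} (v : Vec V n) → ∃[ hs ] RepAll c hs (map j v) × (∀ i → i ∈ dom c → AppAll i hs v)
      all []      = [] , tt , λ _ _ → tt
      all (x ∷ v) = let h , r , a = const x ; hs , rs , as = all v in
        h ∷ hs , (r , rs) , λ i m → a i m , as i m

-- Elementarity from finitely many formulas

NoAtom : ℕ → Set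
NoAtom _ = ⊥

module Pure {ℓ c : Level} {C : Set c} (V : Set ℓ) (_∈_ : V → V → Set ℓ) (g : C → V) where
  open Interpretation V _∈_ {At = NoAtom} {C = C} (λ ()) g public
    renaming (⟦_⟧ to Models)

module _ where
  private
    -- A table with entries in `⊥` has no positions, so a variable that refers to it cannot occur.
    unpad : ∀ n {k} → Vec ⊥ k → Fin (n +ℕ k) → Fin n
    unpad zero    t i       = ⊥-elim (lookup t i)
    unpad (suc n) t zero    = zero
    unpad (suc n) t (suc i) = suc (unpad n t i)

    lookup-unpad : ∀ {v} {V : Set v} {n k} (g : ⊥ → V) (xs : Vec V n) (t : Vec ⊥ k) i →
                   lookup xs (unpad n t i) ≡ lookup (xs ++ map g t) i
    lookup-unpad g []       t i       = ⊥-elim (lookup t i)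
    lookup-unpad g (x ∷ xs) t zero    = refl
    lookup-unpad g (x ∷ xs) t (suc i) = lookup-unpad g xs t i

    codePure : ∀ {n} → Fm NoAtom ⊥ n → Coded ⊥ n
    codePure = Coding.code {C = ⊥} {At = NoAtom} (λ ())

  opaque
    pureFormula : ∀ {n} → Fm NoAtom ⊥ n → Formula n
    pureFormula {n} φ = ren (unpad n (Coded.table (codePure φ))) (Coded.formula (codePure φ))

    pureFormula-correct : ∀ {ℓ} (V : Set ℓ) (_∈_ : V → V → Set ℓ) → ExcludedMiddle ℓ →
      ∀ {n} (φ : Fm NoAtom ⊥ n) v →
      SetTheory.Sat V _∈_ (pureFormula φ) v ⇔ Pure.Models V _∈_ (λ ()) φ v
    pureFormula-correct V _∈_ em {n} φ v =
      Sat-ren V _∈_ (Coded.formula (codePure φ)) (unpad n (Coded.table (codePure φ)))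
          (v ++ map (λ ()) (Coded.table (codePure φ))) v
        (lookup-unpad (λ ()) v (Coded.table (codePure φ)))
      ⟨⇔⟩ CodingCorrect.code-correct V _∈_ em {At = NoAtom} {C = ⊥} (λ ()) (λ ()) (λ ()) (λ ()) φ v

-- A cofinal map preserving these ten formulas is elementary.
module _ where
  open Codes {At = NoAtom} {C = ⊥}

  basicFormulas : Vec (Fm NoAtom ⊥ 5) 10
  basicFormulas =
      -- Numbered from zero, these are the instances that the representation in `Seeds` needs. 0:
      -- `j h` is a function on `j I`. 1, 2: the sets where two functions agree, or where the value
      -- of one is a member of the value of the other. 3, 4: intersections and differences. 5: over
      -- `t` in `j I` and `y` in `j b` there is an element of the image of `I ⊗ b` projecting to
      -- both. 6: composition with a projection. 7: preimages under it. 8, 9: the trivial seed, and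
      -- the constant function on it.
      functionOnᶠ #0 #1
    ∷ (∀ᶠ #0 ∈ᶠ #4 ⇔ᶠ #0 ∈ᶠ #1 ∧ᶠ (∃ᶠ appᶠ #3 #1 #0 ∧ᶠ appᶠ #4 #1 #0))
    ∷ (∀ᶠ #0 ∈ᶠ #4 ⇔ᶠ #0 ∈ᶠ #1 ∧ᶠ (∃ᶠ ∃ᶠ appᶠ #4 #2 #1 ∧ᶠ appᶠ #5 #2 #0 ∧ᶠ #1 ∈ᶠ #0))
    ∷ (∀ᶠ #0 ∈ᶠ #3 ⇔ᶠ #0 ∈ᶠ #1 ∧ᶠ #0 ∈ᶠ #2)
    ∷ (∀ᶠ #0 ∈ᶠ #3 ⇔ᶠ #0 ∈ᶠ #1 ∧ᶠ ¬ᶠ #0 ∈ᶠ #2)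
    ∷ (∀ᶠ #0 ∈ᶠ #1 ⇒ᶠ (∀ᶠ #0 ∈ᶠ #3 ⇒ᶠ (∃ᶠ #0 ∈ᶠ #5 ∧ᶠ appᶠ #6 #0 #2 ∧ᶠ appᶠ #7 #0 #1)))
    ∷ (∀ᶠ ∀ᶠ ∀ᶠ appᶠ #3 #2 #1 ⇒ᶠ appᶠ #4 #1 #0 ⇒ᶠ appᶠ #5 #2 #0)
    ∷ (∀ᶠ #0 ∈ᶠ #4 ⇔ᶠ #0 ∈ᶠ #2 ∧ᶠ (∃ᶠ #0 ∈ᶠ #4 ∧ᶠ appᶠ #2 #1 #0))
    ∷ #0 ∈ᶠ #1
    ∷ appᶠ #0 #1 #2
    ∷ []

module _ {ℓ : Level} {V W : Set ℓ} (_∈_ : V → V → Set ℓ) (_∈′_ : W → W → Set ℓ) (j : V → W) where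

  Preserves : Fm NoAtom ⊥ 5 → Set ℓ
  Preserves θ = ∀ a b c d e → Pure.Models V _∈_ (λ ()) θ (a ∷ b ∷ c ∷ d ∷ e ∷ [])
                            → Pure.Models W _∈′_ (λ ()) θ (j a ∷ j b ∷ j c ∷ j d ∷ j e ∷ [])

  BasicEmbedding : Set ℓ
  BasicEmbedding = ∀ k → Preserves (lookup basicFormulas k)

  Cofinal : Set ℓ
  Cofinal = ∀ y → ∃[ b ] y ∈′ j b

module _ {ℓ : Level} (𝒱 : ZFCModel ℓ) (W : Set ℓ) (_∈′_ : W → W → Set ℓ) where

  open ZFCModel 𝒱
  open SetTheory V _∈_
  open ZF 𝒱
  open Recursion 𝒱
  open Codes
  open Łoś 𝒱 W _∈′_
  private module W′ = SetTheory W _∈′_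

  private
    -- An element `t` of `j I` induces the ultrafilter of all `a ⊆ I` with `t` in `j a`, and a
    -- function `h` on `I` represents `j(h)(t)`; together these ultrafilters are the extender of
    -- `j`. One seed need not reach every `y`. But `y` lies in some `j b` by cofinality, and the
    -- pair of `t` and `y` is a seed in the image of `I ⊗ b`.
    module Seeds (j : V → W) (basic : BasicEmbedding _∈_ _∈′_ j) (cofinal : Cofinal _∈_ _∈′_ j) where

      composite : ∀ {I I′ f h} → FunctionOn I′ f → (∀ i′ i → app f i′ i → i ∈ I) → FunctionOn I h →
                  ∃[ k ] FunctionOn I′ k × (∀ i′ i u → app f i′ i → app h i u → app k i′ u)
      composite {I} {I′} {f} {h} ff range fh
        with functionGraph (∃ᶠ appᶠ (` f) #1 #0 ∧ᶠ appᶠ (` h) #0 #2) I′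
          (λ { p u u′ _ (i , a , b) (i′ , a′ , b′) → unique p i i′ u u′ a a′ b b′ })
          (λ p m → let i , a = to (proj₂ ff p) m ; u , b = to (proj₂ fh i) (range p i a) in u , i , a , b)
        where
        unique : ∀ p i i′ u u′ → app f p i → app f p i′ → app h i u → app h i′ u′ → u ≡ u′
        unique p i i′ u u′ a a′ b b′ with refl ← proj₂ (proj₁ ff) p i i′ a a′ = proj₂ (proj₁ fh) i u u′ b b′
      ... | k , fk , hk = k , fk , λ i′ i u a b →
        from (hk i′ u) (from (proj₂ ff i′) (i , a) , i , a , b)

      projections : ∀ I b → ∃[ f ] ∃[ g ] FunctionOn (I ⊗ b) f × FunctionOn (I ⊗ b) g ×
                    (∀ p i → app f p i → i ∈ I) ×
                    (∀ i → i ∈ I → ∀ z → z ∈ b → ∃[ p ] p ∈ (I ⊗ b) × app f p i × app g p z)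
      projections I b
        with functionGraph (∃ᶠ pairᶠ #2 #0 #1) (I ⊗ b)
               (λ { p x x′ _ (_ , h) (_ , h′) → proj₁ (pair-inj h h′) })
               (λ p m → let x , y , h , _ = to (∈-⊗ I b p) m in x , y , h)
           | functionGraph (∃ᶠ pairᶠ #0 #2 #1) (I ⊗ b)
               (λ { p y y′ _ (_ , h) (_ , h′) → proj₂ (pair-inj h h′) })
               (λ p m → let x , y , h , _ = to (∈-⊗ I b p) m in y , x , h)
      ... | f , ff , hf | g , fg , hg = f , g , ff , fg , range , λ i mi z mz →
          let m = from (∈-⊗ I b _) (i , z , isPair i z , mi , mz) in
          _ , m , from (hf _ i) (m , z , isPair i z) , from (hg _ z) (m , i , isPair i z)
        where
        range : ∀ p i → app f p i → i ∈ I
        range p i a with to (hf p i) a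
        ... | m , z , h with to (∈-⊗ I b p) m
        ... | i′ , z′ , h′ , mi , _ = subst (_∈ I) (proj₁ (pair-inj h′ h)) mi

      onImage : ∀ {I h} → FunctionOn I h → W′.FunctionOn (j I) (j h)
      onImage fh = basic (# 0) _ _ ∅ ∅ ∅ fh

      value-unique : ∀ {I h t x y} → FunctionOn I h → W′.app (j h) t x → W′.app (j h) t y → x ≡ y
      value-unique fh = proj₂ (proj₁ (onImage fh)) _ _ _

      representation : Representation
      representation = record
        { Ctx       = Σ V λ I → Σ W λ t → t ∈′ j I
        ; dom       = proj₁
        ; Large     = λ (_ , t , _) a → t ∈′ j a
        ; Rep       = λ (I , t , _) h y → FunctionOn I h × W′.app (j h) t y
        ; rep-fun   = λ _ → proj₁
        ; rep-total = λ (_ , t , m) fh → let y , a = to (proj₂ (onImage fh) t) m in y , fh , a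
        ; rep-eq    = λ (_ , t , m) (fh , a) (fk , b) ha →
            let e = basic (# 1) _ _ _ _ ∅ ha t in
            mk⇔ (λ { refl → from e (m , _ , a , b) })
                (λ l → let _ , u , a′ , b′ = to e l in trans (value-unique fh a a′) (value-unique fk b′ b))
        ; rep-mem   = λ (_ , t , m) (fh , a) (fk , b) ha →
            let e = basic (# 2) _ _ _ _ ∅ ha t in
            mk⇔ (λ k → from e (m , _ , _ , a , b , k))
                (λ l → let _ , u , v , a′ , b′ , k = to e l in
                       subst₂ _∈′_ (value-unique fh a′ a) (value-unique fk b′ b) k)
        ; large-and = λ (_ , t , _) _ _ hk → basic (# 3) _ _ _ ∅ ∅ hk t
        ; large-neg = λ (_ , t , m) _ hk → basic (# 4) _ _ _ ∅ ∅ hk t ⟨⇔⟩ mk⇔ proj₂ (λ n → m , n)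
        ; extend    = extend
        }
        where
        extend : ∀ (c : Σ V λ I → Σ W λ t → t ∈′ j I) y → _
        extend (I , t , m) y with cofinal y
        ... | b , mb with projections I b
        ... | f , g , ff , fg , range , pairs with basic (# 5) I b (I ⊗ b) f g pairs t m y mb
        ... | p , mp , a , a′ = (I ⊗ b , p , mp) , f
          , (λ i′ m′ → let i , a = to (proj₂ ff i′) m′ in i , a , range i′ i a)
          , (λ h x (fh , ah) → let k , fk , hk = composite ff range fh in
               k , (fk , basic (# 6) f h k ∅ ∅ hk p t x a ah) , hk)
          , (λ s s′ _ hs′ l → let _ , i , mi , a″ = to (basic (# 7) f (I ⊗ b) s s′ ∅ hs′ p) l in
               subst (_∈′ j s) (value-unique ff a″ a) mi)
          , g , fg , a′

      embedding : Embedding _∈_ _∈′_ j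
      embedding = representable-embedding representation j
        -- The trivial seed `j ∅` in the image of a singleton: `j x` is the value there of the image
        -- of the function `∅ ↦ x`.
        (sg ∅ , j ∅ , basic (# 8) ∅ (sg ∅) ∅ ∅ ∅ (self∈sg ∅)) λ x →
          sg ⟨ ∅ , x ⟩
          , (function x , basic (# 9) _ ∅ x ∅ ∅ (app-intro (self∈sg _)))
          , λ i m → subst (λ i → app _ i x) (sym (to (∈-sg ∅ i) m)) (app-intro (self∈sg _))
        where
        only : ∀ x i y → app (sg ⟨ ∅ , x ⟩) i y → i ≡ ∅ × y ≡ x
        only x i y (p , h , m) with refl ← to (∈-sg _ p) m = pair-inj h (isPair ∅ x)
        function : ∀ x → FunctionOn (sg ∅) (sg ⟨ ∅ , x ⟩)
        function x = ((λ p m → ∅ , x , subst (IsPair ∅ x) (sym (to (∈-sg _ p) m)) (isPair ∅ x))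
                     , λ i y y′ a b → trans (proj₂ (only x i y a)) (sym (proj₂ (only x i y′ b))))
                     , λ i → mk⇔ (λ m → x , subst (λ i → app _ i x) (sym (to (∈-sg ∅ i) m)) (app-intro (self∈sg _)))
                                 (λ (y , a) → from (∈-sg ∅ i) (proj₁ (only x i y a)))

  basic-embedding : ∀ {j : V → W} → BasicEmbedding _∈_ _∈′_ j → Cofinal _∈_ _∈′_ j → Embedding _∈_ _∈′_ j
  basic-embedding {j} = Seeds.embedding j

  -- Ultrapowers by a normal ultrafilter

  module Ultrapower (κ u : V) (uf : IsNormalUltrafilter κ u) (rep : V → W → Set ℓ)
    (rep-fun : ∀ {g x} → rep g x → FunctionOn κ g)
    (total : ∀ {g} → FunctionOn κ g → ∃[ x ] rep g x)
    (onto : ∀ x → ∃[ g ] rep g x)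
    (equality : ∀ {g h x y} → rep g x → rep h y →
       x ≡ y ⇔ (u ∋｛ (λ i → i ∈ κ × ∃[ a ] app g i a × app h i a) ｝))
    (membership : ∀ {g h x y} → rep g x → rep h y →
       x ∈′ y ⇔ (u ∋｛ (λ i → i ∈ κ × ∃[ a ] ∃[ b ] app g i a × app h i b × a ∈ b) ｝))
    where
    open IsNormalUltrafilter uf

    large : ∀ {P a} → a Is｛ P ｝ → u ∋｛ P ｝ ⇔ a ∈ u
    large ha = mk⇔ (λ (b , hb , m) → subst (_∈ u) (Is-unique hb ha) m) (λ m → _ , ha , m)

    inter : ∀ {a b k} → a ∈ u → b ∈ u → k Is｛ (λ z → z ∈ a × z ∈ b) ｝ → k ∈ u
    inter ma mb hk = to (large hk) (intersection _ _ ma mb)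

    disjoint : ∀ {a b} → a ∈ u → b ∈ u → ¬ (∀ z → z ∈ a → ¬ z ∈ b)
    disjoint ma mb h with intersection _ _ ma mb
    ... | c , hc , mc = proper c (λ z m → let x , y = to (hc z) m in h z x y) mc

    representation : Representation
    representation = record
      { Ctx       = ⊤
      ; dom       = λ _ → κ
      ; Large     = λ _ a → a ∈ u
      ; Rep       = λ _ → rep
      ; rep-fun   = λ _ → rep-fun
      ; rep-total = λ _ → total
      ; rep-eq    = λ _ r s ha → equality r s ⟨⇔⟩ large ha
      ; rep-mem   = λ _ r s ha → membership r s ⟨⇔⟩ large ha
      ; large-and = λ _ sa sb hk → mk⇔
          (λ m → upward _ _ m (λ z mz → proj₁ (to (hk z) mz)) sa , upward _ _ m (λ z mz → proj₂ (to (hk z) mz)) sb)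
          (λ (ma , mb) → inter ma mb hk)
      ; large-neg = λ _ sa hk → mk⇔
          (λ mk ma → disjoint mk ma λ z m → proj₂ (to (hk z) m))
          (λ na → [ (λ ma → ⊥-elim (na ma)) , to (large hk) ]′ (ultra _ sa))
      ; extend    = λ _ y → tt , identity , (λ i m → i , from (id-app i i) (m , refl) , m)
          , (λ h x r → h , r , λ i′ i u a → subst (λ i → app h i u → app h i′ u) (proj₂ (to (id-app i′ i) a)) id)
          , (λ a a′ sa ha′ l → upward a′ a l (λ z m → let _ , i , mi , e = to (ha′ z) m in
               subst (_∈ a) (sym (proj₂ (to (id-app z i) e))) mi) sa)
          , onto y
      }
      where
      idGraph = functionGraph (#0 ≡ᶠ #1) κ (λ x y y′ _ p q → trans (sym p) q) (λ x m → x , refl)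
      identity : V
      identity = proj₁ idGraph
      id-app : ∀ i i′ → app identity i i′ ⇔ (i ∈ κ × i ≡ i′)
      id-app = proj₂ (proj₂ idGraph)

    constant : ∀ x → ∃[ c ] IsConst κ x c × FunctionOn κ c × (∀ i y → app c i y ⇔ (i ∈ κ × y ≡ x))
    constant x with functionGraph (#1 ≡ᶠ ` x) κ (λ i y y′ _ p q → trans p (sym q)) (λ i m → x , refl)
    ... | c , fc , hc = c
      , (λ p → mk⇔
          (λ m → let i , y , h = proj₁ (proj₁ fc) p m ; mi , e = to (hc i y) (p , h , m) in
                 i , mi , subst (λ y → IsPair i y p) e h)
          (λ (i , mi , h) → app-∈ h (from (hc i x) (mi , refl))))
      , fc , hc

    canonical-embedding : (j : V → W) → (∀ x c → IsConst κ x c → rep c (j x)) → Embedding _∈_ _∈′_ j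
    canonical-embedding j hj = representable-embedding representation j tt λ x →
      let c , hc , fc , ac = constant x in c , hj x c hc , λ i m → from (ac i x) (m , refl)

    -- `b` is the range of a function representing `y`, so the values of this function lie in `b`
    -- everywhere.
    canonical-cofinal : (j : V → W) → (∀ x c → IsConst κ x c → rep c (j x)) → Cofinal _∈_ _∈′_ j
    canonical-cofinal j hj y =
      let g , r = onto y
          (_ , fun) , dm = rep-fun r
          b , hb = image (appᶠ (` g) #0 #1) κ (λ i a a′ _ → fun i a a′)
          c , hc , _ , ac = constant b
      in b , large-everywhere representation (mem zero (suc zero)) tt (g ∷ c ∷ []) (y ∷ j b ∷ [])
        (r , hj b c hc , tt) λ i m → let a , h = to (dm i) m in
          a ∷ b ∷ [] , (h , from (ac i b) (m , refl) , tt) , from (hb a) (i , m , h)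

    module Canonical (j : V → W) (hj : ∀ x c → IsConst κ x c → rep c (j x)) where

      private
        avoidᶠ : V → Fm₀ 2
        avoidᶠ g = ∀ᶠ #0 ∈ᶠ #2 ⇔ᶠ #0 ∈ᶠ ` κ ∧ᶠ ¬ᶠ appᶠ (` g) #0 #1

        avoid : ∀ g d → ∃[ X ] FunctionOn d X × (∀ c a → app X c a ⇔ (c ∈ d × a Is｛ (λ i → i ∈ κ × ¬ app g i c) ｝))
        avoid g d = functionGraph (avoidᶠ g) d (λ c a a′ _ → Is-unique)
          (λ c _ → _ , ∈-comp (¬ᶠ appᶠ (` g) #0 (` c)) κ)

        not-constant : ∀ {g y c a} → rep g y → ¬ y ≡ j c → a Is｛ (λ i → i ∈ κ × ¬ app g i c) ｝ → a ∈ u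
        not-constant {g} {y} {c} r n ha = [ (λ m → ⊥-elim (n (constant-on m))) , to (large ha′) ]′
            (ultra (comp (appᶠ (` g) #0 (` c)) κ) λ i m → proj₁ (to (∈-comp _ κ i) m))
          where
          k = constant c
          ha′ : _ Is｛ _ ｝
          ha′ i = ha i ⟨⇔⟩ mk⇔
            (λ (m , na) → m , λ m′ → na (proj₂ (to (∈-comp (appᶠ (` g) #0 (` c)) κ i) m′)))
            (λ (m , nm) → m , λ a → nm (from (∈-comp (appᶠ (` g) #0 (` c)) κ i) (m , a)))
          constant-on : comp (appᶠ (` g) #0 (` c)) κ ∈ u → y ≡ j c
          constant-on m = from (equality r (hj c (proj₁ k) (proj₁ (proj₂ k))))
            (_ , (λ i → ∈-comp (appᶠ (` g) #0 (` c)) κ i ⟨⇔⟩ mk⇔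
              (λ (mi , a) → mi , c , a , from (proj₂ (proj₂ (proj₂ k)) i c) (mi , refl))
              (λ (mi , b , a , a′) → mi , subst (app g i) (proj₂ (to (proj₂ (proj₂ (proj₂ k)) i b) a′)) a)) , m)

        meet : ∀ {P Q} → u ∋｛ P ｝ → u ∋｛ Q ｝ → ∃[ z ] P z × Q z
        meet (a , ha , ma) (b , hb , mb) = stable λ n →
          disjoint ma mb λ z m k → n (z , to (ha z) m , to (hb z) k)

      -- This is `κ`-completeness. If `y` is none of the `j c`, a representative `g` of `y` avoids
      -- each `c ∈ b` almost everywhere, hence all of them at once on a set in `u`; but `y ∈′ j b`
      -- says that its values lie in `b` almost everywhere.
      below-image : ∀ {b y} → b ∈ κ → y ∈′ j b → ∃[ c ] c ∈ b × y ≡ j c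
      below-image {b} {y} mb my = stable λ none →
        let g , r = onto y
            k , hk , _ , ak = constant b
            X , fX , hX = avoid g b
            z , (mz , c , b′ , gz , kz , mc) , (_ , av) = meet (to (membership r (hj b k hk)) my)
              (complete b X mb fX λ c a h → let mc , ha = to (hX c a) h in
                 not-constant r (λ e → none (c , mc , e)) ha)
            mc′ = subst (c ∈_) (proj₂ (to (ak z b′) kz)) mc
            a , h = to (proj₂ fX c) mc′
        in proj₂ (to (proj₂ (to (hX c a) h) z) (av c a h)) gz

      identityFunction : ∃[ f ] FunctionOn κ f × (∀ i x → app f i x ⇔ (i ∈ κ × x ≡ i))
      identityFunction = functionGraph (#1 ≡ᶠ #0) κ (λ i x x′ _ p q → trans p (sym q)) (λ i m → i , refl)

      -- The element [id] of the ultrapower. At every step of the iteration it will turn out to be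
      -- the critical point.
      seed : W
      seed = proj₁ (total (proj₁ (proj₂ identityFunction)))

      private
        idf : V
        idf = proj₁ identityFunction

        idf-app : ∀ i x → app idf i x ⇔ (i ∈ κ × x ≡ i)
        idf-app = proj₂ (proj₂ identityFunction)

        seed-rep : rep idf seed
        seed-rep = proj₂ (total (proj₁ (proj₂ identityFunction)))

      -- Normality in the form of the pressing-down lemma. A representative of `y` is regressive
      -- almost everywhere, so at `z` only the values `c ∈ z` have to be avoided, and a diagonal
      -- intersection achieves this.
      below-seed : ∀ {y} → y ∈′ seed → ∃[ c ] c ∈ κ × y ≡ j c
      below-seed {y} my = stable λ none →
        let g , r = onto y
            X , fX , hX = avoid g κ
            z , (mz , c , z′ , gz , iz , mc) , (_ , av) = meet (to (membership r seed-rep) my)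
              (diagonal X fX λ c a h → let mc , ha = to (hX c a) h in
                 not-constant r (λ e → none (c , mc , e)) ha)
            mc′ = subst (c ∈_) (proj₂ (to (idf-app z z′) iz)) mc
            a , h = to (proj₂ fX c) (proj₁ ordinal z mz c mc′)
        in proj₂ (to (proj₂ (to (hX c a) h) z) (av c a mc′ h)) gz

      -- The points of `κ` above `c` form a set in `u`: they include the intersection of the
      -- complements of all singletons of points up to `c`, and each complement is in `u` because
      -- `u` is nonprincipal.
      below-κ : ∀ {c} → c ∈ κ → j c ∈′ seed
      below-κ {c} mc = from (membership (hj c k hk) seed-rep) (to-large (upward _ _
          (inter (proj₂ (proj₂ lower)) (remove mc) (∈-comp (#0 ∈ᶠ ` complement c) _)) sub λ i m →
              proj₁ (to (∈-comp (` c ∈ᶠ #0) κ i) m)))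
        where
        k = proj₁ (constant c)
        hk = proj₁ (proj₂ (constant c))
        ak = proj₂ (proj₂ (proj₂ (constant c)))
        complement : V → V
        complement x = comp (¬ᶠ #0 ≡ᶠ ` x) κ
        remove : ∀ {x} → x ∈ κ → complement x ∈ u
        remove {x} mx = [ (λ m → ⊥-elim (nonprincipal x (sg x , ∈-sg x , m))) , to (large ha) ]′
            (ultra (sg x) λ z m → subst (_∈ κ) (sym (to (∈-sg x z) m)) mx)
          where
          ha : complement x Is｛ (λ z → z ∈ κ × ¬ z ∈ sg x) ｝
          ha z = ∈-comp _ κ z ⟨⇔⟩ (⇔-refl ×-⇔ ¬-⇔ (⇔-sym (∈-sg x z)))
        X = functionGraph (∀ᶠ #0 ∈ᶠ #2 ⇔ᶠ #0 ∈ᶠ ` κ ∧ᶠ ¬ᶠ #0 ≡ᶠ #1) c (λ x a a′ _ → Is-unique)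
              (λ x _ → complement x , ∈-comp (¬ᶠ #0 ≡ᶠ ` x) κ)
        lower : u ∋｛ (λ z → z ∈ κ × (∀ i a → app (proj₁ X) i a → z ∈ a)) ｝
        lower = complete c (proj₁ X) mc (proj₁ (proj₂ X)) λ x a h →
          let mx , ha = to (proj₂ (proj₂ X) x a) h in
          subst (_∈ u) (Is-unique (∈-comp (¬ᶠ #0 ≡ᶠ ` x) κ) ha) (remove (proj₁ ordinal c mc x mx))
        sub : comp (#0 ∈ᶠ ` complement c) (proj₁ lower) ⊆ comp (` c ∈ᶠ #0) κ
        sub z m with to (∈-comp _ _ z) m
        ... | ml , mn with to (proj₁ (proj₂ lower) z) ml | to (∈-comp (¬ᶠ #0 ≡ᶠ ` c) κ z) mn
        ... | mz , av | _ , ne = from (∈-comp (` c ∈ᶠ #0) κ z)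
          (mz , above (ordinal-comparable c z (ordinal-∈ ordinal mc) (ordinal-∈ ordinal mz)))
          where
          above : Comparable c z → c ∈ z
          above (inj₁ h)        = h
          above (inj₂ (inj₁ h)) = ⊥-elim (ne (sym h))
          above (inj₂ (inj₂ h)) = ⊥-elim (proj₂ (to (∈-comp (¬ᶠ #0 ≡ᶠ ` z) κ z)
            (av z _ (from (proj₂ (proj₂ X) z _) (h , ∈-comp (¬ᶠ #0 ≡ᶠ ` z) κ)))) refl)
        Above : V → Set ℓ
        Above i = i ∈ κ × ∃[ a ] ∃[ b ] app k i a × app idf i b × a ∈ b
        above⇒ : ∀ i → Above i → c ∈ i
        above⇒ i (mi , a , b , h , h′ , h″) = subst₂ _∈_ (proj₂ (to (ak i a) h)) (proj₂ (to (idf-app i b) h′)) h″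
        to-large : comp (` c ∈ᶠ #0) κ ∈ u → u ∋｛ Above ｝
        to-large m = _ , (λ i → ∈-comp (` c ∈ᶠ #0) κ i ⟨⇔⟩ mk⇔
            (λ (mi , h) → mi , c , i , from (ak i c) (mi , refl) , from (idf-app i i) (mi , refl) , h)
            (λ h → proj₁ h , above⇒ i h)) , m

      seed∈ : seed ∈′ j κ
      seed∈ = from (membership seed-rep (hj κ (proj₁ k) (proj₁ (proj₂ k))))
        (κ , (λ i → mk⇔ (λ m → m , i , κ , from (idf-app i i) (m , refl)
            , from (proj₂ (proj₂ (proj₂ k)) i κ) (m , refl) , m) proj₁)
           , large-dom representation tt)
        where k = constant κ

      -- The familiar equation [g] = j(g)([id]): Łoś's theorem for the constant function with value
      -- `g`, the identity, and `g` itself.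
      value-at-seed : ∀ y → ∃[ g ] FunctionOn κ g × W′.app (j g) seed y
      value-at-seed y =
        let g , r = onto y
            c , hc , _ , ac = constant g
        in g , rep-fun r , to (pureFormula-correct W _∈′_ em (appᶠ #0 #1 #2) (j g ∷ seed ∷ y ∷ []))
          (large-everywhere representation (pureFormula (appᶠ #0 #1 #2)) tt (c ∷ idf ∷ g ∷ []) (j g ∷ seed ∷ y ∷ [])
            (hj g c hc , seed-rep , r , tt) λ i m → let x , h = to (proj₂ (rep-fun r) i) m in
            g ∷ i ∷ x ∷ [] , (from (ac i g) (m , refl) , from (idf-app i i) (m , refl) , h , tt)
            , from (pureFormula-correct V _∈_ em (appᶠ #0 #1 #2) (g ∷ i ∷ x ∷ [])) h)

-- Direct limits and transfer along elementary embeddings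

module DirectLimit {ℓ : Level} {Ix : Set ℓ} (N : Ix → Set ℓ) (E : ∀ i → N i → N i → Set ℓ)
  {W : Set ℓ} (_∈′_ : W → W → Set ℓ) (π : ∀ i → N i → W)
  (injective : ∀ i {x y} → π i x ≡ π i y → x ≡ y)
  (membership : ∀ i {x y} → E i x y ⇔ π i x ∈′ π i y)
  (common : ∀ i k → ∃[ l ] Σ (N i → N l) λ e → Embedding (E i) (E l) e
            × (∀ x → π l (e x) ≡ π i x) × (∀ y → ∃[ z ] π l z ≡ π k y))
  (onto : ∀ y → ∃[ i ] ∃[ x ] π i x ≡ y)
  where

  -- The existential case is the essential one. A witness from a stage `k` is moved to a common
  -- stage `l`, where the induction hypothesis for φ applies; elementarity of the map from stage `i`
  -- to stage `l` brings the existential statement back.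
  limit-embedding : ∀ i → Embedding (E i) _∈′_ (π i)
  limit-embedding i (mem p q) v rewrite lookup-map p (π i) v | lookup-map q (π i) v = membership i
  limit-embedding i (eq p q)  v rewrite lookup-map p (π i) v | lookup-map q (π i) v =
    mk⇔ (cong (π i)) (injective i)
  limit-embedding i (neg φ)   v = ¬-⇔ (limit-embedding i φ v)
  limit-embedding i (and φ ψ) v = limit-embedding i φ v ×-⇔ limit-embedding i ψ v
  limit-embedding i (ex φ)    v = mk⇔ (λ (x , s) → π i x , to (limit-embedding i φ (x ∷ v)) s) back
    where
    map-commute : ∀ {l} {e : N i → N l} → (∀ x → π l (e x) ≡ π i x) →
                  ∀ {n} (v : Vec (N i) n) → map (π l) (map e v) ≡ map (π i) v
    map-commute h []      = refl
    map-commute h (x ∷ v) = cong₂ _∷_ (h x) (map-commute h v)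
    back : SetTheory.Sat W _∈′_ (ex φ) (map (π i) v) → SetTheory.Sat (N i) (E i) (ex φ) v
    back (y , s) with onto y
    ... | k , y₀ , refl with common i k
    ... | l , e , emb , comm , lift with lift y₀
    ... | z , hz = from (emb (ex φ) v) (z , from (limit-embedding l φ (z ∷ map e v))
      (subst (SetTheory.Sat W _∈′_ φ) (sym (cong₂ _∷_ hz (map-commute comm v))) s))

-- The atoms are formulas here, so that the schemes of ZFC can be transferred.
module Elementary {ℓ : Level} (V : Set ℓ) (_∈_ : V → V → Set ℓ) (em : ExcludedMiddle ℓ)
  (W : Set ℓ) (_∈′_ : W → W → Set ℓ) (j : V → W) (embedding : Embedding _∈_ _∈′_ j) where

  private
    code₀ : ∀ {c} {C : Set c} {m} → Formula m → Coded C m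
    code₀ φ = coded (ren (_↑ˡ 0) φ) []

    code₀-correct : ∀ {c} {C : Set c} (S : Set ℓ) (_ε_ : S → S → Set ℓ) (g : C → S) {m} (φ : Formula m) xs →
      SetTheory.Sat S _ε_ (Coded.formula (code₀ {C = C} φ)) (xs ++ map g (Coded.table (code₀ φ)))
      ⇔ SetTheory.Sat S _ε_ φ xs
    code₀-correct S _ε_ g φ xs = Sat-ren S _ε_ φ (_↑ˡ 0) xs (xs ++ []) (lookup-++ˡ xs [])

    module C {c} {C : Set c} = Coding {C = C} {At = Formula} code₀
    code-correct : ∀ {c} {C : Set c} (S : Set ℓ) (_ε_ : S → S → Set ℓ) (g : C → S) {n} (φ : Fm Formula C n) xs →
      SetTheory.Sat S _ε_ (Coded.formula (C.code φ)) (xs ++ map g (Coded.table (C.code φ)))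
      ⇔ Interpretation.⟦_⟧ S _ε_ {At = Formula} (SetTheory.Sat S _ε_) g φ xs
    code-correct S _ε_ g φ xs = CodingCorrect.code-correct S _ε_ em {At = Formula} (SetTheory.Sat S _ε_) g
      code₀ (code₀-correct S _ε_ g) φ xs

  module InV {c} {C : Set c} (g : C → V) = Interpretation V _∈_ {At = Formula} {C = C} (SetTheory.Sat V _∈_) g
  module InW {c} {C : Set c} (g : C → W) = Interpretation W _∈′_ {At = Formula} {C = C} (SetTheory.Sat W _∈′_) g

  opaque
    transfer : ∀ {c} {C : Set c} (g : C → V) (g′ : C → W) → (∀ c → g′ c ≡ j (g c)) →
               ∀ {n} (φ : Fm Formula C n) v → InV.⟦_⟧ g φ v ⇔ InW.⟦_⟧ g′ φ (map j v)
    transfer {C = C} g g′ h φ v = ⇔-sym (code-correct V _∈_ g φ v)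
      ⟨⇔⟩ embedding (Coded.formula (C.code φ)) (v ++ map g (Coded.table (C.code φ)))
      ⟨⇔⟩ ≡⇒⇔ (cong (SetTheory.Sat W _∈′_ (Coded.formula (C.code φ)))
            (trans (map-++ j v _) (cong (map j v ++_) (trans (sym (map-∘ j g _)) (sym (map-cong h _))))))
      ⟨⇔⟩ code-correct W _∈′_ g′ φ (map j v)

  private
    close : ∀ {n} → Fm Formula ⊥ n → Fm Formula ⊥ 0
    close {zero}  φ = φ
    close {suc n} φ = close (∀ᶠ φ)

    module _ (S : Set ℓ) (_ε_ : S → S → Set ℓ) where
      open Interpretation S _ε_ {At = Formula} {C = ⊥} (SetTheory.Sat S _ε_) (λ ())

      close-correct : ∀ {n} (φ : Fm Formula ⊥ n) → ⟦ close φ ⟧ [] ⇔ (∀ v → ⟦ φ ⟧ v)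
      close-correct {zero}  φ = mk⇔ (λ { p [] → p }) (λ f → f [])
      close-correct {suc n} φ = close-correct (∀ᶠ φ) ⟨⇔⟩ mk⇔ (λ { f (x ∷ v) → f v x }) (λ f v x → f (x ∷ v))

    open Codes {At = Formula} {C = ⊥}

    sentence : (φ : Fm Formula ⊥ 0) → InV.⟦_⟧ (λ ()) φ [] → InW.⟦_⟧ (λ ()) φ []
    sentence φ = to (transfer (λ ()) (λ ()) (λ ()) φ [])

    -- Parameters on the side of `W` need not lie in the range of `j`, so the universal closure is
    -- transferred and then instantiated.
    schema : ∀ {n} (φ : Fm Formula ⊥ n) → (∀ v → InV.⟦_⟧ (λ ()) φ v) → ∀ v → InW.⟦_⟧ (λ ()) φ v
    schema φ h = to (close-correct W _∈′_ φ) (sentence (close φ) (from (close-correct V _∈_ φ) h))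

    separationᶠ : ∀ {k} → Formula (1 +ℕ k) → Fm Formula ⊥ k
    separationᶠ F = ∀ᶠ ∃ᶠ ∀ᶠ #0 ∈ᶠ #1 ⇔ᶠ #0 ∈ᶠ #2 ∧ᶠ atom F (#0 ∷ vars (λ i → suc (suc (suc i))))

    replacementᶠ : ∀ {k} → Formula (2 +ℕ k) → Fm Formula ⊥ k
    replacementᶠ F = ∀ᶠ
      (∀ᶠ ∀ᶠ ∀ᶠ #2 ∈ᶠ #3 ⇒ᶠ atom F (#2 ∷ #1 ∷ vars (λ i → suc (suc (suc (suc i)))))
                         ⇒ᶠ atom F (#2 ∷ #0 ∷ vars (λ i → suc (suc (suc (suc i))))) ⇒ᶠ #1 ≡ᶠ #0)
      ⇒ᶠ (∃ᶠ ∀ᶠ #0 ∈ᶠ #1 ⇔ᶠ (∃ᶠ #0 ∈ᶠ #3 ∧ᶠ atom F (#0 ∷ #1 ∷ vars (λ i → suc (suc (suc (suc i)))))))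

    module Schemas (S : Set ℓ) (_ε_ : S → S → Set ℓ) where
      open SetTheory S _ε_
      open Interpretation S _ε_ {At = Formula} {C = ⊥} (SetTheory.Sat S _ε_) (λ ())

      replacement-correct : ∀ {k} (F : Formula (2 +ℕ k)) v → ⟦ replacementᶠ F ⟧ v ⇔
        (∀ a → (∀ x y y′ → x ε a → class F v [ x ∷ y ∷ [] ] → class F v [ x ∷ y′ ∷ [] ] → y ≡ y′) →
               ∃[ b ] b Is｛ (λ y → ∃[ x ] x ε a × class F v [ x ∷ y ∷ [] ]) ｝)
      replacement-correct {k} F v = mk⇔ ⇒ ⇐
        where
        Conclusion : S → Set ℓ
        Conclusion a = ∃[ b ] b Is｛ (λ y → ∃[ x ] x ε a × class F v [ x ∷ y ∷ [] ]) ｝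
        e : ∀ x y p q r a → Sat F (x ∷ y ∷ evals (p ∷ q ∷ r ∷ a ∷ v) (vars (λ i → suc (suc (suc (suc i))))))
                            ⇔ Sat F (x ∷ y ∷ v)
        e x y p q r a = ≡⇒⇔ (cong (λ zs → Sat F (x ∷ y ∷ zs)) (evals-vars _ (p ∷ q ∷ r ∷ a ∷ v) v λ _ → refl))
        ⇒ : ⟦ replacementᶠ F ⟧ v → ∀ a →
            (∀ x y y′ → x ε a → class F v [ x ∷ y ∷ [] ] → class F v [ x ∷ y′ ∷ [] ] → y ≡ y′) → Conclusion a
        ⇒ h a fun with h a (λ x y y′ m p q → fun x y y′ m (to (e x y y′ y x a) p) (to (e x y′ y′ y x a) q))
        ... | b , hb = b , λ y → hb y ⟨⇔⟩ ∃-⇔ λ x → ⇔-refl ×-⇔ e x y x y b a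
        ⇐ : (∀ a → (∀ x y y′ → x ε a → class F v [ x ∷ y ∷ [] ] → class F v [ x ∷ y′ ∷ [] ] → y ≡ y′) → Conclusion a) →
            ⟦ replacementᶠ F ⟧ v
        ⇐ h a fun with h a (λ x y y′ m p q → fun x y y′ m (from (e x y y′ y x a) p) (from (e x y′ y′ y x a) q))
        ... | b , hb = b , λ y → hb y ⟨⇔⟩ ∃-⇔ λ x → ⇔-refl ×-⇔ ⇔-sym (e x y x y b a)

      separation-correct : ∀ {k} (F : Formula (1 +ℕ k)) v → ⟦ separationᶠ F ⟧ v ⇔
        (∀ a → ∃[ b ] b Is｛ (λ z → z ε a × class F v [ z ∷ [] ]) ｝)
      separation-correct F v = mk⇔ ⇒ ⇐
        where
        Conclusion : Set ℓ
        Conclusion = ∀ a → ∃[ b ] b Is｛ (λ z → z ε a × class F v [ z ∷ [] ]) ｝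
        e : ∀ z b a → Sat F (z ∷ evals (z ∷ b ∷ a ∷ v) (vars (λ i → suc (suc (suc i))))) ⇔ Sat F (z ∷ v)
        e z b a = ≡⇒⇔ (cong (λ zs → Sat F (z ∷ zs)) (evals-vars _ (z ∷ b ∷ a ∷ v) v λ _ → refl))
        ⇒ : ⟦ separationᶠ F ⟧ v → Conclusion
        ⇒ h a with h a
        ... | b , hb = b , λ z → hb z ⟨⇔⟩ (⇔-refl ×-⇔ e z b a)
        ⇐ : Conclusion → ⟦ separationᶠ F ⟧ v
        ⇐ h a with h a
        ... | b , hb = b , λ z → hb z ⟨⇔⟩ (⇔-refl ×-⇔ ⇔-sym (e z b a))

  zfc-transfer : SetTheory.IsZFC V _∈_ → SetTheory.IsZFC W _∈′_
  zfc-transfer zfc = record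
    { extensionality = sentence (∀ᶠ ∀ᶠ (∀ᶠ #0 ∈ᶠ #2 ⇔ᶠ #0 ∈ᶠ #1) ⇒ᶠ #1 ≡ᶠ #0) extensionality
    ; foundation     = sentence (∀ᶠ (∃ᶠ #0 ∈ᶠ #1) ⇒ᶠ
                         (∃ᶠ #0 ∈ᶠ #1 ∧ᶠ (∀ᶠ #0 ∈ᶠ #1 ⇒ᶠ ¬ᶠ #0 ∈ᶠ #2))) foundation
    ; pairing        = sentence (∀ᶠ ∀ᶠ ∃ᶠ upairᶠ #2 #1 #0) pairing
    ; union          = sentence (∀ᶠ ∃ᶠ ∀ᶠ #0 ∈ᶠ #1 ⇔ᶠ (∃ᶠ #0 ∈ᶠ #3 ∧ᶠ #1 ∈ᶠ #0)) union
    ; powerset       = sentence (∀ᶠ ∃ᶠ ∀ᶠ #0 ∈ᶠ #1 ⇔ᶠ #0 ⊆ᶠ #2) powerset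
    ; infinity       = sentence (∃ᶠ (∃ᶠ emptyᶠ #0 ∧ᶠ #0 ∈ᶠ #1) ∧ᶠ
                         (∀ᶠ #0 ∈ᶠ #1 ⇒ᶠ (∃ᶠ sucᶠ #1 #0 ∧ᶠ #0 ∈ᶠ #2))) infinity
    ; separation     = λ { (SetTheory.class F v) → to (Schemas.separation-correct W _∈′_ F v)
        (schema (separationᶠ F) (λ v → from (Schemas.separation-correct V _∈_ F v)
          (separation (SetTheory.class F v))) v) }
    ; replacement    = λ { (SetTheory.class F v) → to (Schemas.replacement-correct W _∈′_ F v)
        (schema (replacementᶠ F) (λ v → from (Schemas.replacement-correct V _∈_ F v)
          (replacement (SetTheory.class F v))) v) }
    ; choice         = sentence (∀ᶠ
        (∀ᶠ #0 ∈ᶠ #1 ⇒ᶠ (∃ᶠ #0 ∈ᶠ #1)) ⇒ᶠ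
        (∀ᶠ ∀ᶠ ∀ᶠ #2 ∈ᶠ #3 ⇒ᶠ #1 ∈ᶠ #3 ⇒ᶠ #0 ∈ᶠ #2 ⇒ᶠ #0 ∈ᶠ #1 ⇒ᶠ #2 ≡ᶠ #1) ⇒ᶠ
        (∃ᶠ ∀ᶠ #0 ∈ᶠ #2 ⇒ᶠ (∃ᶠ #0 ∈ᶠ #1 ∧ᶠ #0 ∈ᶠ #2 ∧ᶠ
          (∀ᶠ #0 ∈ᶠ #2 ⇒ᶠ #0 ∈ᶠ #3 ⇒ᶠ #0 ≡ᶠ #1)))) choice
    }
    where open SetTheory.IsZFC zfc

  opaque
    transfer-pure : ∀ {c} {C : Set c} (g : C → V) (g′ : C → W) → (∀ c → g′ c ≡ j (g c)) →
                    ∀ {n} (φ : Fm NoAtom C n) v →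
                    Pure.Models V _∈_ g φ v ⇔ Pure.Models W _∈′_ g′ φ (map j v)
    transfer-pure {C = C} g g′ h φ v =
      let module D = Coding {C = C} {At = NoAtom} (λ ())
          ψ = D.code φ
      in ⇔-sym (CodingCorrect.code-correct V _∈_ em {At = NoAtom} (λ ()) g (λ ()) (λ ()) φ v)
      ⟨⇔⟩ embedding (Coded.formula ψ) (v ++ map g (Coded.table ψ))
      ⟨⇔⟩ ≡⇒⇔ (cong (SetTheory.Sat W _∈′_ (Coded.formula ψ))
            (trans (map-++ j v _) (cong (map j v ++_) (trans (sym (map-∘ j g _)) (sym (map-cong h _))))))
      ⟨⇔⟩ CodingCorrect.code-correct W _∈′_ em {At = NoAtom} (λ ()) g′ (λ ()) (λ ()) φ (map j v)

module _ {ℓ : Level} {V W X : Set ℓ} {_∈_ : V → V → Set ℓ} {_∈′_ : W → W → Set ℓ} {_∈″_ : X → X → Set ℓ}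
  where

  embedding-∘ : ∀ {j : V → W} {k : W → X} → Embedding _∈_ _∈′_ j → Embedding _∈′_ _∈″_ k →
                Embedding _∈_ _∈″_ (k ∘ j)
  embedding-∘ {j} {k} ej ek φ v = ej φ v ⟨⇔⟩ ek φ (map j v)
    ⟨⇔⟩ ≡⇒⇔ (cong (SetTheory.Sat X _∈″_ φ) (sym (map-∘ k j v)))

module _ {ℓ : Level} {V W : Set ℓ} {_∈_ : V → V → Set ℓ} {_∈′_ : W → W → Set ℓ} where

  embedding-cong : ∀ {j k : V → W} → (∀ x → j x ≡ k x) → Embedding _∈_ _∈′_ j → Embedding _∈_ _∈′_ k
  embedding-cong h e φ v = e φ v ⟨⇔⟩ ≡⇒⇔ (cong (SetTheory.Sat W _∈′_ φ) (map-cong h v))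

  embedding-injective : ∀ {j : V → W} → Embedding _∈_ _∈′_ j → ∀ {x y} → j x ≡ j y → x ≡ y
  embedding-injective e {x} {y} = from (e (eq zero (suc zero)) (x ∷ y ∷ []))

  embedding-∈ : ∀ {j : V → W} → Embedding _∈_ _∈′_ j → ∀ {x y} → x ∈ y ⇔ j x ∈′ j y
  embedding-∈ e {x} {y} = e (mem zero (suc zero)) (x ∷ y ∷ [])

embedding-id : ∀ {ℓ} {V : Set ℓ} {_∈_ : V → V → Set ℓ} → Embedding _∈_ _∈_ id
embedding-id {V = V} {_∈_} φ v = ≡⇒⇔ (cong (SetTheory.Sat V _∈_ φ) (sym (map-id v)))

-- An isomorphism is the direct limit of a system with a single stage.
surjective-embedding : ∀ {ℓ} {V W : Set ℓ} {_∈_ : V → V → Set ℓ} {_∈′_ : W → W → Set ℓ} {j : V → W} →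
  (∀ {x y} → j x ≡ j y → x ≡ y) → (∀ {x y} → x ∈ y ⇔ j x ∈′ j y) → (∀ y → ∃[ x ] j x ≡ y) →
  Embedding _∈_ _∈′_ j
surjective-embedding {V = V} {_∈_ = _∈_} {_∈′_} {j} inj members onto =
  DirectLimit.limit-embedding {Ix = ⊤} (λ _ → V) (λ _ → _∈_) _∈′_ (λ _ → j) (λ _ → inj) (λ _ → members)
    (λ _ _ → tt , id , embedding-id , (λ _ → refl) , (λ y → y , refl))
    (λ y → let x , e = onto y in tt , x , e) tt

embedding-basic : ∀ {ℓ} {V W : Set ℓ} {_∈_ : V → V → Set ℓ} {_∈′_ : W → W → Set ℓ} {j : V → W} →
  ExcludedMiddle ℓ → Embedding _∈_ _∈′_ j → BasicEmbedding _∈_ _∈′_ j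
embedding-basic em e k a b c d f = to (Elementary.transfer-pure _ _ em _ _ _ e (λ ()) (λ ()) (λ ())
  (lookup basicFormulas k) (a ∷ b ∷ c ∷ d ∷ f ∷ []))

-- Membership is irrelevant, so that elements of the class are equal iff the
-- underlying sets are.
record Member {ℓ} {V : Set ℓ} (P : V → Set ℓ) : Set ℓ where
  constructor _∣_
  field
    elem  : V
    .proof : P elem

open Member using (elem)

module _ {ℓ} {V : Set ℓ} {P : V → Set ℓ} where

  Member≡ : ∀ {x y : Member P} → elem x ≡ elem y → x ≡ y
  Member≡ refl = refl

  Member≡-⇔ : ∀ (x y : Member P) → x ≡ y ⇔ elem x ≡ elem y
  Member≡-⇔ x y = mk⇔ (λ { refl → refl }) Member≡

  -- Excluded middle decides `P`, and the irrelevant proof suffices to exclude the negative answer.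
  holds : ExcludedMiddle ℓ → (x : Member P) → P (elem x)
  holds em (x ∣ p) = recompute em p

-- Absoluteness for transitive classes

module Transitive {ℓ : Level} (V : Set ℓ) (_∈_ : V → V → Set ℓ) (em : ExcludedMiddle ℓ)
  (P : V → Set ℓ) (transitive : ∀ x y → P y → x ∈ y → P x) where

  _∈ₚ_ : Member P → Member P → Set ℓ
  x ∈ₚ y = elem x ∈ elem y

  open SetTheory V _∈_
  module N = SetTheory (Member P) _∈ₚ_

  element : ∀ {x} (y : Member P) → x ∈ elem y → Member P
  element {x} y m = x ∣ transitive x (elem y) (holds em y) m

  -- Transitivity puts the elements of `x` into the class, and the last hypothesis does so for
  -- everything satisfying `Q`; thus quantifying over the class or over `V` makes no difference.
  Is-absolute : ∀ x {Q : V → Set ℓ} {Q′ : Member P → Set ℓ} → (∀ z → Q′ z ⇔ Q (elem z)) →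
                (∀ z → Q z → P z) → (x N.Is｛ Q′ ｝) ⇔ (elem x Is｛ Q ｝)
  Is-absolute x e hQ = mk⇔
    (λ h z → mk⇔ (λ m → let z′ = element x m in to (e z′) (to (h z′) m))
                 (λ q → let z′ = z ∣ hQ z q in from (h z′) (from (e z′) q)))
    (λ h z → h (elem z) ⟨⇔⟩ ⇔-sym (e z))

  upair-absolute : ∀ x y p → N.IsUnorderedPair x y p ⇔ IsUnorderedPair (elem x) (elem y) (elem p)
  upair-absolute x y p = Is-absolute p
    (λ z → mk⇔ [ (λ e → inj₁ (cong elem e)) , (λ e → inj₂ (cong elem e)) ]′
               [ (λ e → inj₁ (Member≡ e)) , (λ e → inj₂ (Member≡ e)) ]′)
    (λ z → [ (λ { refl → holds em x }) , (λ { refl → holds em y }) ]′)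

  pair-absolute : ∀ x y p → N.IsPair x y p ⇔ IsPair (elem x) (elem y) (elem p)
  pair-absolute x y p = mk⇔
    (λ (a , b , ha , hb , h) → elem a , elem b , to (upair-absolute x x a) ha
       , to (upair-absolute x y b) hb , to (upair-absolute a b p) h)
    (λ (a , b , ha , hb , h) → let a′ = element p (from (h a) (inj₁ refl)) ; b′ = element p (from (h b) (inj₂ refl)) in
       a′ , b′ , from (upair-absolute x x a′) ha , from (upair-absolute x y b′) hb , from (upair-absolute a′ b′ p) h)

  pair-elements : ∀ {x y} (p : Member P) → IsPair x y (elem p) → P x × P y
  pair-elements {x} {y} p (a , b , ha , hb , h) =
    let b′ = element p (from (h b) (inj₂ refl)) in
    transitive x b (holds em b′) (from (hb x) (inj₁ refl)) , transitive y b (holds em b′) (from (hb y) (inj₂ refl))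

  app-absolute : ∀ f x y → N.app f x y ⇔ app (elem f) (elem x) (elem y)
  app-absolute f x y = mk⇔
    (λ (p , h , m) → elem p , to (pair-absolute x y p) h , m)
    (λ (p , h , m) → let p′ = element f m in p′ , from (pair-absolute x y p′) h , m)

  app-elements : ∀ {x y} (f : Member P) → app (elem f) x y → P x × P y
  app-elements f (p , h , m) = pair-elements (element f m) h

  inDom-absolute : ∀ f x → N.InDom f x ⇔ InDom (elem f) (elem x)
  inDom-absolute f x = mk⇔ (λ (y , a) → elem y , to (app-absolute f x y) a)
    (λ (y , a) → let y′ = y ∣ proj₂ (app-elements f a) in y′ , from (app-absolute f x y′) a)

  function-absolute : ∀ f → N.IsFunction f ⇔ IsFunction (elem f)
  function-absolute f = mk⇔
    (λ (r , u) → (λ p m → let p′ = element f m ; x , y , h = r p′ m in elem x , elem y , to (pair-absolute x y p′) h)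
       , λ x y y′ a a′ → let X = x ∣ proj₁ (app-elements f a) ; Y = y ∣ proj₂ (app-elements f a)
                             Y′ = y′ ∣ proj₂ (app-elements f a′) in
           cong elem (u X Y Y′ (from (app-absolute f X Y) a) (from (app-absolute f X Y′) a′)))
    (λ (r , u) → (λ p m → let x , y , h = r (elem p) m ; px , py = pair-elements p h in
                   (x ∣ px) , (y ∣ py) , from (pair-absolute (x ∣ px) (y ∣ py) p) h)
       , λ x y y′ a a′ → Member≡ (u _ _ _ (to (app-absolute f x y) a) (to (app-absolute f x y′) a′)))

  functionOn-absolute : ∀ d f → N.FunctionOn d f ⇔ FunctionOn (elem d) (elem f)
  functionOn-absolute d f = function-absolute f ×-⇔
    Is-absolute d (λ x → inDom-absolute f x) (λ x (y , a) → proj₁ (app-elements f a))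

  const-absolute : ∀ d x c → IsConst (elem d) (elem x) (elem c) → N.IsConst d x c
  const-absolute d x c h p = h (elem p) ⟨⇔⟩ mk⇔
    (λ (i , m , q) → let i′ = element d m in i′ , m , from (pair-absolute i′ x p) q)
    (λ (i , m , q) → elem i , m , to (pair-absolute i x p) q)

  ∋-absolute : ∀ u {Q : V → Set ℓ} {Q′ : Member P → Set ℓ} → (∀ z → Q′ z ⇔ Q (elem z)) →
               (∀ z → Q z → P z) → (u N.∋｛ Q′ ｝) ⇔ (elem u ∋｛ Q ｝)
  ∋-absolute u e hQ = mk⇔
    (λ (a , h , m) → elem a , to (Is-absolute a e hQ) h , m)
    (λ (a , h , m) → let a′ = element u m in a′ , from (Is-absolute a′ e hQ) h , m)

  ordinal-absolute : ∀ x → N.IsOrdinal x ⇔ IsOrdinal (elem x)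
  ordinal-absolute x = tr x ×-⇔ mk⇔
    (λ h y m → to (tr (element x m)) (h (element x m) m)) (λ h y m → from (tr y) (h (elem y) m))
    where
    tr : ∀ x → N.IsTransitive x ⇔ IsTransitive (elem x)
    tr x = mk⇔ (λ h y my z mz → h (element x my) my (element (element x my) mz) mz)
               (λ h y my z mz → h (elem y) my (elem z) mz)

module _ where
  open Codes {At = NoAtom} {C = ⊥}

  -- In this form elementarity carries the normality of the measures to every stage.
  normalUltrafilterᶠ : Fm NoAtom ⊥ 2
  normalUltrafilterᶠ =
      ordinalᶠ #0
    ∧ᶠ (∀ᶠ #0 ∈ᶠ #2 ⇒ᶠ #0 ⊆ᶠ #1)
    ∧ᶠ (∀ᶠ emptyᶠ #0 ⇒ᶠ ¬ᶠ #0 ∈ᶠ #2)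
    ∧ᶠ (∀ᶠ ∀ᶠ #1 ∈ᶠ #3 ⇒ᶠ #1 ⊆ᶠ #0 ⇒ᶠ #0 ⊆ᶠ #2 ⇒ᶠ #0 ∈ᶠ #3)
    ∧ᶠ (∀ᶠ ∀ᶠ #1 ∈ᶠ #3 ⇒ᶠ #0 ∈ᶠ #3 ⇒ᶠ
          (∃ᶠ (∀ᶠ #0 ∈ᶠ #1 ⇔ᶠ #0 ∈ᶠ #3 ∧ᶠ #0 ∈ᶠ #2) ∧ᶠ #0 ∈ᶠ #4))
    ∧ᶠ (∀ᶠ #0 ⊆ᶠ #1 ⇒ᶠ #0 ∈ᶠ #2 ∨ᶠ
          (∃ᶠ (∀ᶠ #0 ∈ᶠ #1 ⇔ᶠ #0 ∈ᶠ #3 ∧ᶠ ¬ᶠ #0 ∈ᶠ #2) ∧ᶠ #0 ∈ᶠ #3))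
    ∧ᶠ (∀ᶠ ¬ᶠ (∃ᶠ (∀ᶠ #0 ∈ᶠ #1 ⇔ᶠ #0 ≡ᶠ #2) ∧ᶠ #0 ∈ᶠ #3))
    ∧ᶠ (∀ᶠ ∀ᶠ #1 ∈ᶠ #2 ⇒ᶠ functionOnᶠ #1 #0 ⇒ᶠ
          (∀ᶠ ∀ᶠ appᶠ #2 #1 #0 ⇒ᶠ #0 ∈ᶠ #5) ⇒ᶠ
          (∃ᶠ (∀ᶠ #0 ∈ᶠ #1 ⇔ᶠ #0 ∈ᶠ #4 ∧ᶠ (∀ᶠ ∀ᶠ appᶠ #4 #1 #0 ⇒ᶠ #2 ∈ᶠ #0)) ∧ᶠ #0 ∈ᶠ #4))
    ∧ᶠ (∀ᶠ functionOnᶠ #1 #0 ⇒ᶠ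
          (∀ᶠ ∀ᶠ appᶠ #2 #1 #0 ⇒ᶠ #0 ∈ᶠ #4) ⇒ᶠ
          (∃ᶠ (∀ᶠ #0 ∈ᶠ #1 ⇔ᶠ #0 ∈ᶠ #3 ∧ᶠ (∀ᶠ ∀ᶠ #1 ∈ᶠ #2 ⇒ᶠ appᶠ #4 #1 #0 ⇒ᶠ #2 ∈ᶠ #0)) ∧ᶠ #0 ∈ᶠ #3))

module _ {ℓ : Level} (V : Set ℓ) (_∈_ : V → V → Set ℓ) where
  open SetTheory V _∈_

  normalUltrafilter-correct : ∀ κ u → IsNormalUltrafilter κ u ⇔
                              Pure.Models V _∈_ (λ ()) normalUltrafilterᶠ (κ ∷ u ∷ [])
  normalUltrafilter-correct κ u = mk⇔
    (λ h → let open IsNormalUltrafilter h in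
      ordinal , subsets , proper , upward , intersection , ultra , nonprincipal , complete , diagonal)
    (λ { (h₁ , h₂ , h₃ , h₄ , h₅ , h₆ , h₇ , h₈ , h₉) → record
      { ordinal = h₁ ; subsets = h₂ ; proper = h₃ ; upward = h₄ ; intersection = h₅
      ; ultra = h₆ ; nonprincipal = h₇ ; complete = h₈ ; diagonal = h₉ } })

#10 : ∀ {c} {C : Set c} {n} → Tm C (11 +ℕ n)
#10 = wk #9
#11 : ∀ {c} {C : Set c} {n} → Tm C (12 +ℕ n)
#11 = wk #10

-- The iteration

record IteratedUltrapower {ℓ : Level} (V : Set ℓ) (_∈_ : V → V → Set ℓ) : Set ℓ where
  open SetTheory V _∈_
  field
    κ α U     : V
    ordinal-α : IsOrdinal α
    sequence  : FunctionOn α U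
    normal    : ∀ γ u → app U γ u → IsNormalUltrafilter κ u
    M         : Class 2
    Π         : Class 4
    Rep       : Class 3

  𝕄 : V → V → Set ℓ
  𝕄 ξ x = M [ ξ ∷ x ∷ [] ]

  π : V → V → V → V → Set ℓ
  π ζ ξ x y = Π [ ζ ∷ ξ ∷ x ∷ y ∷ [] ]

  field
    iteration : IsIteration κ α U 𝕄 π (λ ξ g x → Rep [ ξ ∷ g ∷ x ∷ [] ])
    K         : V
    critical  : IsCriticalSequence α π K

module Iteration {ℓ : Level} (𝒱 : ZFCModel ℓ) (I : IteratedUltrapower (ZFCModel.V 𝒱) (ZFCModel._∈_ 𝒱)) where

  open ZFCModel 𝒱
  open SetTheory V _∈_
  open IteratedUltrapower I
  open IsIteration iteration
  open Codes
  open ZF 𝒱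
  open Recursion 𝒱
  open Member using (elem)

  πᶠ : ∀ {n} → Tm V n → Tm V n → Tm V n → Tm V n → Fm₀ n
  πᶠ ζ ξ x y = atom Π (ζ ∷ ξ ∷ x ∷ y ∷ [])

  Stage : V → Set ℓ
  Stage ξ = Member (𝕄 ξ)

  _∈ₛ_ : ∀ {ξ} → Stage ξ → Stage ξ → Set ℓ
  x ∈ₛ y = elem x ∈ elem y

  ∈-α : ∀ {ζ ξ} → ζ ∈ ξ → ξ ⊴ α → ζ ∈ α
  ∈-α m (inj₁ k)    = proj₁ ordinal-α _ k _ m
  ∈-α m (inj₂ refl) = m

  ordinal-⊴ : ∀ {ξ} → ξ ⊴ α → IsOrdinal ξ
  ordinal-⊴ (inj₁ m)    = ordinal-∈ ordinal-α m
  ordinal-⊴ (inj₂ refl) = ordinal-α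

  ⊴-trans : ∀ {ζ η ξ} → ξ ⊴ α → η ⊴ ξ → ζ ⊴ η → ζ ⊴ ξ
  ⊴-trans p (inj₂ refl) q           = q
  ⊴-trans p (inj₁ m)    (inj₂ refl) = inj₁ m
  ⊴-trans p (inj₁ m)    (inj₁ k)    = inj₁ (proj₁ (ordinal-⊴ p) _ m _ k)

  ∅⊴ : ∀ {ξ} → ξ ⊴ α → ∅ ⊴ ξ
  ∅⊴ {ξ} p with dec (IsEmpty ξ)
  ... | inj₁ e = inj₂ (sym (empty-unique e))
  ... | inj₂ n = inj₁ (∅∈ordinal (ordinal-⊴ p) n)

  data Kind (ξ : V) : Set ℓ where
    zero : IsEmpty ξ → Kind ξ
    suc  : ∀ η → IsSuc η ξ → Kind ξ
    lim  : IsLimit ξ → Kind ξ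

  kind : ∀ {ξ} → ξ ⊴ α → Kind ξ
  kind {ξ} p with dec (IsEmpty ξ) | dec (∃[ η ] IsSuc η ξ)
  ... | inj₁ e | _              = zero e
  ... | inj₂ n | inj₁ (η , h)   = suc η h
  ... | inj₂ n | inj₂ n′        = lim (ordinal-⊴ p , n , n′)

  IsUltrapowerStage : V → V → Set ℓ
  IsUltrapowerStage η ξ = ∃[ u ] ∃[ κ′ ] ∃[ u′ ] app U η u × π ∅ η κ κ′ × π ∅ η u u′ ×
    IsUltrapower (𝕄 η) κ′ u′ (𝕄 ξ) (λ g x → Rep [ η ∷ g ∷ x ∷ [] ]) ×
    (∀ x y → π η ξ x y ⇔ (∃[ c ] IsConst κ′ x c × Rep [ η ∷ c ∷ y ∷ [] ]))

  ultrapower-stage : ∀ {η ξ} → η ∈ α → IsSuc η ξ → IsUltrapowerStage η ξ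
  ultrapower-stage {η} {ξ} m s =
    let u , a   = to (proj₂ sequence η) m
        κ′ , h  = total ∅ η κ (inj₁ m) (∅⊴ (inj₁ m)) (start ∅ κ ∉∅)
        u′ , h′ = total ∅ η u (inj₁ m) (∅⊴ (inj₁ m)) (start ∅ u ∉∅)
        p , q = successor ∅ η ξ u κ′ u′ ∉∅ m s a h h′
    in u , κ′ , u′ , a , h , h′ , p , q

  stage-transitive : ∀ {ξ} → ξ ⊴ α → ∀ x y → 𝕄 ξ y → x ∈ y → 𝕄 ξ x
  stage-transitive {ξ} p x y my m with kind p
  ... | zero e  = start ξ x e
  ... | suc η s = let _ , _ , _ , _ , _ , _ , up , _ = ultrapower-stage (∈-α (suc-∈ s) p) s
                  in IsUltrapower.transitive up x y my m
  ... | lim l   = limit-transitive ξ x y p l my m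

  private
    -- Composition is given only when the last map is a single step. At a limit `ξ` it follows from
    -- `limit-equality`, with `η` as the stage at which the two elements already coincide.
    composite : ∀ ξ → ξ ⊴ α → ∀ ζ η x y z → ζ ∈ η → η ∈ ξ → π ζ η x y → π η ξ y z → π ζ ξ x z
    composite = ∈-induction (#0 ⊴ᶠ ` α ⇒ᶠ (∀ᶠ ∀ᶠ ∀ᶠ ∀ᶠ ∀ᶠ #4 ∈ᶠ #3 ⇒ᶠ #3 ∈ᶠ #5 ⇒ᶠ
        πᶠ #4 #3 #2 #1 ⇒ᶠ πᶠ #3 #5 #1 #0 ⇒ᶠ πᶠ #4 #5 #2 #0)) step
      where
      step : ∀ ξ → (∀ θ → θ ∈ ξ → θ ⊴ α → ∀ ζ η x y z → ζ ∈ η → η ∈ θ → π ζ η x y → π η θ y z → π ζ θ x z) →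
             ξ ⊴ α → ∀ ζ η x y z → ζ ∈ η → η ∈ ξ → π ζ η x y → π η ξ y z → π ζ ξ x z
      step ξ ih p ζ η x y z mζ mη h k with kind p
      ... | zero e  = ⊥-elim (e η mη)
      ... | suc θ s = successor-step
        where
        θ∈α : θ ∈ α
        θ∈α = ∈-α (suc-∈ s) p
        η⊴θ : η ⊴ θ
        η⊴θ = to (s η) mη
        first : ∀ w → η ⊴ θ → π η θ y w → π ζ θ x w
        first w (inj₁ m)    k′ = ih θ (suc-∈ s) (inj₁ θ∈α) ζ η x y w mζ m h k′
        first w (inj₂ refl) k′ with refl ← proj₂ (to (identity θ y w (inj₁ θ∈α)) k′) = h
        successor-step : π ζ ξ x z
        successor-step =
          let w , k₁ , k₂ = to (compose η θ ξ y z θ∈α s η⊴θ) k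
          in from (compose ζ θ ξ x z θ∈α s (⊴-trans (inj₁ θ∈α) η⊴θ (inj₁ mζ))) (w , first w η⊴θ k₁ , k₂)
      ... | lim l =
        let ζ∈ξ = proj₁ (ordinal-⊴ p) η mη ζ mζ
            z′ , h′ = total ζ ξ x p (inj₁ ζ∈ξ) (proj₁ (typed ζ η x y (inj₁ (∈-α mη p)) (inj₁ mζ) h))
            y-in = proj₂ (typed ζ η x y (inj₁ (∈-α mη p)) (inj₁ mζ) h)
            e = from (limit-equality ξ ζ η x y z′ z p l ζ∈ξ mη h′ k)
                  (η , mη , inj₁ mζ , inj₂ refl , y , y , h
                  , from (identity η y y (inj₁ (∈-α mη p))) (y-in , refl) , refl)
        in subst (π ζ ξ x) e h′

  π-∘ : ∀ {ζ η ξ x y z} → ξ ⊴ α → η ⊴ ξ → ζ ⊴ η → π ζ η x y → π η ξ y z → π ζ ξ x z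
  π-∘ {ζ} {η} {ξ} {x} {y} {z} p (inj₁ m) (inj₁ k) h h′ = composite ξ p ζ η x y z k m h h′
  π-∘ {ζ} {η} {ξ} {x} {y} {z} p (inj₂ refl) q h h′ with refl ← proj₂ (to (identity ξ y z p) h′) = h
  π-∘ {ζ} {η} {ξ} {x} {y} {z} p (inj₁ m) (inj₂ refl) h h′
    with refl ← proj₂ (to (identity ζ x y (inj₁ (∈-α m p))) h) = h′

  ⊴-below : ∀ {ζ ξ} → ξ ⊴ α → ζ ⊴ ξ → ζ ⊴ α
  ⊴-below p (inj₁ m)    = inj₁ (∈-α m p)
  ⊴-below p (inj₂ refl) = p

  opaque
    -- The graphs `π ζ ξ` become maps between types of elements of stages. The order proofs are
    -- irrelevant, so a map depends on its two indices only.
    j : ∀ ζ ξ → .(ξ ⊴ α) → .(ζ ⊴ ξ) → Stage ζ → Stage ξ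
    j ζ ξ p q x =
      let p′ = recompute em p ; q′ = recompute em q
          y , h = total ζ ξ (elem x) p′ q′ (holds em x)
      in y ∣ proj₂ (typed ζ ξ (elem x) y p′ q′ h)

    j-graph : ∀ {ζ ξ} (p : ξ ⊴ α) (q : ζ ⊴ ξ) x → π ζ ξ (elem x) (elem (j ζ ξ p q x))
    j-graph {ζ} {ξ} p q x = proj₂ (total ζ ξ (elem x) (recompute em p) (recompute em q) (holds em x))

  j-unique : ∀ {ζ ξ} (p : ξ ⊴ α) (q : ζ ⊴ ξ) x {y} → π ζ ξ (elem x) y → y ≡ elem (j ζ ξ p q x)
  j-unique {ζ} {ξ} p q x h = functional ζ ξ (elem x) _ _ p q h (j-graph p q x)

  j-id : ∀ {ξ} (p : ξ ⊴ α) (q : ξ ⊴ ξ) x → x ≡ j ξ ξ p q x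
  j-id {ξ} p q x = Member≡ (j-unique p q x (from (identity ξ (elem x) (elem x) p) (holds em x , refl)))

  j-∘ : ∀ {ζ η ξ} (p : ξ ⊴ α) (q : η ⊴ ξ) (r : ζ ⊴ η) x →
        j η ξ p q (j ζ η (⊴-below p q) r x) ≡ j ζ ξ p (⊴-trans p q r) x
  j-∘ p q r x = Member≡ (j-unique p (⊴-trans p q r) x
    (π-∘ p q r (j-graph (⊴-below p q) r x) (j-graph p q _)))

  -- That all earlier maps into stage ξ are cofinal and preserve the basic
  -- formulas is a single formula of V, so that induction on ξ applies to it.
  private
    open Interpretation V _∈_ {At = Class} {C = V} (λ C xs → C [ xs ]) id using (eval; eval-wk)

    relTm : ∀ {n m} → Tm ⊥ n → Vec (Tm V m) n → Tm V m
    relTm (var i) ρ = lookup ρ i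

    -- Relativization to the stage named by `z`. The stage is a term of the language, so it can be a
    -- bound variable when preservation between all stages is expressed inside `V`.
    relativize : ∀ {n m} → Fm NoAtom ⊥ n → Tm V m → Vec (Tm V m) n → Fm₀ m
    relativize (s ∈ᶠ t) z ρ = relTm s ρ ∈ᶠ relTm t ρ
    relativize (s ≡ᶠ t) z ρ = relTm s ρ ≡ᶠ relTm t ρ
    relativize (¬ᶠ φ)   z ρ = ¬ᶠ relativize φ z ρ
    relativize (φ ∧ᶠ ψ) z ρ = relativize φ z ρ ∧ᶠ relativize ψ z ρ
    relativize (φ ∨ᶠ ψ) z ρ = relativize φ z ρ ∨ᶠ relativize ψ z ρ
    relativize (φ ⇒ᶠ ψ) z ρ = relativize φ z ρ ⇒ᶠ relativize ψ z ρ
    relativize (φ ⇔ᶠ ψ) z ρ = relativize φ z ρ ⇔ᶠ relativize ψ z ρ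
    relativize (∃ᶠ φ)   z ρ = ∃ᶠ atom M (wk z ∷ #0 ∷ []) ∧ᶠ relativize φ (wk z) (#0 ∷ map wk ρ)
    relativize (∀ᶠ φ)   z ρ = ∀ᶠ atom M (wk z ∷ #0 ∷ []) ⇒ᶠ relativize φ (wk z) (#0 ∷ map wk ρ)

    ModelsAt : ∀ ζ {n} → Fm NoAtom ⊥ n → Vec (Stage ζ) n → Set ℓ
    ModelsAt ζ = Pure.Models (Stage ζ) _∈ₛ_ (λ ())

    relativize-correct : ∀ {ζ n m} (φ : Fm NoAtom ⊥ n) z ρ (v : Vec V m) (w : Vec (Stage ζ) n) →
      eval v z ≡ ζ → (∀ i → eval v (lookup ρ i) ≡ elem (lookup w i)) →
      ⟦ relativize φ z ρ ⟧ v ⇔ ModelsAt ζ φ w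
    relativize-correct {ζ} (s ∈ᶠ t) z ρ v w hz h = ≡⇒⇔ (cong₂ _∈_ (tm s) (tm t))
      where
      tm : ∀ t → eval v (relTm t ρ) ≡ elem (Interpretation.eval (Stage ζ) _∈ₛ_ {At = NoAtom} (λ ()) (λ ()) w t)
      tm (var i) = h i
    relativize-correct {ζ} (s ≡ᶠ t) z ρ v w hz h =
      ≡⇒⇔ (cong₂ _≡_ (tm s) (tm t)) ⟨⇔⟩ ⇔-sym (Member≡-⇔ _ _)
      where
      tm : ∀ t → eval v (relTm t ρ) ≡ elem (Interpretation.eval (Stage ζ) _∈ₛ_ {At = NoAtom} (λ ()) (λ ()) w t)
      tm (var i) = h i
    relativize-correct (¬ᶠ φ)   z ρ v w hz h = ¬-⇔ (relativize-correct φ z ρ v w hz h)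
    relativize-correct (φ ∧ᶠ ψ) z ρ v w hz h =
      relativize-correct φ z ρ v w hz h ×-⇔ relativize-correct ψ z ρ v w hz h
    relativize-correct (φ ∨ᶠ ψ) z ρ v w hz h =
      let e = relativize-correct φ z ρ v w hz h ; f = relativize-correct ψ z ρ v w hz h in
      mk⇔ [ inj₁ ∘ to e , inj₂ ∘ to f ]′ [ inj₁ ∘ from e , inj₂ ∘ from f ]′
    relativize-correct (φ ⇒ᶠ ψ) z ρ v w hz h =
      let e = relativize-correct φ z ρ v w hz h ; f = relativize-correct ψ z ρ v w hz h in
      mk⇔ (λ k → to f ∘ k ∘ from e) (λ k → from f ∘ k ∘ to e)
    relativize-correct (φ ⇔ᶠ ψ) z ρ v w hz h =
      let e = relativize-correct φ z ρ v w hz h ; f = relativize-correct ψ z ρ v w hz h in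
      mk⇔ (λ k → ⇔-sym e ⟨⇔⟩ k ⟨⇔⟩ f) (λ k → e ⟨⇔⟩ k ⟨⇔⟩ ⇔-sym f)
    relativize-correct {ζ} (∃ᶠ φ) z ρ v w hz h = mk⇔
      (λ (x , m , s) → let x′ = x ∣ subst (λ ζ → 𝕄 ζ x) (hz′ x) m in x′ , to (next x′) s)
      (λ (x , s) → elem x , subst (λ ζ → 𝕄 ζ (elem x)) (sym (hz′ (elem x))) (holds em x) , from (next x) s)
      where
      hz′ : ∀ x → eval (x ∷ v) (wk z) ≡ ζ
      hz′ x = trans (eval-wk x v z) hz
      next : ∀ x → ⟦ relativize φ (wk z) (#0 ∷ map wk ρ) ⟧ (elem x ∷ v) ⇔ ModelsAt ζ φ (x ∷ w)
      next x = relativize-correct φ (wk z) (#0 ∷ map wk ρ) (elem x ∷ v) (x ∷ w) (hz′ (elem x)) λ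
        { zero → refl
        ; (suc i) → trans (cong (eval (elem x ∷ v)) (lookup-map i wk ρ))
            (trans (eval-wk (elem x) v (lookup ρ i)) (h i)) }
    relativize-correct {ζ} (∀ᶠ φ) z ρ v w hz h = mk⇔
      (λ f x → to (next x) (f (elem x) (subst (λ ζ → 𝕄 ζ (elem x)) (sym (hz′ (elem x))) (holds em x))))
      (λ f x m → let x′ = x ∣ subst (λ ζ → 𝕄 ζ x) (hz′ x) m in from (next x′) (f x′))
      where
      hz′ : ∀ x → eval (x ∷ v) (wk z) ≡ ζ
      hz′ x = trans (eval-wk x v z) hz
      next : ∀ x → ⟦ relativize φ (wk z) (#0 ∷ map wk ρ) ⟧ (elem x ∷ v) ⇔ ModelsAt ζ φ (x ∷ w)
      next x = relativize-correct φ (wk z) (#0 ∷ map wk ρ) (elem x ∷ v) (x ∷ w) (hz′ (elem x)) λ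
        { zero → refl
        ; (suc i) → trans (cong (eval (elem x ∷ v)) (lookup-map i wk ρ))
            (trans (eval-wk (elem x) v (lookup ρ i)) (h i)) }

    ⋀ᶠ : ∀ {k n} → (Fin k → Fm₀ n) → Fm₀ n
    ⋀ᶠ {zero}  φ = ∀ᶠ #0 ≡ᶠ #0
    ⋀ᶠ {suc k} φ = φ zero ∧ᶠ ⋀ᶠ (φ ∘ suc)

    ⋀-correct : ∀ {k n} (φ : Fin k → Fm₀ n) v → ⟦ ⋀ᶠ φ ⟧ v ⇔ (∀ i → ⟦ φ i ⟧ v)
    ⋀-correct {zero}  φ v = mk⇔ (λ _ ()) (λ _ _ → refl)
    ⋀-correct {suc k} φ v = (⇔-refl ×-⇔ ⋀-correct (φ ∘ suc) v)
      ⟨⇔⟩ mk⇔ (λ { (p , f) zero → p ; (p , f) (suc i) → f i }) (λ f → f zero , f ∘ suc)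

    -- ζ and ξ are variables 0 and 1
    preservesᶠ : Fm NoAtom ⊥ 5 → Fm₀ 2
    preservesᶠ θ = ∀ᶠ ∀ᶠ ∀ᶠ ∀ᶠ ∀ᶠ ∀ᶠ ∀ᶠ ∀ᶠ ∀ᶠ ∀ᶠ
      πᶠ #10 #11 #9 #4 ⇒ᶠ πᶠ #10 #11 #8 #3 ⇒ᶠ πᶠ #10 #11 #7 #2 ⇒ᶠ πᶠ #10 #11 #6 #1 ⇒ᶠ πᶠ #10 #11 #5 #0 ⇒ᶠ
      relativize θ #10 (#9 ∷ #8 ∷ #7 ∷ #6 ∷ #5 ∷ []) ⇒ᶠ relativize θ #11 (#4 ∷ #3 ∷ #2 ∷ #1 ∷ #0 ∷ [])

    cofinalᶠ : Fm₀ 2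
    cofinalᶠ = ∀ᶠ atom M (#2 ∷ #0 ∷ []) ⇒ᶠ (∃ᶠ ∃ᶠ πᶠ #3 #4 #1 #0 ∧ᶠ #2 ∈ᶠ #0)

    basicᶠ : Fin 10 → Fm₀ 2
    basicᶠ k = atom (toClass (preservesᶠ (lookup basicFormulas k))) (#0 ∷ #1 ∷ [])

    opaque
      basicClass cofinalClass : Class 2
      basicClass = toClass (⋀ᶠ basicᶠ)
      cofinalClass = toClass cofinalᶠ

    goodᶠ : Fm₀ 1
    goodᶠ = #0 ⊴ᶠ ` α ⇒ᶠ (∀ᶠ #0 ∈ᶠ #1 ⇒ᶠ atom basicClass (#0 ∷ #1 ∷ []) ∧ᶠ atom cofinalClass (#0 ∷ #1 ∷ []))

  Good : V → Set ℓ
  Good ξ = (p : ξ ⊴ α) → ∀ ζ (m : ζ ∈ ξ) →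
           BasicEmbedding _∈ₛ_ _∈ₛ_ (j ζ ξ p (inj₁ m)) × Cofinal _∈ₛ_ _∈ₛ_ (j ζ ξ p (inj₁ m))

  private
    module _ {ξ : V} (p : ξ ⊴ α) {ζ : V} (m : ζ ∈ ξ) where

      jζξ : Stage ζ → Stage ξ
      jζξ = j ζ ξ p (inj₁ m)

      jζξ-graph : ∀ x → π ζ ξ (elem x) (elem (jζξ x))
      jζξ-graph = j-graph p (inj₁ m)

      source : ∀ {x y} → π ζ ξ x y → Stage ζ
      source {x} {y} h = x ∣ proj₁ (typed ζ ξ x y p (inj₁ m) h)

      image≡ : ∀ {x y} (h : π ζ ξ x y) → y ≡ elem (jζξ (source h))
      image≡ h = j-unique p (inj₁ m) (source h) h

      five : ∀ {a} {P : Fin 5 → Set a} → P (# 0) → P (# 1) → P (# 2) → P (# 3) → P (# 4) → ∀ i → P i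
      five a b c d e zero = a
      five a b c d e (suc zero) = b
      five a b c d e (suc (suc zero)) = c
      five a b c d e (suc (suc (suc zero))) = d
      five a b c d e (suc (suc (suc (suc zero)))) = e

      preserves-correct : ∀ θ → ⟦ preservesᶠ θ ⟧ (ζ ∷ ξ ∷ []) ⇔ Preserves _∈ₛ_ _∈ₛ_ jζξ θ
      preserves-correct θ = mk⇔
        (λ h a b c d e s → to (relativize-correct θ #11 (#4 ∷ #3 ∷ #2 ∷ #1 ∷ #0 ∷ []) _
                                 (jζξ a ∷ jζξ b ∷ jζξ c ∷ jζξ d ∷ jζξ e ∷ []) refl (five refl refl refl refl refl))
          (h (elem a) (elem b) (elem c) (elem d) (elem e) (elem (jζξ a)) (elem (jζξ b)) (elem (jζξ c)) (elem (jζξ d))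
              (elem (jζξ e))
             (jζξ-graph a) (jζξ-graph b) (jζξ-graph c) (jζξ-graph d) (jζξ-graph e)
             (from (relativize-correct θ #10 (#9 ∷ #8 ∷ #7 ∷ #6 ∷ #5 ∷ []) _ (a ∷ b ∷ c ∷ d ∷ e ∷ [])
                     refl (five refl refl refl refl refl)) s)))
        ⇐
        where
        ⇐ : Preserves _∈ₛ_ _∈ₛ_ jζξ θ → ⟦ preservesᶠ θ ⟧ (ζ ∷ ξ ∷ [])
        ⇐ h a b c d e a′ b′ c′ d′ e′ ha hb hc hd he s =
          from (relativize-correct θ #11 (#4 ∷ #3 ∷ #2 ∷ #1 ∷ #0 ∷ []) _
                 (jζξ (source ha) ∷ jζξ (source hb) ∷ jζξ (source hc) ∷ jζξ (source hd) ∷ jζξ (source he) ∷ []) refl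
                 (five (image≡ ha) (image≡ hb) (image≡ hc) (image≡ hd) (image≡ he)))
            (h _ _ _ _ _ (to (relativize-correct θ #10 (#9 ∷ #8 ∷ #7 ∷ #6 ∷ #5 ∷ []) _
                 (source ha ∷ source hb ∷ source hc ∷ source hd ∷ source he ∷ [])
                 refl (five refl refl refl refl refl)) s))

      cofinal-correct : ⟦ cofinalᶠ ⟧ (ζ ∷ ξ ∷ []) ⇔ Cofinal _∈ₛ_ _∈ₛ_ jζξ
      cofinal-correct = mk⇔ ⇒ λ h y hy → let b , my = h (y ∣ hy) in elem b , elem (jζξ b) , jζξ-graph b , my
        where
        ⇒ : ⟦ cofinalᶠ ⟧ (ζ ∷ ξ ∷ []) → Cofinal _∈ₛ_ _∈ₛ_ jζξ
        ⇒ h y with h (elem y) (holds em y)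
        ... | b , b′ , hb , my = source hb , subst (elem y ∈_) (image≡ hb) my

      opaque
        unfolding basicClass

        basicClass-correct : basicClass [ ζ ∷ ξ ∷ [] ] ⇔ BasicEmbedding _∈ₛ_ _∈ₛ_ jζξ
        basicClass-correct = toClass-correct (⋀ᶠ basicᶠ) (ζ ∷ ξ ∷ []) ⟨⇔⟩ ⋀-correct basicᶠ (ζ ∷ ξ ∷ [])
          ⟨⇔⟩ mk⇔ (λ h k → to (preserved k) (h k)) (λ h k → from (preserved k) (h k))
          where
          preserved : ∀ k → toClass (preservesᶠ (lookup basicFormulas k)) [ ζ ∷ ξ ∷ [] ]
                            ⇔ Preserves _∈ₛ_ _∈ₛ_ jζξ (lookup basicFormulas k)
          preserved k = toClass-correct (preservesᶠ (lookup basicFormulas k)) (ζ ∷ ξ ∷ [])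
                        ⟨⇔⟩ preserves-correct (lookup basicFormulas k)

        cofinalClass-correct : cofinalClass [ ζ ∷ ξ ∷ [] ] ⇔ Cofinal _∈ₛ_ _∈ₛ_ jζξ
        cofinalClass-correct = toClass-correct cofinalᶠ (ζ ∷ ξ ∷ []) ⟨⇔⟩ cofinal-correct

    good-correct : ∀ ξ → ⟦ goodᶠ ⟧ (ξ ∷ []) ⇔ Good ξ
    good-correct ξ = mk⇔
      (λ h p ζ m → to (basicClass-correct p m) (proj₁ (h p ζ m)) , to (cofinalClass-correct p m) (proj₂ (h p ζ m)))
      (λ h p ζ m → from (basicClass-correct p m) (proj₁ (h p ζ m)) , from (cofinalClass-correct p m) (proj₂ (h p ζ m)))

  good-induction : (∀ ξ → (∀ η → η ∈ ξ → Good η) → Good ξ) → ∀ ξ → Good ξ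
  good-induction step ξ = to (good-correct ξ) (∈-induction goodᶠ (λ ξ ih →
    from (good-correct ξ) (step ξ λ η m → to (good-correct η) (ih η m))) ξ)

  ι : V → Stage ∅
  ι x = x ∣ start ∅ x ∉∅

  ι-embedding : Embedding _∈_ _∈ₛ_ ι
  ι-embedding = surjective-embedding (λ { refl → refl }) ⇔-refl (λ y → elem y , refl)

  ZFC : V → Set ℓ
  ZFC ξ = SetTheory.IsZFC (Stage ξ) _∈ₛ_

  stageModel : ∀ {ξ} → ZFC ξ → ZFCModel ℓ
  stageModel {ξ} h = record { V = Stage ξ ; _∈_ = _∈ₛ_ ; em = em ; zfc = h }

  zfc-transfer : ∀ {V W : Set ℓ} {_∈_ : V → V → Set ℓ} {_∈′_ : W → W → Set ℓ} {j : V → W} →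
                 Embedding _∈_ _∈′_ j → SetTheory.IsZFC V _∈_ → SetTheory.IsZFC W _∈′_
  zfc-transfer e = Elementary.zfc-transfer _ _ em _ _ _ e

  zfc-∅ : ZFC ∅
  zfc-∅ = zfc-transfer ι-embedding zfc

  -- Elementarity of the maps out of `ζ` requires ZFC in `Stage ζ`. This in turn comes from
  -- elementarity of the map from stage `∅`, a copy of `V`, where ZFC is known from the outset.
  module Known (η : V) (good : ∀ θ → θ ⊴ η → Good θ) where
   opaque

    stage-zfc : ∀ {ζ} → η ⊴ α → ζ ⊴ η → ZFC ζ
    stage-zfc p q with ∅⊴ (⊴-below p q)
    ... | inj₂ refl = zfc-∅
    ... | inj₁ m = let b , c = good _ q (⊴-below p q) ∅ m in
      zfc-transfer (basic-embedding (stageModel zfc-∅) (Stage _) _∈ₛ_ b c) zfc-∅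

    stage-embedding : ∀ {ζ ξ} (p : η ⊴ α) (q : ξ ⊴ η) (r : ζ ⊴ ξ) →
                      Embedding _∈ₛ_ _∈ₛ_ (j ζ ξ (⊴-below p q) r)
    stage-embedding p q (inj₂ refl) = embedding-cong (j-id (⊴-below p q) (inj₂ refl)) embedding-id
    stage-embedding p q (inj₁ m) = let b , c = good _ q (⊴-below p q) _ m in
      basic-embedding (stageModel (stage-zfc p (⊴-trans p q (inj₁ m)))) (Stage _) _∈ₛ_ b c

  module Successor {η ξ : V} (p : ξ ⊴ α) (s : IsSuc η ξ) (zfcη : ZFC η)
    (embedding : Embedding _∈ₛ_ _∈ₛ_ (j ∅ η (inj₁ (∈-α (suc-∈ s) p)) (∅⊴ (inj₁ (∈-α (suc-∈ s) p))))) where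

    η∈α : η ∈ α
    η∈α = ∈-α (suc-∈ s) p

    η⊴ξ : η ⊴ ξ
    η⊴ξ = inj₁ (suc-∈ s)

    j₀ : V → Stage η
    j₀ x = j ∅ η (inj₁ η∈α) (∅⊴ (inj₁ η∈α)) (ι x)

    j₀-embedding : Embedding _∈_ _∈ₛ_ j₀
    j₀-embedding = embedding-∘ ι-embedding embedding

    open Transitive V _∈_ em (𝕄 η) (stage-transitive (inj₁ η∈α)) public

    measure : V
    measure = proj₁ (ultrapower-stage η∈α s)

    κ̂ û : Stage η
    κ̂ = j₀ κ
    û = j₀ measure

    opaque
      ultrapower : IsUltrapower (𝕄 η) (elem κ̂) (elem û) (𝕄 ξ) (λ g x → Rep [ η ∷ g ∷ x ∷ [] ]) ×
                   (∀ x y → π η ξ x y ⇔ (∃[ c ] IsConst (elem κ̂) x c × Rep [ η ∷ c ∷ y ∷ [] ]))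
      ultrapower = rename (ultrapower-stage η∈α s)
        where
        rename : (d : IsUltrapowerStage η ξ) →
          IsUltrapower (𝕄 η) (elem κ̂) (elem (j₀ (proj₁ d))) (𝕄 ξ) (λ g x → Rep [ η ∷ g ∷ x ∷ [] ]) ×
          (∀ x y → π η ξ x y ⇔ (∃[ c ] IsConst (elem κ̂) x c × Rep [ η ∷ c ∷ y ∷ [] ]))
        rename (u , κ′ , u′ , a , h , h′ , up , can)
          with refl ← j-unique (inj₁ η∈α) (∅⊴ (inj₁ η∈α)) (ι κ) h
             | refl ← j-unique (inj₁ η∈α) (∅⊴ (inj₁ η∈α)) (ι u) h′ = up , can

      normal-stage : N.IsNormalUltrafilter κ̂ û
      normal-stage = from (normalUltrafilter-correct (Stage η) _∈ₛ_ κ̂ û)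
        (to (Elementary.transfer-pure V _∈_ em (Stage η) _∈ₛ_ j₀ j₀-embedding (λ ()) (λ ()) (λ ()) normalUltrafilterᶠ
            (κ ∷ measure ∷ []))
          (to (normalUltrafilter-correct V _∈_ κ measure)
            (normal η measure (proj₁ (proj₂ (proj₂ (proj₂ (ultrapower-stage η∈α s))))))))

    open IsUltrapower (proj₁ ultrapower) renaming (typed to rep-typed; total to rep-total; onto to rep-onto;
      equality to rep-equality; membership to rep-membership)

    rep : Stage η → Stage ξ → Set ℓ
    rep g x = Rep [ η ∷ elem g ∷ elem x ∷ [] ]

    private
      both : ∀ g h i → (∃[ a ] N.app g i a × N.app h i a) ⇔
                       (∃[ a ] app (elem g) (elem i) a × app (elem h) (elem i) a)
      both g h i = mk⇔ (λ (a , b , c) → elem a , to (app-absolute g i a) b , to (app-absolute h i a) c)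
        (λ (a , b , c) → let a′ = a ∣ proj₂ (app-elements g b) in
           a′ , from (app-absolute g i a′) b , from (app-absolute h i a′) c)

      both∈ : ∀ g h i → (∃[ a ] ∃[ b ] N.app g i a × N.app h i b × a ∈ₚ b) ⇔
                        (∃[ a ] ∃[ b ] app (elem g) (elem i) a × app (elem h) (elem i) b × a ∈ b)
      both∈ g h i = mk⇔
        (λ (a , b , c , d , e) → elem a , elem b , to (app-absolute g i a) c , to (app-absolute h i b) d , e)
        (λ (a , b , c , d , e) → let a′ = a ∣ proj₂ (app-elements g c) ; b′ = b ∣ proj₂ (app-elements h d) in
           a′ , b′ , from (app-absolute g i a′) c , from (app-absolute h i b′) d , e)

      κ-elements : ∀ {A : V → Set ℓ} z → z ∈ elem κ̂ × A z → 𝕄 η z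
      κ-elements z (m , _) = stage-transitive (inj₁ η∈α) z (elem κ̂) (holds em κ̂) m

    private
      rep-function : ∀ {g x} → rep g x → N.FunctionOn κ̂ g
      rep-function {g} {x} r = from (functionOn-absolute κ̂ g) (proj₁ (proj₂ (rep-typed (elem g) (elem x) r)))

      rep-defined : ∀ {g} → N.FunctionOn κ̂ g → ∃[ x ] rep g x
      rep-defined {g} fg = let x , r = rep-total (elem g) (holds em g) (to (functionOn-absolute κ̂ g) fg) in
        (x ∣ proj₂ (proj₂ (rep-typed (elem g) x r))) , r

      rep-covers : ∀ x → ∃[ g ] rep g x
      rep-covers x = let g , r = rep-onto (elem x) (holds em x) in (g ∣ proj₁ (rep-typed g (elem x) r)) , r

      rep-eq : ∀ {g h x y} → rep g x → rep h y →
               x ≡ y ⇔ (û N.∋｛ (λ i → i ∈ₚ κ̂ × ∃[ a ] N.app g i a × N.app h i a) ｝)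
      rep-eq {g} {h} {x} {y} r r′ = Member≡-⇔ x y
        ⟨⇔⟩ rep-equality (elem g) (elem h) (elem x) (elem y) r r′
        ⟨⇔⟩ ⇔-sym (∋-absolute û (λ i → ⇔-refl ×-⇔ both g h i) κ-elements)

      rep-mem : ∀ {g h x y} → rep g x → rep h y →
                x ∈ₛ y ⇔ (û N.∋｛ (λ i → i ∈ₚ κ̂ × ∃[ a ] ∃[ b ] N.app g i a × N.app h i b × a ∈ₚ b) ｝)
      rep-mem {g} {h} {x} {y} r r′ = rep-membership (elem g) (elem h) (elem x) (elem y) r r′
        ⟨⇔⟩ ⇔-sym (∋-absolute û (λ i → ⇔-refl ×-⇔ both∈ g h i) κ-elements)

    open Ultrapower (stageModel zfcη) (Stage ξ) _∈ₛ_ κ̂ û normal-stage rep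
      (λ {g} {x} → rep-function {g} {x}) (λ {g} → rep-defined {g}) rep-covers
      (λ {g} {h} {x} {y} → rep-eq {g} {h} {x} {y}) (λ {g} {h} {x} {y} → rep-mem {g} {h} {x} {y}) public

    -- The iteration provides some function that is constant in the sense of `V`. By absoluteness it
    -- is constant in the sense of the stage, where the constant function with a given value is
    -- unique.
    const-rep : ∀ x c → N.IsConst κ̂ x c → rep c (j η ξ p η⊴ξ x)
    const-rep x c hc with to (proj₂ ultrapower (elem x) (elem (j η ξ p η⊴ξ x))) (j-graph p η⊴ξ x)
    ... | c′ , hc′ , r = subst (λ c → Rep [ η ∷ c ∷ elem (j η ξ p η⊴ξ x) ∷ [] ]) (to (Member≡-⇔ ĉ c) c≡) r
      where
      ĉ : Stage η
      ĉ = c′ ∣ proj₁ (rep-typed c′ (elem (j η ξ p η⊴ξ x)) r)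
      c≡ : ĉ ≡ c
      c≡ = ZF.Is-unique (stageModel zfcη) (const-absolute κ̂ x ĉ hc′) hc

    step-embedding : Embedding _∈ₛ_ _∈ₛ_ (j η ξ p η⊴ξ)
    step-embedding = canonical-embedding (j η ξ p η⊴ξ) const-rep

    step-cofinal : Cofinal _∈ₛ_ _∈ₛ_ (j η ξ p η⊴ξ)
    step-cofinal = canonical-cofinal (j η ξ p η⊴ξ) const-rep

  module _ {ξ : V} (p : ξ ⊴ α)
    (zfc-below : ∀ {η} → η ∈ ξ → ZFC η)
    (embedding-below : ∀ {η ζ} (m : η ∈ ξ) (q : ζ ⊴ η) → Embedding _∈ₛ_ _∈ₛ_ (j ζ η (inj₁ (∈-α m p)) q))
    (cofinal-below : ∀ {η ζ} (m : η ∈ ξ) (k : ζ ∈ η) → Cofinal _∈ₛ_ _∈ₛ_ (j ζ η (inj₁ (∈-α m p)) (inj₁ k)))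
    where

    private
      ⊴α : ∀ {η} → η ∈ ξ → η ⊴ α
      ⊴α m = inj₁ (∈-α m p)

    module SuccessorStage {η : V} (s : IsSuc η ξ) where

      private
        η∈ξ : η ∈ ξ
        η∈ξ = suc-∈ s

        opaque
          embedding-η : Embedding _∈ₛ_ _∈ₛ_ (j η ξ p (inj₁ η∈ξ))
          embedding-η = Successor.step-embedding p s (zfc-below η∈ξ) (embedding-below η∈ξ (∅⊴ (⊴α η∈ξ)))

          cofinal-η : Cofinal _∈ₛ_ _∈ₛ_ (j η ξ p (inj₁ η∈ξ))
          cofinal-η = Successor.step-cofinal p s (zfc-below η∈ξ) (embedding-below η∈ξ (∅⊴ (⊴α η∈ξ)))

      successor-embedding : ∀ {ζ} (m : ζ ∈ ξ) → Embedding _∈ₛ_ _∈ₛ_ (j ζ ξ p (inj₁ m))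
      successor-embedding m = embedding-cong (j-∘ p (inj₁ η∈ξ) (to (s _) m))
        (embedding-∘ (embedding-below η∈ξ (to (s _) m)) embedding-η)

      private
        Covered : ∀ {ζ} → ζ ⊴ η → Stage η → Set ℓ
        Covered {ζ} q b = Σ (Stage ζ) λ c → ∀ z → z ∈ₛ b → z ∈ₛ j ζ η (⊴α η∈ξ) q c

        -- Cofinality makes `b` an element of the image of some `b₀`, hence a subset of the image of
        -- its union. The inclusion is preserved by the last step, so whatever that step puts into
        -- the image of `b` is covered as well.
        covered : ∀ {ζ} (q : ζ ⊴ η) b → Covered q b
        covered (inj₂ refl) b = b , λ z mz → subst (z ∈ₛ_) (j-id (⊴α η∈ξ) (inj₂ refl) b) mz
        covered {ζ} (inj₁ k) b = cover (cofinal-below η∈ξ k b)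
          where
          module Z = SetTheory.IsZFC (zfc-below (proj₁ (ordinal-⊴ p) η η∈ξ ζ k))
          cover : (∃[ b₀ ] b ∈ₛ j ζ η (⊴α η∈ξ) (inj₁ k) b₀) → Covered (inj₁ k) b
          cover (b₀ , mb) = proj₁ (Z.union b₀) ,
            to (Elementary.transfer-pure _ _ em _ _ _ (embedding-below η∈ξ (inj₁ k)) {C = ⊥} (λ ()) (λ ()) (λ ())
                 (∀ᶠ #0 ∈ᶠ #1 ⇒ᶠ #0 ⊆ᶠ #2) (b₀ ∷ proj₁ (Z.union b₀) ∷ []))
              (λ d md z mz → from (proj₂ (Z.union b₀) z) (d , md , mz)) b mb

      successor-cofinal : ∀ {ζ} (m : ζ ∈ ξ) → Cofinal _∈ₛ_ _∈ₛ_ (j ζ ξ p (inj₁ m))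
      successor-cofinal {ζ} m y = lift (cofinal-η y)
        where
        ζ⊴η : ζ ⊴ η
        ζ⊴η = to (s ζ) m
        lift : (∃[ b ] y ∈ₛ j η ξ p (inj₁ η∈ξ) b) → ∃[ c ] y ∈ₛ j ζ ξ p (inj₁ m) c
        lift (b , mb) = let c , sub = covered ζ⊴η b in c , subst (y ∈ₛ_) (j-∘ p (inj₁ η∈ξ) ζ⊴η c)
          (to (Elementary.transfer-pure _ _ em _ _ _ embedding-η {C = ⊥} (λ ()) (λ ()) (λ ())
                (#0 ⊆ᶠ #1) (b ∷ j ζ η (⊴α η∈ξ) ζ⊴η c ∷ [])) sub y mb)

    module LimitStage (l : IsLimit ξ) where

      private
        Below : Set ℓ
        Below = Member (_∈ ξ)

        below : (i : Below) → elem i ∈ ξ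
        below = holds em

        jξ : ∀ (i : Below) → Stage (elem i) → Stage ξ
        jξ (η ∣ m) = j η ξ p (inj₁ m)

        jξ-injective : ∀ i {x y} → jξ i x ≡ jξ i y → x ≡ y
        jξ-injective i {x} {y} e = inject (to (limit-equality ξ (elem i) (elem i) (elem x) (elem y) _ _ p l (below i)
            (below i)
              (j-graph p (inj₁ (below i)) x) (j-graph p (inj₁ (below i)) y)) (to (Member≡-⇔ _ _) e))
          where
          inject : (∃[ θ ] θ ∈ ξ × elem i ⊴ θ × elem i ⊴ θ ×
                     ∃[ z ] ∃[ z′ ] π (elem i) θ (elem x) z × π (elem i) θ (elem y) z′ × z ≡ z′) → x ≡ y
          inject (θ , m , q , _ , z , _ , h , h′ , refl) = embedding-injective (embedding-below m q)
            (Member≡ (trans (sym (j-unique (⊴α m) q x h)) (j-unique (⊴α m) q y h′)))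

        jξ-∈ : ∀ i {x y} → x ∈ₛ y ⇔ jξ i x ∈ₛ jξ i y
        jξ-∈ i {x} {y} = mk⇔
          (λ k → from lm (elem i , below i , inj₂ refl , inj₂ refl , elem x , elem y , same x , same y , k))
          (λ k → reflect (to lm k))
          where
          same : ∀ x → π (elem i) (elem i) (elem x) (elem x)
          same x = from (identity (elem i) (elem x) (elem x) (⊴α (below i))) (holds em x , refl)
          lm = limit-membership ξ (elem i) (elem i) (elem x) (elem y) _ _ p l (below i) (below i)
                 (j-graph p (inj₁ (below i)) x) (j-graph p (inj₁ (below i)) y)
          reflect : (∃[ θ ] θ ∈ ξ × elem i ⊴ θ × elem i ⊴ θ ×
                      ∃[ z ] ∃[ z′ ] π (elem i) θ (elem x) z × π (elem i) θ (elem y) z′ × z ∈ z′) → x ∈ₛ y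
          reflect (θ , m , q , q′ , z , z′ , h , h′ , k) = from (embedding-∈ (embedding-below m q))
            (subst₂ _∈_ (j-unique (⊴α m) q x h) (j-unique (⊴α m) q y h′) k)

        jξ-onto : ∀ y → Σ Below λ i → ∃[ x ] jξ i x ≡ y
        jξ-onto y = name (limit-onto ξ (elem y) p l (holds em y))
          where
          name : (∃[ ζ ] ∃[ x ] ζ ∈ ξ × π ζ ξ x (elem y)) → Σ Below λ i → ∃[ x ] jξ i x ≡ y
          name (ζ , x , m , h) = let x′ = x ∣ proj₁ (typed ζ ξ x (elem y) p (inj₁ m) h) in
            (ζ ∣ m) , x′ , Member≡ (sym (j-unique p (inj₁ m) x′ h))

        compare : ∀ {η μ} → η ∈ ξ → μ ∈ ξ → η ⊴ μ ⊎ μ ∈ η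
        compare m k = [ inj₁ ∘ inj₁ , [ inj₁ ∘ inj₂ , inj₂ ]′ ]′
          (ordinal-comparable _ _ (ordinal-⊴ (⊴α m)) (ordinal-⊴ (⊴α k)))

        Common : Below → Below → Set ℓ
        Common i k = Σ Below λ l → Σ (Stage (elem i) → Stage (elem l)) λ e → Embedding _∈ₛ_ _∈ₛ_ e
                     × (∀ x → jξ l (e x) ≡ jξ i x) × (∀ y → ∃[ z ] jξ l z ≡ jξ k y)

        common : ∀ i k → Common i k
        common i k = [ upper , lower ]′ (compare (below i) (below k))
          where
          upper : elem i ⊴ elem k → Common i k
          upper q = k , j (elem i) (elem k) (⊴α (below k)) q , embedding-below (below k) q
                  , j-∘ p (inj₁ (below k)) q , λ y → y , refl
          lower : elem k ∈ elem i → Common i k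
          lower q = i , id , embedding-id , (λ _ → refl)
                  , λ y → j (elem k) (elem i) (⊴α (below i)) (inj₁ q) y , j-∘ p (inj₁ (below i)) (inj₁ q) y

      opaque
        limit-embedding : ∀ {ζ} (m : ζ ∈ ξ) → Embedding _∈ₛ_ _∈ₛ_ (j ζ ξ p (inj₁ m))
        limit-embedding {ζ} m = DirectLimit.limit-embedding (λ (i : Below) → Stage (elem i)) (λ _ → _∈ₛ_) _∈ₛ_ jξ
          jξ-injective jξ-∈ common jξ-onto (ζ ∣ m)

      -- An element of the limit comes from some stage `i`. If `i ⊴ ζ`, it is the image of some `x′`
      -- at stage `ζ`, and a singleton covers it; otherwise cofinality of the map from `ζ` to `i`
      -- applies.
      limit-cofinal : ∀ {ζ} (m : ζ ∈ ξ) → Cofinal _∈ₛ_ _∈ₛ_ (j ζ ξ p (inj₁ m))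
      limit-cofinal {ζ} m y = cover (jξ-onto y)
        where
        module Z = SetTheory.IsZFC (zfc-below m)
        cover : (Σ Below λ i → ∃[ x ] jξ i x ≡ y) → ∃[ b ] y ∈ₛ j ζ ξ p (inj₁ m) b
        cover (i , x , refl) = [ upper , lower ]′ (compare (below i) m)
          where
          upper : elem i ⊴ ζ → ∃[ b ] jξ i x ∈ₛ j ζ ξ p (inj₁ m) b
          upper q = let x′ = j (elem i) ζ (⊴α m) q x ; b , hb = Z.pairing x′ x′ in
            b , subst (_∈ₛ j ζ ξ p (inj₁ m) b) (j-∘ p (inj₁ m) q x)
                      (to (embedding-∈ (limit-embedding m)) (from (hb x′) (inj₁ refl)))
          lower : ζ ∈ elem i → ∃[ b ] jξ i x ∈ₛ j ζ ξ p (inj₁ m) b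
          lower q = let b , mb = cofinal-below (below i) q x in
            b , subst (jξ i x ∈ₛ_) (j-∘ p (inj₁ (below i)) (inj₁ q) b)
                      (to (embedding-∈ (limit-embedding (below i))) mb)

  opaque
    all-good : ∀ ξ → Good ξ
    all-good = good-induction step
      where
      module _ (ξ : V) (ih : ∀ η → η ∈ ξ → Good η) (p : ξ ⊴ α) where
        below : ∀ {η} → η ∈ ξ → ∀ θ → θ ⊴ η → Good θ
        below m θ (inj₁ k)    = ih θ (proj₁ (ordinal-⊴ p) _ m _ k)
        below m θ (inj₂ refl) = ih θ m

        zfc-below : ∀ {η} → η ∈ ξ → ZFC η
        zfc-below m = Known.stage-zfc _ (below m) (inj₁ (∈-α m p)) (inj₂ refl)

        embedding-below : ∀ {η ζ} (m : η ∈ ξ) (q : ζ ⊴ η) → Embedding _∈ₛ_ _∈ₛ_ (j ζ η (inj₁ (∈-α m p)) q)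
        embedding-below m q = Known.stage-embedding _ (below m) (inj₁ (∈-α m p)) (inj₂ refl) q

        cofinal-below : ∀ {η ζ} (m : η ∈ ξ) (k : ζ ∈ η) → Cofinal _∈ₛ_ _∈ₛ_ (j ζ η (inj₁ (∈-α m p)) (inj₁ k))
        cofinal-below m k = proj₂ (ih _ m (inj₁ (∈-α m p)) _ k)

        by-kind : Kind ξ → ∀ ζ (m : ζ ∈ ξ) →
                  BasicEmbedding _∈ₛ_ _∈ₛ_ (j ζ ξ p (inj₁ m)) × Cofinal _∈ₛ_ _∈ₛ_ (j ζ ξ p (inj₁ m))
        by-kind (zero e)  ζ m = ⊥-elim (e ζ m)
        by-kind (suc η s) ζ m =
          embedding-basic em (SuccessorStage.successor-embedding p zfc-below embedding-below cofinal-below s m)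
          , SuccessorStage.successor-cofinal p zfc-below embedding-below cofinal-below s m
        by-kind (lim l)   ζ m =
          embedding-basic em (LimitStage.limit-embedding p zfc-below embedding-below cofinal-below l m)
          , LimitStage.limit-cofinal p zfc-below embedding-below cofinal-below l m

      step : ∀ ξ → (∀ η → η ∈ ξ → Good η) → Good ξ
      step ξ ih p = by-kind ξ ih p (kind p)

    stage-zfc : ∀ {ξ} → ξ ⊴ α → ZFC ξ
    stage-zfc p = Known.stage-zfc _ (λ θ _ → all-good θ) p (inj₂ refl)

    stage-embedding : ∀ {ζ ξ} (p : ξ ⊴ α) (q : ζ ⊴ ξ) → Embedding _∈ₛ_ _∈ₛ_ (j ζ ξ p q)
    stage-embedding p q = Known.stage-embedding _ (λ θ _ → all-good θ) p (inj₂ refl) q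

  -- Critical points, and generation of the last model

  module CriticalStage {η ξ : V} (p : ξ ⊴ α) (s : IsSuc η ξ) where

    private
      η∈α : η ∈ α
      η∈α = ∈-α (suc-∈ s) p

      module S = Successor p s (stage-zfc (inj₁ η∈α)) (stage-embedding (inj₁ η∈α) (∅⊴ (inj₁ η∈α)))
      module Can = S.Canonical (j η ξ p S.η⊴ξ) S.const-rep

      J : Stage η → Stage ξ
      J = j η ξ p (inj₁ (suc-∈ s))

    κη : Stage η
    κη = j ∅ η (inj₁ (∈-α (suc-∈ s) p)) (∅⊴ (inj₁ (∈-α (suc-∈ s) p))) (ι κ)

    private
      memberη : ∀ {x} (y : Stage η) → x ∈ elem y → Stage η
      memberη {x} y m = x ∣ stage-transitive (inj₁ η∈α) x (elem y) (holds em y) m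

      memberξ : ∀ {x} (y : Stage ξ) → x ∈ elem y → Stage ξ
      memberξ {x} y m = x ∣ stage-transitive p x (elem y) (holds em y) m

      ordinal-κη : IsOrdinal (elem κη)
      ordinal-κη = to (S.ordinal-absolute κη) (SetTheory.IsNormalUltrafilter.ordinal S.normal-stage)

      opaque
        below-image : ∀ (b : Stage η) (y : Stage ξ) → elem b ∈ elem κη → elem y ∈ elem (J b) →
                      Σ (Stage η) λ c → elem c ∈ elem b × elem y ≡ elem (J c)
        below-image b y m m′ = let c , mc , e = Can.below-image {b} {y} m m′ in c , mc , to (Member≡-⇔ _ _) e

        seed : Stage ξ
        seed = Can.seed

        below-seed : ∀ (y : Stage ξ) → elem y ∈ elem seed → Σ (Stage η) λ c → elem c ∈ elem κη × elem y ≡ elem (J c)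
        below-seed y m = let c , mc , e = Can.below-seed {y} m in c , mc , to (Member≡-⇔ _ _) e

        below-κ : ∀ (c : Stage η) → elem c ∈ elem κη → elem (J c) ∈ elem seed
        below-κ c m = Can.below-κ {c} m

        seed∈ : elem seed ∈ elem (J κη)
        seed∈ = Can.seed∈

        value-at-seed : ∀ (y : Stage ξ) → Σ (Stage η) λ g → IsFunction (elem g) × app (elem (J g)) (elem seed) (elem y)
        value-at-seed y = let g , fg , a = Can.value-at-seed y in
          g , to (S.function-absolute g) (proj₁ fg) , to (Transitive.app-absolute V _∈_ em (𝕄 ξ) (stage-transitive p)
              (J g) seed y) a

    opaque
      -- By induction on `β`: `below-image` shows that an element of the image of `β` is the image
      -- of some `c` in `β`, and `c` is already known to be fixed.
      fixed-π : ∀ β → β ∈ elem κη → π η ξ β β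
      fixed-π = ∈-induction (#0 ∈ᶠ ` elem κη ⇒ᶠ πᶠ (` η) (` ξ) #0 #0) step
        where
        step : ∀ β → (∀ γ → γ ∈ β → γ ∈ elem κη → π η ξ γ γ) → β ∈ elem κη → π η ξ β β
        step β ih m = subst (π η ξ β) (ext ⇒ ⇐) (j-graph p (inj₁ (suc-∈ s)) b)
          where
          b : Stage η
          b = memberη κη m
          fixed-below : ∀ (c : Stage η) → elem c ∈ β → elem c ≡ elem (J c)
          fixed-below c mc = j-unique p (inj₁ (suc-∈ s)) c (ih (elem c) mc (proj₁ ordinal-κη β m (elem c) mc))
          ⇒ : ∀ z → z ∈ elem (J b) → z ∈ β
          ⇒ z mz = let c , mc , e = below-image b (memberξ (J b) mz) m mz in
            subst (_∈ β) (trans (fixed-below c mc) (sym e)) mc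
          ⇐ : ∀ z → z ∈ β → z ∈ elem (J b)
          ⇐ z mz = let c = memberη b mz in
            subst (_∈ elem (J b)) (sym (fixed-below c mz)) (to
                (embedding-∈ (stage-embedding p (inj₁ (suc-∈ s))) {c} {b}) mz)

    fixed : ∀ (b : Stage η) → elem b ∈ elem κη → elem b ≡ elem (J b)
    fixed b m = j-unique p (inj₁ (suc-∈ s)) b (fixed-π (elem b) m)

    opaque
      -- Normality makes the elements of [id] exactly the images of the points below `κη`, and these
      -- points are fixed.
      seed≡ : elem seed ≡ elem κη
      seed≡ = ext
        (λ z mz → let c , mc , e = below-seed (memberξ seed mz) mz in
                  subst (_∈ elem κη) (trans (fixed c mc) (sym e)) mc)
        (λ z mz → let c = memberη κη mz in subst (_∈ elem seed) (sym (fixed c mz)) (below-κ c mz))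

      κη∈ : elem κη ∈ elem (j ∅ ξ p (∅⊴ p) (ι κ))
      κη∈ = subst₂ (λ a b → a ∈ elem b) seed≡ (j-∘ p (inj₁ (suc-∈ s)) (∅⊴ (inj₁ η∈α)) (ι κ)) seed∈

      -- A critical point below `κη` would be fixed. If it were above, `κη` would be fixed, although
      -- `κη`, being the seed, is an element of `J κη`.
      critical≡ : ∀ {k} → app K η k → k ≡ elem κη
      critical≡ {k} a = [ below , [ id , above ]′ ]′
          (ordinal-comparable k (elem κη) (proj₁ crit) ordinal-κη)
        where
        crit : IsCriticalPoint (π η ξ) k
        crit = proj₂ critical η ξ k s a
        below : k ∈ elem κη → k ≡ elem κη
        below m = ⊥-elim (proj₁ (proj₂ crit) (fixed-π k m))
        above : elem κη ∈ k → k ≡ elem κη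
        above m = ⊥-elim (∈-irrefl _ (subst (elem κη ∈_) (sym (j-unique p (inj₁ (suc-∈ s)) κη (proj₂ (proj₂ crit) _ m)))
          (subst (_∈ elem (J κη)) seed≡ seed∈)))

      generated : ∀ (y : Stage ξ) → Σ (Stage η) λ g → IsFunction (elem g) × app (elem (J g)) (elem κη) (elem y)
      generated y = let g , fg , a = value-at-seed y in g , fg , subst (λ k → app (elem (J g)) k (elem y)) seed≡ a

  successor-exists : ∀ {η} → η ∈ α → ∃[ ξ ] IsSuc η ξ × ξ ⊴ α
  successor-exists {η} m = ξ , s , [ inj₁ , [ inj₂ , above ]′ ]′ (ordinal-comparable ξ α ordinal-ξ ordinal-α)
    where
    ξ : V
    ξ = η ∪ sg η
    ordinal-η : IsOrdinal η
    ordinal-η = ordinal-∈ ordinal-α m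
    s : IsSuc η ξ
    s z = ∈-∪ η (sg η) z ⟨⇔⟩ mk⇔ [ inj₁ , (λ k → inj₂ (to (∈-sg η z) k)) ]′ [ inj₁ , (λ e → inj₂ (from (∈-sg η z) e)) ]′
    ordinal-ξ : IsOrdinal ξ
    ordinal-ξ = (λ y my z mz → ∪₁ ([ (λ k → proj₁ ordinal-η y k z mz) , (λ { refl → mz }) ]′ (to (s y) my)))
              , λ y my → [ (λ k → proj₂ ordinal-η y k) , (λ { refl → proj₁ ordinal-η }) ]′ (to (s y) my)
    above : α ∈ ξ → ξ ⊴ α
    above k = ⊥-elim ([ (λ h → ∈-asym _ _ h m) , (λ { refl → ∈-irrefl _ m }) ]′ (to (s α) k))

  private
    -- Concerns the points below the image of `κ` at stage `ξ₀`. At a successor such a point lies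
    -- below the image of `κ` at the preceding stage, that is, below the critical point of the next
    -- step. At a limit an inner induction on the point is needed, since the elements of its image
    -- come from arbitrary earlier stages.
    module Fixed (ξ₀ : V) (p₀ : ξ₀ ⊴ α) where

      κ₀ : Stage ξ₀
      κ₀ = j ∅ ξ₀ p₀ (∅⊴ p₀) (ι κ)

      member : ∀ {x} (y : Stage ξ₀) → x ∈ elem y → Stage ξ₀
      member {x} y m = x ∣ stage-transitive p₀ x (elem y) (holds em y) m

      FixedAt : V → Set ℓ
      FixedAt ζ = ζ ⊴ α → ξ₀ ⊴ ζ → ∀ β → β ∈ elem κ₀ → π ξ₀ ζ β β

      same-stage : ∀ β → β ∈ elem κ₀ → π ξ₀ ξ₀ β β
      same-stage β m = from (identity ξ₀ β β p₀) (holds em (member κ₀ m) , refl)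

      fixed≡ : ∀ {ζ} (p : ζ ⊴ α) (q : ξ₀ ⊴ ζ) (b : Stage ξ₀) → π ξ₀ ζ (elem b) (elem b) → elem b ≡ elem (j ξ₀ ζ p q b)
      fixed≡ p q b h = j-unique p q b h

      κ-image : ∀ {ζ} (p : ζ ⊴ α) (q : ξ₀ ⊴ ζ) → j ξ₀ ζ p q κ₀ ≡ j ∅ ζ p (∅⊴ p) (ι κ)
      κ-image p q = j-∘ p q (∅⊴ p₀) (ι κ)

      at-successor : ∀ {ζ θ} (p : ζ ⊴ α) → IsSuc θ ζ → FixedAt θ → ξ₀ ⊴ θ → ∀ β → β ∈ elem κ₀ → π ξ₀ ζ β β
      at-successor {ζ} {θ} p s ih q β m = π-∘ p (inj₁ (suc-∈ s)) q h (CriticalStage.fixed-π p s β mθ)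
        where
        pθ : θ ⊴ α
        pθ = inj₁ (∈-α (suc-∈ s) p)
        h : π ξ₀ θ β β
        h = ih pθ q β m
        b : Stage ξ₀
        b = member κ₀ m
        mθ : β ∈ elem (j ∅ θ (inj₁ (∈-α (suc-∈ s) p)) (∅⊴ (inj₁ (∈-α (suc-∈ s) p))) (ι κ))
        mθ = subst₂ (λ x y → x ∈ elem y) (sym (fixed≡ pθ q b h)) (κ-image pθ q)
          (to (embedding-∈ (stage-embedding pθ q) {b} {κ₀}) m)

      module AtLimit {ζ : V} (p : ζ ⊴ α) (l : IsLimit ζ) (ih : ∀ θ → θ ∈ ζ → FixedAt θ) (m₀ : ξ₀ ∈ ζ)
                     (ordinal-κ₀ : IsOrdinal (elem κ₀)) where

        J : Stage ξ₀ → Stage ζ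
        J = j ξ₀ ζ p (inj₁ m₀)

        ⊴α : ∀ {θ} → θ ∈ ζ → θ ⊴ α
        ⊴α m = inj₁ (∈-α m p)

        late : ∀ (y : Stage ζ) → ∃[ θ ] Σ (θ ∈ ζ) λ m → Σ (ξ₀ ⊴ θ) λ q → Σ (Stage θ) λ x →
            elem y ≡ elem (j θ ζ p (inj₁ m) x)
        late y = choose (limit-onto ζ (elem y) p l (holds em y))
          where
          choose : (∃[ θ ] ∃[ x ] θ ∈ ζ × π θ ζ x (elem y)) →
                   ∃[ θ ] Σ (θ ∈ ζ) λ m → Σ (ξ₀ ⊴ θ) λ q → Σ (Stage θ) λ x → elem y ≡ elem (j θ ζ p (inj₁ m) x)
          choose (θ , x , m , h) = [ (λ k → ok (inj₁ k)) , [ (λ e → ok (inj₂ e)) , early ]′ ]′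
              (ordinal-comparable ξ₀ θ (ordinal-⊴ p₀) (ordinal-⊴ (⊴α m)))
            where
            x̂ : Stage θ
            x̂ = x ∣ proj₁ (typed θ ζ x (elem y) p (inj₁ m) h)
            e : elem y ≡ elem (j θ ζ p (inj₁ m) x̂)
            e = j-unique p (inj₁ m) x̂ h
            ok : ξ₀ ⊴ θ → _
            ok q = θ , m , q , x̂ , e
            early : θ ∈ ξ₀ → _
            early k = ξ₀ , m₀ , inj₂ refl , j θ ξ₀ p₀ (inj₁ k) x̂
              , trans e (to (Member≡-⇔ _ _) (sym (j-∘ p (inj₁ m₀) (inj₁ k) x̂)))

        fixed-step : ∀ β → (∀ γ → γ ∈ β → γ ∈ elem κ₀ → π ξ₀ ζ γ γ) → β ∈ elem κ₀ → π ξ₀ ζ β β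
        fixed-step β ihβ m = subst (π ξ₀ ζ β) (ext ⇒ ⇐) (j-graph p (inj₁ m₀) b)
          where
          b : Stage ξ₀
          b = member κ₀ m
          κ₀∋ : ∀ {γ} → γ ∈ β → γ ∈ elem κ₀
          κ₀∋ mγ = proj₁ ordinal-κ₀ β m _ mγ
          below : ∀ (c : Stage ξ₀) → elem c ∈ β → elem c ≡ elem (J c)
          below c mc = j-unique p (inj₁ m₀) c (ihβ (elem c) mc (κ₀∋ mc))
          ⇒ : ∀ z → z ∈ elem (J b) → z ∈ β
          -- `z` is the image of some `x` from a stage `θ` below the limit. There `β` is already
          -- fixed, so `x ∈ β`; then `x` is fixed up to `θ`, and up to the limit by the induction on
          -- `β`, whence `z` equals `x`.
          ⇒ z mz = pull (late ẑ)
            where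
            ẑ : Stage ζ
            ẑ = z ∣ stage-transitive p z (elem (J b)) (holds em (J b)) mz
            pull : (∃[ θ ] Σ (θ ∈ ζ) λ m → Σ (ξ₀ ⊴ θ) λ q → Σ (Stage θ) λ x → z ≡ elem (j θ ζ p (inj₁ m) x)) → z ∈ β
            pull (θ , mθ , q , x , e) = subst (_∈ β) (trans (below c mx)
                (trans (to (Member≡-⇔ _ _) (sym (j-∘ p (inj₁ mθ) q c)))
                (trans (to (Member≡-⇔ _ _) (cong (j θ ζ p (inj₁ mθ)) c≡)) (sym e)))) mx
              where
              b-fixed : β ≡ elem (j ξ₀ θ (⊴α mθ) q b)
              b-fixed = fixed≡ (⊴α mθ) q b (ih θ mθ (⊴α mθ) q β m)
              mx : elem x ∈ β
              mx = subst (elem x ∈_) (sym b-fixed) (from (embedding-∈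
                  (stage-embedding p (inj₁ mθ)) {x} {j ξ₀ θ (⊴α mθ) q b})
                (subst₂ (λ u v → u ∈ elem v) e (sym (j-∘ p (inj₁ mθ) q b)) mz))
              c : Stage ξ₀
              c = member b mx
              c≡ : j ξ₀ θ (⊴α mθ) q c ≡ x
              c≡ = Member≡ (sym (fixed≡ (⊴α mθ) q c (ih θ mθ (⊴α mθ) q (elem x) (κ₀∋ mx))))
          ⇐ : ∀ z → z ∈ β → z ∈ elem (J b)
          ⇐ z mz = let c = member b mz in
            subst (_∈ elem (J b)) (sym (below c mz)) (to (embedding-∈ (stage-embedding p (inj₁ m₀)) {c} {b}) mz)

        at-limit : ∀ β → β ∈ elem κ₀ → π ξ₀ ζ β β
        at-limit = ∈-induction (#0 ∈ᶠ ` elem κ₀ ⇒ᶠ πᶠ (` ξ₀) (` ζ) #0 #0) fixed-step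

      ordinal-κ₀ : IsOrdinal κ → IsOrdinal (elem κ₀)
      ordinal-κ₀ o = to (Transitive.ordinal-absolute V _∈_ em (𝕄 ξ₀) (stage-transitive p₀) κ₀)
        (to (Elementary.transfer-pure _ _ em _ _ _ (embedding-∘ ι-embedding (stage-embedding p₀ (∅⊴ p₀)))
              {C = ⊥} (λ ()) (λ ()) (λ ()) (ordinalᶠ #0) (κ ∷ [])) o)

      opaque
        all-fixed : IsOrdinal κ → ∀ ζ → FixedAt ζ
        all-fixed oκ = ∈-induction (#0 ⊴ᶠ ` α ⇒ᶠ ` ξ₀ ⊴ᶠ #0 ⇒ᶠ (∀ᶠ #0 ∈ᶠ ` elem κ₀ ⇒ᶠ πᶠ (` ξ₀) #1 #0 #0)) step
          where
          step : ∀ ζ → (∀ θ → θ ∈ ζ → FixedAt θ) → FixedAt ζ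
          step ζ ih p (inj₂ refl) β m = same-stage β m
          step ζ ih p (inj₁ m₀)   = by-kind (kind p)
            where
            by-kind : Kind ζ → ∀ β → β ∈ elem κ₀ → π ξ₀ ζ β β
            by-kind (zero e)  β m = ⊥-elim (e _ m₀)
            by-kind (suc θ s) β m = at-successor p s (ih θ (suc-∈ s)) (to (s ξ₀) m₀) β m
            by-kind (lim l)   β m = AtLimit.at-limit p l ih m₀ (ordinal-κ₀ oκ) β m

  module _ (ordinal-κ : IsOrdinal κ) where

    fixed-below-κ : ∀ {ξ ζ} (p : ζ ⊴ α) (q : ξ ⊴ ζ) (b : Stage ξ) →
      elem b ∈ elem (j ∅ ξ (⊴-below p q) (∅⊴ (⊴-below p q)) (ι κ)) → elem (j ξ ζ p q b) ≡ elem b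
    fixed-below-κ {ξ} {ζ} p q b m =
      sym (j-unique p q b (Fixed.all-fixed ξ (⊴-below p q) ordinal-κ ζ p q (elem b) m))

    -- The critical point of the step from `η` lies below the image of `κ` at the next stage. The
    -- remaining maps therefore fix it, and as a value of such a map it belongs to the last model.
    critical-∈𝕄 : ∀ {η k} → app K η k → 𝕄 α k
    critical-∈𝕄 {η} {k} a = conclude (successor-exists (from (proj₂ (proj₁ critical) η) (k , a)))
      where
      conclude : (∃[ ξ ] IsSuc η ξ × ξ ⊴ α) → 𝕄 α k
      conclude (ξ , s , p) = subst (𝕄 α) (trans (fixed-below-κ (inj₂ refl) p κ̂ κη∈)
          (sym (CriticalStage.critical≡ p s a)))
          (holds em (j ξ α (inj₂ refl) p κ̂))
        where
        κη∈ = CriticalStage.κη∈ p s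
        κ̂ : Stage ξ
        κ̂ = elem (CriticalStage.κη p s) ∣ stage-transitive p _ _ (holds em (j ∅ ξ p (∅⊴ p) (ι κ))) κη∈

    -- `H` is a class so that `Generated ξ` is a formula with `H` as an atom; only then does
    -- induction on the stage apply to it.
    module Generation (H : Class 1)
      (range : ∀ x → H [ elem (j ∅ α (inj₂ refl) (∅⊴ (inj₂ refl)) (ι x)) ∷ [] ])
      (points : ∀ η k → app K η k → H [ k ∷ [] ])
      (closed : ∀ f x y → H [ f ∷ [] ] → H [ x ∷ [] ] → IsFunction f → app f x y → H [ y ∷ [] ])
      where

      private
        jα : ∀ {ξ} → ξ ⊴ α → Stage ξ → Stage α
        jα {ξ} p = j ξ α (inj₂ refl) p

        Generated : V → Set ℓ
        Generated ξ = ξ ⊴ α → ∀ x y → π ξ α x y → H [ y ∷ [] ]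

        π-image : ∀ {ξ} (p : ξ ⊴ α) {x y} → π ξ α x y → Σ (Stage ξ) λ x′ → y ≡ elem (jα p x′)
        π-image {ξ} p {x} {y} h = let x′ = x ∣ proj₁ (typed ξ α x y (inj₂ refl) p h) in
          x′ , j-unique (inj₂ refl) p x′ h

        at-zero : ∀ (x : Stage ∅) → H [ elem (jα (∅⊴ (inj₂ refl)) x) ∷ [] ]
        at-zero x = range (elem x)

        -- At stage `ξ` the element `x` is the value of the image of some `g` at `κη`. The map to
        -- the last model fixes `κη`, so it sends `x` to the value at `κη` of the image of `g`
        -- there; the induction hypothesis covers this image.
        at-successor : ∀ {ξ η} (p : ξ ⊴ α) → IsSuc η ξ → Generated η → ∀ x → H [ elem (jα p x) ∷ [] ]
        at-successor {ξ} {η} p s ih x = conclude (CriticalStage.generated p s x)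
          where
          pη : η ⊴ α
          pη = inj₁ (∈-α (suc-∈ s) p)
          κη : Stage η
          κη = CriticalStage.κη p s
          q : η ⊴ ξ
          q = inj₁ (suc-∈ s)
          κη∈ : elem κη ∈ elem (j ∅ ξ p (∅⊴ p) (ι κ))
          κη∈ = CriticalStage.κη∈ p s
          κ̂ : Stage ξ
          κ̂ = elem κη ∣ stage-transitive p _ _ (holds em (j ∅ ξ p (∅⊴ p) (ι κ))) κη∈
          κ̂-fixed : elem (jα p κ̂) ≡ elem κη
          κ̂-fixed = fixed-below-κ (inj₂ refl) p κ̂ κη∈
          K-η : ∃[ k ] app K η k
          K-η = to (proj₂ (proj₁ critical) η) (∈-α (suc-∈ s) p)
          H-κη : H [ elem κη ∷ [] ]
          H-κη = subst (λ k → H [ k ∷ [] ]) (CriticalStage.critical≡ p s (proj₂ K-η)) (points η _ (proj₂ K-η))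
          conclude : (Σ (Stage η) λ g → IsFunction (elem g) × app (elem (j η ξ p q g)) (elem κη) (elem x)) →
                     H [ elem (jα p x) ∷ [] ]
          conclude (g , fg , a) = closed (elem (jα pη g)) (elem κη) _ (ih pη (elem g) _ (j-graph (inj₂ refl) pη g)) H-κη
            (to (Transitive.function-absolute V _∈_ em (𝕄 α) (stage-transitive (inj₂ refl)) (jα pη g))
              (to (Elementary.transfer-pure _ _ em _ _ _ (stage-embedding (inj₂ refl) pη) {C = ⊥} (λ ()) (λ ()) (λ ())
                    (functionᶠ #0) (g ∷ []))
                (from (Transitive.function-absolute V _∈_ em (𝕄 η) (stage-transitive pη) g) fg)))
            (subst₂ (λ f k → app f k (elem (jα p x))) (to (Member≡-⇔ _ _) (j-∘ (inj₂ refl) p q g)) κ̂-fixed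
              (to (Transitive.app-absolute V _∈_ em (𝕄 α) (stage-transitive (inj₂ refl))
                    (jα p (j η ξ p q g)) (jα p κ̂) (jα p x))
                (to (Elementary.transfer-pure _ _ em _ _ _ (stage-embedding (inj₂ refl) p) {C = ⊥} (λ ()) (λ ()) (λ ())
                      (appᶠ #0 #1 #2) (j η ξ p q g ∷ κ̂ ∷ x ∷ []))
                  (from (Transitive.app-absolute V _∈_ em (𝕄 ξ) (stage-transitive p) (j η ξ p q g) κ̂ x) a))))

        at-limit : ∀ {ξ} (p : ξ ⊴ α) → IsLimit ξ → (∀ η → η ∈ ξ → Generated η) → ∀ x → H [ elem (jα p x) ∷ [] ]
        at-limit {ξ} p l ih x = conclude (limit-onto ξ (elem x) p l (holds em x))
          where
          conclude : (∃[ ζ ] ∃[ x₀ ] ζ ∈ ξ × π ζ ξ x₀ (elem x)) → H [ elem (jα p x) ∷ [] ]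
          conclude (ζ , x₀ , m , h) = ih ζ m (inj₁ (∈-α m p)) x₀ _
            (π-∘ (inj₂ refl) p (inj₁ m) h (j-graph (inj₂ refl) p x))

        by-kind : ∀ {ξ} (p : ξ ⊴ α) → Kind ξ → (∀ η → η ∈ ξ → Generated η) → ∀ x → H [ elem (jα p x) ∷ [] ]
        by-kind p (zero e)  ih x = zero-case (empty-unique e) p x
          where
          zero-case : ∀ {ξ} → ξ ≡ ∅ → (p : ξ ⊴ α) → ∀ (x : Stage ξ) → H [ elem (jα p x) ∷ [] ]
          zero-case refl p x = at-zero x
        by-kind p (suc η s) ih x = at-successor p s (ih η (suc-∈ s)) x
        by-kind p (lim l)   ih x = at-limit p l ih x

        opaque
          all-generated : ∀ ξ → Generated ξ
          all-generated = ∈-induction (#0 ⊴ᶠ ` α ⇒ᶠ (∀ᶠ ∀ᶠ πᶠ #2 (` α) #1 #0 ⇒ᶠ atom H (#0 ∷ []))) λ ξ ih p x y h →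
            let x′ , e = π-image p h in subst (λ y → H [ y ∷ [] ]) (sym e) (by-kind p (kind p) ih x′)

      generation : ∀ y → 𝕄 α y → H [ y ∷ [] ]
      generation y my = all-generated α (inj₂ refl) y y (from (identity α y y (inj₂ refl)) (my , refl))

-- Boolean-valued names

record BooleanAlgebra {ℓ : Level} (V : Set ℓ) (_∈_ : V → V → Set ℓ) : Set ℓ where
  field
    B ≤B    : V
    algebra : SetTheory.IsCompleteBooleanAlgebra V _∈_ B ≤B

module BooleanValuedModel {ℓ : Level} (𝒱 : ZFCModel ℓ) (𝔹 : BooleanAlgebra (ZFCModel.V 𝒱) (ZFCModel._∈_ 𝒱)) where

  open ZFCModel 𝒱
  open SetTheory V _∈_
  open Codes
  open ZF 𝒱
  open Recursion 𝒱
  open BooleanAlgebra 𝔹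
  open Order B ≤B
  open BooleanValued B ≤B
  open IsCompleteBooleanAlgebra algebra public

  ≤-∈ : ∀ {x y} → x ≤ y → x ∈ B × y ∈ B
  ≤-∈ (p , h , m) with order-on p m
  ... | x , y , h′ , mx , my with refl , refl ← pair-inj h h′ = mx , my

  ≤-trans : ∀ {x y z} → x ≤ y → y ≤ z → x ≤ z
  ≤-trans = transitive _ _ _

  ≤-refl : ∀ {x} → x ∈ B → x ≤ x
  ≤-refl = reflexive _

  Nonzero : V → Set ℓ
  Nonzero x = x ∈ B × ¬ IsBottom x

  top-exists : ∃[ t ] IsTop t
  top-exists = case sups B (λ _ m → m) of λ (t , m , ub , _) →
    t , m , ub

  private
    pr⊆B : ∀ {x y} → x ∈ B → y ∈ B → pr x y ⊆ B
    pr⊆B mx my z m = [ (λ { refl → mx }) , (λ { refl → my }) ]′ (to (∈-pr _ _ z) m)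

  meet-exists : ∀ {x y} → x ∈ B → y ∈ B → ∃[ z ] IsMeet x y z
  meet-exists {x} {y} mx my =
    case infs (pr x y) (pr⊆B mx my) of λ (z , m , lb , gl) →
      z , m , (λ w h → lb w (from (∈-pr x y w) h)) , λ c mc h → gl c mc λ w k → h w (to (∈-pr x y w) k)

  join-exists : ∀ {x y} → x ∈ B → y ∈ B → ∃[ z ] IsJoin x y z
  join-exists {x} {y} mx my =
    case sups (pr x y) (pr⊆B mx my) of λ (z , m , ub , lu) →
      z , m , (λ w h → ub w (from (∈-pr x y w) h)) , λ c mc h → lu c mc λ w k → h w (to (∈-pr x y w) k)

  ≤-meet : ∀ {x y z r} → IsMeet x y z → r ≤ z ⇔ (r ≤ x × r ≤ y)
  ≤-meet (m , lb , gl) = mk⇔ (λ h → ≤-trans h (lb _ (inj₁ refl)) , ≤-trans h (lb _ (inj₂ refl)))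
    (λ (h , h′) → gl _ (proj₁ (≤-∈ h)) λ w → [ (λ { refl → h }) , (λ { refl → h′ }) ]′)

  sup-unique : ∀ {X b b′} → IsSup X b → IsSup X b′ → b ≡ b′
  sup-unique (m , ub , lu) (m′ , ub′ , lu′) = antisymmetric _ _ (lu _ m′ ub′) (lu′ _ m ub)

  inf-unique : ∀ {X b b′} → IsInf X b → IsInf X b′ → b ≡ b′
  inf-unique (m , lb , gl) (m′ , lb′ , gl′) = antisymmetric _ _ (gl′ _ m lb) (gl _ m′ lb′)

  sup-cong : ∀ {X Y b} → (∀ x → X x ⇔ Y x) → IsSup X b → IsSup Y b
  sup-cong e (m , ub , lu) = m , (λ x y → ub x (from (e x) y)) , λ c mc h → lu c mc λ x y → h x (to (e x) y)

  inf-cong : ∀ {X Y b} → (∀ x → X x ⇔ Y x) → IsInf X b → IsInf Y b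
  inf-cong e (m , lb , gl) = m , (λ x y → lb x (from (e x) y)) , λ c mc h → gl c mc λ x y → h x (to (e x) y)

  sup-exists : (φ : Fm₀ 1) → ∃[ b ] IsSup (λ x → x ∈ B × ⟦ φ ⟧ (x ∷ [])) b
  sup-exists φ = case sups (comp φ B) (λ z m → proj₁ (to (∈-comp φ B z) m)) of λ (b , h) →
    b , sup-cong (∈-comp φ B) h

  inf-exists : (φ : Fm₀ 1) → ∃[ b ] IsInf (λ x → x ∈ B × ⟦ φ ⟧ (x ∷ [])) b
  inf-exists φ = case infs (comp φ B) (λ z m → proj₁ (to (∈-comp φ B z) m)) of λ (b , h) →
    b , inf-cong (∈-comp φ B) h

  Compatible : V → V → Set ℓ
  Compatible x y = ∃[ s ] Nonzero s × s ≤ x × s ≤ y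

  complement-disjoint : ∀ {x y} → IsComplement x y → ¬ Compatible x y
  complement-disjoint (_ , _ , (o , (mo , bo) , _ , _ , gl) , _) (s , (ms , ns) , h , h′) =
    ns (ms , λ z mz → ≤-trans (gl s ms λ w → [ (λ { refl → h }) , (λ { refl → h′ }) ]′) (bo z mz))

  -- `x = x ∧ (y ∨ c) = (x ∧ y) ∨ (x ∧ c)`, and incompatibility makes `x ∧ y` zero.
  ≤-complement : ∀ {x y c} → x ∈ B → IsComplement y c → ¬ Compatible x y → x ≤ c
  ≤-complement {x} {y} {c} mx (my , mc , _ , (t , (mt , ut) , jt)) n =
    let n₁ , h₁ = meet-exists mx my
        n₂ , h₂ = meet-exists mx mc
        k , hk  = join-exists (proj₁ h₁) (proj₁ h₂)
        x-meet : IsMeet x t x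
        x-meet = mx , (λ w → [ (λ { refl → ≤-refl mx }) , (λ { refl → ut x mx }) ]′) , λ d _ h → h x (inj₁ refl)
        e = distributive x y c t x n₁ n₂ k jt x-meet h₁ h₂ hk
        l₁ , _ = to (≤-meet h₁) (≤-refl (proj₁ h₁))
        _ , l₁′ = to (≤-meet h₁) (≤-refl (proj₁ h₁))
        bottom : IsBottom n₁
        bottom = stable λ nb → n (n₁ , (proj₁ h₁ , nb) , l₁ , l₁′)
        _ , l₂ = to (≤-meet h₂) (≤-refl (proj₁ h₂))
    in subst (_≤ c) (sym e) (proj₂ (proj₂ hk) c mc λ w → [ (λ { refl → proj₂ bottom c mc }) , (λ { refl → l₂ }) ]′)

  complement-sym : ∀ {x y} → IsComplement x y → IsComplement y x
  complement-sym (mx , my , (o , bo , meet) , (t , tt′ , join)) =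
    my , mx , (o , bo , inf-cong (λ _ → swap) meet) , (t , tt′ , sup-cong (λ _ → swap) join)
    where
    swap : ∀ {A B : Set ℓ} → (A ⊎ B) ⇔ (B ⊎ A)
    swap = mk⇔ [ inj₂ , inj₁ ]′ [ inj₂ , inj₁ ]′

  -- Otherwise some nonzero `s ≤ r` would lie below the complement of `b`, while by hypothesis a
  -- nonzero part of `s` lies below `b`.
  ≤-dense : ∀ {r b} → r ∈ B → b ∈ B → (∀ q → q ≤ r → Nonzero q → ∃[ s ] Nonzero s × s ≤ q × s ≤ b) → r ≤ b
  ≤-dense mr mb h = case complements _ mb of λ (c , hc) →
    ≤-complement mr (complement-sym hc) λ (s , ns , l , l′) →
      case h s l ns of λ (s′ , ns′ , k , k′) →
        complement-disjoint hc (s′ , ns′ , k′ , ≤-trans k l′)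

  -- If `q` were incompatible with every member of `X`, its complement would bound `X`, hence lie
  -- above `b` and above `q` itself.
  below-sup : ∀ {X b q} → (∀ x → X x → x ∈ B) → IsSup X b → Nonzero q → q ≤ b → ∃[ x ] X x × Compatible q x
  below-sup {X} {b} {q} hX (_ , ub , lu) nq l = stable λ n →
    case complements q (proj₁ nq) of λ (c , hc) →
      complement-disjoint hc (q , nq , ≤-refl (proj₁ nq) , ≤-trans l (lu c (proj₁ (proj₂ hc)) λ x Xx →
      ≤-complement (hX x Xx) hc λ (s , ns , h , h′) → n (x , Xx , s , ns , h′ , h)))

  -- Together with `≤-inf` and `≤-implication` this replaces the Boolean operations by statements
  -- about the elements below `r`, that is, by clauses of a forcing relation on the nonzero elements
  -- of `B`.
  ≤-sup : ∀ {X b r} → (∀ x → X x → x ∈ B) → IsSup X b →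
          r ≤ b ⇔ (r ∈ B × (∀ q → q ≤ r → Nonzero q → ∃[ x ] X x × Compatible q x))
  ≤-sup {X} {b} {r} hX hs = mk⇔ (λ h → proj₁ (≤-∈ h) , λ q l nq → below-sup hX hs nq (≤-trans l h)) ⇐
    where
    ⇐ : r ∈ B × (∀ q → q ≤ r → Nonzero q → ∃[ x ] X x × Compatible q x) → r ≤ b
    ⇐ (mr , h) = ≤-dense mr (proj₁ hs) λ q l nq → case h q l nq of λ (x , Xx , s , ns , k , k′) →
      s , ns , k , ≤-trans k′ (proj₁ (proj₂ hs) x Xx)

  ≤-inf : ∀ {X b r} → IsInf X b → r ≤ b ⇔ (r ∈ B × (∀ x → X x → r ≤ x))
  ≤-inf (_ , lb , gl) = mk⇔ (λ h → proj₁ (≤-∈ h) , λ x Xx → ≤-trans h (lb x Xx)) (λ (mr , h) → gl _ mr h)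

  implication-exists : ∀ {c d} → c ∈ B → d ∈ B → ∃[ x ] IsImplication c d x
  implication-exists mc md = case complements _ mc of λ (w , hw) →
    case join-exists (proj₁ (proj₂ hw)) md of λ (x , hx) →
    x , w , hw , hx

  ≤-implication : ∀ {c d x r} → IsImplication c d x →
                  r ≤ x ⇔ (r ∈ B × (∀ q → q ≤ r → q ≤ c → q ≤ d))
  ≤-implication {c} {d} {x} {r} (w , hw , hj) = mk⇔
    (λ h → proj₁ (≤-∈ h) , λ q l k → ≤-dense (proj₁ (≤-∈ l)) d∈B λ q′ l′ nq →
      from-join q′ nq (≤-trans l′ k) (below-sup join⊆B hj nq (≤-trans l′ (≤-trans l h))))
    (λ (mr , h) → ≤-dense mr (proj₁ hj) λ q l nq → [ (λ (s , ns , k , k′) →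
        s , ns , k , ≤-trans (h s (≤-trans k l) k′) (ub d (inj₂ refl)))
      , (λ n → q , nq , ≤-refl (proj₁ nq) , ≤-trans (≤-complement (proj₁ nq) hw n) (ub w (inj₁ refl))) ]′
      (dec (Compatible q c)))
    where
    ub = proj₁ (proj₂ hj)
    d∈B : d ∈ B
    d∈B = proj₁ (≤-∈ (ub d (inj₂ refl)))
    join⊆B : ∀ z → z ≡ w ⊎ z ≡ d → z ∈ B
    join⊆B z = [ (λ { refl → proj₁ (proj₂ hw) }) , (λ { refl → d∈B }) ]′
    from-join : ∀ q′ → Nonzero q′ → q′ ≤ c → (∃[ z ] (z ≡ w ⊎ z ≡ d) × Compatible q′ z) →
                ∃[ s ] Nonzero s × s ≤ q′ × s ≤ d
    from-join q′ nq k (z , inj₁ refl , s , ns , a , b) = ⊥-elim (complement-disjoint hw (s , ns , ≤-trans a k , b))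
    from-join q′ nq k (z , inj₂ refl , s , ns , a , b) = s , ns , a , b

  implication-∈ : ∀ {c d x} → IsImplication c d x → x ∈ B
  implication-∈ (_ , _ , hj) = proj₁ hj

  infix 8 _≤ᶠ_
  _≤ᶠ_ : ∀ {n} → Tm V n → Tm V n → Fm₀ n
  x ≤ᶠ y = appᶠ (` ≤B) x y

  -- A family of formulas X ρ x, where ρ weakens the terms occurring in X.
  Predᶠ : ℕ → Set ℓ
  Predᶠ n = ∀ {k} → (Tm V n → Tm V k) → Tm V k → Fm₀ k

  supᶠ infᶠ : ∀ {n} → Predᶠ n → Tm V n → Fm₀ n
  supᶠ X b = b ∈ᶠ ` B ∧ᶠ (∀ᶠ X wk #0 ⇒ᶠ #0 ≤ᶠ wk b)
          ∧ᶠ (∀ᶠ #0 ∈ᶠ ` B ⇒ᶠ (∀ᶠ X (λ t → wk (wk t)) #0 ⇒ᶠ #0 ≤ᶠ #1) ⇒ᶠ wk b ≤ᶠ #0)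
  infᶠ X b = b ∈ᶠ ` B ∧ᶠ (∀ᶠ X wk #0 ⇒ᶠ wk b ≤ᶠ #0)
          ∧ᶠ (∀ᶠ #0 ∈ᶠ ` B ⇒ᶠ (∀ᶠ X (λ t → wk (wk t)) #0 ⇒ᶠ #1 ≤ᶠ #0) ⇒ᶠ #0 ≤ᶠ wk b)

  bottomᶠ topᶠ : ∀ {n} → Tm V n → Fm₀ n
  bottomᶠ b = b ∈ᶠ ` B ∧ᶠ (∀ᶠ #0 ∈ᶠ ` B ⇒ᶠ wk b ≤ᶠ #0)
  topᶠ    b = b ∈ᶠ ` B ∧ᶠ (∀ᶠ #0 ∈ᶠ ` B ⇒ᶠ #0 ≤ᶠ wk b)

  meetᶠ joinᶠ : ∀ {n} → Tm V n → Tm V n → Tm V n → Fm₀ n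
  meetᶠ x y = infᶠ λ ρ w → w ≡ᶠ ρ x ∨ᶠ w ≡ᶠ ρ y
  joinᶠ x y = supᶠ λ ρ w → w ≡ᶠ ρ x ∨ᶠ w ≡ᶠ ρ y

  complementᶠ : ∀ {n} → Tm V n → Tm V n → Fm₀ n
  complementᶠ x y = x ∈ᶠ ` B ∧ᶠ y ∈ᶠ ` B ∧ᶠ (∃ᶠ bottomᶠ #0 ∧ᶠ meetᶠ (wk x) (wk y) #0)
                                         ∧ᶠ (∃ᶠ topᶠ #0 ∧ᶠ joinᶠ (wk x) (wk y) #0)

  opaque
    implicationClass : Class 3
    implicationClass = toClass (∃ᶠ complementᶠ #1 #0 ∧ᶠ joinᶠ #0 #2 #3)

    implication-correct : ∀ c d x → implicationClass [ c ∷ d ∷ x ∷ [] ] ⇔ IsImplication c d x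
    implication-correct c d x = toClass-correct (∃ᶠ complementᶠ #1 #0 ∧ᶠ joinᶠ #0 #2 #3) (c ∷ d ∷ x ∷ [])

  implicationᶠ : ∀ {n} → Tm V n → Tm V n → Tm V n → Fm₀ n
  implicationᶠ x y z = atom implicationClass (x ∷ y ∷ z ∷ [])

  clause⇔ : ∀ {A C : V → V → V → Set ℓ} {x} →
            (∃[ ρ ] ∃[ c ] ∃[ d ] A ρ c d × C ρ c d × implicationClass [ c ∷ d ∷ x ∷ [] ]) ⇔
            (∃[ ρ ] ∃[ c ] ∃[ d ] A ρ c d × C ρ c d × IsImplication c d x)
  clause⇔ {x = x} = ∃-⇔ λ ρ → ∃-⇔ λ c → ∃-⇔ λ d → ⇔-refl ×-⇔ (⇔-refl ×-⇔ implication-correct c d x)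

  _⊎-⇔_ : ∀ {A A′ C C′ : Set ℓ} → A ⇔ A′ → C ⇔ C′ → (A ⊎ C) ⇔ (A′ ⊎ C′)
  f ⊎-⇔ g = mk⇔ [ inj₁ ∘ to f , inj₂ ∘ to g ]′ [ inj₁ ∘ from f , inj₂ ∘ from g ]′

  app-∈⁺ : ∀ {σ ρ c} → app σ ρ c → ρ ∈⁺ σ
  app-∈⁺ (p , (a , b , ha , hb , h) , m) =
    ∈⁺-step (from (hb _) (inj₁ refl)) (∈⁺-step (from (h b) (inj₂ refl)) (∈⇒∈⁺ m))

  name-elements : ∀ {D σ ρ c} → NameClosed D → σ ∈ D → app σ ρ c → ρ ∈ D × c ∈ B
  name-elements nc m (p , h , mp) with nc _ p m mp
  ... | ρ′ , c′ , h′ , mρ , mc with refl , refl ← pair-inj h h′ = mρ , mc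

  -- The terms of the infimum ⟦σ=τ⟧, with ⟦∈⟧ given by m.
  Clauses : V → V → V → V → Set ℓ
  Clauses m σ τ x = (∃[ ρ ] ∃[ c ] ∃[ d ] app σ ρ c × app₂ m ρ τ d × IsImplication c d x)
                  ⊎ (∃[ ρ ] ∃[ c ] ∃[ d ] app τ ρ c × app₂ m ρ σ d × IsImplication c d x)

  private
    CodedClauses : V → V → V → V → Set ℓ
    CodedClauses m σ τ x = (∃[ ρ ] ∃[ c ] ∃[ d ] app σ ρ c × app₂ m ρ τ d × implicationClass [ c ∷ d ∷ x ∷ [] ])
                         ⊎ (∃[ ρ ] ∃[ c ] ∃[ d ] app τ ρ c × app₂ m ρ σ d × implicationClass [ c ∷ d ∷ x ∷ [] ])

    clauses⇔ : ∀ m σ τ x → CodedClauses m σ τ x ⇔ Clauses m σ τ x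
    clauses⇔ m σ τ x = clause⇔ {λ ρ c d → app σ ρ c} {λ ρ c d → app₂ m ρ τ d} {x}
                    ⊎-⇔ clause⇔ {λ ρ c d → app τ ρ c} {λ ρ c d → app₂ m ρ σ d} {x}

  private
    Elements : V → V → V → V → Set ℓ
    Elements e σ τ x = ∃[ ρ ] ∃[ c ] ∃[ d ] app τ ρ c × app₂ e σ ρ d × IsMeet c d x

    elementsᶠ clausesᶠ : Fm₀ 4
    elementsᶠ = ∃ᶠ ∃ᶠ ∃ᶠ appᶠ #5 #2 #1 ∧ᶠ app₂ᶠ #3 #4 #2 #0 ∧ᶠ meetᶠ #1 #0 #6
    clausesᶠ = (∃ᶠ ∃ᶠ ∃ᶠ appᶠ #4 #2 #1 ∧ᶠ app₂ᶠ #3 #2 #5 #0 ∧ᶠ implicationᶠ #1 #0 #6)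
            ∨ᶠ (∃ᶠ ∃ᶠ ∃ᶠ appᶠ #5 #2 #1 ∧ᶠ app₂ᶠ #3 #2 #4 #0 ∧ᶠ implicationᶠ #1 #0 #6)

    opaque
      elementsClass clausesClass : Class 4
      elementsClass = toClass elementsᶠ
      clausesClass = toClass clausesᶠ

      elements-correct : ∀ e σ τ x → elementsClass [ e ∷ σ ∷ τ ∷ x ∷ [] ] ⇔ Elements e σ τ x
      elements-correct e σ τ x = toClass-correct elementsᶠ (e ∷ σ ∷ τ ∷ x ∷ [])

      clauses-correct : ∀ m σ τ x → clausesClass [ m ∷ σ ∷ τ ∷ x ∷ [] ] ⇔ Clauses m σ τ x
      clauses-correct m σ τ x = decoded (toClass-correct clausesᶠ (m ∷ σ ∷ τ ∷ x ∷ []))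
        where
        decoded : clausesClass [ m ∷ σ ∷ τ ∷ x ∷ [] ] ⇔ CodedClauses m σ τ x →
                  clausesClass [ m ∷ σ ∷ τ ∷ x ∷ [] ] ⇔ Clauses m σ τ x
        decoded h = h ⟨⇔⟩ clauses⇔ m σ τ x

  module Forcing {D e m : V} (valuation : IsValuation D e m) where

    open IsValuation valuation

    -- r ≤ ⟦σ=τ⟧ and r ≤ ⟦σ∈τ⟧
    Eq Mem : V → V → V → Set ℓ
    Eq  r σ τ = ∃[ b ] app₂ e σ τ b × r ≤ b
    Mem r σ τ = ∃[ b ] app₂ m σ τ b × r ≤ b

    eqᶠ : ∀ {n} → Tm V n → Tm V n → Tm V n → Fm₀ n
    eqᶠ r σ τ = ∃ᶠ app₂ᶠ (` e) (wk σ) (wk τ) #0 ∧ᶠ wk r ≤ᶠ #0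

    private
      ElementsOf : V → V → V → Set ℓ
      ElementsOf = Elements e

      elements⊆B : ∀ {σ τ} x → ElementsOf σ τ x → x ∈ B
      elements⊆B x (_ , _ , _ , _ , _ , h) = proj₁ h

      clauses⊆B : ∀ {σ τ} x → Clauses m σ τ x → x ∈ B
      clauses⊆B x (inj₁ (_ , _ , _ , _ , _ , h)) = implication-∈ h
      clauses⊆B x (inj₂ (_ , _ , _ , _ , _ , h)) = implication-∈ h

    mem-value : ∀ {σ τ} → σ ∈ D → τ ∈ D → ∃[ b ] app₂ m σ τ b
    mem-value {σ} {τ} mσ mτ = case sup-exists (atom elementsClass (` e ∷ ` σ ∷ ` τ ∷ #0 ∷ [])) of λ (b , h) →
      b , from (elements σ τ b mσ mτ) (sup-cong (λ x → mk⇔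
        (λ (_ , k) → to (elements-correct e σ τ x) k)
        (λ k → elements⊆B x k , from (elements-correct e σ τ x) k)) h)

    eq-value : ∀ {σ τ} → σ ∈ D → τ ∈ D → ∃[ b ] app₂ e σ τ b
    eq-value {σ} {τ} mσ mτ = case inf-exists (atom clausesClass (` m ∷ ` σ ∷ ` τ ∷ #0 ∷ [])) of λ (b , h) →
      b , from (equality σ τ b mσ mτ) (inf-cong (λ x → mk⇔
        (λ (_ , k) → to (clauses-correct m σ τ x) k)
        (λ k → clauses⊆B x k , from (clauses-correct m σ τ x) k)) h)

    mem-unique : ∀ {σ τ b b′} → σ ∈ D → τ ∈ D → app₂ m σ τ b → app₂ m σ τ b′ → b ≡ b′
    mem-unique mσ mτ h h′ = sup-unique (to (elements _ _ _ mσ mτ) h) (to (elements _ _ _ mσ mτ) h′)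

    eq-unique : ∀ {σ τ b b′} → σ ∈ D → τ ∈ D → app₂ e σ τ b → app₂ e σ τ b′ → b ≡ b′
    eq-unique mσ mτ h h′ = inf-unique (to (equality _ _ _ mσ mτ) h) (to (equality _ _ _ mσ mτ) h′)

    -- The recursive clauses of the forcing relation for names, with suprema, infima and
    -- implications eliminated.
    MemClause : V → V → V → Set ℓ
    MemClause r σ τ = r ∈ B × (∀ q → q ≤ r → Nonzero q →
      ∃[ ρ ] ∃[ c ] ∃[ s ] app τ ρ c × Nonzero s × s ≤ q × s ≤ c × Eq s σ ρ)

    EqClause : V → V → V → Set ℓ
    EqClause r σ τ = r ∈ B × (∀ ρ c → app σ ρ c → ∀ q → q ≤ r → q ≤ c → Mem q ρ τ)
                           × (∀ ρ c → app τ ρ c → ∀ q → q ≤ r → q ≤ c → Mem q ρ σ)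

    opaque
      mem⇒ : ∀ {r σ τ} → σ ∈ D → τ ∈ D → Mem r σ τ → MemClause r σ τ
      mem⇒ {r} {σ} {τ} mσ mτ (b , h , l) =
        proj₁ (≤-∈ l) , λ q k nq → clause (below-sup elements⊆B (to (elements σ τ b mσ mτ) h) nq (≤-trans k l))
        where
        clause : ∀ {q} → (∃[ x ] ElementsOf σ τ x × Compatible q x) →
                 ∃[ ρ ] ∃[ c ] ∃[ s ] app τ ρ c × Nonzero s × s ≤ q × s ≤ c × Eq s σ ρ
        clause (x , (ρ , c , d , a , a′ , hx) , s , ns , k , k′) =
          case to (≤-meet hx) k′ of λ (l₁ , l₂) →
            ρ , c , s , a , ns , k , l₁ , d , a′ , l₂

      mem⇐ : ∀ {r σ τ} → σ ∈ D → τ ∈ D → MemClause r σ τ → Mem r σ τ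
      mem⇐ {r} {σ} {τ} mσ mτ (mr , f) =
        case mem-value mσ mτ of λ (b , h) →
          b , h , from (≤-sup elements⊆B (to (elements σ τ b mσ mτ) h)) (mr , λ q k nq → clause (f q k nq))
        where
        clause : ∀ {q} → (∃[ ρ ] ∃[ c ] ∃[ s ] app τ ρ c × Nonzero s × s ≤ q × s ≤ c × Eq s σ ρ) →
                 ∃[ x ] ElementsOf σ τ x × Compatible q x
        clause (ρ , c , s , a , ns , k , l₁ , d , a′ , l₂) =
          case meet-exists (proj₂ (≤-∈ l₁)) (proj₂ (≤-∈ l₂)) of λ (x , hx) →
            x , (ρ , c , d , a , a′ , hx) , s , ns , k , from (≤-meet hx) (l₁ , l₂)

      eq⇒ : ∀ {r σ τ} → σ ∈ D → τ ∈ D → Eq r σ τ → EqClause r σ τ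
      eq⇒ {r} {σ} {τ} mσ mτ (b , h , l) = proj₁ (≤-∈ l)
        , (λ ρ c a q k k′ → case name-elements names mσ a of λ (mρ , mc) →
          case mem-value mρ mτ of λ (d , hd) →
          case implication-exists mc (value-∈B mρ mτ hd) of λ (x , hx) →
          d , hd , proj₂ (to (≤-implication hx) (≤-trans l (lb x (inj₁ (ρ , c , d , a , hd , hx))))) q k k′)
        , (λ ρ c a q k k′ → case name-elements names mτ a of λ (mρ , mc) →
          case mem-value mρ mσ of λ (d , hd) →
          case implication-exists mc (value-∈B mρ mσ hd) of λ (x , hx) →
          d , hd , proj₂ (to (≤-implication hx) (≤-trans l (lb x (inj₂ (ρ , c , d , a , hd , hx))))) q k k′)
        where
        lb : ∀ x → Clauses m σ τ x → b ≤ x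
        lb = proj₁ (proj₂ (to (equality σ τ b mσ mτ) h))
        value-∈B : ∀ {ρ τ d} → ρ ∈ D → τ ∈ D → app₂ m ρ τ d → d ∈ B
        value-∈B mρ mτ hd = proj₁ (to (elements _ _ _ mρ mτ) hd)

      eq⇐ : ∀ {r σ τ} → σ ∈ D → τ ∈ D → EqClause r σ τ → Eq r σ τ
      eq⇐ {r} {σ} {τ} mσ mτ (mr , f , g) =
        case eq-value mσ mτ of λ (b , h) →
          b , h , from (≤-inf (to (equality σ τ b mσ mτ) h)) (mr , clause)
        where
        apply : ∀ {ρ τ q d} → ρ ∈ D → τ ∈ D → app₂ m ρ τ d → Mem q ρ τ → q ≤ d
        apply mρ mτ hd (d′ , hd′ , l) = subst (_ ≤_) (mem-unique mρ mτ hd′ hd) l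
        clause : ∀ x → Clauses m σ τ x → r ≤ x
        clause x (inj₁ (ρ , c , d , a , hd , hx)) = from (≤-implication hx) (mr , λ q k k′ →
          apply (proj₁ (name-elements names mσ a)) mτ hd (f ρ c a q k k′))
        clause x (inj₂ (ρ , c , d , a , hd , hx)) = from (≤-implication hx) (mr , λ q k k′ →
          apply (proj₁ (name-elements names mτ a)) mσ hd (g ρ c a q k k′))

    eq-mono : ∀ {r s σ τ} → s ≤ r → Eq r σ τ → Eq s σ τ
    eq-mono l (b , h , k) = b , h , ≤-trans l k

    eq-sym : ∀ {r σ τ} → σ ∈ D → τ ∈ D → Eq r σ τ → Eq r τ σ
    eq-sym mσ mτ h = case eq⇒ mσ mτ h of λ (mr , f , g) →
      eq⇐ mτ mσ (mr , g , f)

    opaque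
      eq-refl : ∀ σ → σ ∈ D → ∀ r → r ∈ B → Eq r σ σ
      eq-refl = ∈⁺-induction (#0 ∈ᶠ ` D ⇒ᶠ (∀ᶠ #0 ∈ᶠ ` B ⇒ᶠ eqᶠ #0 #1 #1)) step
        where
        step : ∀ σ → (∀ ρ → ρ ∈⁺ σ → ρ ∈ D → ∀ r → r ∈ B → Eq r ρ ρ) → σ ∈ D → ∀ r → r ∈ B → Eq r σ σ
        step σ ih mσ r mr = eq⇐ mσ mσ (mr , clause , clause)
          where
          clause : ∀ ρ c → app σ ρ c → ∀ q → q ≤ r → q ≤ c → Mem q ρ σ
          clause ρ c a q l k = case name-elements names mσ a of λ (mρ , _) →
            mem⇐ mρ mσ (proj₁ (≤-∈ l) , λ q′ l′ nq → ρ , c , q′ , a , nq , ≤-refl (proj₁ nq) , ≤-trans l′ k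
              , ih ρ (app-∈⁺ a) mρ q′ (proj₁ nq))

      -- Induction on `σ` alone. In the backward half the chain from `ρ″` over `ρ′` to `ρ` ends in
      -- the domain of `σ`; `eq-sym` reverses it so that the induction hypothesis for `ρ` applies.
      eq-trans : ∀ σ → σ ∈ D → ∀ τ υ r → τ ∈ D → υ ∈ D → Eq r σ τ → Eq r τ υ → Eq r σ υ
      eq-trans = ∈⁺-induction (#0 ∈ᶠ ` D ⇒ᶠ (∀ᶠ ∀ᶠ ∀ᶠ #2 ∈ᶠ ` D ⇒ᶠ #1 ∈ᶠ ` D ⇒ᶠ
          eqᶠ #0 #3 #2 ⇒ᶠ eqᶠ #0 #2 #1 ⇒ᶠ eqᶠ #0 #3 #1)) step
        where
        step : ∀ σ → (∀ ρ → ρ ∈⁺ σ → ρ ∈ D → ∀ τ υ r → τ ∈ D → υ ∈ D → Eq r ρ τ → Eq r τ υ → Eq r ρ υ) →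
               σ ∈ D → ∀ τ υ r → τ ∈ D → υ ∈ D → Eq r σ τ → Eq r τ υ → Eq r σ υ
        step σ ih mσ τ υ r mτ mυ h k = eq⇐ mσ mυ (proj₁ E₁ , forth , back)
          where
          E₁ : EqClause r σ τ
          E₁ = eq⇒ mσ mτ h
          E₂ : EqClause r τ υ
          E₂ = eq⇒ mτ mυ k
          forth : ∀ ρ c → app σ ρ c → ∀ q → q ≤ r → q ≤ c → Mem q ρ υ
          forth ρ c a q l l′ = mem⇐ mρ mυ (proj₁ (≤-∈ l) , λ q′ k nq →
              case proj₂ (mem⇒ mρ mτ (proj₁ (proj₂ E₁) ρ c a q l l′)) q′ k nq of λ (ρ′ , c′ , s , a′ , ns , s≤ , s≤c
                  , eq₁) →
                case name-elements names mτ a′ of λ (mρ′ , _) →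
                case proj₂ (mem⇒ mρ′ mυ (proj₁ (proj₂ E₂) ρ′ c′ a′ s (≤-trans s≤ (≤-trans k l)) s≤c)) s
                    (≤-refl (proj₁ ns)) ns of λ (ρ″ , c″ , s′ , a″ , ns′ , s′≤ , s′≤c , eq₂) →
                case name-elements names mυ a″ of λ (mρ″ , _) →
                ρ″ , c″ , s′ , a″ , ns′ , ≤-trans s′≤ s≤ , s′≤c
                 , ih ρ (app-∈⁺ a) mρ ρ′ ρ″ s′ mρ′ mρ″ (eq-mono s′≤ eq₁) eq₂)
            where
            mρ : ρ ∈ D
            mρ = proj₁ (name-elements names mσ a)
          back : ∀ ρ″ c″ → app υ ρ″ c″ → ∀ q → q ≤ r → q ≤ c″ → Mem q ρ″ σ
          back ρ″ c″ a″ q l l′ = mem⇐ mρ″ mσ (proj₁ (≤-∈ l) , λ q′ k nq →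
              case proj₂ (mem⇒ mρ″ mτ (proj₂ (proj₂ E₂) ρ″ c″ a″ q l l′)) q′ k nq of λ (ρ′ , c′ , s , a′ , ns , s≤
                  , s≤c , eq₁) →
                case name-elements names mτ a′ of λ (mρ′ , _) →
                case proj₂ (mem⇒ mρ′ mσ (proj₂ (proj₂ E₁) ρ′ c′ a′ s (≤-trans s≤ (≤-trans k l)) s≤c)) s
                    (≤-refl (proj₁ ns)) ns of λ (ρ , c , s′ , a , ns′ , s′≤ , s′≤c , eq₂) →
                case name-elements names mσ a of λ (mρ , _) →
                ρ , c , s′ , a , ns′ , ≤-trans s′≤ s≤ , s′≤c
                 , eq-sym mρ mρ″ (ih ρ (app-∈⁺ a) mρ ρ′ ρ″ s′ mρ′ mρ″ (eq-sym mρ′ mρ eq₂)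
                     (eq-mono s′≤ (eq-sym mρ″ mρ′ eq₁))))
            where
            mρ″ : ρ″ ∈ D
            mρ″ = proj₁ (name-elements names mυ a″)

    mem-congˡ : ∀ {r σ σ′ τ} → σ ∈ D → σ′ ∈ D → τ ∈ D → Eq r σ σ′ → Mem r σ τ → Mem r σ′ τ
    mem-congˡ {r} {σ} {σ′} {τ} mσ mσ′ mτ h k = mem⇐ mσ′ mτ (proj₁ c , λ q l nq → move (proj₂ c q l nq) l)
      where
      c = mem⇒ mσ mτ k
      move : ∀ {q} → (∃[ ρ ] ∃[ c ] ∃[ s ] app τ ρ c × Nonzero s × s ≤ q × s ≤ c × Eq s σ ρ) → q ≤ r →
             ∃[ ρ ] ∃[ c ] ∃[ s ] app τ ρ c × Nonzero s × s ≤ q × s ≤ c × Eq s σ′ ρ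
      move (ρ , c , s , a , ns , l₁ , l₂ , ev) l = case name-elements names mτ a of λ (mρ , _) →
        ρ , c , s , a , ns , l₁ , l₂
        , eq-trans σ′ mσ′ σ ρ s mσ mρ (eq-mono (≤-trans l₁ l) (eq-sym mσ mσ′ h)) ev

    mem-congʳ : ∀ {r σ τ τ′} → σ ∈ D → τ ∈ D → τ′ ∈ D → Eq r τ τ′ → Mem r σ τ → Mem r σ τ′
    mem-congʳ {r} {σ} {τ} {τ′} mσ mτ mτ′ h k = mem⇐ mσ mτ′ (proj₁ c , λ q l nq → move (proj₂ c q l nq) l)
      where
      c = mem⇒ mσ mτ k
      move : ∀ {q} → (∃[ ρ ] ∃[ c ] ∃[ s ] app τ ρ c × Nonzero s × s ≤ q × s ≤ c × Eq s σ ρ) → q ≤ r →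
             ∃[ ρ ] ∃[ c ] ∃[ s ] app τ′ ρ c × Nonzero s × s ≤ q × s ≤ c × Eq s σ ρ
      move (ρ , c , s , a , ns , l₁ , l₂ , ev) l =
        case name-elements names mτ a of λ (mρ , _) →
          let there = proj₁ (proj₂ (eq⇒ mτ mτ′ h)) ρ c a s (≤-trans l₁ l) l₂ in
          case proj₂ (mem⇒ mσ mτ′ (mem-congˡ mρ mσ mτ′ (eq-sym mσ mρ ev) there)) s
              (≤-refl (proj₁ ns)) ns of λ (ρ′ , c′ , s′ , a′ , ns′ , l₁′ , l₂′ , eq′) →
          ρ′ , c′ , s′ , a′ , ns′ , ≤-trans l₁′ l₁ , l₂′ , eq′

  -- A Boolean value is read off from some valuation on some set of names. Two valuations agree on
  -- the names that they share, since both obey the same recursion; one implication suffices, as the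
  -- two can be exchanged.
  module Agreement {D e m D′ e′ m′ : V} (val : IsValuation D e m) (val′ : IsValuation D′ e′ m′) where

    private
      module F = Forcing val
      module F′ = Forcing val′

    opaque
      eq-agree : ∀ σ → σ ∈ D → σ ∈ D′ → ∀ τ r → τ ∈ D → τ ∈ D′ → F.Eq r σ τ → F′.Eq r σ τ
      eq-agree = ∈⁺-induction (#0 ∈ᶠ ` D ⇒ᶠ #0 ∈ᶠ ` D′ ⇒ᶠ (∀ᶠ ∀ᶠ #1 ∈ᶠ ` D ⇒ᶠ #1 ∈ᶠ ` D′ ⇒ᶠ
          F.eqᶠ #0 #2 #1 ⇒ᶠ F′.eqᶠ #0 #2 #1)) step
        where
        step : ∀ σ → (∀ ρ → ρ ∈⁺ σ → ρ ∈ D → ρ ∈ D′ → ∀ τ r → τ ∈ D → τ ∈ D′ → F.Eq r ρ τ → F′.Eq r ρ τ) →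
               σ ∈ D → σ ∈ D′ → ∀ τ r → τ ∈ D → τ ∈ D′ → F.Eq r σ τ → F′.Eq r σ τ
        step σ ih mσ mσ′ τ r mτ mτ′ h = F′.eq⇐ mσ′ mτ′ (proj₁ E , forth , back)
          where
          E : F.EqClause r σ τ
          E = F.eq⇒ mσ mτ h
          nc : NameClosed D
          nc = IsValuation.names val
          nc′ : NameClosed D′
          nc′ = IsValuation.names val′
          forth : ∀ ρ c → app σ ρ c → ∀ q → q ≤ r → q ≤ c → F′.Mem q ρ τ
          forth ρ c a q l l′ = F′.mem⇐ mρ′ mτ′ (proj₁ (≤-∈ l) , λ q′ k nq →
              case proj₂ (F.mem⇒ mρ mτ (proj₁ (proj₂ E) ρ c a q l l′)) q′ k nq of λ (ρ₁ , c₁ , s , a₁ , ns , l₁ , l₂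
                  , ev) →
                ρ₁ , c₁ , s , a₁ , ns , l₁ , l₂
              , ih ρ (app-∈⁺ a) mρ mρ′ ρ₁ s (proj₁ (name-elements nc mτ a₁)) (proj₁ (name-elements nc′ mτ′ a₁)) ev)
            where
            mρ : ρ ∈ D
            mρ = proj₁ (name-elements nc mσ a)
            mρ′ : ρ ∈ D′
            mρ′ = proj₁ (name-elements nc′ mσ′ a)
          back : ∀ ρ c → app τ ρ c → ∀ q → q ≤ r → q ≤ c → F′.Mem q ρ σ
          back ρ c a q l l′ = F′.mem⇐ mρ′ mσ′ (proj₁ (≤-∈ l) , λ q′ k nq →
              case proj₂ (F.mem⇒ mρ mσ (proj₂ (proj₂ E) ρ c a q l l′)) q′ k nq of λ (ρ₁ , c₁ , s , a₁ , ns , l₁ , l₂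
                  , ev) →
                let mρ₁ = proj₁ (name-elements nc mσ a₁) in
                let mρ₁′ = proj₁ (name-elements nc′ mσ′ a₁) in
                ρ₁ , c₁ , s , a₁ , ns , l₁ , l₂
              , F′.eq-sym mρ₁′ mρ′ (ih ρ₁ (app-∈⁺ a₁) mρ₁ mρ₁′ ρ s mρ mρ′ (F.eq-sym mρ mρ₁ ev)))
            where
            mρ : ρ ∈ D
            mρ = proj₁ (name-elements nc mτ a)
            mρ′ : ρ ∈ D′
            mρ′ = proj₁ (name-elements nc′ mτ′ a)

    mem-agree : ∀ {r σ τ} → σ ∈ D → σ ∈ D′ → τ ∈ D → τ ∈ D′ → F.Mem r σ τ → F′.Mem r σ τ
    mem-agree {r} {σ} {τ} mσ mσ′ mτ mτ′ h = F′.mem⇐ mσ′ mτ′ (proj₁ c , λ q l nq → move (proj₂ c q l nq))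
      where
      c = F.mem⇒ mσ mτ h
      move : ∀ {q} → (∃[ ρ ] ∃[ c ] ∃[ s ] app τ ρ c × Nonzero s × s ≤ q × s ≤ c × F.Eq s σ ρ) →
             ∃[ ρ ] ∃[ c ] ∃[ s ] app τ ρ c × Nonzero s × s ≤ q × s ≤ c × F′.Eq s σ ρ
      move (ρ , c , s , a , ns , l₁ , l₂ , ev) = ρ , c , s , a , ns , l₁ , l₂
        , eq-agree σ mσ mσ′ ρ s (proj₁ (name-elements (IsValuation.names val) mτ a))
            (proj₁ (name-elements (IsValuation.names val′) mτ′ a)) ev

  module ValuationExistence (D : V) (closed : NameClosed D) where

    private
      -- Relative to a candidate E for ⟦σ=τ⟧: the value of ⟦ρ∈τ⟧ and the terms of
      -- one half of the infimum ⟦σ=τ⟧.  With E replaced by its converse in the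
      -- other half, only E ρ ρ′ with ρ ∈ dom σ matters, so that the recursion is
      -- on σ alone.
      MemberValue : (V → V → V → Set ℓ) → V → V → V → Set ℓ
      MemberValue E ρ τ = IsSup λ x → ∃[ ρ′ ] ∃[ c ] ∃[ d ] app τ ρ′ c × E ρ ρ′ d × IsMeet c d x

      Half : (V → V → V → Set ℓ) → V → V → V → Set ℓ
      Half E σ τ x = ∃[ ρ ] ∃[ c ] ∃[ d ] app σ ρ c × MemberValue E ρ τ d × IsImplication c d x

      flip : (V → V → V → Set ℓ) → V → V → V → Set ℓ
      flip E ρ ρ′ = E ρ′ ρ

      Terms : (V → V → V → Set ℓ) → V → V → V → Set ℓ
      Terms E σ τ x = Half E σ τ x ⊎ Half (flip E) τ σ x

      Agree : (E E′ : V → V → V → Set ℓ) → V → V → Set ℓ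
      Agree E E′ σ τ = ∀ ρ c ρ′ c′ → app σ ρ c → app τ ρ′ c′ → ∀ b → E ρ ρ′ b ⇔ E′ ρ ρ′ b

      half-cong : ∀ {E E′ σ τ} → Agree E E′ σ τ → ∀ x → Half E σ τ x ⇔ Half E′ σ τ x
      half-cong agree x = ∃-⇔ λ ρ → ∃-⇔ λ c → ∃-⇔ λ d → mk⇔
        (λ (a , h , i) → a , sup-cong (λ y → inner ρ c a y) h , i)
        (λ (a , h , i) → a , sup-cong (λ y → ⇔-sym (inner ρ c a y)) h , i)
        where
        inner : ∀ ρ c → app _ ρ c → ∀ y → _ ⇔ _
        inner ρ c a y = ∃-⇔ λ ρ′ → ∃-⇔ λ c′ → ∃-⇔ λ d → mk⇔
          (λ (a′ , e , h) → a′ , to (agree ρ c ρ′ c′ a a′ d) e , h)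
          (λ (a′ , e , h) → a′ , from (agree ρ c ρ′ c′ a a′ d) e , h)

      terms-cong : ∀ {E E′ σ τ} → Agree E E′ σ τ → ∀ x → Terms E σ τ x ⇔ Terms E′ σ τ x
      terms-cong agree x = half-cong agree x ⊎-⇔ half-cong (λ ρ c ρ′ c′ a a′ b → agree ρ′ c′ ρ c a′ a b) x

      wk³ : ∀ {n} → Tm V n → Tm V (3 +ℕ n)
      wk³ t = wk (wk (wk t))

      valᶠ : ∀ {n} → Tm V n → Tm V n → Tm V n → Tm V n → Fm₀ n
      valᶠ f ρ ρ′ b = ∃ᶠ appᶠ (wk f) (wk ρ) #0 ∧ᶠ appᶠ #0 (wk ρ′) (wk b)

      memberᶠ : ∀ {n} → (∀ {k} → (Tm V n → Tm V k) → Tm V k → Tm V k → Fm₀ k) → Tm V n → Tm V n → Fm₀ n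
      memberᶠ E τ d = supᶠ (λ w x → ∃ᶠ ∃ᶠ ∃ᶠ appᶠ (wk³ (w τ)) #2 #1 ∧ᶠ E (λ t → wk³ (w t)) #2 #0 ∧ᶠ meetᶠ #1 #0
          (wk³ x)) d

      halfᶠ flippedᶠ : Fm₀ 4
      halfᶠ = ∃ᶠ ∃ᶠ ∃ᶠ appᶠ #4 #2 #1 ∧ᶠ memberᶠ (λ u ρ′ b → valᶠ (u #3) (u #2) ρ′ b) #5 #0
                ∧ᶠ implicationᶠ #1 #0 #6
      flippedᶠ = ∃ᶠ ∃ᶠ ∃ᶠ appᶠ #4 #2 #1 ∧ᶠ memberᶠ (λ u ρ′ b → valᶠ (u #3) ρ′ (u #2) b) #5 #0
                ∧ᶠ implicationᶠ #1 #0 #6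

      Val : V → V → V → V → Set ℓ
      Val f ρ ρ′ b = ∃[ g ] app f ρ g × app g ρ′ b

      CodedHalf : (V → V → V → Set ℓ) → V → V → V → Set ℓ
      CodedHalf E σ τ x = ∃[ ρ ] ∃[ c ] ∃[ d ] app σ ρ c × MemberValue E ρ τ d × implicationClass [ c ∷ d ∷ x ∷ [] ]

      half⁺ : ∀ E σ τ x → CodedHalf E σ τ x ⇔ Half E σ τ x
      half⁺ E σ τ x = clause⇔ {λ ρ c d → app σ ρ c} {λ ρ c d → MemberValue E ρ τ d} {x}

      opaque
        halfClass flippedClass : Class 4
        halfClass = toClass halfᶠ
        flippedClass = toClass flippedᶠ

        half-correct : ∀ f σ τ x → halfClass [ f ∷ σ ∷ τ ∷ x ∷ [] ] ⇔ Half (Val f) σ τ x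
        half-correct f σ τ x = decoded (toClass-correct halfᶠ (f ∷ σ ∷ τ ∷ x ∷ []))
          where
          decoded : halfClass [ f ∷ σ ∷ τ ∷ x ∷ [] ] ⇔ CodedHalf (Val f) σ τ x →
                    halfClass [ f ∷ σ ∷ τ ∷ x ∷ [] ] ⇔ Half (Val f) σ τ x
          decoded h = h ⟨⇔⟩ half⁺ (Val f) σ τ x

        flipped-correct : ∀ f σ τ x → flippedClass [ f ∷ σ ∷ τ ∷ x ∷ [] ] ⇔ Half (flip (Val f)) σ τ x
        flipped-correct f σ τ x = decoded (toClass-correct flippedᶠ (f ∷ σ ∷ τ ∷ x ∷ []))
          where
          decoded : flippedClass [ f ∷ σ ∷ τ ∷ x ∷ [] ] ⇔ CodedHalf (flip (Val f)) σ τ x →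
                    flippedClass [ f ∷ σ ∷ τ ∷ x ∷ [] ] ⇔ Half (flip (Val f)) σ τ x
          decoded h = h ⟨⇔⟩ half⁺ (flip (Val f)) σ τ x

      infimumᶠ : Fm₀ 4
      infimumᶠ = infᶠ (λ w x → atom halfClass (w #1 ∷ w #0 ∷ w #2 ∷ x ∷ [])
                            ∨ᶠ atom flippedClass (w #1 ∷ w #2 ∷ w #0 ∷ x ∷ [])) #3

      CodedTerms : V → V → V → V → Set ℓ
      CodedTerms f σ τ x = halfClass [ f ∷ σ ∷ τ ∷ x ∷ [] ] ⊎ flippedClass [ f ∷ τ ∷ σ ∷ x ∷ [] ]

      codedTerms⇔ : ∀ f σ τ x → CodedTerms f σ τ x ⇔ Terms (Val f) σ τ x
      codedTerms⇔ f σ τ x = half-correct f σ τ x ⊎-⇔ flipped-correct f τ σ x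

      Infimum : V → V → V → V → Set ℓ
      Infimum σ f τ b = IsInf (Terms (Val f) σ τ) b

      opaque
        infimumClass : Class 4
        infimumClass = toClass infimumᶠ

        infimum-correct : ∀ σ f τ b → infimumClass [ σ ∷ f ∷ τ ∷ b ∷ [] ] ⇔ Infimum σ f τ b
        infimum-correct σ f τ b = mk⇔
          (λ h → inf-cong {CodedTerms f σ τ} {Terms (Val f) σ τ} (codedTerms⇔ f σ τ)
                   (to (toClass-correct infimumᶠ (σ ∷ f ∷ τ ∷ b ∷ [])) h))
          (λ i → from (toClass-correct infimumᶠ (σ ∷ f ∷ τ ∷ b ∷ []))
                   (inf-cong {Terms (Val f) σ τ} {CodedTerms f σ τ} (λ x → ⇔-sym (codedTerms⇔ f σ τ x)) i))

      rowᶠ : Fm₀ 3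
      rowᶠ = ∀ᶠ #0 ∈ᶠ #3 ⇔ᶠ (∃ᶠ ∃ᶠ pairᶠ #1 #0 #2 ∧ᶠ #1 ∈ᶠ ` D ∧ᶠ atom infimumClass (#3 ∷ #4 ∷ #1 ∷ #0 ∷ []))

      -- The value of the recursion at `σ` is the whole row of values ⟦σ=τ⟧ for `τ` in `D`, so that
      -- recursion in one variable suffices; `f` maps the earlier names to their rows.
      Row : V → V → V → Set ℓ
      Row σ f y = y Is｛ (λ p → ∃[ τ ] ∃[ b ] IsPair τ b p × τ ∈ D × infimumClass [ σ ∷ f ∷ τ ∷ b ∷ [] ]) ｝

      opaque
        rowClass : Class 3
        rowClass = toClass rowᶠ

        row⇒ : ∀ {σ f y} → rowClass [ σ ∷ f ∷ y ∷ [] ] → Row σ f y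
        row⇒ {σ} {f} {y} = to (toClass-correct rowᶠ (σ ∷ f ∷ y ∷ []))

        row⇐ : ∀ {σ f y} → Row σ f y → rowClass [ σ ∷ f ∷ y ∷ [] ]
        row⇐ {σ} {f} {y} = from (toClass-correct rowᶠ (σ ∷ f ∷ y ∷ []))

      row-exists : ∀ σ f → ∃[ y ] Row σ f y
      row-exists σ f = comp φ (D ⊗ B) , λ p → ∈-comp φ _ p ⟨⇔⟩ mk⇔ proj₂ (λ w → product w , w)
        where
        φ : Fm₀ 1
        φ = ∃ᶠ ∃ᶠ pairᶠ #1 #0 #2 ∧ᶠ #1 ∈ᶠ ` D ∧ᶠ atom infimumClass (` σ ∷ ` f ∷ #1 ∷ #0 ∷ [])
        product : ∀ {p} → (∃[ τ ] ∃[ b ] IsPair τ b p × τ ∈ D × infimumClass [ σ ∷ f ∷ τ ∷ b ∷ [] ]) → p ∈ (D ⊗ B)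
        product (τ , b , h , m , i) = from (∈-⊗ D B _) (τ , b , h , m , proj₁ (to (infimum-correct σ f τ b) i))

      row-local : ∀ σ f f′ y → (∀ z → z ∈⁺ σ → ∀ u → app f z u ⇔ app f′ z u) → Row σ f y → Row σ f′ y
      row-local σ f f′ y agree h p = h p ⟨⇔⟩ ∃-⇔ λ τ → ∃-⇔ λ b → mk⇔
        (λ (hp , m , i) → hp , m , from (infimum-correct σ f′ τ b)
           (inf-cong (terms-cong same) (to (infimum-correct σ f τ b) i)))
        (λ (hp , m , i) → hp , m , from (infimum-correct σ f τ b)
           (inf-cong (λ x → ⇔-sym (terms-cong same x)) (to (infimum-correct σ f′ τ b) i)))
        where
        same : ∀ {τ} → Agree (Val f) (Val f′) σ τ
        same ρ c ρ′ c′ a a′ b = ∃-⇔ λ g → agree ρ (app-∈⁺ a) g ×-⇔ ⇔-refl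

      opaque
        rowClass-unique : ∀ σ f y y′ → rowClass [ σ ∷ f ∷ y ∷ [] ] → rowClass [ σ ∷ f ∷ y′ ∷ [] ] → y ≡ y′
        rowClass-unique σ f y y′ h h′ = Is-unique (row⇒ h) (row⇒ h′)

        rowClass-exists : ∀ σ f → IsFunction f → (∀ z → z ∈⁺ σ → InDom f z) → ∃[ y ] rowClass [ σ ∷ f ∷ y ∷ [] ]
        rowClass-exists σ f _ _ = proj₁ (row-exists σ f) , row⇐ (proj₂ (row-exists σ f))

        rowClass-local : ∀ σ f f′ y → (∀ z → z ∈⁺ σ → ∀ u → app f z u ⇔ app f′ z u) →
                         rowClass [ σ ∷ f ∷ y ∷ [] ] → rowClass [ σ ∷ f′ ∷ y ∷ [] ]
        rowClass-local σ f f′ y agree h = row⇐ (row-local σ f f′ y agree (row⇒ h))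

      module R = Rec rowClass rowClass-unique rowClass-exists rowClass-local

      E : V → V → V → Set ℓ
      E σ τ b = ∃[ y ] R.Value σ y × app y τ b

      Eᶠ : ∀ {n} → Tm V n → Tm V n → Tm V n → Fm₀ n
      Eᶠ σ τ b = ∃ᶠ R.valueᶠ (wk σ) #0 ∧ᶠ appᶠ #0 (wk τ) (wk b)

      opaque
        E-equation : ∀ σ τ b → E σ τ b ⇔ (τ ∈ D × IsInf (Terms E σ τ) b)
        E-equation σ τ b = mk⇔
          (λ (y , v , p , hp , m) → unfold-row (R.value⇒attempt v) p hp m)
          (λ (m , i) → case R.value-exists σ of λ (y , v) →
            fold y v (R.value⇒attempt v) m i)
          where
          module _ {y} (t f : V) (at : R.Attempt t f) (m : app f σ y) where
            same : Agree (Val f) E σ τ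
            same ρ c ρ′ c′ a a′ b = mk⇔
              (λ (g , h , h′) → g , R.attempt⇒value at h , h′)
              (λ (g , v , h′) → case R.below-dom at m ρ (app-∈⁺ a) of λ (g′ , h) →
                g′ , h , subst (λ g → app g ρ′ b) (R.value-unique ρ g g′ v (R.attempt⇒value at h)) h′)
            row : Row σ f y
            row = row⇒ (proj₂ (proj₂ at) σ y m)
          unfold-row : ∀ {y} → (∃[ t ] ∃[ f ] R.Attempt t f × app f σ y) → ∀ p → IsPair τ b p → p ∈ y →
              τ ∈ D × IsInf (Terms E σ τ) b
          unfold-row (t , f , at , m) p hp mp = rename (to (row t f at m p) mp)
            where
            rename : (∃[ τ′ ] ∃[ b′ ] IsPair τ′ b′ p × τ′ ∈ D × infimumClass [ σ ∷ f ∷ τ′ ∷ b′ ∷ [] ]) →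
                     τ ∈ D × IsInf (Terms E σ τ) b
            rename (τ′ , b′ , hp′ , mτ , i) with refl , refl ← pair-inj hp hp′ =
              mτ , inf-cong (terms-cong (same t f at m)) (to (infimum-correct σ f τ b) i)
          fold : ∀ y → R.Value σ y → (∃[ t ] ∃[ f ] R.Attempt t f × app f σ y) →
                 τ ∈ D → IsInf (Terms E σ τ) b → E σ τ b
          fold y v (t , f , at , m) mτ i = y , v , _ , isPair τ b ,
            from (row t f at m _) (τ , b , isPair τ b , mτ , from (infimum-correct σ f τ b)
              (inf-cong (λ x → ⇔-sym (terms-cong (same t f at m) x)) i))

        -- The recursion uses the converse of `E` in the second half of the infimum. Symmetry turns
        -- that half into the one prescribed by the definition of ⟦σ=τ⟧.
        E-sym : ∀ σ → σ ∈ D → ∀ τ b → τ ∈ D → E σ τ b ⇔ E τ σ b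
        E-sym = ∈⁺-induction (#0 ∈ᶠ ` D ⇒ᶠ (∀ᶠ ∀ᶠ #1 ∈ᶠ ` D ⇒ᶠ (Eᶠ #2 #1 #0 ⇔ᶠ Eᶠ #1 #2 #0))) step
          where
          step : ∀ σ → (∀ ρ → ρ ∈⁺ σ → ρ ∈ D → ∀ τ b → τ ∈ D → E ρ τ b ⇔ E τ ρ b) →
                 σ ∈ D → ∀ τ b → τ ∈ D → E σ τ b ⇔ E τ σ b
          step σ ih mσ τ b mτ = E-equation σ τ b
              ⟨⇔⟩ mk⇔ (λ (_ , i) → mσ , inf-cong swapped i) (λ (_ , i) → mτ , inf-cong (λ x → ⇔-sym (swapped x)) i)
              ⟨⇔⟩ ⇔-sym (E-equation τ σ b)
            where
            agree : Agree E (flip E) σ τ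
            agree ρ c ρ′ c′ a a′ b = ih ρ (app-∈⁺ a) (proj₁ (name-elements closed mσ a)) ρ′ b
                                       (proj₁ (name-elements closed mτ a′))
            swapped : ∀ x → Terms E σ τ x ⇔ Terms E τ σ x
            swapped x = (half-cong {E} {flip E} agree x
                ⊎-⇔ half-cong {flip E} {E} (λ ρ c ρ′ c′ a a′ b → agree ρ′ c′ ρ c a′ a b) x)
              ⟨⇔⟩ mk⇔ [ inj₂ , inj₁ ]′ [ inj₂ , inj₁ ]′

      opaque
        e-exists : ∃[ e ] (∀ σ τ b → app₂ e σ τ b ⇔ (σ ∈ D × τ ∈ D × E σ τ b))
        e-exists with relation (∃ᶠ ∃ᶠ pairᶠ #1 #0 #2 ∧ᶠ Eᶠ #1 #0 #3) (D ⊗ D) B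
        ... | e , _ , he = e , λ σ τ b → mk⇔
          (λ (p , hp , a) → ⇒ hp (to (he p b) a))
          (λ (mσ , mτ , h) → ⟨ σ , τ ⟩ , isPair σ τ , from (he _ b)
            (from (∈-⊗ D D _) (σ , τ , isPair σ τ , mσ , mτ) , proj₁ (proj₂ (to (E-equation σ τ b) h)) , σ , τ
                , isPair σ τ , h))
          where
          ⇒ : ∀ {σ τ b p} → IsPair σ τ p → p ∈ (D ⊗ D) × b ∈ B × (∃[ σ′ ] ∃[ τ′ ] IsPair σ′ τ′ p × E σ′ τ′ b) →
              σ ∈ D × τ ∈ D × E σ τ b
          ⇒ hp (mp , _ , σ′ , τ′ , hp′ , h) with to (∈-⊗ D D _) mp
          ... | σ″ , τ″ , hp″ , mσ , mτ with pair-inj hp hp′ | pair-inj hp hp″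
          ... | refl , refl | refl , refl = mσ , mτ , h

      e : V
      e = proj₁ e-exists

      e⇔ : ∀ {σ τ b} → σ ∈ D → τ ∈ D → app₂ e σ τ b ⇔ E σ τ b
      e⇔ mσ mτ = proj₂ e-exists _ _ _ ⟨⇔⟩ mk⇔ (λ (_ , _ , h) → h) (λ h → mσ , mτ , h)

      opaque
        m-exists : ∃[ m ] (∀ σ τ b → app₂ m σ τ b ⇔ (σ ∈ D × τ ∈ D × MemberValue (app₂ e) σ τ b))
        m-exists with relation (∃ᶠ ∃ᶠ pairᶠ #1 #0 #2
          ∧ᶠ memberᶠ (λ u ρ′ b → app₂ᶠ (` e) (u #1) ρ′ b) #0 #3) (D ⊗ D) B
        ... | m , _ , hm = m , λ σ τ b → mk⇔
          (λ (p , hp , a) → ⇒ hp (to (hm p b) a))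
          (λ (mσ , mτ , h) → ⟨ σ , τ ⟩ , isPair σ τ , from (hm _ b)
            (from (∈-⊗ D D _) (σ , τ , isPair σ τ , mσ , mτ) , proj₁ h , σ , τ , isPair σ τ , h))
          where
          ⇒ : ∀ {σ τ b p} → IsPair σ τ p → p ∈ (D ⊗ D) × b ∈ B ×
              (∃[ σ′ ] ∃[ τ′ ] IsPair σ′ τ′ p × MemberValue (app₂ e) σ′ τ′ b) →
              σ ∈ D × τ ∈ D × MemberValue (app₂ e) σ τ b
          ⇒ hp (mp , _ , σ′ , τ′ , hp′ , h) with to (∈-⊗ D D _) mp
          ... | σ″ , τ″ , hp″ , mσ , mτ with pair-inj hp hp′ | pair-inj hp hp″
          ... | refl , refl | refl , refl = mσ , mτ , h

      m : V
      m = proj₁ m-exists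

      m⇔ : ∀ {σ τ b} → σ ∈ D → τ ∈ D → app₂ m σ τ b ⇔ MemberValue (app₂ e) σ τ b
      m⇔ mσ mτ = proj₂ m-exists _ _ _ ⟨⇔⟩ mk⇔ (λ (_ , _ , h) → h) (λ h → mσ , mτ , h)

      half⇔ : ∀ {σ τ} → σ ∈ D → τ ∈ D → ∀ x →
              Half E σ τ x ⇔ (∃[ ρ ] ∃[ c ] ∃[ d ] app σ ρ c × app₂ m ρ τ d × IsImplication c d x)
      half⇔ {σ} {τ} mσ mτ x = half-cong agree x ⟨⇔⟩ ∃-⇔ λ ρ → ∃-⇔ λ c → ∃-⇔ λ d → mk⇔
        (λ (a , h , i) → a , from (m⇔ (proj₁ (name-elements closed mσ a)) mτ) h , i)
        (λ (a , h , i) → a , to (m⇔ (proj₁ (name-elements closed mσ a)) mτ) h , i)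
        where
        agree : Agree E (app₂ e) σ τ
        agree ρ c ρ′ c′ a a′ b = ⇔-sym (e⇔ (proj₁ (name-elements closed mσ a)) (proj₁ (name-elements closed mτ a′)))

      flipped⇔ : ∀ {σ τ} → σ ∈ D → τ ∈ D → ∀ x → Half (flip E) τ σ x ⇔ Half E τ σ x
      flipped⇔ {σ} {τ} mσ mτ x = half-cong (λ ρ c ρ′ c′ a a′ b →
        E-sym ρ′ (proj₁ (name-elements closed mσ a′)) ρ b (proj₁ (name-elements closed mτ a))) x

    opaque
      valuation : ∃[ e ] ∃[ m ] IsValuation D e m
      valuation = e , m , record
        { names    = closed
        ; elements = λ σ τ b mσ mτ → m⇔ mσ mτ
        ; equality = λ σ τ b mσ mτ → e⇔ mσ mτ ⟨⇔⟩ E-equation σ τ b ⟨⇔⟩ mk⇔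
            (λ (_ , i) → inf-cong (terms⇔ mσ mτ) i)
            (λ i → mτ , inf-cong (λ x → ⇔-sym (terms⇔ mσ mτ x)) i)
        }
        where
        terms⇔ : ∀ {σ τ} → σ ∈ D → τ ∈ D → ∀ x → Terms E σ τ x ⇔
          ((∃[ ρ ] ∃[ c ] ∃[ d ] app σ ρ c × app₂ m ρ τ d × IsImplication c d x)
          ⊎ (∃[ ρ ] ∃[ c ] ∃[ d ] app τ ρ c × app₂ m ρ σ d × IsImplication c d x))
        terms⇔ mσ mτ x = half⇔ mσ mτ x ⊎-⇔ (flipped⇔ mσ mτ x ⟨⇔⟩ half⇔ mτ mσ x)

  private
    nameClosedᶠ : ∀ {n} → Tm V n → Fm₀ n
    nameClosedᶠ D = ∀ᶠ ∀ᶠ #1 ∈ᶠ wk (wk D) ⇒ᶠ #0 ∈ᶠ #1 ⇒ᶠ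
      (∃ᶠ ∃ᶠ pairᶠ #1 #0 #2 ∧ᶠ #1 ∈ᶠ wk (wk (wk (wk D))) ∧ᶠ #0 ∈ᶠ ` B)

    valuationᶠ : Fm₀ 3
    valuationᶠ = nameClosedᶠ #0
      ∧ᶠ (∀ᶠ ∀ᶠ ∀ᶠ #2 ∈ᶠ #3 ⇒ᶠ #1 ∈ᶠ #3 ⇒ᶠ (app₂ᶠ #5 #2 #1 #0 ⇔ᶠ
            supᶠ (λ w x → atom elementsClass (w #4 ∷ w #2 ∷ w #1 ∷ x ∷ [])) #0))
      ∧ᶠ (∀ᶠ ∀ᶠ ∀ᶠ #2 ∈ᶠ #3 ⇒ᶠ #1 ∈ᶠ #3 ⇒ᶠ (app₂ᶠ #4 #2 #1 #0 ⇔ᶠ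
            infᶠ (λ w x → atom clausesClass (w #5 ∷ w #2 ∷ w #1 ∷ x ∷ [])) #0))

  opaque
    valuationClass : Class 3
    valuationClass = toClass valuationᶠ

    valuation-correct : ∀ D e m → valuationClass [ D ∷ e ∷ m ∷ [] ] ⇔ IsValuation D e m
    valuation-correct D e m = mk⇔ (λ h → decode (to (toClass-correct valuationᶠ (D ∷ e ∷ m ∷ [])) h))
                                  (λ v → from (toClass-correct valuationᶠ (D ∷ e ∷ m ∷ [])) (encode v))
      where
      Holds : Class 4 → V → V → V → V → Set ℓ
      Holds C e σ τ x = C [ e ∷ σ ∷ τ ∷ x ∷ [] ]
      sup⇔ : ∀ σ τ b → IsSup (Holds elementsClass e σ τ) b ⇔ IsSup (Elements e σ τ) b
      sup⇔ σ τ b = mk⇔ (sup-cong (elements-correct e σ τ)) (sup-cong λ x → ⇔-sym (elements-correct e σ τ x))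
      inf⇔ : ∀ σ τ b → IsInf (Holds clausesClass m σ τ) b ⇔ IsInf (Clauses m σ τ) b
      inf⇔ σ τ b = mk⇔ (inf-cong (clauses-correct m σ τ)) (inf-cong λ x → ⇔-sym (clauses-correct m σ τ x))
      decode : ⟦ valuationᶠ ⟧ (D ∷ e ∷ m ∷ []) → IsValuation D e m
      decode (nc , h , h′) = record
        { names    = nc
        ; elements = λ σ τ b mσ mτ → h σ τ b mσ mτ ⟨⇔⟩ sup⇔ σ τ b
        ; equality = λ σ τ b mσ mτ → h′ σ τ b mσ mτ ⟨⇔⟩ inf⇔ σ τ b
        }
      encode : IsValuation D e m → ⟦ valuationᶠ ⟧ (D ∷ e ∷ m ∷ [])
      encode v = IsValuation.names v
        , (λ σ τ b mσ mτ → IsValuation.elements v σ τ b mσ mτ ⟨⇔⟩ ⇔-sym (sup⇔ σ τ b))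
        , (λ σ τ b mσ mτ → IsValuation.equality v σ τ b mσ mτ ⟨⇔⟩ ⇔-sym (inf⇔ σ τ b))

  private
    equalityᶠ : Fm₀ 3
    equalityᶠ = ∃ᶠ ∃ᶠ ∃ᶠ atom valuationClass (#2 ∷ #1 ∷ #0 ∷ []) ∧ᶠ #3 ∈ᶠ #2 ∧ᶠ #4 ∈ᶠ #2 ∧ᶠ app₂ᶠ #1 #3 #4 #5

  opaque
    equalityClass : Class 3
    equalityClass = toClass equalityᶠ

    equality-correct : ∀ σ τ b → equalityClass [ σ ∷ τ ∷ b ∷ [] ] ⇔ ⟦ σ ≐ τ ⟧ b
    equality-correct σ τ b = toClass-correct equalityᶠ (σ ∷ τ ∷ b ∷ [])
      ⟨⇔⟩ ∃-⇔ λ D → ∃-⇔ λ e → ∃-⇔ λ m → valuation-correct D e m ×-⇔ ⇔-refl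

    nameClass : Class 1
    nameClass = toClass (∃ᶠ nameClosedᶠ #0 ∧ᶠ #1 ∈ᶠ #0)

    name-correct : ∀ σ → nameClass [ σ ∷ [] ] ⇔ IsName σ
    name-correct σ = toClass-correct (∃ᶠ nameClosedᶠ #0 ∧ᶠ #1 ∈ᶠ #0) (σ ∷ [])

  nameClosed-∪ : ∀ {D D′} → NameClosed D → NameClosed D′ → NameClosed (D ∪ D′)
  nameClosed-∪ {D} {D′} nc nc′ τ p mτ mp = [ (λ m → weaken (λ z → ∪₁) (nc τ p m mp))
      , (λ m → weaken (λ z → ∪₂) (nc′ τ p m mp)) ]′
      (to (∈-∪ D D′ τ) mτ)
    where
    weaken : ∀ {D″} → (∀ z → z ∈ D″ → z ∈ (D ∪ D′)) → (∃[ ρ ] ∃[ b ] IsPair ρ b p × ρ ∈ D″ × b ∈ B) →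
             ∃[ ρ ] ∃[ b ] IsPair ρ b p × ρ ∈ (D ∪ D′) × b ∈ B
    weaken s (ρ , b , h , m , mb) = ρ , b , h , s ρ m , mb

  AllNames : ∀ {n} → Vec V n → Set ℓ
  AllNames []       = ⊤
  AllNames (σ ∷ σs) = IsName σ × AllNames σs

  AllIn : V → ∀ {n} → Vec V n → Set ℓ
  AllIn D []       = ⊤
  AllIn D (σ ∷ σs) = σ ∈ D × AllIn D σs

  common-domain : ∀ {n} (σs : Vec V n) → AllNames σs → ∃[ D ] NameClosed D × AllIn D σs
  common-domain []       _              = ∅ , (λ τ p m → ⊥-elim (∉∅ τ m)) , tt
  common-domain (σ ∷ σs) ((D , nc , m) , ns) =
    case common-domain σs ns of λ (D′ , nc′ , ms) →
      D ∪ D′ , nameClosed-∪ nc nc′ , ∪₁ m , weaken σs ms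
    where
    weaken : ∀ {D′ n} (σs : Vec V n) → AllIn D′ σs → AllIn (D ∪ D′) σs
    weaken []       _        = tt
    weaken (σ ∷ σs) (m , ms) = ∪₂ m , weaken σs ms

  -- r ≤ ⟦σ=τ⟧ and r ≤ ⟦σ∈τ⟧
  Eq Mem : V → V → V → Set ℓ
  Eq  r σ τ = ∃[ b ] ⟦ σ ≐ τ ⟧ b × r ≤ b
  Mem r σ τ = ∃[ b ] ⟦ σ ∈̇ τ ⟧ b × r ≤ b

  Eqᶠ : ∀ {n} → Tm V n → Tm V n → Tm V n → Fm₀ n
  Eqᶠ r σ τ = ∃ᶠ atom equalityClass (wk σ ∷ wk τ ∷ #0 ∷ []) ∧ᶠ wk r ≤ᶠ #0

  Eqᶠ-correct : ∀ {r σ τ} → (∃[ b ] equalityClass [ σ ∷ τ ∷ b ∷ [] ] × r ≤ b) ⇔ Eq r σ τ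
  Eqᶠ-correct = ∃-⇔ λ b → equality-correct _ _ b ×-⇔ ⇔-refl

  -- Reduces statements about `Eq` and `Mem`, whose valuations vary, to a single valuation on a set
  -- `D` containing all the names in question; `Agreement` justifies the passage into `D`.
  module Domain {D : V} (nc : NameClosed D) where
    private
      val : ∃[ e ] ∃[ m ] IsValuation D e m
      val = ValuationExistence.valuation D nc

    valuation : IsValuation D (proj₁ val) (proj₁ (proj₂ val))
    valuation = proj₂ (proj₂ val)

    module F = Forcing valuation

    Eq⇒ : ∀ {r σ τ} → F.Eq r σ τ → σ ∈ D → τ ∈ D → Eq r σ τ
    Eq⇒ (b , h , l) mσ mτ = b , (D , _ , _ , valuation , mσ , mτ , h) , l

    Eq⇐ : ∀ {r σ τ} → Eq r σ τ → σ ∈ D → τ ∈ D → F.Eq r σ τ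
    Eq⇐ {r} {σ} {τ} (b , (D′ , e′ , m′ , v′ , mσ′ , mτ′ , h) , l) mσ mτ =
      Agreement.eq-agree v′ valuation σ mσ′ mσ τ r mτ′ mτ (b , h , l)

    Mem⇒ : ∀ {r σ τ} → F.Mem r σ τ → σ ∈ D → τ ∈ D → Mem r σ τ
    Mem⇒ (b , h , l) mσ mτ = b , (D , _ , _ , valuation , mσ , mτ , h) , l

    Mem⇐ : ∀ {r σ τ} → Mem r σ τ → σ ∈ D → τ ∈ D → F.Mem r σ τ
    Mem⇐ (b , (D′ , e′ , m′ , v′ , mσ′ , mτ′ , h) , l) mσ mτ =
      Agreement.mem-agree v′ valuation mσ′ mσ mτ′ mτ (b , h , l)

  equality-value : ∀ {σ τ} → IsName σ → IsName τ → ∃[ b ] ⟦ σ ≐ τ ⟧ b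
  equality-value {σ} {τ} nσ nτ =
    let D , nc , mσ , mτ , _ = common-domain (σ ∷ τ ∷ []) (nσ , nτ , tt)
        open Domain nc
        b , h = F.eq-value mσ mτ
    in b , D , _ , _ , valuation , mσ , mτ , h

  membership-value : ∀ {σ τ} → IsName σ → IsName τ → ∃[ b ] ⟦ σ ∈̇ τ ⟧ b
  membership-value {σ} {τ} nσ nτ =
    let D , nc , mσ , mτ , _ = common-domain (σ ∷ τ ∷ []) (nσ , nτ , tt)
        open Domain nc
        b , h = F.mem-value mσ mτ
    in b , D , _ , _ , valuation , mσ , mτ , h

  private
    value-∈B : ∀ {D e m σ τ b} → IsValuation D e m → σ ∈ D → τ ∈ D → app₂ e σ τ b → b ∈ B
    value-∈B v mσ mτ h = proj₁ (to (IsValuation.equality v _ _ _ mσ mτ) h)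

    value-∈B′ : ∀ {D e m σ τ b} → IsValuation D e m → σ ∈ D → τ ∈ D → app₂ m σ τ b → b ∈ B
    value-∈B′ v mσ mτ h = proj₁ (to (IsValuation.elements v _ _ _ mσ mτ) h)

  equality-∈B : ∀ {σ τ b} → ⟦ σ ≐ τ ⟧ b → b ∈ B
  equality-∈B (D , e , m , v , mσ , mτ , h) = value-∈B v mσ mτ h

  membership-∈B : ∀ {σ τ b} → ⟦ σ ∈̇ τ ⟧ b → b ∈ B
  membership-∈B (D , e , m , v , mσ , mτ , h) = value-∈B′ v mσ mτ h

  -- The value does not depend on the valuation.
  Eq⇒≤ : ∀ {r σ τ b} → ⟦ σ ≐ τ ⟧ b → Eq r σ τ → r ≤ b
  Eq⇒≤ {r} {σ} {τ} {b} (D , e , m , v , mσ , mτ , h) (b′ , (D′ , e′ , m′ , v′ , mσ′ , mτ′ , h′) , l) =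
    case Agreement.eq-agree v′ v σ mσ′ mσ τ r mτ′ mτ (b′ , h′ , l) of λ (b″ , h″ , l″) →
      subst (r ≤_) (Forcing.eq-unique v mσ mτ h″ h) l″

  Mem⇒≤ : ∀ {r σ τ b} → ⟦ σ ∈̇ τ ⟧ b → Mem r σ τ → r ≤ b
  Mem⇒≤ {r} {σ} {τ} {b} (D , e , m , v , mσ , mτ , h) (b′ , (D′ , e′ , m′ , v′ , mσ′ , mτ′ , h′) , l) =
    case Agreement.mem-agree v′ v mσ′ mσ mτ′ mτ (b′ , h′ , l) of λ (b″ , h″ , l″) →
      subst (r ≤_) (Forcing.mem-unique v mσ mτ h″ h) l″

  Eq-mono : ∀ {r s σ τ} → s ≤ r → Eq r σ τ → Eq s σ τ
  Eq-mono l (b , h , k) = b , h , ≤-trans l k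

  Eq-sym : ∀ {r σ τ} → IsName σ → IsName τ → Eq r σ τ → Eq r τ σ
  Eq-sym {r} {σ} {τ} nσ nτ h =
    let D , nc , mσ , mτ , _ = common-domain (σ ∷ τ ∷ []) (nσ , nτ , tt)
        open Domain nc
    in Eq⇒ (F.eq-sym mσ mτ (Eq⇐ h mσ mτ)) mτ mσ

  Eq-trans : ∀ {r σ τ υ} → IsName σ → IsName τ → IsName υ → Eq r σ τ → Eq r τ υ → Eq r σ υ
  Eq-trans {r} {σ} {τ} {υ} nσ nτ nυ h k =
    let D , nc , mσ , mτ , mυ , _ = common-domain (σ ∷ τ ∷ υ ∷ []) (nσ , nτ , nυ , tt)
        open Domain nc
    in Eq⇒ (F.eq-trans σ mσ τ υ r mτ mυ (Eq⇐ h mσ mτ) (Eq⇐ k mτ mυ)) mσ mυ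

  Mem-cong : ∀ {r σ σ′ τ τ′} → IsName σ → IsName σ′ → IsName τ → IsName τ′ →
             Eq r σ σ′ → Eq r τ τ′ → Mem r σ τ → Mem r σ′ τ′
  Mem-cong {r} {σ} {σ′} {τ} {τ′} nσ nσ′ nτ nτ′ h k l =
    let D , nc , mσ , mσ′ , mτ , mτ′ , _ = common-domain (σ ∷ σ′ ∷ τ ∷ τ′ ∷ []) (nσ , nσ′ , nτ , nτ′ , tt)
        open Domain nc
    in Mem⇒ (F.mem-congʳ mσ′ mτ mτ′ (Eq⇐ k mτ mτ′) (F.mem-congˡ mσ mσ′ mτ (Eq⇐ h mσ mσ′) (Mem⇐ l mσ mτ))) mσ′ mτ′

  -- Check names and mixing

  top-unique : ∀ {t t′} → IsTop t → IsTop t′ → t ≡ t′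
  top-unique (m , u) (m′ , u′) = antisymmetric _ _ (u′ _ m) (u _ m′)

  𝟙 : V
  𝟙 = proj₁ top-exists

  𝟙-top : IsTop 𝟙
  𝟙-top = proj₂ top-exists

  private
    checkᶠ : Fm₀ 3
    checkᶠ = ∀ᶠ #0 ∈ᶠ #3 ⇔ᶠ (∃ᶠ ∃ᶠ ∃ᶠ #2 ∈ᶠ #4 ∧ᶠ appᶠ #5 #2 #1 ∧ᶠ topᶠ #0 ∧ᶠ pairᶠ #1 #0 #3)

    CheckStep : V → V → V → Set ℓ
    CheckStep y h w = w Is｛ (λ p → ∃[ z ] ∃[ ž ] ∃[ 𝟙 ] z ∈ y × app h z ž × IsTop 𝟙 × IsPair ž 𝟙 p) ｝

    opaque
      stepClass : Class 3
      stepClass = toClass checkᶠ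

      step⇒ : ∀ {y h w} → stepClass [ y ∷ h ∷ w ∷ [] ] → CheckStep y h w
      step⇒ {y} {h} {w} = to (toClass-correct checkᶠ (y ∷ h ∷ w ∷ []))

      step⇐ : ∀ {y h w} → CheckStep y h w → stepClass [ y ∷ h ∷ w ∷ [] ]
      step⇐ {y} {h} {w} = from (toClass-correct checkᶠ (y ∷ h ∷ w ∷ []))

    step-exists : ∀ y h → IsFunction h → ∃[ w ] CheckStep y h w
    step-exists y h (_ , fun) with image (∃ᶠ ∃ᶠ appᶠ (` h) #2 #1 ∧ᶠ topᶠ #0 ∧ᶠ pairᶠ #1 #0 #3) y unique
      where
      unique : ∀ z p p′ → z ∈ y → (∃[ ž ] ∃[ t ] app h z ž × IsTop t × IsPair ž t p) →
               (∃[ ž ] ∃[ t ] app h z ž × IsTop t × IsPair ž t p′) → p ≡ p′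
      unique z p p′ _ (ž , t , a , ht , hp) (ž′ , t′ , a′ , ht′ , hp′)
        with refl ← fun z ž ž′ a a′ | refl ← top-unique ht ht′ = trans (pair≡ hp) (sym (pair≡ hp′))
    ... | w , hw = w , λ p → hw p ⟨⇔⟩ mk⇔
      (λ (z , mz , ž , t , a , ht , hp) → z , ž , t , mz , a , ht , hp)
      (λ (z , ž , t , mz , a , ht , hp) → z , mz , ž , t , a , ht , hp)

    step-local : ∀ y f f′ w → (∀ z → z ∈⁺ y → ∀ u → app f z u ⇔ app f′ z u) → CheckStep y f w → CheckStep y f′ w
    step-local y f f′ w agree h p = h p ⟨⇔⟩ ∃-⇔ λ z → ∃-⇔ λ ž → ∃-⇔ λ t → mk⇔
      (λ (m , a , r) → m , to (agree z (∈⇒∈⁺ m) ž) a , r)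
      (λ (m , a , r) → m , from (agree z (∈⇒∈⁺ m) ž) a , r)

    opaque
      stepClass-unique : ∀ y f w w′ → stepClass [ y ∷ f ∷ w ∷ [] ] → stepClass [ y ∷ f ∷ w′ ∷ [] ] → w ≡ w′
      stepClass-unique y f w w′ h h′ = Is-unique (step⇒ h) (step⇒ h′)

      stepClass-exists : ∀ y f → IsFunction f → (∀ z → z ∈⁺ y → InDom f z) → ∃[ w ] stepClass [ y ∷ f ∷ w ∷ [] ]
      stepClass-exists y f isf _ = proj₁ (step-exists y f isf) , step⇐ (proj₂ (step-exists y f isf))

      stepClass-local : ∀ y f f′ w → (∀ z → z ∈⁺ y → ∀ u → app f z u ⇔ app f′ z u) →
                        stepClass [ y ∷ f ∷ w ∷ [] ] → stepClass [ y ∷ f′ ∷ w ∷ [] ]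
      stepClass-local y f f′ w agree h = step⇐ (step-local y f f′ w agree (step⇒ h))

    module Ck = Rec stepClass stepClass-unique stepClass-exists stepClass-local

  opaque
    check : V → V
    check x = proj₁ (Ck.value-exists x)

    private
      check-value : ∀ x → Ck.Value x (check x)
      check-value x = proj₂ (Ck.value-exists x)

      value⇒check : ∀ {x w} → Ck.Value x w → w ≡ check x
      value⇒check v = Ck.value-unique _ _ _ v (check-value _)

    checkClass : Class 2
    checkClass = Ck.valueClass

    checkClass-correct : ∀ x w → checkClass [ x ∷ w ∷ [] ] ⇔ w ≡ check x
    checkClass-correct x w = mk⇔ value⇒check (λ { refl → check-value x })

    isCheck : ∀ x → IsCheck x (check x)
    isCheck x = case Ck.value⇒attempt (check-value x) of λ (t , f , (tr , fun , cor) , a) →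
      t , f , tr , fun , (λ y w a′ → step⇒ (cor y w a′)) , a

    check-unique : ∀ {x w} → IsCheck x w → w ≡ check x
    check-unique (t , f , tr , fun , cor , a) = value⇒check
        (Ck.attempt⇒value (tr , fun , λ y w a′ → step⇐ (cor y w a′)) a)

    ∈-check : ∀ x → check x Is｛ (λ p → ∃[ z ] z ∈ x × IsPair (check z) 𝟙 p) ｝
    ∈-check x p = by-attempt (Ck.value⇒attempt (check-value x))
      where
      by-attempt : (∃[ t ] ∃[ f ] Ck.Attempt t f × app f x (check x)) →
          p ∈ check x ⇔ (∃[ z ] z ∈ x × IsPair (check z) 𝟙 p)
      by-attempt (t , f , at , a) = step⇒ (proj₂ (proj₂ at) x (check x) a) p ⟨⇔⟩ mk⇔
        (λ (z , ž , t′ , m , a′ , ht , hp) → z , m ,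
           subst₂ (λ u v → IsPair u v p) (value⇒check (Ck.attempt⇒value at a′)) (top-unique ht 𝟙-top) hp)
        (λ (z , m , hp) → case Ck.below-dom at a z (∈⇒∈⁺ m) of λ (ž , a′) →
          z , ž , 𝟙 , m , a′ , 𝟙-top , subst (λ u → IsPair u 𝟙 p) (sym (value⇒check (Ck.attempt⇒value at a′))) hp)

  app-check : ∀ {x ρ c} → app (check x) ρ c ⇔ (∃[ z ] z ∈ x × ρ ≡ check z × c ≡ 𝟙)
  app-check {x} {ρ} {c} = mk⇔ ⇒
    (λ { (z , m , refl , refl) → app-intro (from (∈-check x _) (z , m , isPair _ _)) })
    where
    ⇒ : app (check x) ρ c → ∃[ z ] z ∈ x × ρ ≡ check z × c ≡ 𝟙
    ⇒ (p , hp , m) = case to (∈-check x p) m of λ (z , mz , hp′) →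
      z , mz , pair-inj hp hp′

  opaque
    check-domain : ∀ t → IsTransitive t → ∃[ D ] NameClosed D × (D Is｛ (λ ρ → ∃[ z ] z ∈ t × ρ ≡ check z) ｝)
    check-domain t tr with image (atom checkClass (#0 ∷ #1 ∷ [])) t
      (λ x w w′ _ h h′ → trans (to (checkClass-correct x w) h) (sym (to (checkClass-correct x w′) h′)))
    ... | D , hD = D , nc , ∈D
      where
      ∈D : D Is｛ (λ ρ → ∃[ z ] z ∈ t × ρ ≡ check z) ｝
      ∈D ρ = hD ρ ⟨⇔⟩ ∃-⇔ λ z → ⇔-refl ×-⇔ checkClass-correct z ρ
      nc : NameClosed D
      nc τ p mτ mp with to (∈D τ) mτ
      ... | x , mx , refl with to (∈-check x p) mp
      ... | z , mz , hp = check z , 𝟙 , hp , from (∈D _) (z , tr x mx z mz , refl) , proj₁ 𝟙-top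

  check-name : ∀ x → IsName (check x)
  check-name x = case transitive-⊇ (sg x) of λ (t , tr , s) →
    case check-domain t tr of λ (D , nc , hD) →
    D , nc , from (hD _) (x , s x (self∈sg x) , refl)

  Mem-check : ∀ {x y r} → x ∈ y → r ∈ B → Mem r (check x) (check y)
  Mem-check {x} {y} m mr =
    let D , nc , mx , my , _ = common-domain (check x ∷ check y ∷ []) (check-name x , check-name y , tt)
        open Domain nc
    in Mem⇒ (F.mem⇐ mx my (mr , λ q l nq → check x , 𝟙 , q , from app-check (x , m , refl , refl) , nq
      , ≤-refl (proj₁ nq) , proj₂ 𝟙-top q (proj₁ nq) , F.eq-refl (check x) mx q (proj₁ nq))) mx my

  private
    mem-witness : ∀ {σ y r} → IsName σ → Nonzero r → Mem r σ (check y) →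
                  ∃[ z ] ∃[ s ] z ∈ y × Nonzero s × s ≤ r × Eq s σ (check z)
    mem-witness {σ} {y} {r} nσ nr h =
      let D , nc , mσ , my , _ = common-domain (σ ∷ check y ∷ []) (nσ , check-name y , tt)
          open Domain nc
          ρ , c , s , a , ns , l , l′ , ev = proj₂ (F.mem⇒ mσ my (Mem⇐ h mσ my)) r (≤-refl (proj₁ nr)) nr
          z , mz , e , _ = to app-check a
          mρ , _ = name-elements nc my a
      in z , s , mz , ns , l , subst (Eq s σ) e (Eq⇒ ev mσ mρ)

    eq-members : ∀ {σ y r} → IsName σ → Eq r σ (check y) →
                 (∀ {ρ c q} → app σ ρ c → q ≤ r → q ≤ c → Mem q ρ (check y))
               × (∀ {z} → z ∈ y → Mem r (check z) σ)
    eq-members {σ} {y} {r} nσ h =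
      let D , nc , mσ , my , _ = common-domain (σ ∷ check y ∷ []) (nσ , check-name y , tt)
          open Domain nc
          mr , f , g = F.eq⇒ mσ my (Eq⇐ h mσ my)
      in (λ {ρ} {c} {q} a l l′ → Mem⇒ (f ρ c a q l l′) (proj₁ (name-elements nc mσ a)) my)
       , (λ {z} m → let a = from app-check (z , m , refl , refl) in
           Mem⇒ (g (check z) 𝟙 a r (≤-refl mr) (proj₂ 𝟙-top r mr)) (proj₁ (name-elements nc my a)) mσ)

  private
    distinctᶠ : Fm₀ 1
    distinctᶠ = ∀ᶠ ∀ᶠ ∀ᶠ ∀ᶠ atom checkClass (#4 ∷ #1 ∷ []) ⇒ᶠ atom checkClass (#3 ∷ #0 ∷ []) ⇒ᶠ
      #2 ∈ᶠ ` B ∧ᶠ ¬ᶠ bottomᶠ #2 ⇒ᶠ Eqᶠ #2 #1 #0 ⇒ᶠ #4 ≡ᶠ #3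

  opaque
    -- By induction on `x`. That the check name of `z` belongs to that of `y` is witnessed below `r`
    -- by some `z′` in `y` and a nonzero `s` forcing the check names of `z` and `z′` to be equal;
    -- the induction hypothesis gives `z ≡ z′`. Check names enter the formula through `checkClass`,
    -- because the language has no symbol for `check`.
    Eq-check : ∀ {x y r} → Nonzero r → Eq r (check x) (check y) → x ≡ y
    Eq-check {x} {y} {r} nr h = ∈-induction distinctᶠ step x y r (check x) (check y)
        (from (checkClass-correct x _) refl) (from (checkClass-correct y _) refl) nr (from Eqᶠ-correct h)
      where
      Distinct : V → Set ℓ
      Distinct x = ∀ y r x̌ y̌ → checkClass [ x ∷ x̌ ∷ [] ] → checkClass [ y ∷ y̌ ∷ [] ] → Nonzero r →
                   (∃[ b ] equalityClass [ x̌ ∷ y̌ ∷ b ∷ [] ] × r ≤ b) → x ≡ y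
      use : ∀ {x y r} → Distinct x → Nonzero r → Eq r (check x) (check y) → x ≡ y
      use {x} {y} {r} d nr h = d y r _ _ (from (checkClass-correct x _) refl) (from (checkClass-correct y _) refl) nr
        (from Eqᶠ-correct h)
      core : ∀ {x y r} → (∀ z → z ∈ x → Distinct z) → Nonzero r → Eq r (check x) (check y) → x ≡ y
      core {x} {y} {r} ih nr h = ext
        (λ z mz → let m = proj₂ (eq-members (check-name y) (Eq-sym (check-name x) (check-name y) h)) mz in
          case mem-witness (check-name z) nr m of λ (z′ , s , mz′ , ns , _ , ev) →
          subst (_∈ y) (sym (use (ih z mz) ns ev)) mz′)
        (λ z mz → let m = proj₂ (eq-members (check-name x) h) mz in
          case mem-witness (check-name z) nr m of λ (z′ , s , mz′ , ns , _ , ev) →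
          subst (_∈ x) (use (ih z′ mz′) ns (Eq-sym (check-name z) (check-name z′) ev)) mz′)
      step : ∀ x → (∀ z → z ∈ x → Distinct z) → Distinct x
      step x ih y r x̌ y̌ hx hy nr h with refl ← to (checkClass-correct x x̌) hx | refl ← to
          (checkClass-correct y y̌) hy =
        core ih nr (to Eqᶠ-correct h)

  Mem-check⁻¹ : ∀ {x y r} → Nonzero r → Mem r (check x) (check y) → x ∈ y
  Mem-check⁻¹ {x} {y} nr h = case mem-witness (check-name x) nr h of λ (z , s , mz , ns , _ , ev) →
    subst (_∈ y) (sym (Eq-check ns ev)) mz

  -- The name obtained by mixing the values x along the conditions c, for
  -- ⟨c,x⟩ ∈ A.
  module Mixing (A : V) (A⊆B : ∀ c x → app A c x → c ∈ B)
    (coherent : ∀ c c′ x x′ → app A c x → app A c′ x′ → Compatible c c′ → x ≡ x′) where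

    private
      t : V
      t = tc (⋃ (⋃ A))

      D : V
      D = proj₁ (check-domain t (tc-transitive _))

      D-closed : NameClosed D
      D-closed = proj₁ (proj₂ (check-domain t (tc-transitive _)))

      ∈-D : D Is｛ (λ ρ → ∃[ z ] z ∈ t × ρ ≡ check z) ｝
      ∈-D = proj₂ (proj₂ (check-domain t (tc-transitive _)))

      mixᶠ : Fm₀ 2
      mixᶠ = ∃ᶠ ∃ᶠ atom checkClass (#1 ∷ #2 ∷ []) ∧ᶠ #1 ∈ᶠ #0 ∧ᶠ appᶠ (` A) #3 #0

      mixed : ∃[ σ ] IsRelation σ × (∀ ρ c → app σ ρ c ⇔ (ρ ∈ D × c ∈ B × ⟦ mixᶠ ⟧ (ρ ∷ c ∷ [])))
      mixed = relation mixᶠ D B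

    mix : V
    mix = proj₁ mixed

    app-mix : ∀ ρ c → app mix ρ c ⇔ (∃[ z ] ∃[ x ] ρ ≡ check z × z ∈ x × app A c x)
    app-mix ρ c = proj₂ (proj₂ mixed) ρ c ⟨⇔⟩ mk⇔
      (λ (_ , _ , z , x , h , m , a) → z , x , to (checkClass-correct z ρ) h , m , a)
      (λ { (z , x , refl , m , a) → from (∈-D _) (z , z∈t m a , refl) , A⊆B c x a
         , z , x , from (checkClass-correct z _) refl , m , a })
      where
      z∈t : ∀ {z x} → z ∈ x → app A c x → z ∈ t
      z∈t m a = from (∈-tc _ _) (∈⁺-step m (∈⇒∈⁺ (proj₂ (app-fields a))))

    mix-name : IsName mix
    mix-name = D ∪ sg mix , nc , ∪₂ (self∈sg mix)
      where
      nc : NameClosed (D ∪ sg mix)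
      nc τ p mτ mp = [ old , new ]′ (to (∈-∪ D (sg mix) τ) mτ)
        where
        old : τ ∈ D → _
        old m = case D-closed τ p m mp of λ (ρ , b , h , mρ , mb) →
          ρ , b , h , ∪₁ mρ , mb
        new : τ ∈ sg mix → ∃[ ρ ] ∃[ b ] IsPair ρ b p × ρ ∈ (D ∪ sg mix) × b ∈ B
        new m with refl ← to (∈-sg mix τ) m =
          case proj₁ (proj₂ mixed) p mp of λ (ρ , c , h) →
            case to (proj₂ (proj₂ mixed) ρ c) (p , h , mp) of λ (mρ , mc , _) →
            ρ , c , h , ∪₁ mρ , mc

    -- A pair of the mixture with second component `c₁` matters below `c` only if `c₁` is compatible
    -- with `c`; by coherence it then stems from the same `x`.
    mix-value : ∀ {c x} → app A c x → Eq c mix (check x)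
    mix-value {c} {x} a = conclude (common-domain (mix ∷ check x ∷ []) (mix-name , check-name x , tt))
      where
      conclude : (∃[ E ] NameClosed E × AllIn E (mix ∷ check x ∷ [])) → Eq c mix (check x)
      conclude (E , nc , mσ , mx , _) = Eq⇒ (F.eq⇐ mσ mx (A⊆B c x a , forth , back)) mσ mx
        where
        open Domain nc
        forth : ∀ ρ c₁ → app mix ρ c₁ → ∀ q → q ≤ c → q ≤ c₁ → F.Mem q ρ (check x)
        forth ρ c₁ a₁ q l l₁ = F.mem⇐ (proj₁ (name-elements nc mσ a₁)) mx (proj₁ (≤-∈ l) , λ q′ k nq →
            witness nq (≤-trans k l) (≤-trans k l₁) (to (app-mix ρ c₁) a₁))
          where
          witness : ∀ {q′} → Nonzero q′ → q′ ≤ c → q′ ≤ c₁ → (∃[ z ] ∃[ x′ ] ρ ≡ check z × z ∈ x′ × app A c₁ x′) →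
            ∃[ ρ₁ ] ∃[ d ] ∃[ s ] app (check x) ρ₁ d × Nonzero s × s ≤ q′ × s ≤ d × F.Eq s ρ ρ₁
          witness {q′} nq k k₁ (z , x′ , refl , m , a′) with refl ← coherent c c₁ x x′ a a′ (q′ , nq , k , k₁) =
            check z , 𝟙 , q′ , from app-check (z , m , refl , refl) , nq , ≤-refl (proj₁ nq)
            , proj₂ 𝟙-top q′ (proj₁ nq) , F.eq-refl (check z) (proj₁ (name-elements nc mσ a₁)) q′ (proj₁ nq)
        back : ∀ ρ c₁ → app (check x) ρ c₁ → ∀ q → q ≤ c → q ≤ c₁ → F.Mem q ρ mix
        back ρ c₁ a₁ q l l₁ = F.mem⇐ (proj₁ (name-elements nc mx a₁)) mσ (proj₁ (≤-∈ l) , λ q′ k nq →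
            witness nq (≤-trans k l) (to app-check a₁))
          where
          witness : ∀ {q′} → Nonzero q′ → q′ ≤ c → (∃[ z ] z ∈ x × ρ ≡ check z × c₁ ≡ 𝟙) →
            ∃[ ρ₁ ] ∃[ d ] ∃[ s ] app mix ρ₁ d × Nonzero s × s ≤ q′ × s ≤ d × F.Eq s ρ ρ₁
          witness {q′} nq k (z , m , refl , refl) =
            check z , c , q′ , from (app-mix _ c) (z , x , refl , m , a) , nq , ≤-refl (proj₁ nq) , k
            , F.eq-refl (check z) (proj₁ (name-elements nc mx a₁)) q′ (proj₁ nq)

-- Magidor forcing

record MagidorData {ℓ : Level} (V : Set ℓ) (_∈_ : V → V → Set ℓ) : Set ℓ where
  open SetTheory V _∈_
  field
    κ α U f  : V
    mitchell : IsMitchellSequence κ α U f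
    P ≤P     : V
    forcing  : IsMagidorForcing κ α U f P ≤P

module MagidorForcing {ℓ : Level} (𝒱 : ZFCModel ℓ) (𝓓 : MagidorData (ZFCModel.V 𝒱) (ZFCModel._∈_ 𝒱)) where

  open ZFCModel 𝒱
  open SetTheory V _∈_
  open Codes
  open ZF 𝒱
  open MagidorData 𝓓
  open IsMitchellSequence mitchell
  open IsMagidorForcing forcing
  open IsCondition

  ≤P-∈ : ∀ {q p} → app ≤P q p → q ∈ P × p ∈ P
  ≤P-∈ (r , h , m) with to (order r) m
  ... | q′ , p′ , h′ , mq , mp , _ with refl , refl ← pair-inj h h′ = mq , mp

  ≤P-stem : ∀ {q p s′ T′ s T} → app ≤P q p → IsPair s′ T′ q → IsPair s T p → s ⊆ s′
  ≤P-stem {s′ = s′} {s = s} (r , h , m) hq hp = stems (to (order r) m)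
    where
    stems : _ → s ⊆ s′
    stems (q , p , h′ , _ , _ , s₁ , T₁ , s₀ , T₀ , hq′ , hp′ , e , _)
      with refl , refl ← pair-inj h h′
      with refl , refl ← pair-inj hq hq′ | refl , refl ← pair-inj hp hp′ = e

  private
    condition : ∀ {p s T} → p ∈ P → IsPair s T p → IsCondition κ α U f s T
    condition m h = unpack (to (conditions _) m) h
      where
      unpack : ∀ {p s T} → (∃[ s ] ∃[ T ] IsPair s T p × IsCondition κ α U f s T) → IsPair s T p →
               IsCondition κ α U f s T
      unpack (s′ , T′ , h′ , c) h with refl , refl ← pair-inj h h′ = c

  stem-exists : ∀ {p} → p ∈ P → ∃[ s ] ∃[ T ] IsPair s T p
  stem-exists m = let s , T , h , _ = to (conditions _) m in s , T , h

  stem-function : ∀ {p s T} → p ∈ P → IsPair s T p → IsFunction s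
  stem-function m h = s-function (condition m h)

  private
    extends⇒≤ : ∀ {q p s′ T′ s T} → q ∈ P → p ∈ P → IsPair s′ T′ q → IsPair s T p → Extends α s′ T′ s T → app ≤P q p
    extends⇒≤ mq mp hq hp e = app-intro (from (order _) (_ , _ , isPair _ _ , mq , mp , _ , _ , _ , _ , hq , hp , e))

  ≤P-refl : ∀ {p} → p ∈ P → app ≤P p p
  ≤P-refl {p} mp = let s , T , h , c = to (conditions p) mp in extends⇒≤ mp mp h h
    ( (λ _ m → m) , (λ β x a n → ⊥-elim (n (x , a)))
    , λ β m n → let a , h = from (T-domain c β) (m , n) in a , a , h , h , λ _ k → k)

  private
    -- `Q` will say that the coordinate at hand is the one to be changed, so that one formula serves
    -- all coordinates. Removing a point stays inside `u` because `u` is nonprincipal; `x` may also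
    -- lie outside `κ`, and then nothing of `κ` is removed.
    remove-point : ∀ {κ u a₀ a x} {Q : Set ℓ} → IsNormalUltrafilter κ u → a₀ ∈ u →
                   a Is｛ (λ z → z ∈ a₀ × ¬ (Q × z ≡ x)) ｝ → a ∈ u
    remove-point {κ} {u} {a₀} {a} {x} {Q} uf m ha with dec Q
    ... | inj₂ n = subst (_∈ u) (ext (λ z mz → from (ha z) (mz , λ (q , _) → n q)) (λ z mz → proj₁ (to (ha z) mz))) m
    ... | inj₁ q = [ (λ mX → ⊥-elim (principal mX)) , (λ (b , hb , mb) → avoid (intersection a₀ b m mb) hb) ]′
          (ultra X λ z mz → proj₁ (to (∈-comp (#0 ≡ᶠ ` x) κ z) mz))
      where
      open IsNormalUltrafilter uf
      X : V
      X = comp (#0 ≡ᶠ ` x) κ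
      principal : ¬ X ∈ u
      principal mX with dec (x ∈ κ)
      ... | inj₁ mx = nonprincipal x (X , (λ z → ∈-comp (#0 ≡ᶠ ` x) κ z ⟨⇔⟩ mk⇔ proj₂ (λ { refl → mx , refl })) , mX)
      ... | inj₂ nx = proper X (λ z mz → let mκ , e = to (∈-comp (#0 ≡ᶠ ` x) κ z) mz in nx (subst (_∈ κ) e mκ)) mX
      avoid : ∀ {b} → u ∋｛ (λ z → z ∈ a₀ × z ∈ b) ｝ → b Is｛ (λ z → z ∈ κ × ¬ z ∈ X) ｝ → a ∈ u
      avoid (c , hc , mc) hb = upward c a mc
        (λ z mz → let m₀ , mb = to (hc z) mz ; mκ , nX = to (hb z) mb in
           from (ha z) (m₀ , λ (_ , e) → nX (from (∈-comp (#0 ≡ᶠ ` x) κ z) (mκ , e))))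
        (λ z mz → subsets a₀ m z (proj₁ (to (ha z) mz)))

    value-unique : ∀ {γ δ ξ x y} → value f γ δ ξ x → value f γ δ ξ y → x ≡ y
    value-unique {γ} {δ} {ξ} {x} {y} (g , h , a) (g′ , h′ , a′)
      with refl ← proj₂ functions ⟨ γ , δ ⟩ g g′ (app₂-elim h) (app₂-elim h′) =
      proj₂ (proj₁ (domains γ δ g h)) ξ x y a a′

  module _ {s T : V} (c : IsCondition κ α U f s T) (η x : V) where

    private
      shrinkᶠ : Fm₀ 2
      shrinkᶠ = ∃ᶠ appᶠ (` T) #1 #0 ∧ᶠ (∀ᶠ #0 ∈ᶠ #3 ⇔ᶠ #0 ∈ᶠ #1 ∧ᶠ ¬ᶠ (#2 ≡ᶠ ` η ∧ᶠ #0 ≡ᶠ ` x))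

      Shrunk : V → V → V → Set ℓ
      Shrunk β a₀ a = a Is｛ (λ z → z ∈ a₀ × ¬ (β ≡ η × z ≡ x)) ｝

      domain : V
      domain = comp (¬ᶠ inDomᶠ (` s) #0) α

      shrunk : ∃[ T′ ] FunctionOn domain T′ ×
               (∀ β a → app T′ β a ⇔ (β ∈ domain × ∃[ a₀ ] app T β a₀ × Shrunk β a₀ a))
      shrunk = functionGraph shrinkᶠ domain
        (λ { β a a′ _ (a₀ , h , k) (a₀′ , h′ , k′) → unique β a a′ a₀ a₀′ h h′ k k′ })
        (λ β m → let a₀ , h = from (T-domain c β) (to (∈-comp _ α β) m) in
                 _ , a₀ , h , ∈-comp (¬ᶠ (` β ≡ᶠ ` η ∧ᶠ #0 ≡ᶠ ` x)) a₀)
        where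
        unique : ∀ β a a′ a₀ a₀′ → app T β a₀ → app T β a₀′ → Shrunk β a₀ a → Shrunk β a₀′ a′ → a ≡ a′
        unique β a a′ a₀ a₀′ h h′ k k′ with refl ← proj₂ (T-function c) β a₀ a₀′ h h′ = Is-unique k k′

    shrink : V
    shrink = proj₁ shrunk

    private
      shrink-app : ∀ β a → app shrink β a → ∃[ a₀ ] app T β a₀ × Shrunk β a₀ a
      shrink-app β a h = proj₂ (to (proj₂ (proj₂ shrunk) β a) h)

      shrink-dom : ∀ β → InDom shrink β ⇔ (β ∈ α × ¬ InDom s β)
      shrink-dom β = ⇔-sym (proj₂ (proj₁ (proj₂ shrunk)) β) ⟨⇔⟩ ∈-comp _ α β

    shrink-condition : IsCondition κ α U f s shrink
    shrink-condition = record
      { s-function   = s-function c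
      ; s-domain     = s-domain c
      ; s-finite     = s-finite c
      ; s-increasing = s-increasing c
      ; s-values     = s-values c
      ; T-function   = proj₁ (proj₁ (proj₂ shrunk))
      ; T-domain     = shrink-dom
      ; T-top        = λ β a u h hu n → let a₀ , h₀ , k = shrink-app β a h in
          remove-point (normal β u hu) (T-top c β a₀ u h₀ hu n) k
      -- The relevant ultrafilter is the one that `f` assigns to the stem point `y` at `γ`. It is
      -- normal on `y` because stem values lie in the sets described by `InA`, so the same removal
      -- works.
      ; T-below      = λ β a γ y h hs m min → let a₀ , h₀ , k = shrink-app β a h
                                                  u , v , mu = T-below c β a₀ γ y h₀ hs m min
                                                  u′ , v′ , uf = proj₁ (proj₂ (proj₂ (s-values c γ y hs))) β m in
          u , v , remove-point (subst (IsNormalUltrafilter y) (value-unique v′ v) uf) mu k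
      ; T-above      = λ β a γ y h hs m max ξ mξ → let a₀ , h₀ , k = shrink-app β a h in
          T-above c β a₀ γ y h₀ hs m max ξ (proj₁ (to (k ξ) mξ))
      }

    shrink-extends : Extends α s shrink s T
    shrink-extends = (λ _ m → m) , (λ β y a n → ⊥-elim (n (y , a))) , λ β m n →
      let a , h = from (shrink-dom β) (m , n) ; a₀ , h₀ , k = shrink-app β a h in
      a , a₀ , h , h₀ , λ z mz → proj₁ (to (k z) mz)

    shrink-avoids : ¬ (∃[ a ] app shrink η a × x ∈ a)
    shrink-avoids (a , h , m) = let a₀ , _ , k = shrink-app η a h in proj₂ (to (k x) m) (refl , refl)

  avoid-point : ∀ {p} → p ∈ P → ∀ η x → ∃[ q ] q ∈ P × app ≤P q p ×
                (∃[ s ] ∃[ T ] IsPair s T q × ¬ (∃[ a ] app T η a × x ∈ a))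
  avoid-point {p} mp η x = build (to (conditions p) mp)
    where
    build : (∃[ s ] ∃[ T ] IsPair s T p × IsCondition κ α U f s T) → _
    build (s , T , h , c) = q , mq , extends⇒≤ mq mp (isPair _ _) h (shrink-extends c η x)
        , s , shrink c η x , isPair _ _ , shrink-avoids c η x
      where
      q : V
      q = ⟨ s , shrink c η x ⟩
      mq : q ∈ P
      mq = from (conditions q) (s , shrink c η x , isPair _ _ , shrink-condition c η x)

-- The collapse of the Boolean ultrapower

record MagidorIteration {ℓ : Level} (V : Set ℓ) (_∈_ : V → V → Set ℓ) : Set ℓ where
  open SetTheory V _∈_
  field
    magidor    : MagidorData V _∈_
  open MagidorData magidor public
  field
    ordinal-κ  : IsOrdinal κ
    α∈κ        : α ∈ κ
    boolean    : BooleanAlgebra V _∈_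
  open BooleanAlgebra boolean public
  field
    e          : V
    completion : IsCompletion P ≤P B ≤B e
    M          : Class 2
    Π          : Class 4
    Rep        : Class 3
    iteration  : IsIteration κ α U (λ ξ x → M [ ξ ∷ x ∷ [] ]) (λ ζ ξ x y → Π [ ζ ∷ ξ ∷ x ∷ y ∷ [] ])
                   (λ ξ g x → Rep [ ξ ∷ g ∷ x ∷ [] ])
    K          : V
    critical   : IsCriticalSequence α (λ ζ ξ x y → Π [ ζ ∷ ξ ∷ x ∷ y ∷ [] ]) K

  iterated : IteratedUltrapower V _∈_
  iterated = record
    { κ = κ ; α = α ; U = U
    ; ordinal-α = proj₂ ordinal-κ α α∈κ , λ z m → proj₂ ordinal-κ z (proj₁ ordinal-κ α α∈κ z m)
    ; sequence = IsMitchellSequence.sequence mitchell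
    ; normal = IsMitchellSequence.normal mitchell
    ; M = M ; Π = Π ; Rep = Rep ; iteration = iteration ; K = K ; critical = critical
    }

module Collapse {ℓ : Level} (𝒱 : ZFCModel ℓ) (𝓘 : MagidorIteration (ZFCModel.V 𝒱) (ZFCModel._∈_ 𝒱)) where

  open ZFCModel 𝒱
  open SetTheory V _∈_
  open Codes
  open ZF 𝒱
  open Recursion 𝒱
  open Member using (elem)
  open MagidorIteration 𝓘
  open IteratedUltrapower iterated using (𝕄; π)
  open IsCompletion completion using (nonzero; monotone; incompatible; dense) renaming (function to e-function)
  open Order B ≤B
  open BooleanValued B ≤B
  open BooleanValuedModel 𝒱 boolean
  open MagidorForcing 𝒱 magidor
  open Iteration 𝒱 iterated

  J : V → Stage α
  J x = j ∅ α (inj₂ refl) (∅⊴ (inj₂ refl)) (ι x)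

  J-embedding : Embedding _∈_ _∈ₛ_ J
  J-embedding = embedding-∘ ι-embedding (stage-embedding (inj₂ refl) (∅⊴ (inj₂ refl)))

  J-unique : ∀ {x y} → π ∅ α x y → y ≡ elem (J x)
  J-unique {x} = j-unique (inj₂ refl) (∅⊴ (inj₂ refl)) (ι x)

  J-graph : ∀ x → π ∅ α x (elem (J x))
  J-graph x = j-graph (inj₂ refl) (∅⊴ (inj₂ refl)) (ι x)

  -- `η` lies below `α`, hence below `κ`, and the whole iteration fixes everything below `κ`.
  J-fixed : ∀ {η} → η ∈ α → elem (J η) ≡ η
  J-fixed {η} m = fixed-below-κ ordinal-κ (inj₂ refl) (∅⊴ (inj₂ refl)) (ι η)
    (subst (η ∈_) (to (Member≡-⇔ _ _) (j-id (⊴-below (inj₂ refl) (∅⊴ (inj₂ refl)))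
        (∅⊴ (⊴-below (inj₂ refl) (∅⊴ (inj₂ refl)))) (ι κ)))
      (proj₁ ordinal-κ α α∈κ η m))

  -- Facts about conditions and Boolean values are proved in `V` and moved to the last model with
  -- this. Their quantifiers then also reach elements outside the range of `J`, such as members of
  -- the generic filter.
  transfer : (φ : Fm NoAtom V 0) → Pure.Models V _∈_ id φ [] → Pure.Models (Stage α) _∈ₛ_ J φ []
  transfer φ = to (Elementary.transfer-pure V _∈_ em (Stage α) _∈ₛ_ J J-embedding id J (λ _ → refl) φ [])

  open Transitive V _∈_ em (𝕄 α) (stage-transitive (inj₂ refl)) public
    using (module N; app-absolute; app-elements; pair-absolute; pair-elements; element; function-absolute; inDom-absolute)

  e-value : ∀ {p} → p ∈ P → ∃[ c ] app e p c
  e-value m = to (proj₂ e-function _) m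

  e-∈P : ∀ {p c} → app e p c → p ∈ P
  e-∈P a = from (proj₂ e-function _) (_ , a)

  e-unique : ∀ {p c d} → app e p c → app e p d → c ≡ d
  e-unique = proj₂ (proj₁ e-function) _ _ _

  e-nonzero : ∀ {p c} → app e p c → Nonzero c
  e-nonzero a = nonzero _ _ a

  e-compatible : ∀ {p q c d} → app e p c → app e q d → Compatible c d → ∃[ r ] app ≤P r p × app ≤P r q
  e-compatible a a′ (s , (ms , ns) , l , l′) = stable λ n →
    case incompatible _ _ _ _ a a′ n of λ (o , (_ , bo) , meet) →
      ns (ms , λ z mz → ≤-trans (from (≤-meet meet) (l , l′)) (bo z mz))

  -- Density yields some `q` with image below `s`, but `q` need not extend `p`. Since the images of
  -- `p` and `q` are compatible, there is a common extension `r`.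
  e-refine : ∀ {p c s} → app e p c → Nonzero s → s ≤ c → ∃[ r ] ∃[ c′ ] app ≤P r p × app e r c′ × c′ ≤ s
  e-refine a ns l =
    case dense _ (proj₁ ns) (proj₂ ns) of λ (q , d , b , k) →
      case e-compatible a b (d , e-nonzero b , ≤-trans k l , ≤-refl (proj₁ (e-nonzero b))) of λ (r , h , h′) →
      case e-value (proj₁ (≤P-∈ h)) of λ (c′ , a′) →
      r , c′ , h , a′ , ≤-trans (monotone _ _ _ _ h′ a′ b) k

  e-decide : ∀ {p} b → p ∈ P → (∃[ r ] ∃[ c ] app ≤P r p × app e r c × c ≤ b)
                              ⊎ (∀ c → app e p c → ¬ Compatible c b)
  e-decide {p} b m with e-value m
  ... | c , a with dec (Compatible c b)
  ...   | inj₁ (s , ns , l , l′) = case e-refine a ns l of λ (r , c′ , h , a′ , k) →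
    inj₁ (r , c′ , h , a′ , ≤-trans k l′)
  ...   | inj₂ n = inj₂ λ c′ a′ → subst (λ c → ¬ Compatible c b) (e-unique a a′) n

  Forces : V → V → V → Set ℓ
  Forces σ p x = ∃[ c ] app e p c × Eq c σ (check x)

  IsForcingRelation : V → V → Set ℓ
  IsForcingRelation σ h = ∀ p x → app h p x ⇔ Forces σ p x

  private
    forcesᶠ : ∀ {n} → Tm V n → Tm V n → Tm V n → Fm₀ n
    forcesᶠ σ p x = ∃ᶠ ∃ᶠ appᶠ (` e) (wk (wk p)) #1 ∧ᶠ atom checkClass (wk (wk x) ∷ #0 ∷ []) ∧ᶠ Eqᶠ #1 (wk (wk σ)) #0

  opaque
    forcesClass : Class 3
    forcesClass = toClass (forcesᶠ #0 #1 #2)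

    forces-correct : ∀ σ p x → forcesClass [ σ ∷ p ∷ x ∷ [] ] ⇔ Forces σ p x
    forces-correct σ p x = toClass-correct (forcesᶠ #0 #1 #2) (σ ∷ p ∷ x ∷ []) ⟨⇔⟩ ∃-⇔ λ c → mk⇔
      (λ (w , a , h , k) → a , subst (Eq c σ) (to (checkClass-correct x w) h) (to Eqᶠ-correct k))
      (λ (a , k) → check x , a , from (checkClass-correct x _) refl , from Eqᶠ-correct k)

  forces-∈P : ∀ {σ p x} → Forces σ p x → p ∈ P
  forces-∈P (c , a , _) = e-∈P a

  forces-mono : ∀ {σ p q x d} → Forces σ p x → app ≤P q p → app e q d → Eq d σ (check x)
  forces-mono (c , a , k) h b = Eq-mono (monotone _ _ _ _ h b a) k

  Eq-values : ∀ {σ c x y} → IsName σ → Nonzero c → Eq c σ (check x) → Eq c σ (check y) → x ≡ y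
  Eq-values nσ nc h k = Eq-check nc (Eq-trans (check-name _) nσ (check-name _) (Eq-sym nσ (check-name _) h) k)

  opaque
    forcing-relation : ∀ {σ} → IsName σ → ∃[ h ] IsForcingRelation σ h
    forcing-relation {σ} nσ =
      case graph (atom forcesClass (` σ ∷ #0 ∷ #1 ∷ [])) P (λ p x y _ h k →
          unique (to (forces-correct σ p x) h) (to (forces-correct σ p y) k)) of λ (h , _ , hh) →
        h , λ p x → hh p x ⟨⇔⟩ mk⇔ (λ (_ , k) → to (forces-correct σ p x) k)
                                    (λ k → forces-∈P k , from (forces-correct σ p x) k)
      where
      unique : ∀ {p x y} → Forces σ p x → Forces σ p y → x ≡ y
      unique (c , a , k) (d , b , l) with refl ← e-unique a b = Eq-values nσ (e-nonzero a) k l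

  InV̌ : V → V → Set ℓ
  InV̌ σ c = ∃[ x ] ∃[ x̌ ] IsCheck x x̌ × ⟦ σ ≐ x̌ ⟧ c

  private
    inV̌ᶠ : ∀ {n} → Tm V n → Tm V n → Fm₀ n
    inV̌ᶠ σ c = ∃ᶠ ∃ᶠ atom checkClass (#1 ∷ #0 ∷ []) ∧ᶠ atom equalityClass (wk (wk σ) ∷ #0 ∷ wk (wk c) ∷ [])

    inV̌-correct : ∀ {σ c} → (∃[ x ] ∃[ w ] checkClass [ x ∷ w ∷ [] ] × equalityClass [ σ ∷ w ∷ c ∷ [] ]) ⇔ InV̌ σ c
    inV̌-correct = ∃-⇔ λ x → ∃-⇔ λ w →
      (checkClass-correct x w ⟨⇔⟩ mk⇔ (λ { refl → isCheck x }) check-unique) ×-⇔ equality-correct _ _ _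

  inV̌-⊆B : ∀ {σ} c → InV̌ σ c → c ∈ B
  inV̌-⊆B c (_ , _ , _ , h) = equality-∈B h

  opaque
    inV̌-value : ∀ σ → ∃[ b ] ⟦ σ ∈V̌⟧ b
    inV̌-value σ = case sup-exists (inV̌ᶠ (` σ) #0) of λ (b , h) →
      b , sup-cong (λ c → mk⇔ (λ (_ , k) → to inV̌-correct k) (λ k → inV̌-⊆B c k , from inV̌-correct k)) h

  -- The ultrafilter `F` and the collapse of names

  module _ (generic : IsGeneric (𝕄 α) (elem (J P)) (elem (J ≤P)) (InG α K (elem (J P)))) (F : V)
    (hF : F Is｛ (λ b → b ∈ B × ∃[ b′ ] π ∅ α b b′ × InGenerated (elem (J B)) (elem (J ≤B)) (elem (J e))
        (InG α K (elem (J P))) b′) ｝)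
    where

    open IsGeneric generic using (directed; meets) renaming (nonempty to G-nonempty)

    G : Stage α → Set ℓ
    G p = InG α K (elem (J P)) (elem p)

    private
      G-element : ∀ {p} → InG α K (elem (J P)) p → Stage α
      G-element g = element (J P) (proj₁ g)

    G-some : ∃[ p ] G p
    G-some = case G-nonempty of λ (p , g) →
      G-element g , g

    Common : Stage α → Stage α → Set ℓ
    Common p q = ∃[ r ] G r × N.app (J ≤P) r p × N.app (J ≤P) r q

    G-directed : ∀ {p q} → G p → G q → Common p q
    G-directed {p} {q} g h = case directed (elem p) (elem q) g h of λ (r , k , a , b) →
      G-element k , k , from (app-absolute (J ≤P) (G-element k) p) a , from (app-absolute (J ≤P) (G-element k) q) b

    G-meetsᴹ : ∀ (D : Stage α) → (∀ p → p ∈ₛ D → p ∈ₛ J P) → (∀ p → p ∈ₛ J P → ∃[ q ] q ∈ₛ D × N.app (J ≤P) q p) →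
               ∃[ q ] q ∈ₛ D × G q
    G-meetsᴹ D sub den =
      case meets (elem D) (holds em D) (λ p m → sub (element D m) m)
                        (λ p m → case den (element (J P) m) m of λ (q , mq , a) →
                          elem q , mq , to (app-absolute (J ≤P) q (element (J P) m)) a) of λ (q , m , g) →
        G-element g , m , g

    G-meets : ∀ D → D ⊆ P → (∀ p → p ∈ P → ∃[ q ] q ∈ D × app ≤P q p) → ∃[ q ] q ∈ₛ J D × G q
    G-meets D sub den = G-meetsᴹ (J D) (transfer (∀ᶠ #0 ∈ᶠ ` D ⇒ᶠ #0 ∈ᶠ ` P) sub)
      (transfer (∀ᶠ #0 ∈ᶠ ` P ⇒ᶠ (∃ᶠ #0 ∈ᶠ ` D ∧ᶠ appᶠ (` ≤P) #0 #1)) den)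

    -- Says that the image of `b` lies in the generated filter, with all quantifiers over the last
    -- model; transferred facts apply to this form.
    Below : V → Set ℓ
    Below b = ∃[ p ] ∃[ c ] G p × N.app (J e) p c × N.app (J ≤B) c (J b)

    F⇒ : ∀ {b} → b ∈ F → Below b
    F⇒ {b} m = unpack (to (hF b) m)
      where
      unpack : (b ∈ B × ∃[ b′ ] π ∅ α b b′ × InGenerated (elem (J B)) (elem (J ≤B)) (elem (J e))
          (InG α K (elem (J P))) b′) →
               Below b
      unpack (_ , b′ , h , _ , p , c , g , a , l) with refl ← J-unique h =
        let ĉ = c ∣ proj₂ (app-elements (J e) a) in
        G-element g , ĉ , g , from (app-absolute (J e) (G-element g) ĉ) a , from (app-absolute (J ≤B) ĉ (J b)) l

    F⇐ : ∀ {b p c} → b ∈ B → G p → N.app (J e) p c → N.app (J ≤B) c (J b) → b ∈ F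
    F⇐ {b} {p} {c} m g a l = from (hF b) (m , elem (J b) , J-graph b , to (embedding-∈ J-embedding) m
      , elem p , elem c , g , to (app-absolute (J e) p c) a , to (app-absolute (J ≤B) c (J b)) l)

    F-from : ∀ {b D q} → b ∈ B → G q → q ∈ₛ J D → (∀ p → p ∈ D → ∃[ c ] app e p c × c ≤ b) → b ∈ F
    F-from {b} {D} {q} mb g m h =
      case transfer (∀ᶠ #0 ∈ᶠ ` D ⇒ᶠ (∃ᶠ appᶠ (` e) #1 #0 ∧ᶠ appᶠ (` ≤B) #0 (` b))) h q m of λ (c , a , l) →
        F⇐ {p = q} {c = c} mb g a l

    ultrafilter : IsUltrafilterOn B ≤B F
    ultrafilter = record
      { subset = λ b m → proj₁ (to (hF b) m)
      ; top    = λ t ht → top ht G-some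
      ; proper = λ o bo m → proper bo (F⇒ m)
      ; upward = λ x y m h → upward h (F⇒ m)
      ; meets  = λ x y z m m′ h → meet h (F⇒ m) (F⇒ m′)
      ; ultra  = λ x y h → ultra x y h
      }
      where
      top : ∀ {t} → IsTop t → (∃[ p ] G p) → t ∈ F
      top (mt , ut) (p , g) = F-from {D = P} {q = p} mt g (proj₁ g) λ p m →
        case e-value m of λ (c , a) →
          c , a , ut c (proj₁ (e-nonzero a))
      proper : ∀ {o} → IsBottom o → ¬ Below o
      proper {o} (_ , bo) (p , c , g , a , l) =
        transfer (∀ᶠ ∀ᶠ appᶠ (` e) #1 #0 ⇒ᶠ ¬ᶠ appᶠ (` ≤B) #0 (` o))
          (λ p c a l → proj₂ (e-nonzero a) (proj₁ (≤-∈ l) , λ z mz → ≤-trans l (bo z mz))) p c a l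
      upward : ∀ {x y} → x ≤ y → Below x → y ∈ F
      upward {x} {y} h (p , c , g , a , l) = F⇐ {p = p} {c = c} (proj₂ (≤-∈ h)) g a
        (transfer (∀ᶠ appᶠ (` ≤B) #0 (` x) ⇒ᶠ appᶠ (` ≤B) #0 (` y)) (λ c l → ≤-trans l h) c l)
      meet : ∀ {x y z} → IsMeet x y z → Below x → Below y → z ∈ F
      meet {x} {y} {z} h (p , c , g , a , l) (q , d , g′ , a′ , l′) = common (G-directed {p} {q} g g′)
        where
        bound : ∀ p c q d r → app e p c → c ≤ x → app e q d → d ≤ y → app ≤P r p → app ≤P r q →
                ∃[ c″ ] app e r c″ × c″ ≤ z
        bound p c q d r a l a′ l′ s s′ = case e-value (proj₁ (≤P-∈ s)) of λ (c″ , a″) →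
          c″ , a″ ,
          from (≤-meet h) (≤-trans (monotone _ _ _ _ s a″ a) l , ≤-trans (monotone _ _ _ _ s′ a″ a′) l′)
        conclude : ∀ r → G r → (∃[ c″ ] N.app (J e) r c″ × N.app (J ≤B) c″ (J z)) → z ∈ F
        conclude r k (c″ , a″ , l″) = F⇐ {p = r} {c = c″} (proj₁ h) k a″ l″
        common : Common p q → z ∈ F
        common (r , k , s , s′) = conclude r k
          (transfer (∀ᶠ ∀ᶠ ∀ᶠ ∀ᶠ ∀ᶠ appᶠ (` e) #4 #3 ⇒ᶠ appᶠ (` ≤B) #3 (` x) ⇒ᶠ
             appᶠ (` e) #2 #1 ⇒ᶠ appᶠ (` ≤B) #1 (` y) ⇒ᶠ appᶠ (` ≤P) #0 #4 ⇒ᶠ appᶠ (` ≤P) #0 #2 ⇒ᶠ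
             (∃ᶠ appᶠ (` e) #1 #0 ∧ᶠ appᶠ (` ≤B) #0 (` z))) bound p c q d r a l a′ l′ s s′)
      -- By genericity: the conditions whose image lies below `x` or below its complement are dense,
      -- by `e-decide`.
      ultra : ∀ x y → IsComplement x y → x ∈ F ⊎ y ∈ F
      ultra x y h = decide (G-meets D (λ z m → proj₁ (to (∈-comp φ P z) m)) den)
        where
        φ : Fm₀ 1
        φ = ∃ᶠ appᶠ (` e) #1 #0 ∧ᶠ (appᶠ (` ≤B) #0 (` x) ∨ᶠ appᶠ (` ≤B) #0 (` y))
        D : V
        D = comp φ P
        den : ∀ p → p ∈ P → ∃[ q ] q ∈ D × app ≤P q p
        den p m = [ (λ (r , c , k , a , l) → r , from (∈-comp φ P r) (e-∈P a , c , a , inj₁ l) , k)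
                  , (λ n → case e-value m of λ (c , a) →
                    p , from (∈-comp φ P p)
                      (m , c , a , inj₂ (≤-complement (proj₁ (e-nonzero a)) h (n c a))) , ≤P-refl m) ]′ (e-decide x m)
        decide : (∃[ q ] q ∈ₛ J D × G q) → x ∈ F ⊎ y ∈ F
        decide (q , m , g) =
          case transfer (∀ᶠ #0 ∈ᶠ ` D ⇒ᶠ (∃ᶠ appᶠ (` e) #1 #0 ∧ᶠ (appᶠ (` ≤B) #0 (` x) ∨ᶠ appᶠ (` ≤B) #0 (` y))))
                            (λ p m → proj₂ (to (∈-comp φ P p) m)) q m of λ (c , a , l) →
            [ (λ l → inj₁ (F⇐ {p = q} {c = c} (proj₁ h) g a l))
                , (λ l → inj₂ (F⇐ {p = q} {c = c} (proj₁ (proj₂ h)) g a l)) ]′ l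

    -- The value of a function h of V, defined on conditions, along G.
    Ev : V → Stage α → Set ℓ
    Ev h x = ∃[ p ] G p × N.app (J h) p x

    private
      -- `Ev` with quantifiers over `V` instead of `Stage α`, the shape in which a formula expresses
      -- it.
      RawEv : V → V → Set ℓ
      RawEv h x = ∃[ h′ ] π ∅ α h h′ × ∃[ p ] InG α K (elem (J P)) p × app h′ p x

      raw⇒ : ∀ {h x} → RawEv h x → Σ (Stage α) λ x̂ → elem x̂ ≡ x × Ev h x̂
      raw⇒ {h} {x} (h′ , k , p , g , a) with refl ← J-unique k =
        let x̂ = x ∣ proj₂ (app-elements (J h) a) in
        x̂ , refl , G-element g , g , from (app-absolute (J h) (G-element g) x̂) a

      raw⇐ : ∀ {h} x → Ev h x → RawEv h (elem x)
      raw⇐ {h} x (p , g , a) = elem (J h) , J-graph h , elem p , g , to (app-absolute (J h) p x) a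

      genericᶠ : ∀ {n} → Tm V n → Fm₀ n
      genericᶠ p = p ∈ᶠ ` elem (J P) ∧ᶠ (∃ᶠ ∃ᶠ pairᶠ #1 #0 (wk (wk p))
        ∧ᶠ (∃ᶠ domainᶠ #2 #0 ∧ᶠ restrictionᶠ (` K) #0 #2)
        ∧ᶠ (∀ᶠ #0 ∈ᶠ ` α ⇒ᶠ ¬ᶠ inDomᶠ #2 #0 ⇒ᶠ (∃ᶠ ∃ᶠ appᶠ (` K) #2 #1 ∧ᶠ appᶠ #3 #2 #0 ∧ᶠ #1 ∈ᶠ #0)))

      evᶠ : ∀ {n} → Tm V n → Tm V n → Fm₀ n
      evᶠ h x = ∃ᶠ πᶠ (` ∅) (` α) (wk h) #0 ∧ᶠ (∃ᶠ genericᶠ #0 ∧ᶠ appᶠ #1 #0 (wk (wk x)))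

      forcedᶠ : Fm₀ 1
      forcedᶠ = atom nameClass (#0 ∷ []) ∧ᶠ (∃ᶠ supᶠ (λ w c → inV̌ᶠ (w #1) c) #0 ∧ᶠ #0 ∈ᶠ ` F)

    opaque
      forcedClass : Class 1
      forcedClass = toClass forcedᶠ

      forced-correct : ∀ σ → forcedClass [ σ ∷ [] ] ⇔ ForcedInV F σ
      forced-correct σ = toClass-correct forcedᶠ (σ ∷ [])
        ⟨⇔⟩ (name-correct σ ×-⇔ ∃-⇔ λ b →
          mk⇔ (sup-cong (λ c → inV̌-correct)) (sup-cong (λ c → ⇔-sym inV̌-correct)) ×-⇔ ⇔-refl)

      evClass : Class 2
      evClass = toClass (evᶠ #0 #1)

      ev⇒ : ∀ {h x} → evClass [ h ∷ x ∷ [] ] → Σ (Stage α) λ x̂ → elem x̂ ≡ x × Ev h x̂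
      ev⇒ {h} {x} k = raw⇒ (to (toClass-correct (evᶠ #0 #1) (h ∷ x ∷ [])) k)

      ev⇐ : ∀ {h} x → Ev h x → evClass [ h ∷ elem x ∷ [] ]
      ev⇐ {h} x k = from (toClass-correct (evᶠ #0 #1) (h ∷ elem x ∷ [])) (raw⇐ x k)

    private
      collapseᶠ : Fm₀ 2
      collapseᶠ = atom forcedClass (#0 ∷ []) ∧ᶠ (∃ᶠ
        (∀ᶠ ∀ᶠ appᶠ #2 #1 #0 ⇔ᶠ atom forcesClass (#3 ∷ #1 ∷ #0 ∷ [])) ∧ᶠ atom evClass (#0 ∷ #2 ∷ []))

    Collapses : V → Stage α → Set ℓ
    Collapses σ x = ForcedInV F σ × ∃[ h ] IsForcingRelation σ h × Ev h x

    opaque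
      collapseClass : Class 2
      collapseClass = toClass collapseᶠ

      collapse⇒ : ∀ {σ x} → collapseClass [ σ ∷ x ∷ [] ] → Σ (Stage α) λ x̂ → elem x̂ ≡ x × Collapses σ x̂
      collapse⇒ {σ} {x} k = unpack (to (toClass-correct collapseᶠ (σ ∷ x ∷ [])) k)
        where
        unpack : (forcedClass [ σ ∷ [] ] × ∃[ h ] (∀ p x → app h p x ⇔ forcesClass [ σ ∷ p ∷ x ∷ [] ])
                   × evClass [ h ∷ x ∷ [] ]) → Σ (Stage α) λ x̂ → elem x̂ ≡ x × Collapses σ x̂
        unpack (fo , h , hh , ev) = case ev⇒ ev of λ (x̂ , eq₁ , v) →
          x̂ , eq₁ , to (forced-correct σ) fo , h , (λ p x → hh p x ⟨⇔⟩ forces-correct σ p x) , v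

      collapse⇐ : ∀ {σ} x → Collapses σ x → collapseClass [ σ ∷ elem x ∷ [] ]
      collapse⇐ {σ} x (fo , h , hh , ev) = from (toClass-correct collapseᶠ (σ ∷ elem x ∷ []))
        (from (forced-correct σ) fo , h , (λ p x → hh p x ⟨⇔⟩ ⇔-sym (forces-correct σ p x)) , ev⇐ x ev)

    -- Densely many conditions either force `σ` to equal a particular check name or are incompatible
    -- with `b`, the value of `σ` being in the ground model. A member of the generic filter is not
    -- of the second kind, because `b ∈ F` yields another member with image below `b`, and the two
    -- have a common extension.
    collapse-total : ∀ {σ} → ForcedInV F σ → ∃[ x ] Collapses σ x
    collapse-total {σ} fo@(nσ , b , hb , mb) = conclude (F⇒ mb) (G-meets D (λ z m → proj₁ (to (∈-comp φ P z) m)) den)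
      where
      h : V
      h = proj₁ (forcing-relation nσ)
      hh : IsForcingRelation σ h
      hh = proj₂ (forcing-relation nσ)
      φ : Fm₀ 1
      φ = (∃ᶠ appᶠ (` h) #1 #0) ∨ᶠ (∀ᶠ appᶠ (` e) #1 #0 ⇒ᶠ
            ¬ᶠ (∃ᶠ (#0 ∈ᶠ ` B ∧ᶠ ¬ᶠ bottomᶠ #0) ∧ᶠ #0 ≤ᶠ #1 ∧ᶠ #0 ≤ᶠ ` b))
      D : V
      D = comp φ P
      den : ∀ p → p ∈ P → ∃[ q ] q ∈ D × app ≤P q p
      den p m = [ below , (λ n → p , from (∈-comp φ P p) (m , inj₂ n) , ≤P-refl m) ]′ (e-decide b m)
        where
        decided : ∀ {r c z} → app ≤P r p → app e r c → InV̌ σ z → Compatible c z → ∃[ q ] q ∈ D × app ≤P q p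
        decided {r} {c} {z} k a (x , x̌ , ck , v) (s , ns , l , l′) =
          case e-value m of λ (d , a₀) →
            finish (e-refine a₀ ns (≤-trans l (monotone _ _ _ _ k a a₀)))
          where
          finish : (∃[ q ] ∃[ c′ ] app ≤P q p × app e q c′ × c′ ≤ s) → ∃[ q ] q ∈ D × app ≤P q p
          finish (q , c′ , k′ , a′ , l″) = q
            , from (∈-comp φ P q) (e-∈P a′ , inj₁ (x , from (hh q x) (c′ , a′ , z
                , subst (λ w → ⟦ σ ≐ w ⟧ z) (check-unique ck) v , ≤-trans l″ l′)))
            , k′
        below : (∃[ r ] ∃[ c ] app ≤P r p × app e r c × c ≤ b) → ∃[ q ] q ∈ D × app ≤P q p
        below (r , c , k , a , l) = case below-sup inV̌-⊆B hb (e-nonzero a) l of λ (z , v , co) →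
          decided k a v co
      conclude : Below b → (∃[ q ] q ∈ₛ J D × G q) → ∃[ x ] Collapses σ x
      conclude (p , c , g , a , l) (q , m , g′) = common (G-directed {p} {q} g g′)
        where
        meetsBelow : ∀ q → q ∈ D → ∀ p c r → app e p c → c ≤ b → app ≤P r p → app ≤P r q → ∃[ x ] app h q x
        meetsBelow q m p c r a l k k′ = [ id , (λ n →
            case e-value (proj₂ (≤P-∈ k′)) of λ (d , a₁) →
              case e-value (proj₁ (≤P-∈ k)) of λ (d′ , a₂) →
              ⊥-elim (n d a₁ (d′ , e-nonzero a₂ , monotone _ _ _ _ k′ a₂ a₁ , ≤-trans (monotone _ _ _ _ k a₂ a) l))) ]′
          (proj₂ (to (∈-comp φ P q) m))
        found : (∃[ x ] N.app (J h) q x) → ∃[ x ] Collapses σ x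
        found (x , v) = x , fo , h , hh , q , g′ , v
        common : Common p q → ∃[ x ] Collapses σ x
        common (r , _ , k , k′) = found
          (transfer (∀ᶠ #0 ∈ᶠ ` D ⇒ᶠ (∀ᶠ ∀ᶠ ∀ᶠ appᶠ (` e) #2 #1 ⇒ᶠ appᶠ (` ≤B) #1 (` b) ⇒ᶠ
             appᶠ (` ≤P) #0 #2 ⇒ᶠ appᶠ (` ≤P) #0 #3 ⇒ᶠ (∃ᶠ appᶠ (` h) #4 #0)))
            meetsBelow q m p c r a l k k′)

    module _ {σ τ : V} {x y : Stage α} (cσ : Collapses σ x) (cτ : Collapses τ y) where

      private
        nσ : IsName σ
        nσ = proj₁ (proj₁ cσ)
        nτ : IsName τ
        nτ = proj₁ (proj₁ cτ)
        h k : V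
        h = proj₁ (proj₂ cσ)
        k = proj₁ (proj₂ cτ)
        hh : IsForcingRelation σ h
        hh = proj₁ (proj₂ (proj₂ cσ))
        hk : IsForcingRelation τ k
        hk = proj₁ (proj₂ (proj₂ cτ))

        both : ∀ {p q x y r c} → app h p x → app k q y → app ≤P r p → app ≤P r q → app e r c →
               Nonzero c × Eq c σ (check x) × Eq c τ (check y)
        both a b l l′ v = e-nonzero v , forces-mono (to (hh _ _) a) l v , forces-mono (to (hk _ _) b) l′ v

        -- Serves equality and membership alike: `R` is the relation between the decided values and
        -- `b` the Boolean value of the corresponding statement about names. In `holds⇐` the
        -- condition `s` with image below `b` need not extend `p` and `q`, so a common extension `t`
        -- of `r` and `s` is used.
        module Decide (R : V → V → Set ℓ) (b : V)
          (hb : ∀ {x y c} → Nonzero c → Eq c σ (check x) → Eq c τ (check y) → c ≤ b ⇔ R x y) where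

          holds⇒ : ∀ p q r x y → app h p x → app k q y → app ≤P r p → app ≤P r q → R x y →
                   ∃[ c ] app e r c × c ≤ b
          holds⇒ p q r x y a a′ l l′ v =
            case e-value (proj₁ (≤P-∈ l)) of λ (c , a₁) →
              case both a a′ l l′ a₁ of λ (n , u , w) →
              c , a₁ , from (hb n u w) v

          holds⇐ : ∀ p q r x y s c t → app h p x → app k q y → app ≤P r p → app ≤P r q →
                   app e s c → c ≤ b → app ≤P t r → app ≤P t s → R x y
          holds⇐ p q r x y s c t a a′ l l′ v d m m′ =
            case e-value (proj₁ (≤P-∈ l)) of λ (c₁ , a₁) →
              case both a a′ l l′ a₁ of λ (n , u , w) →
              case e-value (proj₁ (≤P-∈ m)) of λ (c₂ , a₂) →
              let below = monotone _ _ _ _ m a₂ a₁ in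
              to (hb (e-nonzero a₂) (Eq-mono below u) (Eq-mono below w)) (≤-trans (monotone _ _ _ _ m′ a₂ v) d)

        p q : Stage α
        p = proj₁ (proj₂ (proj₂ (proj₂ cσ)))
        q = proj₁ (proj₂ (proj₂ (proj₂ cτ)))
        gp : G p
        gp = proj₁ (proj₂ (proj₂ (proj₂ (proj₂ cσ))))
        gq : G q
        gq = proj₁ (proj₂ (proj₂ (proj₂ (proj₂ cτ))))
        ap : N.app (J h) p x
        ap = proj₂ (proj₂ (proj₂ (proj₂ (proj₂ cσ))))
        aq : N.app (J k) q y
        aq = proj₂ (proj₂ (proj₂ (proj₂ (proj₂ cτ))))

        Up Down : (Stage α → Stage α → Set ℓ) → V → Set ℓ
        Up R b = ∀ p q r x y → N.app (J h) p x → N.app (J k) q y → N.app (J ≤P) r p → N.app (J ≤P) r q → R x y →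
                 ∃[ c ] N.app (J e) r c × N.app (J ≤B) c (J b)
        Down R b = ∀ p q r x y s c t → N.app (J h) p x → N.app (J k) q y → N.app (J ≤P) r p → N.app (J ≤P) r q →
                   N.app (J e) s c → N.app (J ≤B) c (J b) → N.app (J ≤P) t r → N.app (J ≤P) t s → R x y

        decided : ∀ {R b} → b ∈ B → Up R b → Down R b → R x y ⇔ b ∈ F
        decided {R} {b} mb up down =
          mk⇔ (λ v → forth v (G-directed {p} {q} gp gq)) (λ m → back (G-directed {p} {q} gp gq) (F⇒ m))
          where
          forth : R x y → Common p q → b ∈ F
          forth v (r , g , l , l′) = bounded (up p q r x y ap aq l l′ v)
            where
            bounded : (∃[ c ] N.app (J e) r c × N.app (J ≤B) c (J b)) → b ∈ F
            bounded (c , a , d) = F⇐ {p = r} {c = c} mb g a d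
          back : Common p q → Below b → R x y
          back (r , g , l , l′) (s , c , g′ , a , d) = common (G-directed {r} {s} g g′)
            where
            common : Common r s → R x y
            common (t , _ , l₁ , l₂) = down p q r x y s c t ap aq l l′ a d l₁ l₂

      collapse-equality : ∀ {b} → ⟦ σ ≐ τ ⟧ b → x ≡ y ⇔ b ∈ F
      collapse-equality {b} hb = decided (equality-∈B hb) up down
        where
        decides : ∀ {x y c} → Nonzero c → Eq c σ (check x) → Eq c τ (check y) → c ≤ b ⇔ x ≡ y
        decides n u w = mk⇔
          (λ l → Eq-check n (Eq-trans (check-name _) nσ (check-name _) (Eq-sym nσ (check-name _) u)
                   (Eq-trans nσ nτ (check-name _) (b , hb , l) w)))
          (λ { refl → Eq⇒≤ hb (Eq-trans nσ (check-name _) nτ u (Eq-sym nτ (check-name _) w)) })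
        open Decide _≡_ b decides
        up : Up _≡_ b
        up = transfer (∀ᶠ ∀ᶠ ∀ᶠ ∀ᶠ ∀ᶠ appᶠ (` h) #4 #1 ⇒ᶠ appᶠ (` k) #3 #0 ⇒ᶠ appᶠ (` ≤P) #2 #4 ⇒ᶠ
               appᶠ (` ≤P) #2 #3 ⇒ᶠ #1 ≡ᶠ #0 ⇒ᶠ (∃ᶠ appᶠ (` e) #3 #0 ∧ᶠ appᶠ (` ≤B) #0 (` b))) holds⇒
        down : Down _≡_ b
        down = transfer (∀ᶠ ∀ᶠ ∀ᶠ ∀ᶠ ∀ᶠ ∀ᶠ ∀ᶠ ∀ᶠ appᶠ (` h) #7 #4 ⇒ᶠ appᶠ (` k) #6 #3 ⇒ᶠ appᶠ (` ≤P) #5 #7 ⇒ᶠ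
                 appᶠ (` ≤P) #5 #6 ⇒ᶠ appᶠ (` e) #2 #1 ⇒ᶠ appᶠ (` ≤B) #1 (` b) ⇒ᶠ appᶠ (` ≤P) #0 #5 ⇒ᶠ
                 appᶠ (` ≤P) #0 #2 ⇒ᶠ #4 ≡ᶠ #3) holds⇐

      collapse-membership : ∀ {b} → ⟦ σ ∈̇ τ ⟧ b → x ∈ₛ y ⇔ b ∈ F
      collapse-membership {b} hb = decided (membership-∈B hb) up down
        where
        decides : ∀ {x y c} → Nonzero c → Eq c σ (check x) → Eq c τ (check y) → c ≤ b ⇔ x ∈ y
        decides n u w = mk⇔
          (λ l → Mem-check⁻¹ n (Mem-cong nσ (check-name _) nτ (check-name _) u w (b , hb , l)))
          (λ m → Mem⇒≤ hb (Mem-cong (check-name _) nσ (check-name _) nτ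
                   (Eq-sym nσ (check-name _) u) (Eq-sym nτ (check-name _) w) (Mem-check m (proj₁ n))))
        open Decide _∈_ b decides
        up : Up _∈ₛ_ b
        up = transfer (∀ᶠ ∀ᶠ ∀ᶠ ∀ᶠ ∀ᶠ appᶠ (` h) #4 #1 ⇒ᶠ appᶠ (` k) #3 #0 ⇒ᶠ appᶠ (` ≤P) #2 #4 ⇒ᶠ
               appᶠ (` ≤P) #2 #3 ⇒ᶠ #1 ∈ᶠ #0 ⇒ᶠ (∃ᶠ appᶠ (` e) #3 #0 ∧ᶠ appᶠ (` ≤B) #0 (` b))) holds⇒
        down : Down _∈ₛ_ b
        down = transfer (∀ᶠ ∀ᶠ ∀ᶠ ∀ᶠ ∀ᶠ ∀ᶠ ∀ᶠ ∀ᶠ appᶠ (` h) #7 #4 ⇒ᶠ appᶠ (` k) #6 #3 ⇒ᶠ appᶠ (` ≤P) #5 #7 ⇒ᶠ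
                 appᶠ (` ≤P) #5 #6 ⇒ᶠ appᶠ (` e) #2 #1 ⇒ᶠ appᶠ (` ≤B) #1 (` b) ⇒ᶠ appᶠ (` ≤P) #0 #5 ⇒ᶠ
                 appᶠ (` ≤P) #0 #2 ⇒ᶠ #4 ∈ᶠ #3) holds⇐

    -- A function of V on conditions, well-defined along every generic filter.
    IsCoherent : V → Set ℓ
    IsCoherent h = (∀ p x → app h p x → p ∈ P) ×
                   (∀ p q x y c d → app h p x → app h q y → app e p c → app e q d → Compatible c d → x ≡ y)

    Generated : Stage α → Set ℓ
    Generated x = ∃[ h ] IsCoherent h × Ev h x

    private
      coherentᶠ : ∀ {n} → Tm V n → Fm₀ n
      coherentᶠ h = (∀ᶠ ∀ᶠ appᶠ (wk (wk h)) #1 #0 ⇒ᶠ #1 ∈ᶠ ` P) ∧ᶠ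
        (∀ᶠ ∀ᶠ ∀ᶠ ∀ᶠ ∀ᶠ ∀ᶠ appᶠ (wk (wk (wk (wk (wk (wk h)))))) #5 #3 ⇒ᶠ appᶠ (wk (wk (wk (wk (wk (wk h)))))) #4 #2 ⇒ᶠ
           appᶠ (` e) #5 #1 ⇒ᶠ appᶠ (` e) #4 #0 ⇒ᶠ
           (∃ᶠ (#0 ∈ᶠ ` B ∧ᶠ ¬ᶠ bottomᶠ #0) ∧ᶠ #0 ≤ᶠ #2 ∧ᶠ #0 ≤ᶠ #1) ⇒ᶠ #3 ≡ᶠ #2)

      generatedᶠ : Fm₀ 1
      generatedᶠ = ∃ᶠ coherentᶠ #0 ∧ᶠ atom evClass (#0 ∷ #1 ∷ [])

    opaque
      generatedClass : Class 1
      generatedClass = toClass generatedᶠ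

      generated⇒ : ∀ {x} → generatedClass [ x ∷ [] ] → Σ (Stage α) λ x̂ → elem x̂ ≡ x × Generated x̂
      generated⇒ {x} k = unpack (to (toClass-correct generatedᶠ (x ∷ [])) k)
        where
        unpack : (∃[ h ] IsCoherent h × evClass [ h ∷ x ∷ [] ]) → Σ (Stage α) λ x̂ → elem x̂ ≡ x × Generated x̂
        unpack (h , co , ev) = case ev⇒ ev of λ (x̂ , eq₁ , v) →
          x̂ , eq₁ , h , co , v

      generated⇐ : ∀ x → Generated x → generatedClass [ elem x ∷ [] ]
      generated⇐ x (h , co , ev) = from (toClass-correct generatedᶠ (elem x ∷ [])) (h , co , ev⇐ x ev)

    -- Every element of the last model is the value of a coherent function

    private
      field-∈ : ∀ {g x y a} → g ∈ a → app g x y → y ∈ ⋃ (⋃ (⋃ a))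
      field-∈ {g} {x} {y} {a} m v = from (∈-⋃ _ y) (lift (to (∈-⋃ _ y) (proj₂ (app-fields v))))
        where
        lift : (∃[ z ] z ∈ ⋃ g × y ∈ z) → ∃[ z ] z ∈ ⋃ (⋃ a) × y ∈ z
        lift (z , mz , my) = case to (∈-⋃ g z) mz of λ (u , mu , mz′) →
          z , from (∈-⋃ _ z) (u , from (∈-⋃ a u) (g , m , mu) , mz′) , my

      pair-field : ∀ {p s T} → p ∈ P → IsPair s T p → s ∈ ⋃ (⋃ P)
      pair-field m h = proj₁ (app-fields (_ , h , m))

      generated-range : ∀ x → Generated (J x)
      generated-range x =
        case G-some of λ (p , g) →
          h , ((λ p y a → proj₁ (to (hh p y) a))
          , λ p q y z c d a b _ _ _ → trans (proj₂ (proj₂ (to (hh p y) a))) (sym (proj₂ (proj₂ (to (hh q z) b)))))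
          , p , g , transfer (∀ᶠ #0 ∈ᶠ ` P ⇒ᶠ appᶠ (` h) #0 (` x)) (λ p m → from (hh p x) (m , self∈sg x , refl)) p
              (proj₁ g)
        where
        r = relation (#1 ≡ᶠ ` x) P (sg x)
        h : V
        h = proj₁ r
        hh : ∀ p y → app h p y ⇔ (p ∈ P × y ∈ sg x × y ≡ x)
        hh = proj₂ (proj₂ r)

      -- The values of `h` and `k` may be determined by different conditions. Hence `l` is defined
      -- at their common extensions, and directedness of `G` provides one in `G`.
      module Application (h k : V) (ch : IsCoherent h) (ck : IsCoherent k) where

        φ : Fm₀ 2
        φ = ∃ᶠ ∃ᶠ ∃ᶠ ∃ᶠ appᶠ (` h) #3 #1 ∧ᶠ appᶠ (` k) #2 #0 ∧ᶠ appᶠ (` ≤P) #4 #3 ∧ᶠ appᶠ (` ≤P) #4 #2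
              ∧ᶠ functionᶠ #1 ∧ᶠ appᶠ #1 #0 #5

        Applied : V → V → Set ℓ
        Applied r y = ∃[ p ] ∃[ q ] ∃[ g ] ∃[ x ] app h p g × app k q x × app ≤P r p × app ≤P r q × IsFunction g
            × app g x y

        -- A bound for the values of `l`: the functions `g` lie in `⋃ (⋃ h)`, and by `field-∈` their
        -- values lie three unions further down.
        values : V
        values = ⋃ (⋃ (⋃ (⋃ (⋃ h))))

        l : V
        l = proj₁ (relation φ P values)

        hl : ∀ r y → app l r y ⇔ (r ∈ P × y ∈ values × Applied r y)
        hl = proj₂ (proj₂ (relation φ P values))

        intro : ∀ p q g x r y → app h p g → app k q x → app ≤P r p → app ≤P r q → IsFunction g → app g x y → app l r y
        intro p q g x r y a b m m′ fg v = from (hl r y) (proj₁ (≤P-∈ m)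
          , field-∈ (proj₂ (app-fields a)) v , p , q , g , x , a , b , m , m′ , fg , v)

        coherent : IsCoherent l
        coherent = (λ r y a → proj₁ (to (hl r y) a)) , λ r r′ y y′ c c′ a a′ v v′ co →
          same v v′ co (proj₂ (proj₂ (to (hl r y) a))) (proj₂ (proj₂ (to (hl r′ y′) a′)))
          where
          above : ∀ {r p c} → app ≤P r p → app e r c → ∃[ d ] app e p d × c ≤ d
          above m v = case e-value (proj₂ (≤P-∈ m)) of λ (d , a) →
            d , a , monotone _ _ _ _ m v a
          same : ∀ {r r′ y y′ c c′} → app e r c → app e r′ c′ → Compatible c c′ → Applied r y → Applied r′ y′ → y ≡ y′
          same {y = y} {y′} v v′ (s , ns , l , l′) (p , q , g , x , a , b , m , n , fg , w)
              (p′ , q′ , g′ , x′ , a′ , b′ , m′ , n′ , fg′ , w′) =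
            case above m v of λ (d₁ , u₁ , k₁) →
              case above n v of λ (d₂ , u₂ , k₂) →
              case above m′ v′ of λ (d₁′ , u₁′ , k₁′) →
              case above n′ v′ of λ (d₂′ , u₂′ , k₂′) →
              let g≡ = proj₂ ch p p′ g g′ d₁ d₁′ a a′ u₁ u₁′ (s , ns , ≤-trans l k₁ , ≤-trans l′ k₁′) in
              let x≡ = proj₂ ck q q′ x x′ d₂ d₂′ b b′ u₂ u₂′ (s , ns , ≤-trans l k₂ , ≤-trans l′ k₂′) in
              proj₂ fg x y y′ w (subst₂ (λ g x → app g x y′) (sym g≡) (sym x≡) w′)

        applied : ∀ {g x y : Stage α} → Ev h g → Ev k x → N.IsFunction g → N.app g x y → Ev l y
        applied {g} {x} {y} (p , γp , a) (q , γq , b) fg v = common (G-directed {p} {q} γp γq)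
          where
          common : Common p q → Ev l y
          common (r , γr , m , n) = r , γr , transfer (∀ᶠ ∀ᶠ ∀ᶠ ∀ᶠ ∀ᶠ ∀ᶠ appᶠ (` h) #5 #3 ⇒ᶠ appᶠ (` k) #4 #2 ⇒ᶠ
              appᶠ (` ≤P) #1 #5 ⇒ᶠ appᶠ (` ≤P) #1 #4 ⇒ᶠ functionᶠ #3 ⇒ᶠ appᶠ #3 #2 #0 ⇒ᶠ appᶠ (` l) #1 #0)
            intro p q g x r y a b m n fg v

      generated-closed : ∀ f x y → generatedClass [ f ∷ [] ] → generatedClass [ x ∷ [] ] → IsFunction f → app f x y →
                         generatedClass [ y ∷ [] ]
      generated-closed f x y hf hx ff a = apply (generated⇒ hf) (generated⇒ hx)
        where
        apply : (Σ (Stage α) λ f̂ → elem f̂ ≡ f × Generated f̂) → (Σ (Stage α) λ x̂ → elem x̂ ≡ x × Generated x̂) →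
                generatedClass [ y ∷ [] ]
        apply (f̂ , refl , h , ch , vf) (x̂ , refl , k , ck , vx) =
          let ŷ = y ∣ proj₂ (app-elements f̂ a) in
          generated⇐ ŷ (Application.l h k ch ck , Application.coherent h k ch ck
            , Application.applied h k ch ck vf vx (from (function-absolute f̂) ff) (from (app-absolute f̂ x̂ ŷ) a))

      -- `h` reads the entry at `η` from the stem of a condition. Compatible conditions have a
      -- common extension, whose stem includes both stems, so their entries agree.
      module CriticalPoint {η k : V} (Kη : app K η k) where

        η∈α : η ∈ α
        η∈α = from (proj₂ (proj₁ critical) η) (k , Kη)

        k̂ : Stage α
        k̂ = k ∣ critical-∈𝕄 ordinal-κ Kη

        φ : Fm₀ 2
        φ = ∃ᶠ ∃ᶠ pairᶠ #1 #0 #2 ∧ᶠ appᶠ #1 (` η) #3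

        values : V
        values = ⋃ (⋃ (⋃ (⋃ (⋃ P))))

        h : V
        h = proj₁ (relation φ P values)

        hh : ∀ p y → app h p y ⇔ (p ∈ P × y ∈ values × (∃[ s ] ∃[ T ] IsPair s T p × app s η y))
        hh = proj₂ (proj₂ (relation φ P values))

        coherent : IsCoherent h
        coherent = (λ p y a → proj₁ (to (hh p y) a)) , λ p q x y c d a a′ v v′ co →
          same (proj₂ (proj₂ (to (hh p x) a))) (proj₂ (proj₂ (to (hh q y) a′))) (e-compatible v v′ co)
          where
          same : ∀ {p q x y} → (∃[ s ] ∃[ T ] IsPair s T p × app s η x) → (∃[ s ] ∃[ T ] IsPair s T q × app s η y) →
                 (∃[ r ] app ≤P r p × app ≤P r q) → x ≡ y
          same {x = x} {y} (s , T , hp , a) (s′ , T′ , hq , a′) (r , l , l′) =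
            case stem-exists (proj₁ (≤P-∈ l)) of λ (t , _ , hr) →
              proj₂ (stem-function (proj₁ (≤P-∈ l)) hr) η x y
              (app-intro (≤P-stem l hr hp _ (app-elim a))) (app-intro (≤P-stem l′ hr hq _ (app-elim a′)))

        value-∈ : ∀ p s T y → p ∈ P → IsPair s T p → app s η y → app h p y
        value-∈ p s T y m hp a = from (hh p y) (m , field-∈ (pair-field m hp) a , s , T , hp , a)

        Decides : V → V → Set ℓ
        Decides x q = ∃[ s ] ∃[ T ] IsPair s T q × (InDom s η ⊎ ¬ (∃[ a ] app T η a × x ∈ a))

        -- Stated for every `x` of `V`, because after the transfer it is applied to `k̂`, which need
        -- not be in the range of `J`.
        dense-set : ∀ x → ∃[ D ] (∀ q → q ∈ D → q ∈ P × Decides x q) × (∀ p → p ∈ P → ∃[ q ] q ∈ D × app ≤P q p)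
        dense-set x = comp ψ P , (λ q m → to (∈-comp ψ P q) m)
          , λ p m → case avoid-point m η x of λ (q , mq , l , s , T , hq , n) →
            q , from (∈-comp ψ P q) (mq , s , T , hq , inj₂ n) , l
          where
          ψ : Fm₀ 1
          ψ = ∃ᶠ ∃ᶠ pairᶠ #1 #0 #2 ∧ᶠ (inDomᶠ #1 (` η) ∨ᶠ ¬ᶠ (∃ᶠ appᶠ #1 (` η) #0 ∧ᶠ ` x ∈ᶠ #0))

        Decidesᴹ : Stage α → Set ℓ
        Decidesᴹ q = ∃[ s ] ∃[ T ] N.IsPair s T q × (N.InDom s (J η) ⊎ ¬ (∃[ a ] N.app T (J η) a × k̂ ∈ₛ a))

        Along : V → V → Set ℓ
        Along s T = (∃[ d ] IsDomain s d × IsRestriction K d s) ×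
                    (∀ ξ → ξ ∈ α → ¬ InDom s ξ → ∃[ k ] ∃[ a ] app K ξ k × app T ξ a × k ∈ a)

        K-unique : ∀ {y y′} → app K η y → app K η y′ → y ≡ y′
        K-unique = proj₂ (proj₁ (proj₁ critical)) η _ _

        -- The alternative is obtained by transfer and speaks of `J η`, whereas the definition of
        -- the filter speaks of `η`; `J-fixed` makes them comparable. Once `η` is in the domain of
        -- the stem, the value there is `k` because the stem is a restriction of `K`.
        stem-value : ∀ (s T : Stage α) → Along (elem s) (elem T) →
                     N.InDom s (J η) ⊎ ¬ (∃[ a ] N.app T (J η) a × k̂ ∈ₛ a) → N.app s (J η) k̂
        stem-value s T ((d , hd , hs) , sides) alt = from (app-absolute s (J η) k̂)
            (subst (λ η → app (elem s) η k) (sym (J-fixed η∈α)) (at-η inDom))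
          where
          contradict : ¬ (∃[ a ] N.app T (J η) a × k̂ ∈ₛ a) →
                       (∃[ k′ ] ∃[ a ] app K η k′ × app (elem T) η a × k′ ∈ a) → ⊥
          contradict avoids (k′ , a , Kη′ , Ta , m) =
            let â = a ∣ proj₂ (app-elements T Ta) in
            avoids (â , from (app-absolute T (J η) â) (subst (λ η → app (elem T) η a) (sym (J-fixed η∈α)) Ta)
               , subst (_∈ a) (K-unique Kη′ Kη) m)
          inDom : InDom (elem s) η
          inDom = [ (λ i → subst (InDom (elem s)) (J-fixed η∈α) (to (inDom-absolute s (J η)) i))
                  , (λ avoids → stable λ n → contradict avoids (sides η η∈α n)) ]′ alt
          at-η : InDom (elem s) η → app (elem s) η k
          at-η (y , p , hp , mp) = subst (app (elem s) η)
            (K-unique (p , hp , proj₁ (to (hs p) mp)) Kη) (p , hp , mp)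

        in-stem : ∀ q → G q → Decidesᴹ q → N.app (J h) q k̂
        in-stem q (mq , s′ , T′ , hq′ , along) (s , T , hq , alt) =
          transfer (∀ᶠ ∀ᶠ ∀ᶠ ∀ᶠ #3 ∈ᶠ ` P ⇒ᶠ pairᶠ #2 #1 #3 ⇒ᶠ appᶠ #2 (` η) #0 ⇒ᶠ appᶠ (` h) #3 #0)
            value-∈ q s T k̂ mq hq (stem-value s T (rename (pair-inj hq′ (to (pair-absolute s T q) hq)) along) alt)
          where
          rename : ∀ {a b a′ b′} → a ≡ a′ × b ≡ b′ → Along a b → Along a′ b′
          rename (refl , refl) x = x

        generated : Generated k̂
        generated = h , coherent , meet
          (transfer (∀ᶠ ∃ᶠ (∀ᶠ #0 ∈ᶠ #1 ⇒ᶠ #0 ∈ᶠ ` P ∧ᶠ (∃ᶠ ∃ᶠ pairᶠ #1 #0 #2 ∧ᶠ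
              (inDomᶠ #1 (` η) ∨ᶠ ¬ᶠ (∃ᶠ appᶠ #1 (` η) #0 ∧ᶠ #5 ∈ᶠ #0)))) ∧ᶠ
              (∀ᶠ #0 ∈ᶠ ` P ⇒ᶠ (∃ᶠ #0 ∈ᶠ #2 ∧ᶠ appᶠ (` ≤P) #0 #1))) dense-set k̂)
          where
          meet : (∃[ D ] (∀ q → q ∈ₛ D → q ∈ₛ J P × Decidesᴹ q) × (∀ p → p ∈ₛ J P → ∃[ q ] q ∈ₛ D × N.app (J ≤P) q p)) →
                 Ev h k̂
          meet (D , sub , den) = case G-meetsᴹ D (λ p m → proj₁ (sub p m)) den of λ (q , m , g) →
            q , g , in-stem q g (proj₂ (sub q m))

    every-generated : ∀ x → 𝕄 α x → Σ (Stage α) λ x̂ → elem x̂ ≡ x × Generated x̂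
    every-generated x m = generated⇒ (Generation.generation ordinal-κ generatedClass
      (λ x → generated⇐ (J x) (generated-range x))
      (λ η k Kη → generated⇐ (CriticalPoint.k̂ Kη) (CriticalPoint.generated Kη))
      generated-closed x m)

    collapse-onto : ∀ x → 𝕄 α x → ∃[ σ ] Σ (Stage α) λ x̂ → elem x̂ ≡ x × Collapses σ x̂
    collapse-onto x m = name (every-generated x m)
      where
      -- `A` relates the image of `p` under `e` to the value of `h` at `p`. Although `e` need not be
      -- injective, coherence of `h` makes the values along compatible elements of `B` agree, which
      -- is what mixing requires.
      module Name (h : V) (coherent : IsCoherent h) where

        φ : Fm₀ 2
        φ = ∃ᶠ appᶠ (` e) #0 #1 ∧ᶠ appᶠ (` h) #0 #2

        values : V
        values = ⋃ (⋃ h)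

        A : V
        A = proj₁ (relation φ B values)

        A-app : ∀ c x → app A c x ⇔ (∃[ p ] app e p c × app h p x)
        A-app c x = proj₂ (proj₂ (relation φ B values)) c x ⟨⇔⟩ mk⇔ (λ (_ , _ , r) → r)
          (λ (p , a , b) → proj₁ (e-nonzero a) , proj₂ (app-fields b) , p , a , b)

        A⊆B : ∀ c x → app A c x → c ∈ B
        A⊆B c x a = proj₁ (e-nonzero (proj₁ (proj₂ (to (A-app c x) a))))

        A-coherent : ∀ c c′ x x′ → app A c x → app A c′ x′ → Compatible c c′ → x ≡ x′
        A-coherent c c′ x x′ a a′ co =
          case to (A-app c x) a of λ (p , v , w) →
            case to (A-app c′ x′) a′ of λ (p′ , v′ , w′) →
            proj₂ coherent p p′ x x′ c c′ w w′ v v′ co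

        open Mixing A A⊆B A-coherent public

        forces : ∀ p x → app h p x → Forces mix p x
        forces p x a = case e-value (proj₁ coherent p x a) of λ (c , v) →
          c , v , mix-value (from (A-app c x) (p , v , a))

        collapses : ∀ x → Ev h x → Collapses mix x
        collapses x (p , g , a) = (mix-name , b , hb , inF) , k , hk , p , g
            , transfer (∀ᶠ ∀ᶠ appᶠ (` h) #1 #0 ⇒ᶠ appᶠ (` k) #1 #0) (λ p x a → from (hk p x) (forces p x a)) p x a
          where
          b : V
          b = proj₁ (inV̌-value mix)
          hb : ⟦ mix ∈V̌⟧ b
          hb = proj₂ (inV̌-value mix)
          k : V
          k = proj₁ (forcing-relation mix-name)
          hk : IsForcingRelation mix k
          hk = proj₂ (forcing-relation mix-name)
          below : ∀ p x → app h p x → ∃[ c ] app e p c × c ≤ b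
          below p x a = case forces p x a of λ (c , v , d , w , l) →
            c , v , ≤-trans l (proj₁ (proj₂ hb) d (x , check x , isCheck x , w))
          inF : b ∈ F
          inF = case transfer (∀ᶠ ∀ᶠ appᶠ (` h) #1 #0 ⇒ᶠ (∃ᶠ appᶠ (` e) #2 #0 ∧ᶠ appᶠ (` ≤B) #0
              (` b))) below p x a of λ (c , v , l) →
            F⇐ {p = p} {c = c} (proj₁ hb) g v l

      name : (Σ (Stage α) λ x̂ → elem x̂ ≡ x × Generated x̂) → ∃[ σ ] Σ (Stage α) λ x̂ → elem x̂ ≡ x × Collapses σ x̂
      name (x̂ , eq₁ , h , co , v) = Name.mix h co , x̂ , eq₁ , Name.collapses h co x̂ v

    collapse : IsCollapse F (𝕄 α) (λ σ x → collapseClass [ σ ∷ x ∷ [] ])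
    collapse = record
      { transitive = stage-transitive (inj₂ refl)
      ; typed      = λ σ x k → typed-collapse (collapse⇒ k)
      ; total      = λ σ fo → case collapse-total fo of λ (x , c) →
        elem x , collapse⇐ x c
      ; onto       = λ x m → onto-collapse (collapse-onto x m)
      ; equality   = λ σ τ x y k l → equality-collapse (collapse⇒ k) (collapse⇒ l)
      ; membership = λ σ τ x y k l → membership-collapse (collapse⇒ k) (collapse⇒ l)
      }
      where
      Names : V → V → Set ℓ
      Names σ x = Σ (Stage α) λ x̂ → elem x̂ ≡ x × Collapses σ x̂
      typed-collapse : ∀ {σ x} → Names σ x → ForcedInV F σ × 𝕄 α x
      typed-collapse (x̂ , refl , c) = proj₁ c , holds em x̂
      onto-collapse : ∀ {x} → (∃[ σ ] Names σ x) → ∃[ σ ] collapseClass [ σ ∷ x ∷ [] ]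
      onto-collapse (σ , x̂ , refl , c) = σ , collapse⇐ x̂ c
      equality-collapse : ∀ {σ τ x y} → Names σ x → Names τ y → x ≡ y ⇔ (∃[ b ] ⟦ σ ≐ τ ⟧ b × b ∈ F)
      equality-collapse (x̂ , refl , c) (ŷ , refl , d) = ⇔-sym (Member≡-⇔ x̂ ŷ) ⟨⇔⟩ mk⇔
        (λ h → case equality-value (proj₁ (proj₁ c)) (proj₁ (proj₁ d)) of λ (b , hb) →
          b , hb , to (collapse-equality {x = x̂} {ŷ} c d hb) h)
        (λ (b , hb , m) → from (collapse-equality {x = x̂} {ŷ} c d hb) m)
      membership-collapse : ∀ {σ τ x y} → Names σ x → Names τ y → x ∈ y ⇔ (∃[ b ] ⟦ σ ∈̇ τ ⟧ b × b ∈ F)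
      membership-collapse (x̂ , refl , c) (ŷ , refl , d) = mk⇔
        (λ h → case membership-value (proj₁ (proj₁ c)) (proj₁ (proj₁ d)) of λ (b , hb) →
          b , hb , to (collapse-membership {x = x̂} {ŷ} c d hb) h)
        (λ (b , hb , m) → from (collapse-membership {x = x̂} {ŷ} c d hb) m)

  -- Images under the iteration map are unique, so the given images of the parameters are the ones
  -- chosen by `J`.
  boolean-ultrapower : ∀ {P′ ≤P′ B′ ≤B′ e′} →
    π ∅ α P P′ → π ∅ α ≤P ≤P′ → π ∅ α B B′ → π ∅ α ≤B ≤B′ → π ∅ α e e′ →
    IsGeneric (𝕄 α) P′ ≤P′ (InG α K P′) → ∀ F →
    F Is｛ (λ b → b ∈ B × ∃[ b′ ] π ∅ α b b′ × InGenerated B′ ≤B′ e′ (InG α K P′) b′) ｝ →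
    IsBooleanUltrapower B ≤B F (𝕄 α)
  boolean-ultrapower hP h≤P hB h≤B he generic F hF
    with refl ← J-unique hP | refl ← J-unique h≤P | refl ← J-unique hB | refl ← J-unique h≤B | refl ← J-unique he =
    algebra , ultrafilter generic F hF , collapseClass generic F hF , collapse generic F hF

theorem2p6 :
    ∀ {ℓ : Level} (V : Set ℓ) (_∈_ : V → V → Set ℓ) → ExcludedMiddle ℓ →
    let open SetTheory V _∈_ in
    IsZFC →
    ∀ (κ α U f : V) → IsCardinal κ → α ∈ κ → IsMitchellSequence κ α U f →
    ∀ (P ≤P : V) → IsMagidorForcing κ α U f P ≤P →
    ∀ (B ≤B e : V) → IsCompletion P ≤P B ≤B e →
    ∀ (M : Class 2) (π : Class 4) (rep : Class 3) →
    let M[_] = λ ξ x → M [ ξ ∷ x ∷ [] ]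
        π[_,_] = λ ζ ξ x y → π [ ζ ∷ ξ ∷ x ∷ y ∷ [] ]
        rep[_] = λ ξ g x → rep [ ξ ∷ g ∷ x ∷ [] ]
    in
    IsIteration κ α U M[_] π[_,_] rep[_] →
    ∀ (K : V) → IsCriticalSequence α π[_,_] K →
    -- P′ = π_{0,α}(P), etc., so that G is G_K and G* is the filter it generates
    ∀ (o P′ ≤P′ B′ ≤B′ e′ : V) → IsEmpty o →
    π[ o , α ] P P′ → π[ o , α ] ≤P ≤P′ →
    π[ o , α ] B B′ → π[ o , α ] ≤B ≤B′ → π[ o , α ] e e′ →
    let G = InG α K P′
        G* = InGenerated B′ ≤B′ e′ G
    in
    IsGeneric M[ α ] P′ ≤P′ G →
    ∀ (F : V) → F Is｛ (λ b → b ∈ B × ∃[ b′ ] π[ o , α ] b b′ × G* b′) ｝ →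
    IsBooleanUltrapower B ≤B F M[ α ]
theorem2p6 V _∈_ em zfc κ α U f cardinal α∈κ mitchell P ≤P forcing B ≤B e completion M π rep iteration K critical
    o P′ ≤P′ B′ ≤B′ e′ empty hP h≤P hB h≤B he generic F hF
  with refl ← ZF.empty-unique (record { V = V ; _∈_ = _∈_ ; em = em ; zfc = zfc }) empty = Collapse.boolean-ultrapower (record { V = V ; _∈_ = _∈_ ; em = em ; zfc = zfc }) record
    { magidor = record
        { κ = κ ; α = α ; U = U ; f = f ; mitchell = mitchell ; P = P ; ≤P = ≤P ; forcing = forcing }
    ; ordinal-κ = proj₁ cardinal ; α∈κ = α∈κ
    ; boolean = record { B = B ; ≤B = ≤B ; algebra = SetTheory.IsCompletion.algebra completion }
    ; e = e ; completion = completion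
    ; M = M ; Π = π ; Rep = rep ; iteration = iteration ; K = K ; critical = critical
    } hP h≤P hB h≤B he generic F hF
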